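{- There exist absolute constants $C_1, C_2 > 0$ such that the following holds. Let $D$ be a positive integer, let $K$ be a real number, and let $A$ be a non-empty finite subset of $\mathbf{Z}^D$ with $|A+A| \leq K|A|$. Then there is a set $A' \subseteq A$ with $|A'| \geq K^{ -C_1/2}|A|$ and $\dim A' \leq C_2 \log K$.
   Context: $A+A = \{a+a' : a,a'\in A\}$. For a non-empty finite set $B \subset \mathbf{Z}^D$, $\dim B$ denotes the dimension of the smallest affine subspace (coset of a linear subspace) of $\mathbf{R}^D$ containing $B$. Logarithms are natural. The constants $C_1,C_2$ do not depend on $D$, $K$ or $A$. -}

module Defs where

open import Data.Nat.Base as ℕ using (ℕ; zero; suc; z≤n; s≤s)
import Data.Nat.Properties as ℕₚ
open import Data.Integer.Base as ℤ using (ℤ; +_; -[1+_])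
import Data.Integer.Properties as ℤₚ
open import Data.Rational.Base
import Data.Rational.Unnormalised.Base as ℚᵘ
import Data.Rational.Unnormalised.Properties as ℚᵘₚ
open import Data.Rational.Properties
open import Data.Rational.Solver using (module +-*-Solver)
open import Data.Fin.Base using (Fin)
open import Data.List.Base as List using (List; []; _∷_; length)
open import Data.List.Membership.Propositional using (_∈_)
open import Data.List.Relation.Unary.Unique.Propositional using (Unique)
import Data.List.Relation.Unary.Unique.DecPropositional.Properties as UniqueDec
open import Data.Vec.Base as Vec using (Vec; lookup; zipWith)
import Data.Vec.Properties as Vecₚ
open import Data.Vec.Functional as Vector using (Vector)
open import Data.Product.Base using (Σ; Σ-syntax; _×_; _,_; proj₁; proj₂)
open import Relation.Binary.Definitions using (DecidableEquality)
open import Relation.Binary.PropositionalEquality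

fromℕℚ : ℕ → ℚ
fromℕℚ n = + n / 1

module _ where
  open +-*-Solver

  dist-swap : ∀ a b → a - b ≡ - (b - a)
  dist-swap = solve 2 (λ a b → a :- b := :- (b :- a)) refl

  dist-split : ∀ a b c → a - c ≡ (a - b) + (b - c)
  dist-split = solve 3 (λ a b c → a :- c := (a :- b) :+ (b :- c)) refl

  dist-+ : ∀ a b c d → (a + b) - (c + d) ≡ (a - c) + (b - d)
  dist-+ = solve 4 (λ a b c d → (a :+ b) :- (c :+ d) := (a :- c) :+ (b :- d)) refl

  dist-* : ∀ a b c d → a * b - c * d ≡ a * (b - d) + d * (a - c)
  dist-* = solve 4 (λ a b c d → a :* b :- c :* d := a :* (b :- d) :+ d :* (a :- c)) refl

  dist-neg : ∀ a b → (- a) - (- b) ≡ b - a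
  dist-neg = solve 2 (λ a b → (:- a) :- (:- b) := b :- a) refl

  split-+ : ∀ a b → a ≡ (a - b) + b
  split-+ = solve 2 (λ a b → a := (a :- b) :+ b) refl

  dist-step : ∀ a b c → (a + c) - b ≡ (a - b) + c
  dist-step = solve 3 (λ a b c → (a :+ c) :- b := (a :- b) :+ c) refl

  halves : ∀ a → a * ½ + a * ½ ≡ a
  halves = solve 1 (λ a → a :* con ½ :+ a :* con ½ := a) refl

  halve-double : ∀ a → (a + a) * ½ ≡ a
  halve-double = solve 1 (λ a → (a :+ a) :* con ½ := a) refl

  thirds : ∀ a → let d = a * (+ 1 / 3) in d + d + d ≡ a
  thirds = solve 1 (λ a → let d = a :* con (+ 1 / 3) in d :+ d :+ d := a) refl

  assoc-*-+ : ∀ b r → (b + b) * r ≡ b * r + b * r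
  assoc-*-+ = solve 2 (λ b r → (b :+ b) :* r := b :* r :+ b :* r) refl

  *-swap₂ : ∀ e i b → e * i * b ≡ e * (b * i)
  *-swap₂ = solve 3 (λ e i b → e :* i :* b := e :* (b :* i)) refl

  half-suc : ∀ t s → (t * ½) * (1ℚ + (1ℚ + s)) + (t * ½) * s ≡ t * (1ℚ + s)
  half-suc = solve 2 (λ t s → (t :* con ½) :* (con 1ℚ :+ (con 1ℚ :+ s)) :+ (t :* con ½) :* s
                              := t :* (con 1ℚ :+ s)) refl

dist-sym : ∀ a b → ∣ a - b ∣ ≡ ∣ b - a ∣
dist-sym a b = trans (cong ∣_∣ (dist-swap a b)) (∣-p∣≡∣p∣ (b - a))

triangle : ∀ a b c → ∣ a - c ∣ ≤ ∣ a - b ∣ + ∣ b - c ∣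
triangle a b c = ≤-trans (≤-reflexive (cong ∣_∣ (dist-split a b c)))
                         (∣p+q∣≤∣p∣+∣q∣ (a - b) (b - c))

*-pos : ∀ {p q} → 0ℚ < p → 0ℚ < q → 0ℚ < p * q
*-pos {p} {q} 0<p 0<q =
  positive⁻¹ (p * q) {{pos*pos⇒pos p {{positive 0<p}} q {{positive 0<q}}}}

*-mono-≤-nn : ∀ {p q r s} → 0ℚ ≤ r → 0ℚ ≤ q → p ≤ q → r ≤ s → p * r ≤ q * s
*-mono-≤-nn {p} {q} {r} {s} 0≤r 0≤q p≤q r≤s =
  ≤-trans (*-monoʳ-≤-nonNeg r {{nonNegative 0≤r}} p≤q)
          (*-monoˡ-≤-nonNeg q {{nonNegative 0≤q}} r≤s)

quotient : ∀ e b → 0ℚ < e → 0ℚ < b → Σ[ δ ∈ ℚ ] (0ℚ < δ × δ * b ≡ e)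
quotient e b 0<e 0<b = e * i , *-pos 0<e (positive⁻¹ i {{1/pos⇒pos b}})
  , trans (*-swap₂ e i b) (trans (cong (e *_) (*-inverseʳ b)) (*-identityʳ e))
  where
  instance
    b>0 : Positive b
    b>0 = positive 0<b
    b≠0 : NonZero b
    b≠0 = pos⇒nonZero b
  i = 1/ b

toℚᵘ-fromℕℚ : ∀ n → toℚᵘ (fromℕℚ n) ℚᵘ.≃ ℚᵘ.mkℚᵘ (+ n) 0
toℚᵘ-fromℕℚ n = toℚᵘ-fromℚᵘ (ℚᵘ.mkℚᵘ (+ n) 0)

fromℕℚ-mono : ∀ {m n} → m ℕ.≤ n → fromℕℚ m ≤ fromℕℚ n
fromℕℚ-mono {m} {n} m≤n = toℚᵘ-cancel-≤
  (ℚᵘₚ.≤-respˡ-≃ (ℚᵘₚ.≃-sym (toℚᵘ-fromℕℚ m))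
  (ℚᵘₚ.≤-respʳ-≃ (ℚᵘₚ.≃-sym (toℚᵘ-fromℕℚ n))
    (ℚᵘ.*≤* (ℤₚ.*-monoʳ-≤-nonNeg (+ 1) (ℤ.+≤+ m≤n)))))

fromℕℚ-suc : ∀ n → fromℕℚ (suc n) ≡ 1ℚ + fromℕℚ n
fromℕℚ-suc n = toℚᵘ-injective (begin
  toℚᵘ (fromℕℚ (suc n))                 ≈⟨ toℚᵘ-fromℕℚ (suc n) ⟩
  ℚᵘ.mkℚᵘ (+ suc n) 0                   ≈⟨ ℚᵘ.*≡* (cong (ℤ._* + 1) (cong (λ z → + 1 ℤ.+ z) (sym (ℤₚ.*-identityʳ (+ n))))) ⟩
  ℚᵘ.1ℚᵘ ℚᵘ.+ ℚᵘ.mkℚᵘ (+ n) 0           ≈⟨ ℚᵘₚ.+-cong (ℚᵘₚ.≃-refl {ℚᵘ.1ℚᵘ}) (toℚᵘ-fromℕℚ n) ⟨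
  ℚᵘ.1ℚᵘ ℚᵘ.+ toℚᵘ (fromℕℚ n)           ≈⟨ toℚᵘ-homo-+ 1ℚ (fromℕℚ n) ⟨
  toℚᵘ (1ℚ + fromℕℚ n)                  ∎)
  where open ℚᵘₚ.≃-Reasoning

suc*1/suc : ∀ k → fromℕℚ (suc k) * (+ 1 / suc k) ≡ 1ℚ
suc*1/suc k = toℚᵘ-injective (begin
  toℚᵘ (fromℕℚ (suc k) * (+ 1 / suc k))
    ≈⟨ toℚᵘ-homo-* (fromℕℚ (suc k)) (+ 1 / suc k) ⟩
  toℚᵘ (fromℕℚ (suc k)) ℚᵘ.* toℚᵘ (+ 1 / suc k)
    ≈⟨ ℚᵘₚ.*-cong (toℚᵘ-fromℕℚ (suc k)) (toℚᵘ-fromℚᵘ (ℚᵘ.mkℚᵘ (+ 1) k)) ⟩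
  ℚᵘ.mkℚᵘ (+ suc k) 0 ℚᵘ.* ℚᵘ.mkℚᵘ (+ 1) k
    ≈⟨ ℚᵘ.*≡* (trans (ℤₚ.*-identityʳ _) (trans (ℤₚ.*-identityʳ (+ suc k))
         (sym (trans (ℤₚ.*-identityˡ _) (cong (λ j → + suc j) (ℕₚ.+-identityʳ k)))))) ⟩
  ℚᵘ.1ℚᵘ ∎)
  where open ℚᵘₚ.≃-Reasoning

1/suc>0 : ∀ k → 0ℚ < + 1 / suc k
1/suc>0 k = positive⁻¹ (+ 1 / suc k) {{normalize-pos 1 (suc k)}}

archimedean : ∀ q → Σ[ n ∈ ℕ ] q ≤ fromℕℚ n
archimedean q@(mkℚ (+ n) d-1 _) = n , toℚᵘ-cancel-≤
  (ℚᵘₚ.≤-respʳ-≃ (ℚᵘₚ.≃-sym (toℚᵘ-fromℕℚ n))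
    (ℚᵘ.*≤* (ℤₚ.*-monoˡ-≤-nonNeg (+ n) (ℤ.+≤+ (s≤s z≤n)))))
archimedean q@(mkℚ -[1+ n ] d-1 _) = 0 , <⇒≤ (negative⁻¹ q)

-- A real number is a Cauchy sequence of rationals; equality of reals is the
-- equivalence relation _≃ᴿ_.
IsCauchy : (ℕ → ℚ) → Set
IsCauchy s = ∀ ε → 0ℚ < ε →
  Σ[ N ∈ ℕ ] (∀ m n → N ℕ.≤ m → N ℕ.≤ n → ∣ s m - s n ∣ < ε)

record ℝ : Set where
  constructor mkℝ
  field
    seq    : ℕ → ℚ
    cauchy : IsCauchy seq

open ℝ public

infix 4 _≃ᴿ_ _≤ᴿ_ _<ᴿ_

_≃ᴿ_ : ℝ → ℝ → Set
x ≃ᴿ y = ∀ ε → 0ℚ < ε →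
  Σ[ N ∈ ℕ ] (∀ n → N ℕ.≤ n → ∣ seq x n - seq y n ∣ < ε)

_≤ᴿ_ : ℝ → ℝ → Set
x ≤ᴿ y = ∀ ε → 0ℚ < ε →
  Σ[ N ∈ ℕ ] (∀ n → N ℕ.≤ n → seq x n < seq y n + ε)

_<ᴿ_ : ℝ → ℝ → Set
x <ᴿ y = Σ[ ε ∈ ℚ ] (0ℚ < ε ×
  Σ[ N ∈ ℕ ] (∀ n → N ℕ.≤ n → seq x n + ε < seq y n))

fromℚ : ℚ → ℝ
fromℚ q = mkℝ (λ _ → q) λ ε 0<ε → 0 , λ _ _ _ _ →
  subst (λ d → ∣ d ∣ < ε) (sym (+-inverseʳ q)) 0<ε

fromℕ : ℕ → ℝ
fromℕ n = fromℚ (fromℕℚ n)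

fromℤ : ℤ → ℝ
fromℤ z = fromℚ (z / 1)

0ᴿ : ℝ
0ᴿ = fromℚ 0ℚ

half>0 : ∀ {ε} → 0ℚ < ε → 0ℚ < ε * ½
half>0 0<ε = *-pos 0<ε (positive⁻¹ ½)

eventually-bounded : ∀ x → Σ[ b ∈ ℚ ] (0ℚ < b ×
  Σ[ N ∈ ℕ ] (∀ n → N ℕ.≤ n → ∣ seq x n ∣ ≤ b))
eventually-bounded x with cauchy x 1ℚ (positive⁻¹ 1ℚ)
... | N , close = 1ℚ + ∣ seq x N ∣
  , +-mono-<-≤ (positive⁻¹ 1ℚ) (0≤∣p∣ (seq x N))
  , N , λ n N≤n → begin
    ∣ seq x n ∣                           ≡⟨ cong ∣_∣ (split-+ (seq x n) (seq x N)) ⟩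
    ∣ (seq x n - seq x N) + seq x N ∣     ≤⟨ ∣p+q∣≤∣p∣+∣q∣ (seq x n - seq x N) (seq x N) ⟩
    ∣ seq x n - seq x N ∣ + ∣ seq x N ∣   ≤⟨ +-monoˡ-≤ ∣ seq x N ∣ (<⇒≤ (close n N N≤n ℕₚ.≤-refl)) ⟩
    1ℚ + ∣ seq x N ∣                      ∎
  where open ≤-Reasoning

*-close : ∀ {b c δ} → 0ℚ < b → 0ℚ < c → ∀ u v u′ v′ → ∣ u ∣ ≤ b → ∣ v′ ∣ ≤ c →
  ∣ u - u′ ∣ < δ → ∣ v - v′ ∣ < δ → ∣ u * v - u′ * v′ ∣ < δ * (b + c)
*-close {b} {c} {δ} 0<b 0<c u v u′ v′ ∣u∣≤b ∣v′∣≤c Δu<δ Δv<δ = begin-strict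
  ∣ u * v - u′ * v′ ∣
    ≡⟨ cong ∣_∣ (dist-* u v u′ v′) ⟩
  ∣ u * (v - v′) + v′ * (u - u′) ∣
    ≤⟨ ∣p+q∣≤∣p∣+∣q∣ (u * (v - v′)) (v′ * (u - u′)) ⟩
  ∣ u * (v - v′) ∣ + ∣ v′ * (u - u′) ∣
    ≡⟨ cong₂ _+_ (∣p*q∣≡∣p∣*∣q∣ u (v - v′)) (∣p*q∣≡∣p∣*∣q∣ v′ (u - u′)) ⟩
  ∣ u ∣ * ∣ v - v′ ∣ + ∣ v′ ∣ * ∣ u - u′ ∣
    ≤⟨ +-mono-≤ (*-monoʳ-≤-nonNeg ∣ v - v′ ∣ {{∣-∣-nonNeg (v - v′)}} ∣u∣≤b)
                (*-monoʳ-≤-nonNeg ∣ u - u′ ∣ {{∣-∣-nonNeg (u - u′)}} ∣v′∣≤c) ⟩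
  b * ∣ v - v′ ∣ + c * ∣ u - u′ ∣
    <⟨ +-mono-< (*-monoʳ-<-pos b {{positive 0<b}} Δv<δ)
                (*-monoʳ-<-pos c {{positive 0<c}} Δu<δ) ⟩
  b * δ + c * δ
    ≡⟨ *-distribʳ-+ δ b c ⟨
  (b + c) * δ
    ≡⟨ *-comm (b + c) δ ⟩
  δ * (b + c) ∎
  where open ≤-Reasoning

-- Opaque to the typechecker, so that the operations below unfold only in
-- their sequences and not in their moduli of convergence.
abstract
  +-cauchy : ∀ x y → IsCauchy (λ n → seq x n + seq y n)
  +-cauchy x y ε 0<ε with cauchy x (ε * ½) (half>0 0<ε) | cauchy y (ε * ½) (half>0 0<ε)
  ... | N , cx | M , cy = N ℕ.⊔ M , λ m n N≤m N≤n → begin-strict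
    ∣ (seq x m + seq y m) - (seq x n + seq y n) ∣
      ≡⟨ cong ∣_∣ (dist-+ (seq x m) (seq y m) (seq x n) (seq y n)) ⟩
    ∣ (seq x m - seq x n) + (seq y m - seq y n) ∣
      ≤⟨ ∣p+q∣≤∣p∣+∣q∣ (seq x m - seq x n) (seq y m - seq y n) ⟩
    ∣ seq x m - seq x n ∣ + ∣ seq y m - seq y n ∣
      <⟨ +-mono-< (cx m n (ℕₚ.m⊔n≤o⇒m≤o N M N≤m) (ℕₚ.m⊔n≤o⇒m≤o N M N≤n))
                  (cy m n (ℕₚ.m⊔n≤o⇒n≤o N M N≤m) (ℕₚ.m⊔n≤o⇒n≤o N M N≤n)) ⟩
    ε * ½ + ε * ½
      ≡⟨ halves ε ⟩
    ε ∎
    where open ≤-Reasoning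

  neg-cauchy : ∀ x → IsCauchy (λ n → - seq x n)
  neg-cauchy x ε 0<ε with cauchy x ε 0<ε
  ... | N , cx = N , λ m n N≤m N≤n →
    subst (_< ε) (cong ∣_∣ (sym (dist-neg (seq x m) (seq x n)))) (cx n m N≤n N≤m)

  *-cauchy : ∀ x y → IsCauchy (λ n → seq x n * seq y n)
  *-cauchy x y ε 0<ε =
    let b , 0<b , N₁ , ∣x∣≤b = eventually-bounded x
        c , 0<c , N₂ , ∣y∣≤c = eventually-bounded y
        δ , 0<δ , δ*[b+c]≡ε  = quotient ε (b + c) 0<ε (+-mono-< 0<b 0<c)
        N₃ , cx              = cauchy x δ 0<δ
        N₄ , cy              = cauchy y δ 0<δ
        L                    = N₁ ℕ.⊔ N₂
        R                    = N₃ ℕ.⊔ N₄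
    in L ℕ.⊔ R , λ m n N≤m N≤n →
       subst (∣ seq x m * seq y m - seq x n * seq y n ∣ <_) δ*[b+c]≡ε
         (*-close 0<b 0<c (seq x m) (seq y m) (seq x n) (seq y n)
           (∣x∣≤b m (ℕₚ.m⊔n≤o⇒m≤o N₁ N₂ (ℕₚ.m⊔n≤o⇒m≤o L R N≤m)))
           (∣y∣≤c n (ℕₚ.m⊔n≤o⇒n≤o N₁ N₂ (ℕₚ.m⊔n≤o⇒m≤o L R N≤n)))
           (cx m n (ℕₚ.m⊔n≤o⇒m≤o N₃ N₄ (ℕₚ.m⊔n≤o⇒n≤o L R N≤m))
                   (ℕₚ.m⊔n≤o⇒m≤o N₃ N₄ (ℕₚ.m⊔n≤o⇒n≤o L R N≤n)))
           (cy m n (ℕₚ.m⊔n≤o⇒n≤o N₃ N₄ (ℕₚ.m⊔n≤o⇒n≤o L R N≤m))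
                   (ℕₚ.m⊔n≤o⇒n≤o N₃ N₄ (ℕₚ.m⊔n≤o⇒n≤o L R N≤n))))

infixl 6 _+ᴿ_ _-ᴿ_
infixl 7 _*ᴿ_
infix  8 -ᴿ_

_+ᴿ_ : ℝ → ℝ → ℝ
x +ᴿ y = mkℝ (λ n → seq x n + seq y n) (+-cauchy x y)

-ᴿ_ : ℝ → ℝ
-ᴿ x = mkℝ (λ n → - seq x n) (neg-cauchy x)

_-ᴿ_ : ℝ → ℝ → ℝ
x -ᴿ y = x +ᴿ (-ᴿ y)

_*ᴿ_ : ℝ → ℝ → ℝ
x *ᴿ y = mkℝ (λ n → seq x n * seq y n) (*-cauchy x y)

-- expTerm q k = qᵏ / k!
expTerm : ℚ → ℕ → ℚ
expTerm q zero    = 1ℚ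
expTerm q (suc k) = expTerm q k * (q * (+ 1 / suc k))

-- expSum q n = Σ_{k < n} qᵏ / k!
expSum : ℚ → ℕ → ℚ
expSum q zero    = 0ℚ
expSum q (suc n) = expSum q n + expTerm q n

expTermᴿ : ℝ → ℕ → ℝ
expTermᴿ x zero    = fromℚ 1ℚ
expTermᴿ x (suc k) = expTermᴿ x k *ᴿ (x *ᴿ fromℚ (+ 1 / suc k))

expSumᴿ : ℝ → ℕ → ℝ
expSumᴿ x zero    = fromℚ 0ℚ
expSumᴿ x (suc n) = expSumᴿ x n +ᴿ expTermᴿ x n

seq-expTermᴿ : ∀ x k n → seq (expTermᴿ x k) n ≡ expTerm (seq x n) k
seq-expTermᴿ x zero    n = refl
seq-expTermᴿ x (suc k) n = cong (_* (seq x n * (+ 1 / suc k))) (seq-expTermᴿ x k n)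

seq-expSumᴿ : ∀ x k n → seq (expSumᴿ x k) n ≡ expSum (seq x n) k
seq-expSumᴿ x zero    n = refl
seq-expSumᴿ x (suc k) n = cong₂ _+_ (seq-expSumᴿ x k n) (seq-expTermᴿ x k n)

-- For q in [-b , b] the tail of the series is dominated by a geometric one.
module Tail (b : ℚ) (0<b : 0ℚ < b) where
  t : ℕ → ℚ
  t = expTerm b

  t>0 : ∀ k → 0ℚ < t k
  t>0 zero    = positive⁻¹ 1ℚ
  t>0 (suc k) = *-pos (t>0 k) (*-pos 0<b (1/suc>0 k))

  ∣expTerm∣≤t : ∀ q → ∣ q ∣ ≤ b → ∀ k → ∣ expTerm q k ∣ ≤ t k
  ∣expTerm∣≤t q ∣q∣≤b zero    = ≤-refl
  ∣expTerm∣≤t q ∣q∣≤b (suc k) = begin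
    ∣ expTerm q k * (q * r) ∣         ≡⟨ ∣p*q∣≡∣p∣*∣q∣ (expTerm q k) (q * r) ⟩
    ∣ expTerm q k ∣ * ∣ q * r ∣       ≡⟨ cong (∣ expTerm q k ∣ *_) (∣p*q∣≡∣p∣*∣q∣ q r) ⟩
    ∣ expTerm q k ∣ * (∣ q ∣ * ∣ r ∣) ≡⟨ cong (λ z → ∣ expTerm q k ∣ * (∣ q ∣ * z)) (0≤p⇒∣p∣≡p 0≤r) ⟩
    ∣ expTerm q k ∣ * (∣ q ∣ * r)
      ≤⟨ *-mono-≤-nn (≤-trans (≤-reflexive (sym (*-zeroˡ r))) (*-monoʳ-≤-nonNeg r {{nonNegative 0≤r}} (0≤∣p∣ q)))
                     (<⇒≤ (t>0 k)) (∣expTerm∣≤t q ∣q∣≤b k)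
                     (*-monoʳ-≤-nonNeg r {{nonNegative 0≤r}} ∣q∣≤b) ⟩
    t k * (b * r) ∎
    where
    open ≤-Reasoning
    r = + 1 / suc k
    0≤r = <⇒≤ (1/suc>0 k)

  K₀ : ℕ
  K₀ = proj₁ (archimedean (b + b))

  t-halves : ∀ k → K₀ ℕ.≤ k → t (suc k) ≤ t k * ½
  t-halves k K₀≤k = *-monoˡ-≤-nonNeg (t k) {{nonNegative (<⇒≤ (t>0 k))}} (begin
    b * r                       ≡⟨ halve-double (b * r) ⟨
    (b * r + b * r) * ½         ≡⟨ cong (_* ½) (assoc-*-+ b r) ⟨
    (b + b) * r * ½
      ≤⟨ *-monoʳ-≤-nonNeg ½ (*-monoʳ-≤-nonNeg r {{nonNegative (<⇒≤ (1/suc>0 k))}}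
           (≤-trans (proj₂ (archimedean (b + b))) (fromℕℚ-mono (ℕₚ.m≤n⇒m≤1+n K₀≤k)))) ⟩
    fromℕℚ (suc k) * r * ½      ≡⟨ cong (_* ½) (suc*1/suc k) ⟩
    1ℚ * ½                      ≡⟨ *-identityˡ ½ ⟩
    ½                           ∎)
    where
    open ≤-Reasoning
    r = + 1 / suc k

  double-t : ∀ k → K₀ ℕ.≤ k → t (suc k) + t (suc k) ≤ t k
  double-t k K₀≤k = ≤-trans (+-mono-≤ (t-halves k K₀≤k) (t-halves k K₀≤k))
                            (≤-reflexive (halves (t k)))

  tail-bound : ∀ q → ∣ q ∣ ≤ b → ∀ N → K₀ ℕ.≤ N → ∀ j →
    ∣ expSum q (j ℕ.+ N) - expSum q N ∣ + (t (j ℕ.+ N) + t (j ℕ.+ N)) ≤ t N + t N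
  tail-bound q ∣q∣≤b N K₀≤N zero = ≤-reflexive
    (trans (cong (λ d → ∣ d ∣ + (t N + t N)) (+-inverseʳ (expSum q N))) (+-identityˡ (t N + t N)))
  tail-bound q ∣q∣≤b N K₀≤N (suc j) = begin
    ∣ expSum q n + expTerm q n - expSum q N ∣ + (t (suc n) + t (suc n))
      ≡⟨ cong (λ d → ∣ d ∣ + (t (suc n) + t (suc n))) (dist-step (expSum q n) (expSum q N) (expTerm q n)) ⟩
    ∣ (expSum q n - expSum q N) + expTerm q n ∣ + (t (suc n) + t (suc n))
      ≤⟨ +-mono-≤ (≤-trans (∣p+q∣≤∣p∣+∣q∣ (expSum q n - expSum q N) (expTerm q n))
                           (+-monoʳ-≤ ∣ expSum q n - expSum q N ∣ (∣expTerm∣≤t q ∣q∣≤b n)))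
                  (double-t n (ℕₚ.≤-trans K₀≤N (ℕₚ.m≤n+m N j))) ⟩
    ∣ expSum q n - expSum q N ∣ + t n + t n
      ≡⟨ +-assoc ∣ expSum q n - expSum q N ∣ (t n) (t n) ⟩
    ∣ expSum q n - expSum q N ∣ + (t n + t n)
      ≤⟨ tail-bound q ∣q∣≤b N K₀≤N j ⟩
    t N + t N ∎
    where
    open ≤-Reasoning
    n = j ℕ.+ N

  t-decay : ∀ j → t (j ℕ.+ K₀) * fromℕℚ (suc j) ≤ t K₀
  t-decay zero    = ≤-reflexive (*-identityʳ (t K₀))
  t-decay (suc j) = begin
    t (suc k) * fromℕℚ (suc (suc j))
      ≤⟨ *-monoʳ-≤-nonNeg (fromℕℚ (suc (suc j))) {{normalize-nonNeg (suc (suc j)) 1}}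
           (t-halves k (ℕₚ.m≤n+m K₀ j)) ⟩
    t k * ½ * fromℕℚ (suc (suc j))
      ≡⟨ cong (t k * ½ *_) (trans (fromℕℚ-suc (suc j)) (cong (λ z → 1ℚ + z) (fromℕℚ-suc j))) ⟩
    t k * ½ * (1ℚ + (1ℚ + s))
      ≤⟨ ≤-trans (≤-reflexive (sym (+-identityʳ _)))
                 (+-monoʳ-≤ (t k * ½ * (1ℚ + (1ℚ + s))) 0≤rest) ⟩
    t k * ½ * (1ℚ + (1ℚ + s)) + t k * ½ * s
      ≡⟨ half-suc (t k) s ⟩
    t k * (1ℚ + s)
      ≡⟨ cong (t k *_) (fromℕℚ-suc j) ⟨
    t k * fromℕℚ (suc j)
      ≤⟨ t-decay j ⟩
    t K₀ ∎
    where
    open ≤-Reasoning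
    k = j ℕ.+ K₀
    s = fromℕℚ j
    0≤rest : 0ℚ ≤ t k * ½ * s
    0≤rest = ≤-trans (≤-reflexive (sym (*-zeroʳ (t k * ½))))
      (*-monoˡ-≤-nonNeg (t k * ½) {{nonNegative (<⇒≤ (half>0 (t>0 k)))}}
        (nonNegative⁻¹ s {{normalize-nonNeg j 1}}))

  t-small : ∀ δ → 0ℚ < δ → Σ[ N ∈ ℕ ] (K₀ ℕ.≤ N × t N < δ)
  t-small δ 0<δ =
    let c , _ , c*δ≡tK₀ = quotient (t K₀) δ (t>0 K₀) 0<δ
        j , c≤j         = archimedean c
    in j ℕ.+ K₀ , ℕₚ.m≤n+m K₀ j , small c j c*δ≡tK₀ c≤j
    where
    open ≤-Reasoning
    j<suc-j : ∀ j → fromℕℚ j < fromℕℚ (suc j)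
    j<suc-j j = begin-strict
      fromℕℚ j       ≡⟨ +-identityˡ (fromℕℚ j) ⟨
      0ℚ + fromℕℚ j  <⟨ +-monoˡ-< (fromℕℚ j) (positive⁻¹ 1ℚ) ⟩
      1ℚ + fromℕℚ j  ≡⟨ fromℕℚ-suc j ⟨
      fromℕℚ (suc j) ∎
    small : ∀ c j → c * δ ≡ t K₀ → c ≤ fromℕℚ j → t (j ℕ.+ K₀) < δ
    small c j c*δ≡tK₀ c≤j = *-cancelʳ-<-nonNeg (fromℕℚ (suc j)) {{normalize-nonNeg (suc j) 1}} (begin-strict
        t (j ℕ.+ K₀) * fromℕℚ (suc j)  ≤⟨ t-decay j ⟩
        t K₀                           ≡⟨ c*δ≡tK₀ ⟨
        c * δ                          ≤⟨ *-monoʳ-≤-nonNeg δ {{nonNegative (<⇒≤ 0<δ)}} c≤j ⟩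
        fromℕℚ j * δ                   <⟨ *-monoˡ-<-pos δ {{positive 0<δ}} (j<suc-j j) ⟩
        fromℕℚ (suc j) * δ             ≡⟨ *-comm (fromℕℚ (suc j)) δ ⟩
        δ * fromℕℚ (suc j)             ∎)

  expSum-tail : ∀ δ → 0ℚ < δ → Σ[ N ∈ ℕ ] (∀ q → ∣ q ∣ ≤ b → ∀ n → N ℕ.≤ n →
    ∣ expSum q n - expSum q N ∣ < δ)
  expSum-tail δ 0<δ =
    let N , K₀≤N , tN<δ/2 = t-small (δ * ½) (half>0 0<δ)
    in N , λ q ∣q∣≤b n N≤n →
      subst (λ m → ∣ expSum q m - expSum q N ∣ < δ) (ℕₚ.m∸n+n≡m N≤n)
        (bound q ∣q∣≤b N K₀≤N tN<δ/2 (n ℕ.∸ N))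
    where
    open ≤-Reasoning
    bound : ∀ q → ∣ q ∣ ≤ b → ∀ N → K₀ ℕ.≤ N → t N < δ * ½ → ∀ j →
      ∣ expSum q (j ℕ.+ N) - expSum q N ∣ < δ
    bound q ∣q∣≤b N K₀≤N tN<δ/2 j = begin-strict
      ∣ expSum q (j ℕ.+ N) - expSum q N ∣
        ≡⟨ +-identityʳ ∣ expSum q (j ℕ.+ N) - expSum q N ∣ ⟨
      ∣ expSum q (j ℕ.+ N) - expSum q N ∣ + 0ℚ
        ≤⟨ +-monoʳ-≤ ∣ expSum q (j ℕ.+ N) - expSum q N ∣
             (<⇒≤ (+-mono-< (t>0 (j ℕ.+ N)) (t>0 (j ℕ.+ N)))) ⟩
      ∣ expSum q (j ℕ.+ N) - expSum q N ∣ + (t (j ℕ.+ N) + t (j ℕ.+ N))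
        ≤⟨ tail-bound q ∣q∣≤b N K₀≤N j ⟩
      t N + t N
        <⟨ +-mono-< tN<δ/2 tN<δ/2 ⟩
      δ * ½ + δ * ½
        ≡⟨ halves δ ⟩
      δ ∎

within-thirds : ∀ ε a b c d → let δ = ε * (+ 1 / 3) in
  ∣ a - b ∣ < δ → ∣ b - c ∣ < δ → ∣ d - c ∣ < δ → ∣ a - d ∣ < ε
within-thirds ε a b c d a~b b~c d~c = begin-strict
  ∣ a - d ∣                             ≤⟨ triangle a c d ⟩
  ∣ a - c ∣ + ∣ c - d ∣                 ≤⟨ +-monoˡ-≤ ∣ c - d ∣ (triangle a b c) ⟩
  ∣ a - b ∣ + ∣ b - c ∣ + ∣ c - d ∣     ≡⟨ cong (λ z → ∣ a - b ∣ + ∣ b - c ∣ + z) (dist-sym c d) ⟩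
  ∣ a - b ∣ + ∣ b - c ∣ + ∣ d - c ∣     <⟨ +-mono-< (+-mono-< a~b b~c) d~c ⟩
  ε * (+ 1 / 3) + ε * (+ 1 / 3) + ε * (+ 1 / 3)
                                        ≡⟨ thirds ε ⟩
  ε                                     ∎
  where open ≤-Reasoning

abstract
  exp-cauchy : ∀ x → IsCauchy (λ n → expSum (seq x n) n)
  exp-cauchy x ε 0<ε =
    let δ                     = ε * (+ 1 / 3)
        0<δ                   = *-pos 0<ε (positive⁻¹ (+ 1 / 3))
        b , 0<b , M₁ , ∣x∣≤b  = eventually-bounded x
        N , tail<δ            = Tail.expSum-tail b 0<b δ 0<δ
        M₂ , close            = cauchy (expSumᴿ x N) δ 0<δ
        M                     = M₁ ℕ.⊔ M₂
    in M ℕ.⊔ N , λ m n L≤m L≤n →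
       within-thirds ε (expSum (seq x m) m) (expSum (seq x m) N)
                       (expSum (seq x n) N) (expSum (seq x n) n)
         (tail<δ (seq x m) (∣x∣≤b m (ℕₚ.m⊔n≤o⇒m≤o M₁ M₂ (ℕₚ.m⊔n≤o⇒m≤o M N L≤m)))
                 m (ℕₚ.m⊔n≤o⇒n≤o M N L≤m))
         (subst₂ (λ u v → ∣ u - v ∣ < δ) (seq-expSumᴿ x N m) (seq-expSumᴿ x N n)
           (close m n (ℕₚ.m⊔n≤o⇒n≤o M₁ M₂ (ℕₚ.m⊔n≤o⇒m≤o M N L≤m))
                      (ℕₚ.m⊔n≤o⇒n≤o M₁ M₂ (ℕₚ.m⊔n≤o⇒m≤o M N L≤n))))
         (tail<δ (seq x n) (∣x∣≤b n (ℕₚ.m⊔n≤o⇒m≤o M₁ M₂ (ℕₚ.m⊔n≤o⇒m≤o M N L≤n)))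
                 n (ℕₚ.m⊔n≤o⇒n≤o M N L≤n))

exp : ℝ → ℝ
exp x = mkℝ (λ n → expSum (seq x n) n) (exp-cauchy x)

-- ℓ is the natural logarithm of x.  (exp is injective, so ℓ is unique up to
-- _≃ᴿ_; it exists exactly when x is positive.)
_IsLogOf_ : ℝ → ℝ → Set
ℓ IsLogOf x = exp ℓ ≃ᴿ x

_≟ⱽ_ : ∀ {D} → DecidableEquality (Vec ℤ D)
_≟ⱽ_ = Vecₚ.≡-dec ℤₚ._≟_

-- Duplicate-free, so that the length of the list is the cardinality of the set.
record FinSet (D : ℕ) : Set where
  constructor mkFinSet
  field
    elements : List (Vec ℤ D)
    unique   : Unique elements

open FinSet public

infix 4 _∈ˢ_ _⊆ˢ_

_∈ˢ_ : ∀ {D} → Vec ℤ D → FinSet D → Set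
v ∈ˢ A = v ∈ elements A

_⊆ˢ_ : ∀ {D} → FinSet D → FinSet D → Set
A ⊆ˢ B = ∀ {v} → v ∈ˢ A → v ∈ˢ B

Nonempty : ∀ {D} → FinSet D → Set
Nonempty {D} A = Σ[ v ∈ Vec ℤ D ] v ∈ˢ A

card : ∀ {D} → FinSet D → ℕ
card A = length (elements A)

infixl 6 _⊕_

_⊕_ : ∀ {D} → FinSet D → FinSet D → FinSet D
A ⊕ B = mkFinSet (List.deduplicate _≟ⱽ_ sums) (UniqueDec.deduplicate-! _≟ⱽ_ sums)
  where sums = List.cartesianProductWith (zipWith ℤ._+_) (elements A) (elements B)

infix 4 _≈ⱽ_

_≈ⱽ_ : ∀ {D} → Vector ℝ D → Vector ℝ D → Set
v ≈ⱽ w = ∀ i → v i ≃ᴿ w i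

sumⱽ : ∀ {n} → Vector ℝ n → ℝ
sumⱽ = Vector.foldr _+ᴿ_ 0ᴿ

linComb : ∀ {D d} → Vector ℝ d → Vector (Vector ℝ D) d → Vector ℝ D
linComb c b i = sumⱽ (λ j → c j *ᴿ b j i)

record LinearSubspace (D : ℕ) : Set₁ where
  field
    Member : Vector ℝ D → Set
    respᴹ  : ∀ {v w} → v ≈ⱽ w → Member v → Member w
    zeroᴹ  : Member (λ _ → 0ᴿ)
    addᴹ   : ∀ {v w} → Member v → Member w → Member (λ i → v i +ᴿ w i)
    scaleᴹ : ∀ r {v} → Member v → Member (λ i → r *ᴿ v i)

open LinearSubspace public

record AffineSubspace (D : ℕ) : Set₁ where
  field
    point     : Vector ℝ D
    direction : LinearSubspace D

open AffineSubspace public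

_∈ᵃ_ : ∀ {D} → Vector ℝ D → AffineSubspace D → Set
v ∈ᵃ S = Member (direction S) (λ i → v i -ᴿ point S i)

_⊆ᵃ_ : ∀ {D} → AffineSubspace D → AffineSubspace D → Set
S ⊆ᵃ T = ∀ v → v ∈ᵃ S → v ∈ᵃ T

LinearlyIndependent : ∀ {D d} → Vector (Vector ℝ D) d → Set
LinearlyIndependent b =
  ∀ c → linComb c b ≈ⱽ (λ _ → 0ᴿ) → ∀ j → c j ≃ᴿ 0ᴿ

record Basis {D} (W : LinearSubspace D) (d : ℕ) : Set where
  field
    vectors     : Vector (Vector ℝ D) d
    inside      : ∀ j → Member W (vectors j)
    independent : LinearlyIndependent vectors
    spanning    : ∀ v → Member W v → Σ[ c ∈ Vector ℝ d ] v ≈ⱽ linComb c vectors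

embed : ∀ {D} → Vec ℤ D → Vector ℝ D
embed v i = fromℤ (lookup v i)

_Contains_ : ∀ {D} → AffineSubspace D → FinSet D → Set
S Contains B = ∀ {v} → v ∈ˢ B → embed v ∈ᵃ S

-- HasDim B d says that dim B is defined and equals d.  (It is never defined
-- for B empty and D positive, as then there is no smallest affine subspace.)
record HasDim {D} (B : FinSet D) (d : ℕ) : Set₁ where
  field
    hull     : AffineSubspace D
    contains : hull Contains B
    smallest : ∀ T → T Contains B → hull ⊆ᵃ T
    basis    : Basis (direction hull) d

{-# OPTIONS --safe #-}

-- For independent random variables X, Y put δ(X , Y) = 2 H(X + Y) − H(X) − H(Y); for X and Y uniform on A
-- this is at most 2 log (|A + A| / |A|). The reduction of X modulo 2 has entropy O(δ(X , Y)), since x + 2y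
-- has the parity of x. By the entropy decrement argument of Gowers, Green, Manners and Tao, a random variable x
-- on 𝔽₂ⁿ has, modulo a subgroup of size exp O(H(x)), an entropy bounded by its doubling. Applied to the reduction
-- modulo 2 of uniform variables on A and B, in coordinates for the lattice generated by their differences, this
-- yields a homomorphism that either splits A or B into proper fibres, on some pair of which 101 δ(X , Y) − H(X) − H(Y)
-- does not increase, or vanishes and bounds the rank of the lattice by O(δ(X , Y)). Iteration ends in a dense
-- piece of small dimension. Existence is proved up to ¬¬ and made effective by a search over the subsets of A.

module Submission where

open import Defs
open import Data.Nat.Base as ℕ using (ℕ; zero; suc; z≤n; s≤s; _>_)
import Data.Nat.Properties as ℕₚ
open import Data.Integer.Base as ℤ using (ℤ; +_; -[1+_])
import Data.Integer.Properties as ℤₚ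
open import Data.Rational.Base hiding (_>_)
import Data.Rational.Properties as ℚₚ
import Data.Rational.Unnormalised.Base as ℚᵘ
import Data.Rational.Unnormalised.Properties as ℚᵘₚ
open import Data.Rational.Solver using (module +-*-Solver)
open import Data.Bool.Base using (Bool; true; false; T; _∧_; _xor_; not)
import Data.Bool.Properties as Boolₚ
open import Data.Unit.Base using (⊤; tt)
open import Data.Empty using (⊥; ⊥-elim)
open import Data.Fin.Base using (Fin)
open import Data.List.Base as List using (List; []; _∷_; length; _++_)
import Data.List.Properties as Listₚ
open import Data.List.Membership.Propositional using (_∈_)
import Data.List.Membership.Propositional.Properties as ∈ₚ
open import Data.List.Relation.Unary.Any as Any using (Any; here; there)
open import Data.List.Relation.Unary.All as All using (All; []; _∷_)
import Data.List.Relation.Unary.All.Properties as Allₚ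
import Data.List.Relation.Unary.AllPairs as AllPairs
open import Data.List.Relation.Unary.Unique.Propositional using (Unique)
import Data.List.Relation.Unary.Unique.Propositional.Properties as Uniqueₚ
open import Data.Vec.Base as Vec using (Vec; []; _∷_; lookup; zipWith)
import Data.Vec.Properties as Vecₚ
open import Data.Vec.Functional using (Vector)
open import Data.Product.Base using (Σ; Σ-syntax; ∃; _×_; _,_; proj₁; proj₂)
import Data.Product.Properties as Productₚ
open import Data.Sum.Base using (_⊎_; inj₁; inj₂; [_,_]′)
open import Function.Base using (_∘_; id; case_of_)
open import Relation.Binary.Definitions using (DecidableEquality)
open import Relation.Binary.PropositionalEquality
open import Relation.Nullary using (¬_; Dec; yes; no; does; contradiction; _×-dec_)
open import Relation.Nullary.Decidable using (dec-true; dec-false; decidable-stable; toWitness)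
open import Data.List.Relation.Binary.Sublist.Propositional as Sublist using (_⊆_; ⊆-refl; ⊆-trans)
import Data.List.Relation.Binary.Sublist.Propositional.Properties as Sublistₚ

-- Ordered modules over ℚ

-- The usual entropy proof chooses a minimiser of a distance functional; here entropies are Cauchy
-- reals with undecidable order, and no minimiser can be chosen. Instead `τ` is made to fall by at
-- least `D`, so that after finitely many steps `D` is as small as desired, and a variable of tiny
-- `D` is compared with an exact subgroup. The tolerance may depend on the dimension n, because the
-- distance to the original variable stays bounded during the descent and the final bounds refer to
-- that distance alone. The entropy argument runs over an abstract `LogModule`, whose analytic core
-- is log p ≤ p - 1. This yields submodularity, and the further Shannon-type inequalities are
-- nonnegative combinations checked by `linear`. Lattice coordinates are what give parity its force:
-- a set of even vectors shows no parity in its original coordinates. In coordinates for the lattice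
-- generated by the differences, a binary homomorphism that is constant on both sets kills the
-- generators, hence the whole lattice; being onto, it has a trivial target.

/1-+ : ∀ a b → (a ℤ.+ b) / 1 ≡ a / 1 + b / 1
/1-+ a b = ℚₚ.toℚᵘ-injective (begin
  toℚᵘ ((a ℤ.+ b) / 1)                  ≈⟨ ℚₚ.toℚᵘ-fromℚᵘ (ℚᵘ.mkℚᵘ (a ℤ.+ b) 0) ⟩
  ℚᵘ.mkℚᵘ (a ℤ.+ b) 0                   ≈⟨ ℚᵘ.*≡* (cong (ℤ._* + 1) (sym (cong₂ ℤ._+_ (ℤₚ.*-identityʳ a) (ℤₚ.*-identityʳ b)))) ⟩
  ℚᵘ.mkℚᵘ a 0 ℚᵘ.+ ℚᵘ.mkℚᵘ b 0          ≈⟨ ℚᵘₚ.+-cong (ℚₚ.toℚᵘ-fromℚᵘ (ℚᵘ.mkℚᵘ a 0)) (ℚₚ.toℚᵘ-fromℚᵘ (ℚᵘ.mkℚᵘ b 0)) ⟨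
  toℚᵘ (a / 1) ℚᵘ.+ toℚᵘ (b / 1)        ≈⟨ ℚₚ.toℚᵘ-homo-+ (a / 1) (b / 1) ⟨
  toℚᵘ (a / 1 + b / 1)                  ∎)
  where open ℚᵘₚ.≃-Reasoning

/1-* : ∀ a b → (a ℤ.* b) / 1 ≡ (a / 1) * (b / 1)
/1-* a b = ℚₚ.toℚᵘ-injective (begin
  toℚᵘ ((a ℤ.* b) / 1)                  ≈⟨ ℚₚ.toℚᵘ-fromℚᵘ (ℚᵘ.mkℚᵘ (a ℤ.* b) 0) ⟩
  ℚᵘ.mkℚᵘ a 0 ℚᵘ.* ℚᵘ.mkℚᵘ b 0          ≈⟨ ℚᵘₚ.*-cong (ℚₚ.toℚᵘ-fromℚᵘ (ℚᵘ.mkℚᵘ a 0)) (ℚₚ.toℚᵘ-fromℚᵘ (ℚᵘ.mkℚᵘ b 0)) ⟨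
  toℚᵘ (a / 1) ℚᵘ.* toℚᵘ (b / 1)        ≈⟨ ℚₚ.toℚᵘ-homo-* (a / 1) (b / 1) ⟨
  toℚᵘ ((a / 1) * (b / 1))              ∎)
  where open ℚᵘₚ.≃-Reasoning

/1-neg : ∀ a → (ℤ.- a) / 1 ≡ - (a / 1)
/1-neg a = ℚₚ.toℚᵘ-injective (begin
  toℚᵘ ((ℤ.- a) / 1)   ≈⟨ ℚₚ.toℚᵘ-fromℚᵘ (ℚᵘ.mkℚᵘ (ℤ.- a) 0) ⟩
  ℚᵘ.- ℚᵘ.mkℚᵘ a 0     ≈⟨ ℚᵘₚ.-‿cong (ℚₚ.toℚᵘ-fromℚᵘ (ℚᵘ.mkℚᵘ a 0)) ⟨
  ℚᵘ.- toℚᵘ (a / 1)    ≈⟨ ℚₚ.toℚᵘ-homo‿- (a / 1) ⟨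
  toℚᵘ (- (a / 1))     ∎)
  where open ℚᵘₚ.≃-Reasoning

p≤q⇒0≤q-p : ∀ {p q} → p ≤ q → 0ℚ ≤ q - p
p≤q⇒0≤q-p {p} {q} p≤q = subst (_≤ q - p) (ℚₚ.+-inverseʳ p) (ℚₚ.+-monoˡ-≤ (- p) p≤q)

-- Linear expressions in the atoms ρ, normalised to their list of integer
-- coefficients.
infixl 6 _⊹_ _⊝_
infixr 7 _⊛_
data Linear : Set where
  var  : ℕ → Linear
  _⊹_ _⊝_ : Linear → Linear → Linear
  _⊛_ : ℕ → Linear → Linear
  𝕠   : Linear

pattern v₀ = var 0
pattern v₁ = var 1
pattern v₂ = var 2
pattern v₃ = var 3
pattern v₄ = var 4
pattern v₅ = var 5
pattern v₆ = var 6
pattern v₇ = var 7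
pattern v₈ = var 8
pattern v₉ = var 9

-- One interface for the rationals, where probabilities live, and for the reals, where entropies
-- live, so that integration is developed once for both. Equality is inequality in both directions,
-- which for Cauchy reals is `_≃ᴿ_`.
record OrderedModule : Set₁ where
  infix  4 _≤ᵛ_ _≈ᵛ_
  infixl 6 _+ᵛ_ _-ᵛ_
  infixr 7 _•_ _×ᵛ_
  infix  8 -ᵛ_
  field
    Carrier : Set
    _≤ᵛ_    : Carrier → Carrier → Set
    _+ᵛ_    : Carrier → Carrier → Carrier
    -ᵛ_     : Carrier → Carrier
    0ᵛ      : Carrier
    _•_     : ℚ → Carrier → Carrier

  _≈ᵛ_ : Carrier → Carrier → Set
  x ≈ᵛ y = x ≤ᵛ y × y ≤ᵛ x

  _-ᵛ_ : Carrier → Carrier → Carrier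
  x -ᵛ y = x +ᵛ -ᵛ y

  _×ᵛ_ : ℕ → Carrier → Carrier
  n ×ᵛ x = fromℕℚ n • x

  field
    ≤ᵛ-refl  : ∀ {x} → x ≤ᵛ x
    ≤ᵛ-trans : ∀ {x y z} → x ≤ᵛ y → y ≤ᵛ z → x ≤ᵛ z
    +ᵛ-mono  : ∀ {x y u v} → x ≤ᵛ y → u ≤ᵛ v → x +ᵛ u ≤ᵛ y +ᵛ v
    +ᵛ-assoc : ∀ x y z → (x +ᵛ y) +ᵛ z ≈ᵛ x +ᵛ (y +ᵛ z)
    +ᵛ-comm  : ∀ x y → x +ᵛ y ≈ᵛ y +ᵛ x
    +ᵛ-identityˡ : ∀ x → 0ᵛ +ᵛ x ≈ᵛ x
    +ᵛ-inverseʳ  : ∀ x → x -ᵛ x ≈ᵛ 0ᵛ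
    •-distribˡ : ∀ q x y → q • (x +ᵛ y) ≈ᵛ q • x +ᵛ q • y
    •-distribʳ : ∀ p q x → (p + q) • x ≈ᵛ p • x +ᵛ q • x
    •-assoc    : ∀ p q x → (p * q) • x ≈ᵛ p • (q • x)
    •-identity : ∀ x → 1ℚ • x ≈ᵛ x
    •-monoʳ    : ∀ {q x y} → 0ℚ ≤ q → x ≤ᵛ y → q • x ≤ᵛ q • y

  ≈ᵛ-refl : ∀ {x} → x ≈ᵛ x
  ≈ᵛ-refl = ≤ᵛ-refl , ≤ᵛ-refl

  ≈ᵛ-sym : ∀ {x y} → x ≈ᵛ y → y ≈ᵛ x
  ≈ᵛ-sym (p , q) = q , p

  ≈ᵛ-trans : ∀ {x y z} → x ≈ᵛ y → y ≈ᵛ z → x ≈ᵛ z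
  ≈ᵛ-trans (p , p′) (q , q′) = ≤ᵛ-trans p q , ≤ᵛ-trans q′ p′

  ≡⇒≈ᵛ : ∀ {x y} → x ≡ y → x ≈ᵛ y
  ≡⇒≈ᵛ refl = ≈ᵛ-refl

  +ᵛ-cong : ∀ {x y u v} → x ≈ᵛ y → u ≈ᵛ v → x +ᵛ u ≈ᵛ y +ᵛ v
  +ᵛ-cong (p , p′) (q , q′) = +ᵛ-mono p q , +ᵛ-mono p′ q′

  +ᵛ-identityʳ : ∀ x → x +ᵛ 0ᵛ ≈ᵛ x
  +ᵛ-identityʳ x = ≈ᵛ-trans (+ᵛ-comm x 0ᵛ) (+ᵛ-identityˡ x)

  +ᵛ-cancelʳ-≤ : ∀ {x y} z → x +ᵛ z ≤ᵛ y +ᵛ z → x ≤ᵛ y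
  +ᵛ-cancelʳ-≤ {x} {y} z p =
    ≤ᵛ-trans (proj₂ (cancel x)) (≤ᵛ-trans (+ᵛ-mono p ≤ᵛ-refl) (proj₁ (cancel y)))
    where
    cancel : ∀ x → (x +ᵛ z) -ᵛ z ≈ᵛ x
    cancel x = ≈ᵛ-trans (+ᵛ-assoc x z (-ᵛ z))
      (≈ᵛ-trans (+ᵛ-cong ≈ᵛ-refl (+ᵛ-inverseʳ z)) (+ᵛ-identityʳ x))

  +ᵛ-cancelʳ : ∀ {x y} z → x +ᵛ z ≈ᵛ y +ᵛ z → x ≈ᵛ y
  +ᵛ-cancelʳ z (p , q) = +ᵛ-cancelʳ-≤ z p , +ᵛ-cancelʳ-≤ z q

  +ᵛ-interchange : ∀ a b c d → (a +ᵛ b) +ᵛ (c +ᵛ d) ≈ᵛ (a +ᵛ c) +ᵛ (b +ᵛ d)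
  +ᵛ-interchange a b c d =
    ≈ᵛ-trans (+ᵛ-assoc a b (c +ᵛ d)) (≈ᵛ-trans (+ᵛ-cong ≈ᵛ-refl
      (≈ᵛ-trans (≈ᵛ-sym (+ᵛ-assoc b c d)) (≈ᵛ-trans (+ᵛ-cong (+ᵛ-comm b c) ≈ᵛ-refl) (+ᵛ-assoc c b d))))
      (≈ᵛ-sym (+ᵛ-assoc a c (b +ᵛ d))))

  -- `•-monoʳ` covers q ≥ 0. For q ≤ 0, q • x and q • y are additive inverses of (- q) • x and (- q)
  -- • y, which are already known to agree.
  •-congʳ : ∀ q {x y} → x ≈ᵛ y → q • x ≈ᵛ q • y
  •-congʳ q {x} {y} x≈y with ℚₚ.≤-total 0ℚ q
  ... | inj₁ 0≤q = •-monoʳ 0≤q (proj₁ x≈y) , •-monoʳ 0≤q (proj₂ x≈y)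
  ... | inj₂ q≤0 = +ᵛ-cancelʳ ((- q) • x) (≈ᵛ-trans (zero-sum x)
          (≈ᵛ-trans (≈ᵛ-sym (zero-sum y)) (+ᵛ-cong ≈ᵛ-refl (flip (≈ᵛ-sym x≈y)))))
    where
    flip : ∀ {x y} → x ≈ᵛ y → (- q) • x ≈ᵛ (- q) • y
    flip (p , p′) = •-monoʳ (ℚₚ.neg-antimono-≤ q≤0) p , •-monoʳ (ℚₚ.neg-antimono-≤ q≤0) p′
    twice : ∀ x → 0ℚ • x ≈ᵛ 0ᵛ
    twice x = +ᵛ-cancelʳ (0ℚ • x) (≈ᵛ-trans (≈ᵛ-sym (•-distribʳ 0ℚ 0ℚ x)) (≈ᵛ-sym (+ᵛ-identityˡ _)))
    zero-sum : ∀ x → q • x +ᵛ (- q) • x ≈ᵛ 0ᵛ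
    zero-sum x = ≈ᵛ-trans (≈ᵛ-sym (•-distribʳ q (- q) x))
      (≈ᵛ-trans (≡⇒≈ᵛ (cong (_• x) (ℚₚ.+-inverseʳ q))) (twice x))

  •-zeroˡ : ∀ x → 0ℚ • x ≈ᵛ 0ᵛ
  •-zeroˡ x = +ᵛ-cancelʳ (0ℚ • x) (≈ᵛ-trans (≈ᵛ-sym (•-distribʳ 0ℚ 0ℚ x)) (≈ᵛ-sym (+ᵛ-identityˡ _)))

  •-zeroʳ : ∀ q → q • 0ᵛ ≈ᵛ 0ᵛ
  •-zeroʳ q = +ᵛ-cancelʳ (q • 0ᵛ) (≈ᵛ-trans (≈ᵛ-sym (•-distribˡ q 0ᵛ 0ᵛ))
    (≈ᵛ-trans (•-congʳ q (+ᵛ-identityˡ 0ᵛ)) (≈ᵛ-sym (+ᵛ-identityˡ _))))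

  neg-• : ∀ x → (- 1ℚ) • x ≈ᵛ -ᵛ x
  neg-• x = +ᵛ-cancelʳ x (≈ᵛ-trans
    (≈ᵛ-trans (+ᵛ-cong ≈ᵛ-refl (≈ᵛ-sym (•-identity x)))
      (≈ᵛ-trans (≈ᵛ-sym (•-distribʳ (- 1ℚ) 1ℚ x)) (•-zeroˡ x)))
    (≈ᵛ-sym (≈ᵛ-trans (+ᵛ-comm (-ᵛ x) x) (+ᵛ-inverseʳ x))))

  •-nonNeg : ∀ {q x} → 0ℚ ≤ q → 0ᵛ ≤ᵛ x → 0ᵛ ≤ᵛ q • x
  •-nonNeg {q} 0≤q 0≤x = ≤ᵛ-trans (proj₂ (•-zeroʳ q)) (•-monoʳ 0≤q 0≤x)

  •-monoˡ : ∀ {p q x} → 0ᵛ ≤ᵛ x → p ≤ q → p • x ≤ᵛ q • x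
  •-monoˡ {p} {q} {x} 0≤x p≤q = ≤ᵛ-trans (proj₂ (+ᵛ-identityˡ _)) (≤ᵛ-trans
    (+ᵛ-mono (•-nonNeg (p≤q⇒0≤q-p p≤q) 0≤x) ≤ᵛ-refl)
    (≤ᵛ-trans (proj₂ (•-distribʳ (q - p) p x)) (proj₁ (≡⇒≈ᵛ (cong (_• x) (sym (split-+ q p)))))))

  atom : List Carrier → ℕ → Carrier
  atom []       _       = 0ᵛ
  atom (x ∷ _)  zero    = x
  atom (_ ∷ xs) (suc i) = atom xs i

  ⟦_⟧ : Linear → List Carrier → Carrier
  ⟦ var i ⟧ ρ  = atom ρ i
  ⟦ e ⊹ f ⟧ ρ = ⟦ e ⟧ ρ +ᵛ ⟦ f ⟧ ρ
  ⟦ e ⊝ f ⟧ ρ = ⟦ e ⟧ ρ -ᵛ ⟦ f ⟧ ρ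
  ⟦ n ⊛ e ⟧ ρ = n ×ᵛ ⟦ e ⟧ ρ
  ⟦ 𝕠 ⟧ ρ     = 0ᵛ

  addᶜ : List ℤ → List ℤ → List ℤ
  addᶜ []       bs       = bs
  addᶜ (a ∷ as) []       = a ∷ as
  addᶜ (a ∷ as) (b ∷ bs) = (a ℤ.+ b) ∷ addᶜ as bs

  scaleᶜ : ℤ → List ℤ → List ℤ
  scaleᶜ z = List.map (z ℤ.*_)

  unitᶜ : ℕ → List ℤ
  unitᶜ zero    = + 1 ∷ []
  unitᶜ (suc i) = + 0 ∷ unitᶜ i

  coefficients : Linear → List ℤ
  coefficients (var i)  = unitᶜ i
  coefficients (e ⊹ f) = addᶜ (coefficients e) (coefficients f)
  coefficients (e ⊝ f) = addᶜ (coefficients e) (scaleᶜ (ℤ.- + 1) (coefficients f))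
  coefficients (n ⊛ e) = scaleᶜ (+ n) (coefficients e)
  coefficients 𝕠       = []

  eval : List ℤ → List Carrier → Carrier
  eval []       _        = 0ᵛ
  eval (_ ∷ _)  []       = 0ᵛ
  eval (c ∷ cs) (x ∷ xs) = (c / 1) • x +ᵛ eval cs xs

  eval-add : ∀ as bs ρ → eval (addᶜ as bs) ρ ≈ᵛ eval as ρ +ᵛ eval bs ρ
  eval-add []       bs       ρ       = ≈ᵛ-sym (+ᵛ-identityˡ _)
  eval-add (a ∷ as) []       ρ       = ≈ᵛ-sym (+ᵛ-identityʳ _)
  eval-add (a ∷ as) (b ∷ bs) []      = ≈ᵛ-sym (+ᵛ-identityʳ _)
  eval-add (a ∷ as) (b ∷ bs) (x ∷ ρ) = ≈ᵛ-trans
    (+ᵛ-cong (≈ᵛ-trans (≡⇒≈ᵛ (cong (_• x) (/1-+ a b))) (•-distribʳ (a / 1) (b / 1) x)) (eval-add as bs ρ))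
    (+ᵛ-interchange _ _ _ _)

  eval-scale : ∀ z as ρ → eval (scaleᶜ z as) ρ ≈ᵛ (z / 1) • eval as ρ
  eval-scale z []       ρ       = ≈ᵛ-sym (•-zeroʳ _)
  eval-scale z (a ∷ as) []      = ≈ᵛ-sym (•-zeroʳ _)
  eval-scale z (a ∷ as) (x ∷ ρ) = ≈ᵛ-trans
    (+ᵛ-cong (≈ᵛ-trans (≡⇒≈ᵛ (cong (_• x) (/1-* z a))) (•-assoc (z / 1) (a / 1) x)) (eval-scale z as ρ))
    (≈ᵛ-sym (•-distribˡ _ _ _))

  eval-unit : ∀ i ρ → eval (unitᶜ i) ρ ≈ᵛ atom ρ i
  eval-unit zero    []      = ≈ᵛ-refl
  eval-unit (suc i) []      = ≈ᵛ-refl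
  eval-unit zero    (x ∷ ρ) = ≈ᵛ-trans (+ᵛ-identityʳ _) (•-identity x)
  eval-unit (suc i) (x ∷ ρ) = ≈ᵛ-trans (+ᵛ-cong (•-zeroˡ x) ≈ᵛ-refl) (≈ᵛ-trans (+ᵛ-identityˡ _) (eval-unit i ρ))

  eval-coefficients : ∀ e ρ → eval (coefficients e) ρ ≈ᵛ ⟦ e ⟧ ρ
  eval-coefficients (var i)  ρ = eval-unit i ρ
  eval-coefficients (e ⊹ f) ρ = ≈ᵛ-trans (eval-add (coefficients e) (coefficients f) ρ)
    (+ᵛ-cong (eval-coefficients e ρ) (eval-coefficients f ρ))
  eval-coefficients (e ⊝ f) ρ = ≈ᵛ-trans (eval-add (coefficients e) _ ρ)
    (+ᵛ-cong (eval-coefficients e ρ) (≈ᵛ-trans (eval-scale (ℤ.- + 1) (coefficients f) ρ)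
      (≈ᵛ-trans (neg-• _) (≈ᵛ-trans (≈ᵛ-sym (neg-• _)) (≈ᵛ-trans (•-congʳ (- 1ℚ) (eval-coefficients f ρ)) (neg-• _))))))
  eval-coefficients (n ⊛ e) ρ = ≈ᵛ-trans (eval-scale (+ n) (coefficients e) ρ)
    (•-congʳ _ (eval-coefficients e ρ))
  eval-coefficients 𝕠       ρ = ≈ᵛ-refl

  isZero : List ℤ → Bool
  isZero []           = true
  isZero (+ zero ∷ cs) = isZero cs
  isZero (_ ∷ _)      = false

  eval-isZero : ∀ cs ρ → T (isZero cs) → eval cs ρ ≈ᵛ 0ᵛ
  eval-isZero []            ρ       _ = ≈ᵛ-refl
  eval-isZero (+ zero ∷ cs) []      _ = ≈ᵛ-refl
  eval-isZero (+ zero ∷ cs) (x ∷ ρ) t = ≈ᵛ-trans (+ᵛ-cong (•-zeroˡ x) (eval-isZero cs ρ t)) (+ᵛ-identityˡ _)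

  infixr 5 _·_≦_∵_∷_
  -- A Farkas certificate: each inequality carries its multiplier, so that checking the certificate
  -- amounts to computing one vector of integers.
  data Hypotheses (ρ : List Carrier) : Set where
    []        : Hypotheses ρ
    _·_≦_∵_∷_ : (m : ℕ) (e f : Linear) → ⟦ e ⟧ ρ ≤ᵛ ⟦ f ⟧ ρ → Hypotheses ρ → Hypotheses ρ

  slack : ∀ {ρ} → Hypotheses ρ → Linear
  slack []                 = 𝕠
  slack (m · e ≦ f ∵ _ ∷ hs) = m ⊛ (f ⊝ e) ⊹ slack hs

  slack-nonNeg : ∀ {ρ} (hs : Hypotheses ρ) → 0ᵛ ≤ᵛ ⟦ slack hs ⟧ ρ
  slack-nonNeg []                 = ≤ᵛ-refl
  slack-nonNeg (m · e ≦ f ∵ h ∷ hs) = ≤ᵛ-trans (proj₂ (+ᵛ-identityˡ _)) (+ᵛ-mono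
    (•-nonNeg (ℚₚ.nonNegative⁻¹ (fromℕℚ m) {{ℚₚ.normalize-nonNeg m 1}})
      (≤ᵛ-trans (proj₂ (+ᵛ-inverseʳ _)) (+ᵛ-mono h ≤ᵛ-refl)))
    (slack-nonNeg hs))

  -- The goal e ≤ f is a nonnegative integer combination of the hypotheses.
  linear : (ρ : List Carrier) (e f : Linear) (hs : Hypotheses ρ) →
    {_ : T (isZero (coefficients (f ⊝ (e ⊹ slack hs))))} → ⟦ e ⟧ ρ ≤ᵛ ⟦ f ⟧ ρ
  linear ρ e f hs {t} = ≤ᵛ-trans (proj₂ (+ᵛ-identityʳ _)) (≤ᵛ-trans (+ᵛ-mono ≤ᵛ-refl (slack-nonNeg hs))
    (+ᵛ-cancelʳ-≤ (-ᵛ ⟦ e ⊹ slack hs ⟧ ρ)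
      (≤ᵛ-trans (proj₁ (+ᵛ-inverseʳ _)) (proj₂ (≈ᵛ-trans (≈ᵛ-sym (eval-coefficients (f ⊝ (e ⊹ slack hs)) ρ))
        (eval-isZero (coefficients (f ⊝ (e ⊹ slack hs))) ρ t))))))

ℚ-module : OrderedModule
ℚ-module = record
  { Carrier = ℚ ; _≤ᵛ_ = _≤_ ; _+ᵛ_ = _+_ ; -ᵛ_ = -_ ; 0ᵛ = 0ℚ ; _•_ = _*_
  ; ≤ᵛ-refl = ℚₚ.≤-refl ; ≤ᵛ-trans = ℚₚ.≤-trans ; +ᵛ-mono = ℚₚ.+-mono-≤
  ; +ᵛ-assoc = λ x y z → both (ℚₚ.+-assoc x y z) ; +ᵛ-comm = λ x y → both (ℚₚ.+-comm x y)
  ; +ᵛ-identityˡ = λ x → both (ℚₚ.+-identityˡ x) ; +ᵛ-inverseʳ = λ x → both (ℚₚ.+-inverseʳ x)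
  ; •-distribˡ = λ q x y → both (ℚₚ.*-distribˡ-+ q x y) ; •-distribʳ = λ p q x → both (ℚₚ.*-distribʳ-+ x p q)
  ; •-assoc = λ p q x → both (ℚₚ.*-assoc p q x) ; •-identity = λ x → both (ℚₚ.*-identityˡ x)
  ; •-monoʳ = λ {q} 0≤q x≤y → ℚₚ.*-monoˡ-≤-nonNeg q {{nonNegative 0≤q}} x≤y
  }
  where
  both : ∀ {x y : ℚ} → x ≡ y → x ≤ y × y ≤ x
  both refl = ℚₚ.≤-refl , ℚₚ.≤-refl

module ℚᴹ = OrderedModule ℚ-module

-- Finite probability spaces

-- Total, with value 0 at 0, so that densities such as 1/ℙ can be integrated without a proof of
-- positivity at each point.
recip : ℚ → ℚ
recip p with p ℚₚ.≟ 0ℚ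
... | yes _  = 0ℚ
... | no p≢0 = 1/_ p {{≢-nonZero p≢0}}

<⇒≢0 : ∀ {p} → 0ℚ < p → p ≢ 0ℚ
<⇒≢0 0<p refl = ℚₚ.<-irrefl refl 0<p

recip-inverseˡ : ∀ {p} → 0ℚ < p → recip p * p ≡ 1ℚ
recip-inverseˡ {p} 0<p with p ℚₚ.≟ 0ℚ
... | yes p≡0 = contradiction p≡0 (<⇒≢0 0<p)
... | no p≢0  = ℚₚ.*-inverseˡ p {{≢-nonZero p≢0}}

recip-inverseʳ : ∀ {p} → 0ℚ < p → p * recip p ≡ 1ℚ
recip-inverseʳ {p} 0<p = trans (ℚₚ.*-comm p (recip p)) (recip-inverseˡ 0<p)

recip-pos : ∀ {p} → 0ℚ < p → 0ℚ < recip p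
recip-pos {p} 0<p with p ℚₚ.≟ 0ℚ
... | yes p≡0 = contradiction p≡0 (<⇒≢0 0<p)
... | no p≢0  = ℚₚ.positive⁻¹ (1/_ p {{≢-nonZero p≢0}}) {{ℚₚ.1/pos⇒pos p {{positive 0<p}}}}

*-nonNeg : ∀ {p q} → 0ℚ ≤ p → 0ℚ ≤ q → 0ℚ ≤ p * q
*-nonNeg {p} {q} 0≤p 0≤q = subst (_≤ p * q) (ℚₚ.*-zeroʳ p) (ℚₚ.*-monoˡ-≤-nonNeg p {{nonNegative 0≤p}} 0≤q)

square-nonNeg : ∀ q → 0ℚ ≤ q * q
square-nonNeg q with ℚₚ.≤-total 0ℚ q
... | inj₁ 0≤q = *-nonNeg 0≤q 0≤q
... | inj₂ q≤0 = subst (0ℚ ≤_) (solve 1 (λ q → (:- q) :* (:- q) := q :* q) refl q)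
        (*-nonNeg (ℚₚ.neg-antimono-≤ q≤0) (ℚₚ.neg-antimono-≤ q≤0))
  where open +-*-Solver

0≤1 : 0ℚ ≤ 1ℚ
0≤1 = ℚₚ.nonNegative⁻¹ 1ℚ

𝟙 : Bool → ℚ
𝟙 true  = 1ℚ
𝟙 false = 0ℚ

𝟙-nonNeg : ∀ b → 0ℚ ≤ 𝟙 b
𝟙-nonNeg true  = 0≤1
𝟙-nonNeg false = ℚₚ.≤-refl

𝟙≤1 : ∀ b → 𝟙 b ≤ 1ℚ
𝟙≤1 true  = ℚₚ.≤-refl
𝟙≤1 false = 0≤1

𝟙-∧ : ∀ a b → 𝟙 (a ∧ b) ≡ 𝟙 a * 𝟙 b
𝟙-∧ true  b = sym (ℚₚ.*-identityˡ (𝟙 b))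
𝟙-∧ false b = sym (ℚₚ.*-zeroˡ (𝟙 b))

Weighted : Set → Set
Weighted S = List (ℚ × S)

Positive-weights : ∀ {S} → Weighted S → Set
Positive-weights = All (λ p → 0ℚ < proj₁ p)

scale : ∀ {S T : Set} → ℚ → (S → T) → Weighted S → Weighted T
scale q f = List.map (λ p → q * proj₁ p , f (proj₂ p))

bind : ∀ {S T : Set} → Weighted S → (S → Weighted T) → Weighted (S × T)
bind []             κ = []
bind ((w , s) ∷ ps) κ = scale w (s ,_) (κ s) ++ bind ps κ

scale-positive : ∀ {S T : Set} {q} {f : S → T} {ps} → 0ℚ < q → Positive-weights ps → Positive-weights (scale q f ps)
scale-positive 0<q []           = []
scale-positive 0<q (0<w ∷ 0<ws) = *-pos 0<q 0<w ∷ scale-positive 0<q 0<ws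

bind-positive : ∀ {S T : Set} {ps} {κ : S → Weighted T} → Positive-weights ps →
  (∀ s → Positive-weights (κ s)) → Positive-weights (bind ps κ)
bind-positive []           κ>0 = []
bind-positive (0<w ∷ 0<ws) κ>0 = Allₚ.++⁺ (scale-positive 0<w (κ>0 _)) (bind-positive 0<ws κ>0)

support : ∀ {S} → Weighted S → List S
support = List.map proj₂

module Integral (M : OrderedModule) where
  open OrderedModule M

  ∫ : ∀ {S} → Weighted S → (S → Carrier) → Carrier
  ∫ []             g = 0ᵛ
  ∫ ((w , s) ∷ ps) g = w • g s +ᵛ ∫ ps g

  module _ {S : Set} where
    ∫-mono : ∀ {ps : Weighted S} {g h} → Positive-weights ps →
      (∀ s → s ∈ support ps → g s ≤ᵛ h s) → ∫ ps g ≤ᵛ ∫ ps h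
    ∫-mono []           g≤h = ≤ᵛ-refl
    ∫-mono (0<w ∷ 0<ws) g≤h = +ᵛ-mono (•-monoʳ (ℚₚ.<⇒≤ 0<w) (g≤h _ (here refl)))
                                      (∫-mono 0<ws λ s s∈ → g≤h s (there s∈))

    ∫-cong : ∀ (ps : Weighted S) {g h} → (∀ s → s ∈ support ps → g s ≈ᵛ h s) → ∫ ps g ≈ᵛ ∫ ps h
    ∫-cong []             g≈h = ≈ᵛ-refl
    ∫-cong ((w , s) ∷ ps) g≈h = +ᵛ-cong (•-congʳ w (g≈h s (here refl))) (∫-cong ps λ t t∈ → g≈h t (there t∈))

    ∫-+ : ∀ (ps : Weighted S) g h → ∫ ps (λ s → g s +ᵛ h s) ≈ᵛ ∫ ps g +ᵛ ∫ ps h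
    ∫-+ []             g h = ≈ᵛ-sym (+ᵛ-identityˡ 0ᵛ)
    ∫-+ ((w , s) ∷ ps) g h = ≈ᵛ-trans (+ᵛ-cong (•-distribˡ w (g s) (h s)) (∫-+ ps g h)) (+ᵛ-interchange _ _ _ _)

    ∫-• : ∀ (ps : Weighted S) q g → ∫ ps (λ s → q • g s) ≈ᵛ q • ∫ ps g
    ∫-• []             q g = ≈ᵛ-sym (•-zeroʳ q)
    ∫-• ((w , s) ∷ ps) q g = ≈ᵛ-trans (+ᵛ-cong
      (≈ᵛ-trans (≈ᵛ-sym (•-assoc w q (g s))) (≈ᵛ-trans (≡⇒≈ᵛ (cong (_• g s) (ℚₚ.*-comm w q))) (•-assoc q w (g s))))
      (∫-• ps q g)) (≈ᵛ-sym (•-distribˡ q _ _))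

    ∫-++ : ∀ (ps qs : Weighted S) g → ∫ (ps ++ qs) g ≈ᵛ ∫ ps g +ᵛ ∫ qs g
    ∫-++ []             qs g = ≈ᵛ-sym (+ᵛ-identityˡ _)
    ∫-++ ((w , s) ∷ ps) qs g = ≈ᵛ-trans (+ᵛ-cong ≈ᵛ-refl (∫-++ ps qs g)) (≈ᵛ-sym (+ᵛ-assoc _ _ _))

    ∫-0 : ∀ (ps : Weighted S) → ∫ ps (λ _ → 0ᵛ) ≈ᵛ 0ᵛ
    ∫-0 []             = ≈ᵛ-refl
    ∫-0 ((w , _) ∷ ps) = ≈ᵛ-trans (+ᵛ-cong (•-zeroʳ w) (∫-0 ps)) (+ᵛ-identityˡ 0ᵛ)

    ∫-nonNeg : ∀ {ps : Weighted S} {g} → Positive-weights ps → (∀ s → s ∈ support ps → 0ᵛ ≤ᵛ g s) → 0ᵛ ≤ᵛ ∫ ps g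
    ∫-nonNeg {ps} 0<ps 0≤g = ≤ᵛ-trans (proj₂ (∫-0 ps)) (∫-mono 0<ps 0≤g)

  ∫-scale : ∀ {S T : Set} q (f : S → T) ps g → ∫ (scale q f ps) g ≈ᵛ q • ∫ ps (g ∘ f)
  ∫-scale q f []             g = ≈ᵛ-sym (•-zeroʳ q)
  ∫-scale q f ((w , s) ∷ ps) g = ≈ᵛ-trans (+ᵛ-cong (•-assoc q w _) (∫-scale q f ps g)) (≈ᵛ-sym (•-distribˡ q _ _))

  ∫-bind : ∀ {S T : Set} ps (κ : S → Weighted T) g → ∫ (bind ps κ) g ≈ᵛ ∫ ps (λ s → ∫ (κ s) (λ t → g (s , t)))
  ∫-bind []             κ g = ≈ᵛ-refl
  ∫-bind ((w , s) ∷ ps) κ g = ≈ᵛ-trans (∫-++ (scale w (s ,_) (κ s)) (bind ps κ) g)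
    (+ᵛ-cong (∫-scale w (s ,_) (κ s) g) (∫-bind ps κ g))

  ∫-swap : ∀ {S T : Set} (ps : Weighted S) (qs : Weighted T) (g : S → T → Carrier) →
    ∫ ps (λ s → ∫ qs (g s)) ≈ᵛ ∫ qs (λ t → ∫ ps (λ s → g s t))
  ∫-swap []             qs g = ≈ᵛ-sym (∫-0 qs)
  ∫-swap ((w , s) ∷ ps) qs g = ≈ᵛ-trans (+ᵛ-cong (≈ᵛ-sym (∫-• qs w (g s))) (∫-swap ps qs g)) (≈ᵛ-sym (∫-+ qs _ _))

module ℚ∫ = Integral ℚ-module

ℚ-≈⇒≡ : ∀ {p q : ℚ} → p ≤ q × q ≤ p → p ≡ q
ℚ-≈⇒≡ (p≤q , q≤p) = ℚₚ.≤-antisym p≤q q≤p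

-- A finite distribution with rational weights. Points may repeat, and `supp` lists only points of
-- positive probability.
record Space (S : Set) : Set where
  field
    points   : Weighted S
    weights-positive : Positive-weights points
    total    : ℚ∫.∫ points (λ _ → 1ℚ) ≡ 1ℚ

  supp : List S
  supp = support points

open Space

infixl 1 _>>=_
-- The joint law of a point and a sample from the kernel at that point. The first component is kept
-- because the chain rule for entropy involves both.
_>>=_ : ∀ {S T : Set} → Space S → (S → Space T) → Space (S × T)
points   (Ω >>= κ) = bind (points Ω) (points ∘ κ)
weights-positive (Ω >>= κ) = bind-positive (weights-positive Ω) (weights-positive ∘ κ)
total    (Ω >>= κ) = trans (ℚ-≈⇒≡ (ℚ∫.∫-bind (points Ω) (points ∘ κ) (λ _ → 1ℚ)))
  (trans (ℚ-≈⇒≡ (ℚ∫.∫-cong (points Ω) λ s _ → ℚᴹ.≡⇒≈ᵛ (total (κ s)))) (total Ω))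

infixr 5 _⊗_
_⊗_ : ∀ {S T : Set} → Space S → Space T → Space (S × T)
Ω ⊗ Ω′ = Ω >>= λ _ → Ω′

supp-scale : ∀ {S T : Set} q (f : S → T) ps {t} → t ∈ support (scale q f ps) → ∃ λ s → s ∈ support ps × t ≡ f s
supp-scale q f ((w , s) ∷ ps) (here refl) = s , here refl , refl
supp-scale q f ((w , s) ∷ ps) (there t∈)  with supp-scale q f ps t∈
... | u , u∈ , eq = u , there u∈ , eq

supp-bind : ∀ {S T : Set} ps (κ : S → Weighted T) {s t} → (s , t) ∈ support (bind ps κ) → s ∈ support ps × t ∈ support (κ s)
supp-bind ((w , s) ∷ ps) κ st∈
  with ∈ₚ.∈-++⁻ (support (scale w (s ,_) (κ s))) (subst (_ ∈_) (Listₚ.map-++ proj₂ (scale w (s ,_) (κ s)) (bind ps κ)) st∈)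
... | inj₁ p with supp-scale w (s ,_) (κ s) p
...   | _ , t∈ , refl = here refl , t∈
supp-bind ((w , s) ∷ ps) κ st∈ | inj₂ p with supp-bind ps κ p
...   | s∈ , t∈ = there s∈ , t∈

supp->>= : ∀ {S T : Set} (Ω : Space S) (κ : S → Space T) {s t} → (s , t) ∈ supp (Ω >>= κ) → s ∈ supp Ω × t ∈ supp (κ s)
supp->>= Ω κ = supp-bind (points Ω) (points ∘ κ)

module Expectation (M : OrderedModule) where
  open OrderedModule M
  open Integral M public

  𝔼 : ∀ {S} → Space S → (S → Carrier) → Carrier
  𝔼 Ω = ∫ (points Ω)

  module _ {S : Set} (Ω : Space S) where
    𝔼-mono : ∀ {g h} → (∀ s → s ∈ supp Ω → g s ≤ᵛ h s) → 𝔼 Ω g ≤ᵛ 𝔼 Ω h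
    𝔼-mono = ∫-mono (weights-positive Ω)

    𝔼-cong : ∀ {g h} → (∀ s → s ∈ supp Ω → g s ≈ᵛ h s) → 𝔼 Ω g ≈ᵛ 𝔼 Ω h
    𝔼-cong = ∫-cong (points Ω)

    𝔼-+ : ∀ g h → 𝔼 Ω (λ s → g s +ᵛ h s) ≈ᵛ 𝔼 Ω g +ᵛ 𝔼 Ω h
    𝔼-+ = ∫-+ (points Ω)

    𝔼-• : ∀ q g → 𝔼 Ω (λ s → q • g s) ≈ᵛ q • 𝔼 Ω g
    𝔼-• = ∫-• (points Ω)

    𝔼-scalar : ∀ g v → 𝔼 Ω (λ s → g s • v) ≈ᵛ ℚ∫.∫ (points Ω) g • v
    𝔼-scalar g v = go (points Ω)
      where
      go : ∀ ps → ∫ ps (λ s → g s • v) ≈ᵛ ℚ∫.∫ ps g • v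
      go []             = ≈ᵛ-sym (•-zeroˡ v)
      go ((w , s) ∷ ps) = ≈ᵛ-trans (+ᵛ-cong (≈ᵛ-sym (•-assoc w (g s) v)) (go ps)) (≈ᵛ-sym (•-distribʳ _ _ v))

    𝔼-const : ∀ v → 𝔼 Ω (λ _ → v) ≈ᵛ v
    𝔼-const v = ≈ᵛ-trans (𝔼-cong λ _ _ → ≈ᵛ-sym (•-identity v)) (≈ᵛ-trans (𝔼-scalar (λ _ → 1ℚ) v)
      (≈ᵛ-trans (≡⇒≈ᵛ (cong (_• v) (total Ω))) (•-identity v)))

    𝔼-nonNeg : ∀ {g} → (∀ s → s ∈ supp Ω → 0ᵛ ≤ᵛ g s) → 0ᵛ ≤ᵛ 𝔼 Ω g
    𝔼-nonNeg = ∫-nonNeg (weights-positive Ω)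

    𝔼-≤-const : ∀ {g v} → (∀ s → s ∈ supp Ω → g s ≤ᵛ v) → 𝔼 Ω g ≤ᵛ v
    𝔼-≤-const g≤v = ≤ᵛ-trans (𝔼-mono g≤v) (proj₁ (𝔼-const _))

    𝔼->>= : ∀ {T} (κ : S → Space T) g → 𝔼 (Ω >>= κ) g ≈ᵛ 𝔼 Ω (λ s → 𝔼 (κ s) (λ t → g (s , t)))
    𝔼->>= κ = ∫-bind (points Ω) (points ∘ κ)

  𝔼-swap : ∀ {S T : Set} (Ω : Space S) (Ω′ : Space T) (g : S → T → Carrier) →
    𝔼 Ω (λ s → 𝔼 Ω′ (g s)) ≈ᵛ 𝔼 Ω′ (λ t → 𝔼 Ω (λ s → g s t))
  𝔼-swap Ω Ω′ = ∫-swap (points Ω) (points Ω′)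

module ℚ𝔼 where
  open Expectation ℚ-module public
  module _ {S : Set} (Ω : Space S) where
    ≡-cong : ∀ {g h} → (∀ s → s ∈ supp Ω → g s ≡ h s) → 𝔼 Ω g ≡ 𝔼 Ω h
    ≡-cong g≡h = ℚ-≈⇒≡ (𝔼-cong Ω λ s s∈ → ℚᴹ.≡⇒≈ᵛ (g≡h s s∈))
    *-distˡ : ∀ q g → 𝔼 Ω (λ s → q * g s) ≡ q * 𝔼 Ω g
    *-distˡ q g = ℚ-≈⇒≡ (𝔼-• Ω q g)
    *-distʳ : ∀ q g → 𝔼 Ω (λ s → g s * q) ≡ 𝔼 Ω g * q
    *-distʳ q g = trans (≡-cong λ s _ → ℚₚ.*-comm (g s) q) (trans (*-distˡ q g) (ℚₚ.*-comm q (𝔼 Ω g)))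
    ≡->>= : ∀ {T} (κ : S → Space T) g → 𝔼 (Ω >>= κ) g ≡ 𝔼 Ω (λ s → 𝔼 (κ s) (λ t → g (s , t)))
    ≡->>= κ g = ℚ-≈⇒≡ (𝔼->>= Ω κ g)
  𝔼-neg′ : ∀ {S} (Ω : Space S) g → 𝔼 Ω (λ s → - g s) ℚᴹ.≈ᵛ - 𝔼 Ω g
  𝔼-neg′ Ω g = ℚᴹ.≈ᵛ-trans (𝔼-cong Ω λ s _ → ℚᴹ.≈ᵛ-sym (ℚᴹ.neg-• (g s))) (ℚᴹ.≈ᵛ-trans (𝔼-• Ω (- 1ℚ) g) (ℚᴹ.neg-• _))
  ≡-swap : ∀ {S T : Set} (Ω : Space S) (Ω′ : Space T) (g : S → T → ℚ) →
    𝔼 Ω (λ s → 𝔼 Ω′ (g s)) ≡ 𝔼 Ω′ (λ t → 𝔼 Ω (λ s → g s t))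
  ≡-swap Ω Ω′ g = ℚ-≈⇒≡ (𝔼-swap Ω Ω′ g)

open ℚ𝔼 using () renaming (𝔼 to 𝔼ℚ) public

-- Equality of laws tested against functions into every ordered module: `H-law` needs rational test
-- functions for the probabilities and `Carrier`-valued ones for their logarithms.
record SameLaw {S S′ T : Set} (Ω : Space S) (X : S → T) (Ω′ : Space S′) (X′ : S′ → T) : Set₁ where
  field
    transfer : (M : OrderedModule) → let open OrderedModule M; open Expectation M in
      (g : T → Carrier) → 𝔼 Ω (g ∘ X) ≈ᵛ 𝔼 Ω′ (g ∘ X′)

open SameLaw public

record DecEq (T : Set) : Set where
  infix 4 _≟_
  field _≟_ : DecidableEquality T
open DecEq {{...}} public

instance
  DecEq-⊤ : DecEq ⊤
  DecEq-⊤ = record { _≟_ = λ _ _ → yes refl }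
  DecEq-Bool : DecEq Bool
  DecEq-Bool = record { _≟_ = Boolₚ._≟_ }
  DecEq-ℤ : DecEq ℤ
  DecEq-ℤ = record { _≟_ = ℤₚ._≟_ }
  DecEq-Vec : ∀ {A n} → {{DecEq A}} → DecEq (Vec A n)
  DecEq-Vec = record { _≟_ = Vecₚ.≡-dec _≟_ }
  DecEq-× : ∀ {A B : Set} → {{DecEq A}} → {{DecEq B}} → DecEq (A × B)
  DecEq-× = record { _≟_ = Productₚ.≡-dec _≟_ _≟_ }

-- The type of values is part of the variable, since one inequality compares sums, pairs and side
-- information of different types; of that type entropy uses the decidable equality.
record RV (S : Set) : Set₁ where
  constructor mkRV
  field
    {Value} : Set
    {{eq}}  : DecEq Value
    fn      : S → Value

open RV

⟨_⟩ : ∀ {S T : Set} → {{DecEq T}} → (S → T) → RV S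
⟨ f ⟩ = mkRV f

infixr 4 _&_
_&_ : ∀ {S} → RV S → RV S → RV S
X & Y = mkRV (λ s → fn X s , fn Y s)

infix 3 _⇒_
-- `Y` is a function of `X`, on the whole sample space and not only almost surely.
_⇒_ : ∀ {S} → RV S → RV S → Set
X ⇒ Y = ∀ s t → fn X s ≡ fn X t → fn Y s ≡ fn Y t

same : ∀ {S} (X : RV S) → S → S → Bool
same X s t = does (_≟_ {{eq X}} (fn X s) (fn X t))

module _ {S : Set} where
  same-true : ∀ (X : RV S) {s t} → fn X s ≡ fn X t → same X s t ≡ true
  same-true X = dec-true (_≟_ {{eq X}} _ _)

  same⇒≡ : ∀ (X : RV S) {s t} → same X s t ≡ true → fn X s ≡ fn X t
  same⇒≡ X {s} {t} p with _≟_ {{eq X}} (fn X s) (fn X t)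
  ... | yes q = q
  same⇒≡ X () | no _

  same-⇒ : ∀ (X Y : RV S) → X ⇒ Y → ∀ s t → 𝟙 (same X s t) ≤ 𝟙 (same Y s t)
  same-⇒ X Y X⇒Y s t with same X s t in p
  ... | false = 𝟙-nonNeg (same Y s t)
  ... | true rewrite same-true Y (X⇒Y s t (same⇒≡ X p)) = ℚₚ.≤-refl

  same-cong : ∀ (X : RV S) {s t} u → fn X s ≡ fn X t → same X u s ≡ same X u t
  same-cong X u p = cong (λ v → does (_≟_ {{eq X}} (fn X u) v)) p

  same-sym : ∀ (X : RV S) s t → same X s t ≡ same X t s
  same-sym X s t with same X s t in p | same X t s in q
  ... | true  | true  = refl
  ... | false | false = refl
  ... | true  | false = trans (sym (same-true X (sym (same⇒≡ X p)))) q
  ... | false | true  = trans (sym p) (same-true X (sym (same⇒≡ X q)))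

  module _ (Ω : Space S) where
    -- The probability of the value that `X` takes at `s`, hence itself a random variable; entropy
    -- is the mean of its negative logarithm.
    ℙ : RV S → S → ℚ
    ℙ X s = 𝔼ℚ Ω (λ t → 𝟙 (same X t s))

    ℙ-cong : ∀ X {s t} → fn X s ≡ fn X t → ℙ X s ≡ ℙ X t
    ℙ-cong X p = ℚ𝔼.≡-cong Ω λ u _ → cong 𝟙 (same-cong X u p)

    ℙ-mono : ∀ X Y → X ⇒ Y → ∀ s → ℙ X s ≤ ℙ Y s
    ℙ-mono X Y X⇒Y s = ℚ𝔼.𝔼-mono Ω λ t _ → same-⇒ X Y X⇒Y t s

    ℙ≤1 : ∀ X s → ℙ X s ≤ 1ℚ
    ℙ≤1 X s = ℚ𝔼.𝔼-≤-const Ω λ t _ → 𝟙≤1 (same X t s)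

    ℙ-pos : ∀ X {s} → s ∈ supp Ω → 0ℚ < ℙ X s
    ℙ-pos X {s} = go (weights-positive Ω)
      where
      go : ∀ {ps} → Positive-weights ps → s ∈ support ps → 0ℚ < ℚ∫.∫ ps (λ t → 𝟙 (same X t s))
      go {(w , _) ∷ ps} (0<w ∷ 0<ws) (here refl) rewrite same-true X {s} {s} refl =
        ℚₚ.+-mono-<-≤ (*-pos 0<w (ℚₚ.positive⁻¹ 1ℚ)) (ℚ∫.∫-nonNeg 0<ws λ t _ → 𝟙-nonNeg (same X t s))
      go {(w , t) ∷ ps} (0<w ∷ 0<ws) (there s∈) =
        ℚₚ.+-mono-≤-< (*-nonNeg (ℚₚ.<⇒≤ 0<w) (𝟙-nonNeg (same X t s))) (go 0<ws s∈)

    -- Σ over the values of D meeting K of ℙ(D = value)/ℙ(D = value) has at most one term.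
    ℙ-atom : ∀ (D : RV S) (K : S → Bool) → (∀ s t → K s ≡ true → K t ≡ true → fn D s ≡ fn D t) →
      𝔼ℚ Ω (λ s → 𝟙 (K s) * recip (ℙ D s)) ≤ 1ℚ
    ℙ-atom D K K⇒D with List.filter (λ s → K s Boolₚ.≟ true) (supp Ω) in eq
    ... | [] = ℚₚ.≤-trans (ℚₚ.≤-reflexive (trans (ℚ𝔼.≡-cong Ω vanish) (ℚ-≈⇒≡ (ℚ𝔼.𝔼-const Ω 0ℚ)))) 0≤1
      where
      vanish : ∀ s → s ∈ supp Ω → 𝟙 (K s) * recip (ℙ D s) ≡ 0ℚ
      vanish s s∈ with K s in q
      ... | false = ℚₚ.*-zeroˡ (recip (ℙ D s))
      ... | true with subst (s ∈_) eq (∈ₚ.∈-filter⁺ (λ s → K s Boolₚ.≟ true) s∈ q)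
      ...   | ()
    ... | s₀ ∷ _ with ∈ₚ.∈-filter⁻ (λ s → K s Boolₚ.≟ true) {xs = supp Ω} (subst (s₀ ∈_) (sym eq) (here refl))
    ...   | s₀∈ , Ks₀ = begin
      𝔼ℚ Ω (λ s → 𝟙 (K s) * recip (ℙ D s))          ≤⟨ ℚ𝔼.𝔼-mono Ω (λ s _ → bound s) ⟩
      𝔼ℚ Ω (λ s → 𝟙 (same D s s₀) * recip (ℙ D s₀)) ≡⟨ ℚ𝔼.*-distʳ Ω (recip (ℙ D s₀)) (λ s → 𝟙 (same D s s₀)) ⟩
      ℙ D s₀ * recip (ℙ D s₀)                       ≡⟨ recip-inverseʳ (ℙ-pos D s₀∈) ⟩
      1ℚ                                            ∎
      where
      open ℚₚ.≤-Reasoning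
      bound : ∀ s → 𝟙 (K s) * recip (ℙ D s) ≤ 𝟙 (same D s s₀) * recip (ℙ D s₀)
      bound s with K s in q
      ... | false = ℚₚ.≤-trans (ℚₚ.≤-reflexive (ℚₚ.*-zeroˡ (recip (ℙ D s))))
                      (*-nonNeg (𝟙-nonNeg (same D s s₀)) (ℚₚ.<⇒≤ (recip-pos (ℙ-pos D s₀∈))))
      ... | true rewrite same-true D (K⇒D s s₀ q Ks₀) | ℙ-cong D (K⇒D s s₀ q Ks₀) = ℚₚ.≤-refl

    -- The probabilities of A and B are expanded as averages over independent copies t and u. For
    -- fixed t and u, all s that agree with t on A and with u on B share one value of D, so that 1/ℙ
    -- D sums to at most 1 over them by `ℙ-atom`. Such s exist only if t and u agree on C, and
    -- averaging over u then cancels 1/ℙ C.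
    submodular-mass : ∀ A B C D → A ⇒ C → B ⇒ C → (A & B) ⇒ D →
      𝔼ℚ Ω (λ s → (ℙ A s * ℙ B s) * (recip (ℙ D s) * recip (ℙ C s))) ≤ 1ℚ
    submodular-mass A B C D A⇒C B⇒C AB⇒D = begin
      𝔼ℚ Ω (λ s → (ℙ A s * ℙ B s) * (rD s * rC s))
        ≡⟨ ℚ𝔼.≡-cong Ω (λ s _ → expand s) ⟩
      𝔼ℚ Ω (λ s → 𝔼ℚ Ω λ t → 𝔼ℚ Ω λ u → (𝟙 (same A t s) * 𝟙 (same B u s)) * (rD s * rC s))
        ≡⟨ ℚ𝔼.≡-swap Ω Ω (λ s t → 𝔼ℚ Ω λ u → kernel t u s) ⟩
      𝔼ℚ Ω (λ t → 𝔼ℚ Ω λ s → 𝔼ℚ Ω λ u → (𝟙 (same A t s) * 𝟙 (same B u s)) * (rD s * rC s))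
        ≡⟨ ℚ𝔼.≡-cong Ω (λ t _ → ℚ𝔼.≡-swap Ω Ω (λ s u → kernel t u s)) ⟩
      𝔼ℚ Ω (λ t → 𝔼ℚ Ω λ u → 𝔼ℚ Ω λ s → (𝟙 (same A t s) * 𝟙 (same B u s)) * (rD s * rC s))
        ≤⟨ ℚ𝔼.𝔼-mono Ω (λ t t∈ → ℚ𝔼.𝔼-mono Ω λ u _ → inner t t∈ u) ⟩
      𝔼ℚ Ω (λ t → 𝔼ℚ Ω λ u → 𝟙 (same C u t) * rC t)
        ≡⟨ ℚ𝔼.≡-cong Ω (λ t t∈ → trans (ℚ𝔼.*-distʳ Ω (rC t) (λ u → 𝟙 (same C u t))) (recip-inverseʳ (ℙ-pos C t∈))) ⟩
      𝔼ℚ Ω (λ t → 1ℚ)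
        ≡⟨ total Ω ⟩
      1ℚ ∎
      where
      open ℚₚ.≤-Reasoning
      rD rC : S → ℚ
      rD s = recip (ℙ D s)
      rC s = recip (ℙ C s)
      kernel : S → S → S → ℚ
      kernel t u s = (𝟙 (same A t s) * 𝟙 (same B u s)) * (rD s * rC s)
      expand : ∀ s → (ℙ A s * ℙ B s) * (rD s * rC s) ≡
        𝔼ℚ Ω λ t → 𝔼ℚ Ω λ u → (𝟙 (same A t s) * 𝟙 (same B u s)) * (rD s * rC s)
      expand s = trans (cong (_* (rD s * rC s)) (sym (ℚ𝔼.*-distʳ Ω (ℙ B s) (λ t → 𝟙 (same A t s)))))
        (trans (sym (ℚ𝔼.*-distʳ Ω (rD s * rC s) (λ t → 𝟙 (same A t s) * ℙ B s)))
        (ℚ𝔼.≡-cong Ω λ t _ → trans (cong (_* (rD s * rC s)) (sym (ℚ𝔼.*-distˡ Ω (𝟙 (same A t s)) (λ u → 𝟙 (same B u s)))))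
          (sym (ℚ𝔼.*-distʳ Ω (rD s * rC s) (λ u → 𝟙 (same A t s) * 𝟙 (same B u s))))))
      inner : ∀ t → t ∈ supp Ω → ∀ u → 𝔼ℚ Ω (λ s → (𝟙 (same A t s) * 𝟙 (same B u s)) * (rD s * rC s)) ≤ 𝟙 (same C u t) * rC t
      inner t t∈ u = begin
        𝔼ℚ Ω (λ s → (𝟙 (same A t s) * 𝟙 (same B u s)) * (rD s * rC s))
          ≤⟨ ℚ𝔼.𝔼-mono Ω (λ s s∈ → pointwise s s∈) ⟩
        𝔼ℚ Ω (λ s → (𝟙 (same C u t) * rC t) * (𝟙 (K s) * rD s))
          ≡⟨ ℚ𝔼.*-distˡ Ω (𝟙 (same C u t) * rC t) (λ s → 𝟙 (K s) * rD s) ⟩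
        (𝟙 (same C u t) * rC t) * 𝔼ℚ Ω (λ s → 𝟙 (K s) * rD s)
          ≤⟨ ℚₚ.*-monoˡ-≤-nonNeg (𝟙 (same C u t) * rC t) {{nonNegative (*-nonNeg (𝟙-nonNeg (same C u t)) (ℚₚ.<⇒≤ (recip-pos (ℙ-pos C t∈))))}}
               (ℙ-atom D K K⇒D) ⟩
        (𝟙 (same C u t) * rC t) * 1ℚ
          ≡⟨ ℚₚ.*-identityʳ (𝟙 (same C u t) * rC t) ⟩
        𝟙 (same C u t) * rC t ∎
        where
        K : S → Bool
        K s = same A t s ∧ same B u s
        K⇒ : ∀ s → K s ≡ true → fn A t ≡ fn A s × fn B u ≡ fn B s
        K⇒ s p with same A t s in pA | same B u s in pB
        ... | true | true = same⇒≡ A pA , same⇒≡ B pB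
        K⇒D : ∀ s s′ → K s ≡ true → K s′ ≡ true → fn D s ≡ fn D s′
        K⇒D s s′ p p′ with K⇒ s p | K⇒ s′ p′
        ... | a , b | a′ , b′ = AB⇒D s s′ (cong₂ _,_ (trans (sym a) a′) (trans (sym b) b′))
        pointwise : ∀ s → s ∈ supp Ω → (𝟙 (same A t s) * 𝟙 (same B u s)) * (rD s * rC s) ≤ (𝟙 (same C u t) * rC t) * (𝟙 (K s) * rD s)
        pointwise s s∈ rewrite sym (𝟙-∧ (same A t s) (same B u s)) with K s in p
        ... | false = ℚₚ.≤-reflexive (trans (ℚₚ.*-zeroˡ (rD s * rC s))
                        (sym (trans (cong ((𝟙 (same C u t) * rC t) *_) (ℚₚ.*-zeroˡ (rD s))) (ℚₚ.*-zeroʳ (𝟙 (same C u t) * rC t)))))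
        ... | true with K⇒ s p
        ...   | a , b rewrite same-true C {u} {t} (trans (B⇒C u s b) (sym (A⇒C t s a))) =
                ℚₚ.≤-reflexive (trans (ℚₚ.*-identityˡ (rD s * rC s)) (trans (ℚₚ.*-comm (rD s) (rC s))
                  (cong₂ _*_ (trans (cong recip (sym (ℙ-cong C (A⇒C t s a)))) (sym (ℚₚ.*-identityˡ (rC t))))
                    (sym (ℚₚ.*-identityˡ (rD s))))))

-- What the entropy argument knows of the real logarithm. The order is undecidable, so classical
-- reasoning enters through `≰⇒≥`, stability, and a doubly negated Archimedean property.
record LogModule : Set₁ where
  field
    orderedModule : OrderedModule
  open OrderedModule orderedModule public
  field
    one      : Carrier
    log      : ℚ → Carrier
    0≤one    : 0ᵛ ≤ᵛ one
    one≰0    : ¬ one ≤ᵛ 0ᵛ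
    log-*    : ∀ {p q} → 0ℚ < p → 0ℚ < q → log (p * q) ≈ᵛ log p +ᵛ log q
    log-≤    : ∀ {p} → 0ℚ < p → log p ≤ᵛ (p - 1ℚ) • one
    ≰⇒≥      : ∀ {x y} → ¬ (x ≤ᵛ y) → y ≤ᵛ x
    ≤-stable : ∀ {x y} → ¬ ¬ (x ≤ᵛ y) → x ≤ᵛ y
    bounded  : ∀ x → Σ[ n ∈ ℕ ] x ≤ᵛ n ×ᵛ one
    archimedes : ∀ {x} → ¬ (x ≤ᵛ 0ᵛ) → ¬ ¬ (Σ[ n ∈ ℕ ] one ≤ᵛ n ×ᵛ x)

-- Integer vectors and echelon forms

infixl 6 _⊞_
_⊞_ : ∀ {n} → Vec Bool n → Vec Bool n → Vec Bool n
_⊞_ = zipWith _xor_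

𝟎 : ∀ {n} → Vec Bool n
𝟎 = Vec.replicate _ false

⊞-comm : ∀ {n} (x y : Vec Bool n) → x ⊞ y ≡ y ⊞ x
⊞-comm = Vecₚ.zipWith-comm Boolₚ.xor-comm

⊞-assoc : ∀ {n} (x y z : Vec Bool n) → (x ⊞ y) ⊞ z ≡ x ⊞ (y ⊞ z)
⊞-assoc = Vecₚ.zipWith-assoc Boolₚ.xor-assoc

⊞-identityˡ : ∀ {n} (x : Vec Bool n) → 𝟎 ⊞ x ≡ x
⊞-identityˡ = Vecₚ.zipWith-identityˡ Boolₚ.xor-identityˡ

⊞-identityʳ : ∀ {n} (x : Vec Bool n) → x ⊞ 𝟎 ≡ x
⊞-identityʳ x = trans (⊞-comm x 𝟎) (⊞-identityˡ x)

⊞-self : ∀ {n} (x : Vec Bool n) → x ⊞ x ≡ 𝟎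
⊞-self []      = refl
⊞-self (b ∷ x) = cong₂ _∷_ (Boolₚ.xor-same b) (⊞-self x)

⊞-cancelˡ : ∀ {n} (x y : Vec Bool n) → x ⊞ (x ⊞ y) ≡ y
⊞-cancelˡ x y = trans (sym (⊞-assoc x x y)) (trans (cong (_⊞ y) (⊞-self x)) (⊞-identityˡ y))

⊞-cancelʳ : ∀ {n} (x y : Vec Bool n) → (x ⊞ y) ⊞ y ≡ x
⊞-cancelʳ x y = trans (⊞-comm (x ⊞ y) y) (trans (cong (y ⊞_) (⊞-comm x y)) (⊞-cancelˡ y x))

⊞-interchange : ∀ {n} (a b c d : Vec Bool n) → (a ⊞ b) ⊞ (c ⊞ d) ≡ (a ⊞ c) ⊞ (b ⊞ d)
⊞-interchange a b c d = trans (⊞-assoc a b (c ⊞ d)) (trans (cong (a ⊞_)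
  (trans (sym (⊞-assoc b c d)) (trans (cong (_⊞ d) (⊞-comm b c)) (⊞-assoc c b d)))) (sym (⊞-assoc a c (b ⊞ d))))

infixl 6 _⊞ᶻ_
_⊞ᶻ_ : ∀ {n} → Vec ℤ n → Vec ℤ n → Vec ℤ n
_⊞ᶻ_ = zipWith ℤ._+_

-ᶻ_ : ∀ {n} → Vec ℤ n → Vec ℤ n
-ᶻ_ = Vec.map (λ a → ℤ.- a)

𝟎ᶻ : ∀ {n} → Vec ℤ n
𝟎ᶻ = Vec.replicate _ (+ 0)

⊞ᶻ-comm : ∀ {n} (x y : Vec ℤ n) → x ⊞ᶻ y ≡ y ⊞ᶻ x
⊞ᶻ-comm = Vecₚ.zipWith-comm ℤₚ.+-comm

⊞ᶻ-assoc : ∀ {n} (x y z : Vec ℤ n) → (x ⊞ᶻ y) ⊞ᶻ z ≡ x ⊞ᶻ (y ⊞ᶻ z)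
⊞ᶻ-assoc = Vecₚ.zipWith-assoc ℤₚ.+-assoc

⊞ᶻ-identityˡ : ∀ {n} (x : Vec ℤ n) → 𝟎ᶻ ⊞ᶻ x ≡ x
⊞ᶻ-identityˡ = Vecₚ.zipWith-identityˡ ℤₚ.+-identityˡ

⊞ᶻ-identityʳ : ∀ {n} (x : Vec ℤ n) → x ⊞ᶻ 𝟎ᶻ ≡ x
⊞ᶻ-identityʳ = Vecₚ.zipWith-identityʳ ℤₚ.+-identityʳ

⊞ᶻ-inverseʳ : ∀ {n} (x : Vec ℤ n) → x ⊞ᶻ (-ᶻ x) ≡ 𝟎ᶻ
⊞ᶻ-inverseʳ = Vecₚ.zipWith-inverseʳ ℤₚ.+-inverseʳ

⊞ᶻ-cancelʳ : ∀ {n} (x y : Vec ℤ n) → (x ⊞ᶻ y) ⊞ᶻ (-ᶻ y) ≡ x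
⊞ᶻ-cancelʳ x y = trans (⊞ᶻ-assoc x y (-ᶻ y)) (trans (cong (x ⊞ᶻ_) (⊞ᶻ-inverseʳ y)) (⊞ᶻ-identityʳ x))

⊞ᶻ-cancelˡ : ∀ {n} (x y : Vec ℤ n) → (-ᶻ x) ⊞ᶻ (x ⊞ᶻ y) ≡ y
⊞ᶻ-cancelˡ x y = trans (⊞ᶻ-comm (-ᶻ x) (x ⊞ᶻ y)) (trans (cong (_⊞ᶻ (-ᶻ x)) (⊞ᶻ-comm x y)) (⊞ᶻ-cancelʳ y x))

⊞ᶻ-interchange : ∀ {n} (a b c d : Vec ℤ n) → (a ⊞ᶻ b) ⊞ᶻ (c ⊞ᶻ d) ≡ (a ⊞ᶻ c) ⊞ᶻ (b ⊞ᶻ d)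
⊞ᶻ-interchange a b c d = trans (⊞ᶻ-assoc a b (c ⊞ᶻ d)) (trans (cong (a ⊞ᶻ_)
  (trans (sym (⊞ᶻ-assoc b c d)) (trans (cong (_⊞ᶻ d) (⊞ᶻ-comm b c)) (⊞ᶻ-assoc c b d)))) (sym (⊞ᶻ-assoc a c (b ⊞ᶻ d))))

double-injective : ∀ {n} (x y : Vec ℤ n) → x ⊞ᶻ x ≡ y ⊞ᶻ y → x ≡ y
double-injective []      []      _ = refl
double-injective (a ∷ x) (b ∷ y) p = cong₂ _∷_
  (ℤₚ.*-cancelˡ-≡ (+ 2) a b (trans (twice a) (trans (Vecₚ.∷-injectiveˡ p) (sym (twice b)))))
  (double-injective x y (Vecₚ.∷-injectiveʳ p))
  where
  twice : ∀ a → + 2 ℤ.* a ≡ a ℤ.+ a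
  twice a = trans (ℤₚ.*-distribʳ-+ a (+ 1) (+ 1)) (cong₂ ℤ._+_ (ℤₚ.*-identityˡ a) (ℤₚ.*-identityˡ a))

oddℕ : ℕ → Bool
oddℕ zero    = false
oddℕ (suc n) = not (oddℕ n)

odd : ℤ → Bool
odd z = oddℕ ℤ.∣ z ∣

oddℕ-+ : ∀ m n → oddℕ (m ℕ.+ n) ≡ oddℕ m xor oddℕ n
oddℕ-+ zero    n = refl
oddℕ-+ (suc m) n = trans (cong not (oddℕ-+ m n)) (Boolₚ.not-distribˡ-xor (oddℕ m) (oddℕ n))

odd-⊖ : ∀ m n → odd (m ℤ.⊖ n) ≡ oddℕ m xor oddℕ n
odd-⊖ zero    zero    = refl
odd-⊖ zero    (suc n) = refl
odd-⊖ (suc m) zero    = sym (Boolₚ.xor-identityʳ (oddℕ (suc m)))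
odd-⊖ (suc m) (suc n) = trans (cong odd (ℤₚ.[1+m]⊖[1+n]≡m⊖n m n)) (trans (odd-⊖ m n)
  (cancel (oddℕ m) (oddℕ n)))
  where
  cancel : ∀ a b → a xor b ≡ not a xor not b
  cancel true  true  = refl
  cancel true  false = refl
  cancel false true  = refl
  cancel false false = refl

odd-+ : ∀ a b → odd (a ℤ.+ b) ≡ odd a xor odd b
odd-+ (+ m)    (+ n)    = oddℕ-+ m n
odd-+ (+ m)    -[1+ n ] = odd-⊖ m (suc n)
odd-+ -[1+ m ] (+ n)    = trans (odd-⊖ n (suc m)) (Boolₚ.xor-comm (oddℕ n) (oddℕ (suc m)))
odd-+ -[1+ m ] -[1+ n ] = trans (cong (not ∘ not) (oddℕ-+ m n)) (double-not (oddℕ m) (oddℕ n))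
  where
  double-not : ∀ a b → not (not (a xor b)) ≡ not a xor not b
  double-not true  true  = refl
  double-not true  false = refl
  double-not false true  = refl
  double-not false false = refl

parity : ∀ {n} → Vec ℤ n → Vec Bool n
parity = Vec.map odd

parity-+ : ∀ {n} (x y : Vec ℤ n) → parity (x ⊞ᶻ y) ≡ parity x ⊞ parity y
parity-+ []      []      = refl
parity-+ (a ∷ x) (b ∷ y) = cong₂ _∷_ (odd-+ a b) (parity-+ x y)

data Span {n} (P : Vec ℤ n → Set) : Vec ℤ n → Set where
  gen  : ∀ {v} → P v → Span P v
  zero : Span P 𝟎ᶻ
  add  : ∀ {u v} → Span P u → Span P v → Span P (u ⊞ᶻ v)
  minus : ∀ {v} → Span P v → Span P (-ᶻ v)

Span-bind : ∀ {n} {P Q : Vec ℤ n → Set} → (∀ {v} → P v → Span Q v) → ∀ {v} → Span P v → Span Q v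
Span-bind f (gen p)   = f p
Span-bind f zero      = zero
Span-bind f (add s t) = add (Span-bind f s) (Span-bind f t)
Span-bind f (minus s)   = minus (Span-bind f s)

infixr 7 _·ᶻ_
_·ᶻ_ : ∀ {n} → ℤ → Vec ℤ n → Vec ℤ n
c ·ᶻ v = Vec.map (c ℤ.*_) v

·ᶻ-zero : ∀ {n} (v : Vec ℤ n) → + 0 ·ᶻ v ≡ 𝟎ᶻ
·ᶻ-zero []      = refl
·ᶻ-zero (a ∷ v) = cong₂ _∷_ (ℤₚ.*-zeroˡ a) (·ᶻ-zero v)

·ᶻ-distribʳ : ∀ {n} a b (v : Vec ℤ n) → (a ℤ.+ b) ·ᶻ v ≡ a ·ᶻ v ⊞ᶻ b ·ᶻ v
·ᶻ-distribʳ a b []      = refl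
·ᶻ-distribʳ a b (x ∷ v) = cong₂ _∷_ (ℤₚ.*-distribʳ-+ x a b) (·ᶻ-distribʳ a b v)

·ᶻ-neg : ∀ {n} a (v : Vec ℤ n) → (ℤ.- a) ·ᶻ v ≡ -ᶻ (a ·ᶻ v)
·ᶻ-neg a []      = refl
·ᶻ-neg a (x ∷ v) = cong₂ _∷_ (sym (ℤₚ.neg-distribˡ-* a x)) (·ᶻ-neg a v)

·ᶻ-one : ∀ {n} (v : Vec ℤ n) → + 1 ·ᶻ v ≡ v
·ᶻ-one []      = refl
·ᶻ-one (x ∷ v) = cong₂ _∷_ (ℤₚ.*-identityˡ x) (·ᶻ-one v)

Span-·ℕ : ∀ {n} {P : Vec ℤ n → Set} k {v} → Span P v → Span P (+ k ·ᶻ v)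
Span-·ℕ zero    {v} s = subst (Span _) (sym (·ᶻ-zero v)) zero
Span-·ℕ (suc k) {v} s = subst (Span _) (trans (cong (_⊞ᶻ (+ k ·ᶻ v)) (sym (·ᶻ-one v))) (sym (·ᶻ-distribʳ (+ 1) (+ k) v))) (add s (Span-·ℕ k s))

Span-· : ∀ {n} {P : Vec ℤ n → Set} c {v} → Span P v → Span P (c ·ᶻ v)
Span-· (+ k)    s = Span-·ℕ k s
Span-· -[1+ k ] {v} s = subst (Span _) (sym (·ᶻ-neg (+ suc k) v)) (minus (Span-·ℕ (suc k) s))

Span-0∷ : ∀ {n} {P : Vec ℤ n → Set} {Q : Vec ℤ (suc n) → Set} → (∀ {v} → P v → Span Q (+ 0 ∷ v)) → ∀ {v} → Span P v → Span Q (+ 0 ∷ v)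
Span-0∷ f (gen p)   = f p
Span-0∷ f zero      = zero
Span-0∷ f (add s t) = add (Span-0∷ f s) (Span-0∷ f t)
Span-0∷ f (minus s)   = minus (Span-0∷ f s)

-- A row echelon matrix over ℤ, read column by column: `skip` is a column without pivot, `pivot`
-- adds a first row p ∷ t and zeros below p. Rank, independence and coordinates then come by
-- structural recursion.
data Echelon : ℕ → Set where
  []    : Echelon 0
  skip  : ∀ {n} → Echelon n → Echelon (suc n)
  pivot : ∀ {n} (p : ℤ) → p ≢ + 0 → Vec ℤ n → Echelon n → Echelon (suc n)

rank : ∀ {n} → Echelon n → ℕ
rank []              = 0
rank (skip E)        = rank E
rank (pivot p _ t E) = suc (rank E)

row : ∀ {n} (E : Echelon n) → Fin (rank E) → Vec ℤ n
row (skip E)        j            = + 0 ∷ row E j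
row (pivot p _ t E) Fin.zero     = p ∷ t
row (pivot p _ t E) (Fin.suc j)  = + 0 ∷ row E j

Row : ∀ {n} → Echelon n → Vec ℤ n → Set
Row E v = Σ[ j ∈ Fin (rank E) ] row E j ≡ v

-- The result spans over ℤ exactly what v and the rows of E span. Integral rather than rational span
-- matters, because parity is later taken in coordinates for this lattice.
record Inserted {n} (v : Vec ℤ n) (E : Echelon n) : Set where
  field
    result    : Echelon n
    covers    : Span (Row result) v
    extends   : ∀ {w} → Row E w → Span (Row result) w
    generated : ∀ {w} → Row result w → Span (λ u → u ≡ v ⊎ Row E u) w
    rank-mono : rank E ℕ.≤ rank result

open Inserted

module _ where
  open import Data.Integer.DivMod using (a≡a%n+[a/n]*n; n%d<d)

  insert : ∀ {n} (v : Vec ℤ n) (E : Echelon n) → Inserted v E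
  insert-zero : ∀ {n} (s : Vec ℤ n) (p : ℤ) (p≢0 : p ≢ + 0) (t : Vec ℤ n) (E : Echelon n) → Inserted s E → Inserted (+ 0 ∷ s) (pivot p p≢0 t E)
  -- Euclid's algorithm on the leading entries: the old pivot row is reduced modulo the new vector,
  -- which becomes the pivot, and the remainder row is inserted in turn. Its leading entry is
  -- smaller than |q|, so the fuel suffices.
  insert-pivot : ∀ fuel {n} (q : ℤ) (s : Vec ℤ n) (p : ℤ) (p≢0 : p ≢ + 0) (t : Vec ℤ n) (E : Echelon n) → ℤ.∣ q ∣ ℕ.≤ fuel → Inserted (q ∷ s) (pivot p p≢0 t E)

  insert-zero s p p≢0 t E I = record
    { result = pivot p p≢0 t (result I)
    ; covers = Span-0∷ (λ { (j , refl) → gen (Fin.suc j , refl) }) (covers I)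
    ; extends = λ { (Fin.zero , refl) → gen (Fin.zero , refl)
                  ; (Fin.suc j , refl) → Span-0∷ (λ { (i , refl) → gen (Fin.suc i , refl) }) (extends I (j , refl)) }
    ; generated = λ { (Fin.zero , refl) → gen (inj₂ (Fin.zero , refl))
                    ; (Fin.suc j , refl) → Span-0∷ (λ { (inj₁ refl) → gen (inj₁ refl) ; (inj₂ (i , refl)) → gen (inj₂ (Fin.suc i , refl)) }) (generated I (j , refl)) }
    ; rank-mono = s≤s (rank-mono I) }

  insert [] [] = record { result = [] ; covers = zero ; extends = λ { (() , _) } ; generated = λ { (() , _) } ; rank-mono = z≤n }
  insert (q ∷ s) (skip E) with q ℤₚ.≟ + 0
  ... | yes refl = record
    { result = skip (result I)
    ; covers = Span-0∷ (λ { (j , refl) → gen (j , refl) }) (covers I)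
    ; extends = λ { (j , refl) → Span-0∷ (λ { (i , refl) → gen (i , refl) }) (extends I (j , refl)) }
    ; generated = λ { (j , refl) → Span-0∷ (λ { (inj₁ refl) → gen (inj₁ refl) ; (inj₂ (i , refl)) → gen (inj₂ (i , refl)) }) (generated I (j , refl)) }
    ; rank-mono = rank-mono I }
    where I = insert s E
  ... | no q≢0 = record
    { result = pivot q q≢0 s E
    ; covers = gen (Fin.zero , refl)
    ; extends = λ { (j , refl) → gen (Fin.suc j , refl) }
    ; generated = λ { (Fin.zero , refl) → gen (inj₁ refl) ; (Fin.suc j , refl) → gen (inj₂ (j , refl)) }
    ; rank-mono = ℕₚ.n≤1+n (rank E) }
  insert (q ∷ s) (pivot p p≢0 t E) = insert-pivot ℤ.∣ q ∣ q s p p≢0 t E ℕₚ.≤-refl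

  insert-pivot fuel q s p p≢0 t E ∣q∣≤ with q ℤₚ.≟ + 0
  ... | yes refl = insert-zero s p p≢0 t E (insert s E)
  insert-pivot zero q s p p≢0 t E ∣q∣≤ | no q≢0 = contradiction (ℤₚ.∣i∣≡0⇒i≡0 (ℕₚ.n≤0⇒n≡0 ∣q∣≤)) q≢0
  insert-pivot (suc fuel) {n} q s p p≢0 t E ∣q∣≤ | no q≢0 = record
    { result = result I
    ; covers = extends I (Fin.zero , refl)
    ; extends = λ { (Fin.zero , refl) → subst (Span _) b≡ (add (covers I) (Span-· k (extends I (Fin.zero , refl))))
                  ; (Fin.suc j , refl) → extends I (Fin.suc j , refl) }
    ; generated = λ r → Span-bind (λ { (inj₁ refl) → subst (Span _) w≡ (add (gen (inj₂ (Fin.zero , refl))) (minus (Span-· k (gen (inj₁ refl)))))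
                                     ; (inj₂ (Fin.zero , refl)) → gen (inj₁ refl)
                                     ; (inj₂ (Fin.suc j , refl)) → gen (inj₂ (Fin.suc j , refl)) }) (generated I r)
    ; rank-mono = rank-mono I }
    where
    instance
      q-nonZero : ℤ.NonZero q
      q-nonZero = ℤ.≢-nonZero q≢0
    k : ℤ
    k = p ℤ./ q
    r = + (p ℤ.% q)
    I = insert-pivot fuel r (t ⊞ᶻ (-ᶻ (k ·ᶻ s))) q q≢0 s E (ℕₚ.≤-pred (ℕₚ.≤-trans (n%d<d p q) ∣q∣≤))
    p≡ : p ≡ r ℤ.+ k ℤ.* q
    p≡ = a≡a%n+[a/n]*n p q
    b≡ : (r ∷ (t ⊞ᶻ (-ᶻ (k ·ᶻ s)))) ⊞ᶻ k ·ᶻ (q ∷ s) ≡ p ∷ t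
    b≡ = cong₂ _∷_ (sym p≡) (trans (⊞ᶻ-assoc t (-ᶻ (k ·ᶻ s)) (k ·ᶻ s)) (trans (cong (t ⊞ᶻ_) (trans (⊞ᶻ-comm (-ᶻ (k ·ᶻ s)) (k ·ᶻ s)) (⊞ᶻ-inverseʳ (k ·ᶻ s)))) (⊞ᶻ-identityʳ t)))
    w≡ : (p ∷ t) ⊞ᶻ (-ᶻ (k ·ᶻ (q ∷ s))) ≡ r ∷ (t ⊞ᶻ (-ᶻ (k ·ᶻ s)))
    w≡ = cong (_∷ (t ⊞ᶻ (-ᶻ (k ·ᶻ s)))) (trans (cong (ℤ._+ (ℤ.- (k ℤ.* q))) p≡)
      (trans (ℤₚ.+-assoc r (k ℤ.* q) (ℤ.- (k ℤ.* q))) (trans (cong (λ z → r ℤ.+ z) (ℤₚ.+-inverseʳ (k ℤ.* q))) (ℤₚ.+-identityʳ r))))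

insert-all : ∀ {n} → List (Vec ℤ n) → Echelon n → Echelon n
insert-all []       E = E
insert-all (v ∷ vs) E = insert-all vs (result (insert v E))

insert-all-extends : ∀ {n} vs (E : Echelon n) {w} → Row E w → Span (Row (insert-all vs E)) w
insert-all-extends []       E r = gen r
insert-all-extends (v ∷ vs) E r = Span-bind (insert-all-extends vs (result (insert v E))) (extends (insert v E) r)

insert-all-covers : ∀ {n} vs (E : Echelon n) {v} → v ∈ vs → Span (Row (insert-all vs E)) v
insert-all-covers (v ∷ vs) E (here refl) = Span-bind (insert-all-extends vs (result (insert v E))) (covers (insert v E))
insert-all-covers (v ∷ vs) E (there v∈)  = insert-all-covers vs (result (insert v E)) v∈

insert-all-generated : ∀ {n} vs (E : Echelon n) {w} → Row (insert-all vs E) w → Span (λ u → u ∈ vs ⊎ Row E u) w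
insert-all-generated []       E r = gen (inj₂ r)
insert-all-generated (v ∷ vs) E r = Span-bind (λ where
    (inj₁ u∈) → gen (inj₁ (there u∈))
    (inj₂ r′) → Span-bind (λ { (inj₁ refl) → gen (inj₁ (here refl)) ; (inj₂ r″) → gen (inj₂ r″) }) (generated (insert v E) r′))
  (insert-all-generated vs (result (insert v E)) r)

insert-all-rank : ∀ {n} vs (E : Echelon n) → rank E ℕ.≤ rank (insert-all vs E)
insert-all-rank []       E = ℕₚ.≤-refl
insert-all-rank (v ∷ vs) E = ℕₚ.≤-trans (rank-mono (insert v E)) (insert-all-rank vs (result (insert v E)))

empty : ∀ n → Echelon n
empty zero    = []
empty (suc n) = skip (empty n)

¬Row-empty : ∀ n {v} → ¬ Row (empty n) v
¬Row-empty (suc n) (j , refl) = ¬Row-empty n (j , refl)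

combine : ∀ {n} (E : Echelon n) → Vec ℤ (rank E) → Vec ℤ n
combine []              c       = []
combine (skip E)        c       = + 0 ∷ combine E c
combine (pivot p _ t E) (a ∷ c) = (a ℤ.* p) ∷ (a ·ᶻ t ⊞ᶻ combine E c)

combine-+ : ∀ {n} (E : Echelon n) u v → combine E (u ⊞ᶻ v) ≡ combine E u ⊞ᶻ combine E v
combine-+ []              u       v       = refl
combine-+ (skip E)        u       v       = cong (+ 0 ∷_) (combine-+ E u v)
combine-+ (pivot p _ t E) (a ∷ u) (b ∷ v) = cong₂ _∷_ (ℤₚ.*-distribʳ-+ p a b)
  (trans (cong₂ _⊞ᶻ_ (·ᶻ-distribʳ a b t) (combine-+ E u v)) (⊞ᶻ-interchange (a ·ᶻ t) (b ·ᶻ t) (combine E u) (combine E v)))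

-- `combine` is triangular with nonzero pivots, so the coordinates are recovered one after another
-- by cancelling the pivot.
combine-injective : ∀ {n} (E : Echelon n) u v → combine E u ≡ combine E v → u ≡ v
combine-injective []              []      []      _  = refl
combine-injective (skip E)        u       v       eq = combine-injective E u v (Vecₚ.∷-injectiveʳ eq)
combine-injective (pivot p p≢0 t E) (a ∷ u) (b ∷ v) eq = cong₂ _∷_ a≡b (combine-injective E u v
  (trans (sym (⊞ᶻ-cancelˡ (a ·ᶻ t) (combine E u))) (trans (cong₂ (λ x y → (-ᶻ (x ·ᶻ t)) ⊞ᶻ y) a≡b (Vecₚ.∷-injectiveʳ eq)) (⊞ᶻ-cancelˡ (b ·ᶻ t) (combine E v)))))
  where
  a≡b : a ≡ b
  a≡b = ℤₚ.*-cancelʳ-≡ a b p {{ℤ.≢-nonZero p≢0}} (Vecₚ.∷-injectiveˡ eq)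

combine-𝟎 : ∀ {n} (E : Echelon n) → combine E 𝟎ᶻ ≡ 𝟎ᶻ
combine-𝟎 []              = refl
combine-𝟎 (skip E)        = cong (+ 0 ∷_) (combine-𝟎 E)
combine-𝟎 (pivot p _ t E) = cong₂ _∷_ (ℤₚ.*-zeroˡ p) (trans (cong₂ _⊞ᶻ_ (·ᶻ-zero t) (combine-𝟎 E)) (⊞ᶻ-identityˡ 𝟎ᶻ))

combine-neg : ∀ {n} (E : Echelon n) u → combine E (-ᶻ u) ≡ -ᶻ combine E u
combine-neg E u = trans (sym (⊞ᶻ-identityˡ (combine E (-ᶻ u)))) (trans (cong (_⊞ᶻ combine E (-ᶻ u)) (sym (trans (⊞ᶻ-comm (-ᶻ combine E u) (combine E u)) (⊞ᶻ-inverseʳ (combine E u)))))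
  (trans (⊞ᶻ-assoc (-ᶻ combine E u) (combine E u) (combine E (-ᶻ u))) (trans (cong ((-ᶻ combine E u) ⊞ᶻ_)
    (trans (sym (combine-+ E u (-ᶻ u))) (trans (cong (combine E) (⊞ᶻ-inverseʳ u)) (combine-𝟎 E)))) (⊞ᶻ-identityʳ (-ᶻ combine E u)))))

combine-Row : ∀ {n} (E : Echelon n) {w} → Row E w → Σ[ u ∈ Vec ℤ (rank E) ] combine E u ≡ w
combine-Row (skip E) (j , refl) with combine-Row E (j , refl)
... | u , eq = u , cong (+ 0 ∷_) eq
combine-Row (pivot p _ t E) (Fin.zero , refl) = (+ 1 ∷ 𝟎ᶻ) , cong₂ _∷_ (ℤₚ.*-identityˡ p)
  (trans (cong₂ _⊞ᶻ_ (·ᶻ-one t) (combine-𝟎 E)) (⊞ᶻ-identityʳ t))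
combine-Row (pivot p _ t E) (Fin.suc j , refl) with combine-Row E (j , refl)
... | u , eq = (+ 0 ∷ u) , cong₂ _∷_ (ℤₚ.*-zeroˡ p) (trans (cong₂ _⊞ᶻ_ (·ᶻ-zero t) eq) (⊞ᶻ-identityˡ (row E j)))

coordinates : ∀ {n} (E : Echelon n) {w} → Span (Row E) w → Σ[ u ∈ Vec ℤ (rank E) ] combine E u ≡ w
coordinates E (gen r) = combine-Row E r
coordinates E zero    = 𝟎ᶻ , combine-𝟎 E
coordinates E (add s t) with coordinates E s | coordinates E t
... | u , refl | v , refl = u ⊞ᶻ v , combine-+ E u v
coordinates E (minus s) with coordinates E s
... | u , refl = -ᶻ u , combine-neg E u

combine-Span : ∀ {n} (E : Echelon n) u → Span (Row E) (combine E u)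
combine-Span []              []      = zero
combine-Span (skip E)        u       = Span-0∷ (λ { (j , refl) → gen (j , refl) }) (combine-Span E u)
combine-Span (pivot p _ t E) (a ∷ u) = subst (Span _) (cong₂ _∷_ (ℤₚ.+-identityʳ (a ℤ.* p)) refl)
  (add (Span-· a (gen (Fin.zero , refl))) (Span-0∷ (λ { (j , refl) → gen (Fin.suc j , refl) }) (combine-Span E u)))

differences : ∀ {n} → Vec ℤ n → List (Vec ℤ n) → List (Vec ℤ n)
differences a = List.map (_⊞ᶻ (-ᶻ a))

abstract
  -- Junk for the empty list.
  hull-basis : ∀ {n} → List (Vec ℤ n) → Echelon n
  hull-basis {n} []      = empty n
  hull-basis {n} (a ∷ A) = insert-all (differences a (a ∷ A)) (empty n)

  hull-covers : ∀ {n} (a : Vec ℤ n) A {v} → v ∈ differences a (a ∷ A) → Span (Row (hull-basis (a ∷ A))) v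
  hull-covers {n} a A = insert-all-covers (differences a (a ∷ A)) (empty n)

  hull-generated : ∀ {n} (a : Vec ℤ n) A {v} → Row (hull-basis (a ∷ A)) v → Span (_∈ differences a (a ∷ A)) v
  hull-generated {n} a A r = Span-bind (λ { (inj₁ v∈) → gen v∈ ; (inj₂ e) → contradiction e (¬Row-empty n) })
    (insert-all-generated (differences a (a ∷ A)) (empty n) r)

-- Numerals, translates and sublists

fromℕℚ-nonNeg : ∀ n → 0ℚ ≤ fromℕℚ n
fromℕℚ-nonNeg n = ℚₚ.nonNegative⁻¹ (fromℕℚ n) {{ℚₚ.normalize-nonNeg n 1}}

fromℕℚ-pos : ∀ n → 1 ℕ.≤ n → 0ℚ < fromℕℚ n
fromℕℚ-pos n 1≤n = ℚₚ.<-≤-trans (ℚₚ.positive⁻¹ 1ℚ) (fromℕℚ-mono {1} {n} 1≤n)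

fromℕℚ-* : ∀ m n → fromℕℚ (m ℕ.* n) ≡ fromℕℚ m * fromℕℚ n
fromℕℚ-* m n = trans (cong (_/ 1) (ℤₚ.pos-* m n)) (/1-* (+ m) (+ n))

fromℕℚ-+ : ∀ m n → fromℕℚ (m ℕ.+ n) ≡ fromℕℚ m + fromℕℚ n
fromℕℚ-+ m n = /1-+ (+ m) (+ n)

fromℕℚ-cancel : ∀ {m n} → fromℕℚ m ≤ fromℕℚ n → m ℕ.≤ n
fromℕℚ-cancel {m} {n} le = ℕₚ.≮⇒≥ λ n<m → ℚₚ.<-irrefl refl (ℚₚ.<-≤-trans
  (subst₂ _<_ (ℚₚ.+-identityˡ (fromℕℚ n)) (sym (fromℕℚ-suc n)) (ℚₚ.+-monoˡ-< (fromℕℚ n) (ℚₚ.positive⁻¹ 1ℚ)))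
  (ℚₚ.≤-trans (fromℕℚ-mono n<m) le))

1≤^ : ∀ {n} → 1 ℕ.≤ n → ∀ k → 1 ℕ.≤ n ℕ.^ k
1≤^ {n} 1≤n k = ℕₚ.m^n>0 n {{ℕ.>-nonZero 1≤n}} k

nonempty-length : ∀ {S : Set} (L : List S) → L ≢ [] → 1 ℕ.≤ length L
nonempty-length []      ne = contradiction refl ne
nonempty-length (_ ∷ _) ne = s≤s z≤n

∈⇒nonempty : ∀ {S : Set} {s : S} {L} → s ∈ L → L ≢ []
∈⇒nonempty (here _) ()

card-pos : ∀ {S : Set} (L : List S) → L ≢ [] → 0ℚ < fromℕℚ (length L)
card-pos L ne = fromℕℚ-pos (length L) (nonempty-length L ne)

map-nonempty : ∀ {S T : Set} (f : S → T) L → L ≢ [] → List.map f L ≢ []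
map-nonempty f []      ne _  = ne refl
map-nonempty f (_ ∷ _) ne ()

translation-fixing : ∀ {n} (E : Echelon n) u c → combine E u ⊞ᶻ c ≡ c → u ≡ 𝟎ᶻ
translation-fixing E u c fixes = combine-injective E u 𝟎ᶻ (trans (sym (⊞ᶻ-cancelʳ (combine E u) c))
  (trans (cong (_⊞ᶻ (-ᶻ c)) fixes) (trans (⊞ᶻ-inverseʳ c) (sym (combine-𝟎 E)))))

-- If χ is constant on the coordinates of C relative to its first element c, the constant is χ 𝟎ᶻ =
-- 𝟎, because c itself has coordinates 𝟎ᶻ. So every difference v - c has coordinates on which χ
-- vanishes.
from-difference : ∀ {n m} (E : Echelon n) (χ : Vec ℤ (rank E) → Vec Bool m) → χ 𝟎ᶻ ≡ 𝟎 →
  ∀ (h : Vec ℤ (rank E) → Vec ℤ n) c → (∀ u → h u ≡ combine E u ⊞ᶻ c) → ∀ {C K C₀} → List.map h K ≡ C → C ≡ c ∷ C₀ →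
  ∀ {q} → All (λ u → χ u ≡ q) K → ∀ {v} → v ∈ differences c C → Σ[ u ∈ Vec ℤ (rank E) ] (combine E u ≡ v × χ u ≡ 𝟎)
from-difference E χ χ-𝟎 h c h≡ {K = u₀ ∷ K} refl starts {q} all {v} v∈ = locate (∈ₚ.∈-map⁻ (_⊞ᶻ (-ᶻ c)) v∈)
  where
  q≡𝟎 : q ≡ 𝟎
  q≡𝟎 = trans (sym (All.head all)) (trans (cong χ (translation-fixing E u₀ c (trans (sym (h≡ u₀)) (Listₚ.∷-injectiveˡ starts)))) χ-𝟎)
  locate : Σ[ w ∈ _ ] (w ∈ List.map h (u₀ ∷ K) × v ≡ w ⊞ᶻ (-ᶻ c)) → Σ[ u ∈ _ ] (combine E u ≡ v × χ u ≡ 𝟎)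
  locate (w , w∈ , v≡) =
    let u , u∈ , w≡ = ∈ₚ.∈-map⁻ h w∈
    in u , trans (sym (⊞ᶻ-cancelʳ (combine E u) c)) (trans (cong (_⊞ᶻ (-ᶻ c)) (trans (sym (h≡ u)) (sym w≡))) (sym v≡)) , trans (All.lookup all u∈) q≡𝟎

module _ {S : Set} where
  Unique-⊆ : ∀ {xs ys : List S} → xs ⊆ ys → Unique ys → Unique xs
  Unique-⊆ Sublist.[]         []ᵘ              = AllPairs.[]
  Unique-⊆ (y Sublist.∷ʳ sub) (_ AllPairs.∷ uniq)     = Unique-⊆ sub uniq
  Unique-⊆ (refl Sublist.∷ sub) (y∉ AllPairs.∷ uniq)  = Sublistₚ.All-resp-⊆ sub y∉ AllPairs.∷ Unique-⊆ sub uniq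

  sublist? : ∀ {P : List S → Set} → (∀ xs → Dec (P xs)) → ∀ ys → Dec (Σ[ xs ∈ List S ] (xs ⊆ ys × P xs))
  sublist? P? [] with P? []
  ... | yes p = yes ([] , Sublist.[] , p)
  ... | no ¬p = no λ { (_ , Sublist.[] , p) → ¬p p }
  sublist? P? (y ∷ ys) with sublist? (λ xs → P? (y ∷ xs)) ys | sublist? P? ys
  ... | yes (xs , sub , p) | _                  = yes (y ∷ xs , refl Sublist.∷ sub , p)
  ... | no _               | yes (xs , sub , p) = yes (xs , y Sublist.∷ʳ sub , p)
  ... | no ¬with-y         | no ¬without-y      = no λ where
    (_ , (_ Sublist.∷ʳ sub) , p)   → ¬without-y (_ , sub , p)
    (_ , (refl Sublist.∷ sub) , p) → ¬with-y (_ , sub , p)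

module WithLog (𝕃 : LogModule) where
  open LogModule 𝕃
  open Expectation orderedModule

  -- Entropy

  log-1 : log 1ℚ ≈ᵛ 0ᵛ
  log-1 = +ᵛ-cancelʳ (log 1ℚ) (≈ᵛ-trans (≈ᵛ-sym (log-* (ℚₚ.positive⁻¹ 1ℚ) (ℚₚ.positive⁻¹ 1ℚ))) (≈ᵛ-sym (+ᵛ-identityˡ _)))

  log-recip : ∀ {p} → 0ℚ < p → log (recip p) ≈ᵛ -ᵛ log p
  log-recip {p} 0<p = +ᵛ-cancelʳ (log p) (≈ᵛ-trans (≈ᵛ-sym (log-* (recip-pos 0<p) 0<p))
    (≈ᵛ-trans (≡⇒≈ᵛ (cong log (recip-inverseˡ 0<p))) (≈ᵛ-trans log-1
      (≈ᵛ-sym (≈ᵛ-trans (+ᵛ-comm _ _) (+ᵛ-inverseʳ _))))))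

  p≤1⇒log≤0 : ∀ {p} → 0ℚ < p → p ≤ 1ℚ → log p ≤ᵛ 0ᵛ
  p≤1⇒log≤0 {p} 0<p p≤1 = ≤ᵛ-trans (log-≤ 0<p) (≤ᵛ-trans
    (•-monoˡ 0≤one (subst (p - 1ℚ ≤_) (ℚₚ.+-inverseʳ 1ℚ) (ℚₚ.+-monoˡ-≤ (- 1ℚ) p≤1))) (proj₁ (•-zeroˡ one)))

  log-mono : ∀ {p q} → 0ℚ < p → p ≤ q → log p ≤ᵛ log q
  log-mono {p} {q} 0<p p≤q =
    ≤ᵛ-trans (proj₁ (≡⇒≈ᵛ (cong log p≡))) (≤ᵛ-trans (proj₁ (log-* 0<q 0<pr))
      (≤ᵛ-trans (+ᵛ-mono ≤ᵛ-refl (p≤1⇒log≤0 0<pr pr≤1)) (proj₁ (+ᵛ-identityʳ _))))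
    where
    0<q = ℚₚ.<-≤-trans 0<p p≤q
    0<pr = *-pos 0<p (recip-pos 0<q)
    p≡ : p ≡ q * (p * recip q)
    p≡ = trans (sym (ℚₚ.*-identityʳ p)) (trans (cong (p *_) (sym (recip-inverseʳ 0<q)))
      (trans (sym (ℚₚ.*-assoc p q (recip q))) (trans (cong (_* recip q) (ℚₚ.*-comm p q)) (ℚₚ.*-assoc q p (recip q)))))
    pr≤1 : p * recip q ≤ 1ℚ
    pr≤1 = ℚₚ.≤-trans (ℚₚ.*-monoʳ-≤-nonNeg (recip q) {{nonNegative (ℚₚ.<⇒≤ (recip-pos 0<q))}} p≤q)
      (ℚₚ.≤-reflexive (recip-inverseʳ 0<q))

  -ᵛ-mono : ∀ {x y} → x ≤ᵛ y → -ᵛ y ≤ᵛ -ᵛ x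
  -ᵛ-mono {x} {y} x≤y = ≤ᵛ-trans (proj₂ (+ᵛ-identityˡ _)) (≤ᵛ-trans (proj₁ (+ᵛ-comm _ _))
    (linear (x ∷ y ∷ -ᵛ y ∷ -ᵛ x ∷ []) (v₂ ⊹ 𝕠) v₃
      (1 · v₀ ≦ v₁ ∵ x≤y ∷ 1 · 𝕠 ≦ v₀ ⊹ v₃ ∵ proj₂ (+ᵛ-inverseʳ x) ∷ 1 · v₁ ⊹ v₂ ≦ 𝕠 ∵ proj₁ (+ᵛ-inverseʳ y) ∷ [])))

  -ᵛ-cong : ∀ {x y} → x ≈ᵛ y → -ᵛ x ≈ᵛ -ᵛ y
  -ᵛ-cong (p , q) = -ᵛ-mono q , -ᵛ-mono p

  -ᵛ-+ : ∀ x y → -ᵛ (x +ᵛ y) ≈ᵛ (-ᵛ x) +ᵛ (-ᵛ y)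
  -ᵛ-+ x y =
    ≈ᵛ-trans (≈ᵛ-sym (neg-• _)) (≈ᵛ-trans (•-distribˡ (- 1ℚ) x y) (+ᵛ-cong (neg-• x) (neg-• y)))

  𝔼-neg : ∀ {S} (Ω : Space S) g → 𝔼 Ω (λ s → -ᵛ g s) ≈ᵛ -ᵛ 𝔼 Ω g
  𝔼-neg Ω g = ≈ᵛ-trans (𝔼-cong Ω λ s _ → ≈ᵛ-sym (neg-• (g s))) (≈ᵛ-trans (𝔼-• Ω (- 1ℚ) g) (neg-• _))

  -- Refuting g s ≤ v at every s gives only v ≤ g s, so all terms in the mean of g - v are
  -- nonnegative. A nonpositive mean then forces the first term to be nonpositive, which was
  -- refuted. The order being undecidable, the point exists up to double negation.
  𝔼-pick : ∀ {S} (Ω : Space S) {g v} → 𝔼 Ω g ≤ᵛ v → ¬ ¬ (Σ[ s ∈ S ] (s ∈ supp Ω × g s ≤ᵛ v))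
  𝔼-pick {S} Ω {g} {v} 𝔼g≤v none = go (points Ω) (weights-positive Ω) nonempty (λ s∈ → s∈) (≤ᵛ-trans (proj₁ shift) (≤ᵛ-trans
      (+ᵛ-mono 𝔼g≤v ≤ᵛ-refl) (proj₁ (+ᵛ-inverseʳ v))))
    where
    open Space
    f : S → Carrier
    f s = g s -ᵛ v
    f≰0 : ∀ {s} → s ∈ supp Ω → ¬ (f s ≤ᵛ 0ᵛ)
    f≰0 {s} s∈ le = none (s , s∈ , linear (g s ∷ v ∷ []) v₀ v₁ (1 · v₀ ⊝ v₁ ≦ 𝕠 ∵ le ∷ []))
    shift : 𝔼 Ω f ≈ᵛ 𝔼 Ω g -ᵛ v
    shift = ≈ᵛ-trans (𝔼-+ Ω g (λ _ → -ᵛ v)) (+ᵛ-cong ≈ᵛ-refl (𝔼-const Ω (-ᵛ v)))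
    nonempty : points Ω ≢ []
    nonempty eq with points Ω | total Ω
    nonempty refl | [] | ()
    scaled : ∀ {w x} → 0ℚ < w → w • x ≤ᵛ 0ᵛ → x ≤ᵛ 0ᵛ
    scaled {w} {x} 0<w p = ≤ᵛ-trans (proj₂ (≈ᵛ-trans (≈ᵛ-sym (•-assoc (recip w) w x))
        (≈ᵛ-trans (≡⇒≈ᵛ (cong (_• x) (recip-inverseˡ 0<w))) (•-identity x))))
      (≤ᵛ-trans (•-monoʳ (ℚₚ.<⇒≤ (recip-pos 0<w)) p) (proj₁ (•-zeroʳ (recip w))))
    go : ∀ ps → Positive-weights ps → ps ≢ [] → (∀ {s} → s ∈ support ps → s ∈ supp Ω) → ∫ ps f ≤ᵛ 0ᵛ → ⊥
    go []             _            ne _   _  = ne refl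
    go ((w , s) ∷ ps) (0<w ∷ 0<ws) _  sub le = f≰0 (sub (here refl)) (scaled 0<w
      (≤ᵛ-trans (proj₂ (+ᵛ-identityʳ _)) (≤ᵛ-trans (+ᵛ-mono ≤ᵛ-refl
        (∫-nonNeg 0<ws λ t t∈ → ≰⇒≥ (f≰0 (sub (there t∈))))) le)))

  module _ {S : Set} where
    H : Space S → RV S → Carrier
    H Ω X = 𝔼 Ω (λ s → -ᵛ log (ℙ Ω X s))

    module _ (Ω : Space S) where
      -- The cases C constant and B = C give subadditivity and monotonicity.
      submodular : ∀ A B C D → A ⇒ C → B ⇒ C → (A & B) ⇒ D → H Ω D +ᵛ H Ω C ≤ᵛ H Ω A +ᵛ H Ω B
      submodular A B C D A⇒C B⇒C AB⇒D =
        linear (H Ω A ∷ H Ω B ∷ H Ω C ∷ H Ω D ∷ 𝔼 Ω (ℓ A) ∷ 𝔼 Ω (ℓ B) ∷ 𝔼 Ω gap ∷ [])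
          (v₃ ⊹ v₂) (v₀ ⊹ v₁)
          (1 · v₆ ≦ 𝕠 ∵ gap≤0 ∷ 1 · (v₄ ⊹ v₅) ⊹ (v₃ ⊹ v₂) ≦ v₆ ∵ proj₂ gap≈ ∷
           1 · 𝕠 ≦ v₄ ⊹ v₀ ∵ proj₂ (cancel A) ∷ 1 · 𝕠 ≦ v₅ ⊹ v₁ ∵ proj₂ (cancel B) ∷ [])
        where
        ℓ : RV S → S → Carrier
        ℓ X s = log (ℙ Ω X s)
        -- Gibbs' inequality: `gap` is log w, which is at most w - 1, and w has mean at most 1 by
        -- `submodular-mass`.
        w : S → ℚ
        w s = (ℙ Ω A s * ℙ Ω B s) * (recip (ℙ Ω D s) * recip (ℙ Ω C s))
        gap : S → Carrier
        gap s = (ℓ A s +ᵛ ℓ B s) +ᵛ ((-ᵛ ℓ D s) +ᵛ (-ᵛ ℓ C s))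
        cancel : ∀ X → 𝔼 Ω (ℓ X) +ᵛ H Ω X ≈ᵛ 0ᵛ
        cancel X = ≈ᵛ-trans (+ᵛ-cong ≈ᵛ-refl (𝔼-neg Ω (ℓ X))) (+ᵛ-inverseʳ _)
        gap≈ : 𝔼 Ω gap ≈ᵛ (𝔼 Ω (ℓ A) +ᵛ 𝔼 Ω (ℓ B)) +ᵛ (H Ω D +ᵛ H Ω C)
        gap≈ = ≈ᵛ-trans (𝔼-+ Ω _ _) (+ᵛ-cong (𝔼-+ Ω _ _) (𝔼-+ Ω _ _))
        gap≤ : ∀ s → s ∈ supp Ω → gap s ≤ᵛ (w s - 1ℚ) • one
        gap≤ s s∈ = ≤ᵛ-trans (proj₂ (≈ᵛ-trans (log-* 0<AB 0<DC) (+ᵛ-cong (log-* 0<A 0<B)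
            (≈ᵛ-trans (log-* (recip-pos 0<D) (recip-pos 0<C)) (+ᵛ-cong (log-recip 0<D) (log-recip 0<C))))))
          (log-≤ (*-pos 0<AB 0<DC))
          where
          0<A = ℙ-pos Ω A s∈
          0<B = ℙ-pos Ω B s∈
          0<C = ℙ-pos Ω C s∈
          0<D = ℙ-pos Ω D s∈
          0<AB = *-pos 0<A 0<B
          0<DC = *-pos (recip-pos 0<D) (recip-pos 0<C)
        mass≤0 : 𝔼ℚ Ω (λ s → w s - 1ℚ) ≤ 0ℚ
        mass≤0 = ℚₚ.≤-trans (ℚₚ.≤-reflexive (trans (ℚ-≈⇒≡ (ℚ𝔼.𝔼-+ Ω w (λ _ → - 1ℚ)))
            (cong (λ q → 𝔼ℚ Ω w + q) (ℚ-≈⇒≡ (ℚ𝔼.𝔼-const Ω (- 1ℚ))))))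
          (ℚₚ.+-monoˡ-≤ (- 1ℚ) (submodular-mass Ω A B C D A⇒C B⇒C AB⇒D))
        gap≤0 : 𝔼 Ω gap ≤ᵛ 0ᵛ
        gap≤0 = ≤ᵛ-trans (𝔼-mono Ω gap≤) (≤ᵛ-trans (proj₁ (𝔼-scalar Ω (λ s → w s - 1ℚ) one))
          (≤ᵛ-trans (•-monoˡ 0≤one mass≤0) (proj₁ (•-zeroˡ one))))

      H-const : H Ω ⟨ (λ _ → tt) ⟩ ≈ᵛ 0ᵛ
      H-const = ≈ᵛ-trans (𝔼-cong Ω λ s _ → ≈ᵛ-trans (-ᵛ-cong (≈ᵛ-trans (≡⇒≈ᵛ (cong log (total Ω))) log-1))
        (≈ᵛ-trans (≈ᵛ-sym (neg-• 0ᵛ)) (•-zeroʳ (- 1ℚ)))) (𝔼-const Ω 0ᵛ)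

      H-mono : ∀ X Y → X ⇒ Y → H Ω Y ≤ᵛ H Ω X
      H-mono X Y X⇒Y = 𝔼-mono Ω λ s s∈ → -ᵛ-mono (log-mono (ℙ-pos Ω X s∈) (ℙ-mono Ω X Y X⇒Y s))

      H-cong : ∀ X Y → X ⇒ Y → Y ⇒ X → H Ω X ≈ᵛ H Ω Y
      H-cong X Y X⇒Y Y⇒X = H-mono Y X Y⇒X , H-mono X Y X⇒Y

      H-nonNeg : ∀ X → 0ᵛ ≤ᵛ H Ω X
      H-nonNeg X = ≤ᵛ-trans (proj₂ H-const) (H-mono X ⟨ (λ _ → tt) ⟩ λ _ _ _ → refl)

      subadditive : ∀ A B D → (A & B) ⇒ D → H Ω D ≤ᵛ H Ω A +ᵛ H Ω B
      subadditive A B D AB⇒D = linear (H Ω D ∷ H Ω ⟨ (λ _ → tt) ⟩ ∷ H Ω A ∷ H Ω B ∷ []) v₀ (v₂ ⊹ v₃)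
        (1 · v₀ ⊹ v₁ ≦ v₂ ⊹ v₃ ∵ submodular A B ⟨ (λ _ → tt) ⟩ D (λ _ _ _ → refl) (λ _ _ _ → refl) AB⇒D ∷
         1 · 𝕠 ≦ v₁ ∵ proj₂ H-const ∷ [])

  infixr 9 _∘ʳ_
  _∘ʳ_ : ∀ {S T : Set} → RV T → (S → T) → RV S
  F ∘ʳ X = mkRV {{eq F}} (fn F ∘ X)
    where open RV

  H-law : ∀ {S S′ T : Set} {Ω : Space S} {Ω′ : Space S′} {X : S → T} {X′ : S′ → T} →
    SameLaw Ω X Ω′ X′ → (F : RV T) → H Ω (F ∘ʳ X) ≈ᵛ H Ω′ (F ∘ʳ X′)
  H-law {Ω = Ω} {Ω′} {X} {X′} law F = ≈ᵛ-trans
    (𝔼-cong Ω λ s _ → -ᵛ-cong (≡⇒≈ᵛ (cong log (ℚ-≈⇒≡ (transfer law ℚ-module λ t → 𝟙 (same F t (X s)))))))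
    (transfer law orderedModule λ t → -ᵛ log (𝔼ℚ Ω′ λ s → 𝟙 (same F (X′ s) t)))

  bool-ext : ∀ {a b : Bool} → (a ≡ true → b ≡ true) → (b ≡ true → a ≡ true) → a ≡ b
  bool-ext {true}  f g = sym (f refl)
  bool-ext {false} {false} f g = refl
  bool-ext {false} {true}  f g = g refl

  does-true : ∀ {P : Set} (d : Dec P) → does d ≡ true → P
  does-true (yes p) _ = p

  ∧-true : ∀ {a b} → a ∧ b ≡ true → a ≡ true × b ≡ true
  ∧-true {true} p = refl , p

  module _ {S S′ : Set} where
    infixr 4 _⊠_
    _⊠_ : RV S → RV S′ → RV (S × S′)
    X ⊠ Y = X ∘ʳ proj₁ & Y ∘ʳ proj₂

    same-⊠ : ∀ X Y s u t v → same (X ⊠ Y) (s , u) (t , v) ≡ same X s t ∧ same Y u v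
    same-⊠ X Y s u t v = bool-ext
      (λ p → cong₂ _∧_ (same-true X (cong proj₁ (same⇒≡ (X ⊠ Y) {s , u} {t , v} p))) (same-true Y (cong proj₂ (same⇒≡ (X ⊠ Y) {s , u} {t , v} p))))
      (λ p → same-true (X ⊠ Y) (cong₂ _,_ (same⇒≡ X (proj₁ (∧-true p))) (same⇒≡ Y (proj₂ (∧-true p)))))

    -- The kernel depends on s through W s only, and X determines W. Points with the same value of X
    -- therefore share one kernel, and the joint probability factors.
    H-chain : ∀ {T : Set} (Ω : Space S) (W : S → T) (κ : T → Space S′) (X : RV S) (Y : RV S′) →
      (∀ s t → RV.fn X s ≡ RV.fn X t → W s ≡ W t) →
      H (Ω >>= κ ∘ W) (X ⊠ Y) ≈ᵛ H Ω X +ᵛ 𝔼 Ω (λ s → H (κ (W s)) Y)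
    H-chain Ω W κ X Y X⇒W = ≈ᵛ-trans (𝔼->>= Ω (κ ∘ W) _) (≈ᵛ-trans (𝔼-cong Ω λ s s∈ →
        ≈ᵛ-trans (𝔼-cong (κ (W s)) λ u u∈ → ≈ᵛ-trans (-ᵛ-cong (≈ᵛ-trans (≡⇒≈ᵛ (cong log (factor s u)))
            (log-* (ℙ-pos Ω X s∈) (ℙ-pos (κ (W s)) Y u∈)))) (-ᵛ-+ _ _))
          (≈ᵛ-trans (𝔼-+ (κ (W s)) _ _) (+ᵛ-cong (𝔼-const (κ (W s)) _) ≈ᵛ-refl)))
      (𝔼-+ Ω _ _))
      where
      factor : ∀ s u → ℙ (Ω >>= κ ∘ W) (X ⊠ Y) (s , u) ≡ ℙ Ω X s * ℙ (κ (W s)) Y u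
      factor s u = trans (ℚ𝔼.≡->>= Ω (κ ∘ W) (λ tv → 𝟙 (same (X ⊠ Y) tv (s , u)))) (trans (ℚ𝔼.≡-cong Ω λ t _ → inner t)
          (ℚ𝔼.*-distʳ Ω (ℙ (κ (W s)) Y u) (λ t → 𝟙 (same X t s))))
        where
        inner : ∀ t → 𝔼ℚ (κ (W t)) (λ v → 𝟙 (same (X ⊠ Y) (t , v) (s , u))) ≡ 𝟙 (same X t s) * ℙ (κ (W s)) Y u
        inner t = trans (ℚ𝔼.≡-cong (κ (W t)) λ v _ → trans (cong 𝟙 (same-⊠ X Y t v s u)) (𝟙-∧ (same X t s) (same Y v u)))
          (trans (ℚ𝔼.*-distˡ (κ (W t)) (𝟙 (same X t s)) (λ v → 𝟙 (same Y v u))) rest)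
          where
          rest : 𝟙 (same X t s) * ℙ (κ (W t)) Y u ≡ 𝟙 (same X t s) * ℙ (κ (W s)) Y u
          rest with same X t s in p
          ... | true  = cong (λ q → 1ℚ * ℙ (κ q) Y u) (X⇒W t s (same⇒≡ X p))
          ... | false = trans (ℚₚ.*-zeroˡ (ℙ (κ (W t)) Y u)) (sym (ℚₚ.*-zeroˡ (ℙ (κ (W s)) Y u)))

    H-⊗ : ∀ (Ω : Space S) (Ω′ : Space S′) X Y → H (Ω ⊗ Ω′) (X ⊠ Y) ≈ᵛ H Ω X +ᵛ H Ω′ Y
    H-⊗ Ω Ω′ X Y = ≈ᵛ-trans (H-chain Ω (λ _ → tt) (λ _ → Ω′) X Y (λ _ _ _ → refl)) (+ᵛ-cong ≈ᵛ-refl (𝔼-const Ω _))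

  law-proj₁ : ∀ {S S′ : Set} (Ω : Space S) (κ : S → Space S′) → SameLaw (Ω >>= κ) proj₁ Ω id
  law-proj₁ Ω κ .transfer M g = ≈ᵛ-trans′ (𝔼->>=′ Ω κ _) (𝔼-cong′ Ω λ s _ → 𝔼-const′ (κ s) (g s))
    where
    open OrderedModule M using () renaming (≈ᵛ-trans to ≈ᵛ-trans′)
    open Expectation M using () renaming (𝔼->>= to 𝔼->>=′; 𝔼-cong to 𝔼-cong′; 𝔼-const to 𝔼-const′)

  law-proj₂ : ∀ {S S′ : Set} (Ω : Space S) (Ω′ : Space S′) → SameLaw (Ω ⊗ Ω′) proj₂ Ω′ id
  law-proj₂ Ω Ω′ .transfer M g = ≈ᵛ-trans′ (𝔼->>=′ Ω (λ _ → Ω′) _) (𝔼-const′ Ω _)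
    where
    open OrderedModule M using () renaming (≈ᵛ-trans to ≈ᵛ-trans′)
    open Expectation M using () renaming (𝔼->>= to 𝔼->>=′; 𝔼-const to 𝔼-const′)

  -- κ is a family of conditional distributions of Ω given the value of Q.
  record Disintegrates {S T : Set} (Ω : Space S) (Q : S → T) (κ : T → Space S) : Set₁ where
    field disintegration : SameLaw (Ω >>= κ ∘ Q) (λ p → Q (proj₁ p) , proj₂ p) Ω (λ s → Q s , s)

  open Disintegrates public

  module _ {S S₀ T : Set} {{_ : DecEq T}} (Ω : Space S) (Q : S → T) {κ : T → Space S}
           (dis : Disintegrates Ω Q κ) where
    -- Conditional entropy as the mean entropy of the fibres: the chain rule on `Ω >>= κ ∘ Q`,
    -- carried back to Ω by the disintegration.
    𝔼-fibre : ∀ (Y : RV S) → H Ω ⟨ Q ⟩ +ᵛ 𝔼 Ω (λ s → H (κ (Q s)) Y) ≈ᵛ H Ω (⟨ Q ⟩ & Y)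
    𝔼-fibre Y = ≈ᵛ-trans (≈ᵛ-sym (H-chain Ω Q κ ⟨ Q ⟩ Y (λ _ _ p → p))) (H-law (disintegration dis) (⟨ id ⟩ ⊠ Y))

    -- The same with an independent factor Ω₀ that is not conditioned; Fubini moves it past the
    -- conditioning.
    𝔼-fibre₂ : ∀ (Ω₀ : Space S₀) (F : RV (S₀ × S)) →
      H Ω ⟨ Q ⟩ +ᵛ 𝔼 Ω (λ s → H (Ω₀ ⊗ κ (Q s)) F) ≈ᵛ H (Ω₀ ⊗ Ω) (⟨ Q ⟩ ∘ʳ proj₂ & F)
    𝔼-fibre₂ Ω₀ F = ≈ᵛ-trans (≈ᵛ-sym (H-chain Ω Q (λ q → Ω₀ ⊗ κ q) ⟨ Q ⟩ F (λ _ _ p → p)))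
      (H-law law (⟨ id ⟩ ⊠ F))
      where
      law : SameLaw (Ω >>= (λ q → Ω₀ ⊗ κ q) ∘ Q) (λ p → Q (proj₁ p) , proj₂ p) (Ω₀ ⊗ Ω) (λ p → Q (proj₂ p) , p)
      law .transfer M g = begin
        E.𝔼 (Ω >>= (λ q → Ω₀ ⊗ κ q) ∘ Q) (λ p → g (Q (proj₁ p) , proj₂ p))
          ≈⟨ E.𝔼->>= Ω (λ s → Ω₀ ⊗ κ (Q s)) _ ⟩
        E.𝔼 Ω (λ s → E.𝔼 (Ω₀ ⊗ κ (Q s)) λ p → g (Q s , p))
          ≈⟨ E.𝔼-cong Ω (λ s _ → E.𝔼->>= Ω₀ (λ _ → κ (Q s)) _) ⟩
        E.𝔼 Ω (λ s → E.𝔼 Ω₀ λ r → E.𝔼 (κ (Q s)) λ u → g (Q s , r , u))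
          ≈⟨ E.𝔼-swap Ω Ω₀ (λ s r → E.𝔼 (κ (Q s)) λ u → g (Q s , r , u)) ⟩
        E.𝔼 Ω₀ (λ r → E.𝔼 Ω λ s → E.𝔼 (κ (Q s)) λ u → g (Q s , r , u))
          ≈⟨ E.𝔼-cong Ω₀ (λ r _ → M.≈ᵛ-trans (M.≈ᵛ-sym (E.𝔼->>= Ω (κ ∘ Q) _)) (transfer (disintegration dis) M λ p → g (proj₁ p , r , proj₂ p))) ⟩
        E.𝔼 Ω₀ (λ r → E.𝔼 Ω λ u → g (Q u , r , u))
          ≈⟨ E.𝔼->>= Ω₀ (λ _ → Ω) _ ⟨
        E.𝔼 (Ω₀ ⊗ Ω) (λ p → g (Q (proj₂ p) , p)) ∎
        where
        module M = OrderedModule M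
        module E = Expectation M
        infixr 2 _≈⟨_⟩_ _≈⟨_⟨_
        infix 3 _∎
        infix 1 begin_
        begin_ : ∀ {x y} → x M.≈ᵛ y → x M.≈ᵛ y
        begin p = p
        _≈⟨_⟩_ : ∀ x {y z} → x M.≈ᵛ y → y M.≈ᵛ z → x M.≈ᵛ z
        x ≈⟨ p ⟩ q = M.≈ᵛ-trans p q
        _≈⟨_⟨_ : ∀ x {y z} → y M.≈ᵛ x → y M.≈ᵛ z → x M.≈ᵛ z
        x ≈⟨ p ⟨ q = M.≈ᵛ-trans (M.≈ᵛ-sym p) q
        _∎ : ∀ x → x M.≈ᵛ x
        x ∎ = M.≈ᵛ-refl

  module Conditioning {S T : Set} {{_ : DecEq T}} (Ω : Space S) (Q : S → T) where
    open Space

    mass : T → ℚ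
    mass q = 𝔼ℚ Ω (λ s → 𝟙 (does (Q s ≟ q)))

    fibre : T → Weighted S
    fibre q = List.filter (λ p → Q (proj₂ p) ≟ q) (points Ω)

    module _ (M : OrderedModule) where
      private module M = OrderedModule M
      private module E = Expectation M

      ∫-fibre : ∀ q g → E.∫ (fibre q) g M.≈ᵛ E.𝔼 Ω (λ s → 𝟙 (does (Q s ≟ q)) M.• g s)
      ∫-fibre q g = go (points Ω)
        where
        go : ∀ ps → E.∫ (List.filter (λ p → Q (proj₂ p) ≟ q) ps) g M.≈ᵛ E.∫ ps (λ s → 𝟙 (does (Q s ≟ q)) M.• g s)
        go []             = M.≈ᵛ-refl
        go ((w , s) ∷ ps) with does (Q s ≟ q)
        ... | true  = M.+ᵛ-cong (M.•-congʳ w (M.≈ᵛ-sym (M.•-identity _))) (go ps)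
        ... | false = M.≈ᵛ-trans (go ps) (M.≈ᵛ-trans (M.≈ᵛ-sym (M.+ᵛ-identityˡ _))
          (M.+ᵛ-cong (M.≈ᵛ-sym (M.≈ᵛ-trans (M.•-congʳ w (M.•-zeroˡ _)) (M.•-zeroʳ w))) M.≈ᵛ-refl))

    -- The defining property of conditional expectation, isolated because two kernels have it: the
    -- general `cond` and, for uniform distributions, the uniform distributions on fibres in
    -- `Fibres`.
    IntegratesFibres : (T → Space S) → Set₁
    IntegratesFibres κ = ∀ (M : OrderedModule) s → s ∈ supp Ω → (g : S → OrderedModule.Carrier M) →
      OrderedModule._≈ᵛ_ M (Expectation.𝔼 M (κ (Q s)) g)
        (OrderedModule._•_ M (recip (mass (Q s))) (Expectation.𝔼 M Ω (λ t → OrderedModule._•_ M (𝟙 (does (Q t ≟ Q s))) (g t))))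

    -- The weight 𝟙[Q s = Q t] / mass is symmetric in s and t. After Fubini the sum over s is the
    -- mass of the fibre of t, which cancels the denominator.
    disintegrates : (κ : T → Space S) → IntegratesFibres κ → Disintegrates Ω Q κ
    disintegrates κ fibres .disintegration .transfer M g =
      M.≈ᵛ-trans (E.𝔼->>= Ω (κ ∘ Q) _)
      (M.≈ᵛ-trans (E.𝔼-cong Ω λ s s∈ → M.≈ᵛ-trans (fibres M s s∈ _) (M.≈ᵛ-trans (M.≈ᵛ-sym (E.𝔼-• Ω _ _)) (E.𝔼-cong Ω λ t _ → move s t)))
      (M.≈ᵛ-trans (E.𝔼-swap Ω Ω (λ s t → 𝟙 (does (Q s ≟ Q t)) M.• (recip (mass (Q t)) M.• g (Q t , t))))
      (E.𝔼-cong Ω λ t t∈ → M.≈ᵛ-trans (E.𝔼-scalar Ω (λ s → 𝟙 (does (Q s ≟ Q t))) _)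
        (M.≈ᵛ-trans (M.≈ᵛ-sym (M.•-assoc _ _ _)) (M.≈ᵛ-trans (M.≡⇒≈ᵛ (cong (M._• g (Q t , t)) (recip-inverseʳ (0<mass t∈)))) (M.•-identity _))))))
      where
      module M = OrderedModule M
      module E = Expectation M
      0<mass : ∀ {s} → s ∈ supp Ω → 0ℚ < mass (Q s)
      0<mass = ℙ-pos Ω ⟨ Q ⟩
      move : ∀ s t → recip (mass (Q s)) M.• (𝟙 (does (Q t ≟ Q s)) M.• g (Q s , t)) M.≈ᵛ
        𝟙 (does (Q s ≟ Q t)) M.• (recip (mass (Q t)) M.• g (Q t , t))
      move s t rewrite same-sym ⟨ Q ⟩ s t with does (Q t ≟ Q s) in p
      ... | false = M.≈ᵛ-trans (M.•-congʳ _ (M.•-zeroˡ _)) (M.≈ᵛ-trans (M.•-zeroʳ _) (M.≈ᵛ-sym (M.•-zeroˡ _)))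
      ... | true rewrite same⇒≡ ⟨ Q ⟩ {t} {s} p = M.≈ᵛ-trans (M.•-congʳ _ (M.•-identity _)) (M.≈ᵛ-sym (M.•-identity _))

    abstract
      -- Equal to Ω, a junk value, when q has probability zero.
      cond : T → Space S
      cond q with 0ℚ ℚₚ.<? mass q
      ... | no  _   = Ω
      ... | yes 0<m = record
        { points = scale (recip (mass q)) id (fibre q)
        ; weights-positive = scale-positive (recip-pos 0<m) (Allₚ.filter⁺ (λ p → Q (proj₂ p) ≟ q) (weights-positive Ω))
        ; total = trans (ℚ-≈⇒≡ (ℚ∫.∫-scale (recip (mass q)) id (fibre q) (λ _ → 1ℚ)))
            (trans (cong (recip (mass q) *_) (trans (ℚ-≈⇒≡ (∫-fibre ℚ-module q (λ _ → 1ℚ)))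
              (ℚ𝔼.≡-cong Ω λ s _ → ℚₚ.*-identityʳ _))) (recip-inverseˡ 0<m)) }

      cond-disintegrates : Disintegrates Ω Q cond
      cond-disintegrates = disintegrates cond inner
        where
        inner : IntegratesFibres cond
        inner M s s∈ g with 0ℚ ℚₚ.<? mass (Q s)
        ... | no ≮    = contradiction (ℙ-pos Ω ⟨ Q ⟩ s∈) ≮
        ... | yes 0<m = OrderedModule.≈ᵛ-trans M (Expectation.∫-scale M _ id (fibre (Q s)) g)
                          (OrderedModule.•-congʳ M _ (∫-fibre M (Q s) g))

  det : ∀ {S A B : Set} {f : S → A} {g : S → B} (h : A → B) → (∀ s → g s ≡ h (f s)) →
    ∀ s t → f s ≡ f t → g s ≡ g t
  det h g≡ s t p = trans (g≡ s) (trans (cong h p) (sym (g≡ t)))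

  det-refl : ∀ {S A B : Set} {f : S → A} (h : A → B) → ∀ s t → f s ≡ f t → h (f s) ≡ h (f t)
  det-refl h s t p = cong h p

  record MeasurePreserving {S T : Set} (Ω : Space S) (φ : S → T) (Ω′ : Space T) : Set₁ where
    constructor mp
    field law : SameLaw Ω φ Ω′ id
  open MeasurePreserving public

  mp-H : ∀ {S T : Set} {Ω : Space S} {φ : S → T} {Ω′ : Space T} → MeasurePreserving Ω φ Ω′ →
    ∀ (F : RV T) → H Ω (F ∘ʳ φ) ≈ᵛ H Ω′ F
  mp-H φ-mp F = H-law (law φ-mp) F

  mp-∘ : ∀ {S T U : Set} {Ω : Space S} {φ : S → T} {Ω′ : Space T} {ψ : T → U} {Ω″ : Space U} →
    MeasurePreserving Ω φ Ω′ → MeasurePreserving Ω′ ψ Ω″ → MeasurePreserving Ω (ψ ∘ φ) Ω″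
  mp-∘ {ψ = ψ} p q .law .transfer M g = OrderedModule.≈ᵛ-trans M (transfer (law p) M (g ∘ ψ)) (transfer (law q) M g)

  mp-proj₁ : ∀ {S S′ : Set} (Ω : Space S) (κ : S → Space S′) → MeasurePreserving (Ω >>= κ) proj₁ Ω
  mp-proj₁ Ω κ = mp (law-proj₁ Ω κ)

  mp-proj₂ : ∀ {S S′ : Set} (Ω : Space S) (Ω′ : Space S′) → MeasurePreserving (Ω ⊗ Ω′) proj₂ Ω′
  mp-proj₂ Ω Ω′ = mp (law-proj₂ Ω Ω′)

  mp-swap : ∀ {S S′ : Set} (Ω : Space S) (Ω′ : Space S′) → MeasurePreserving (Ω ⊗ Ω′) (λ p → proj₂ p , proj₁ p) (Ω′ ⊗ Ω)
  mp-swap Ω Ω′ .law .transfer M g = M.≈ᵛ-trans (E.𝔼->>= Ω (λ _ → Ω′) _)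
    (M.≈ᵛ-trans (E.𝔼-swap Ω Ω′ (λ s t → g (t , s))) (M.≈ᵛ-sym (E.𝔼->>= Ω′ (λ _ → Ω) g)))
    where module M = OrderedModule M
          module E = Expectation M

  mp-assoc : ∀ {S S′ S″ : Set} (Ω : Space S) (Ω′ : Space S′) (Ω″ : Space S″) →
    MeasurePreserving (Ω ⊗ (Ω′ ⊗ Ω″)) (λ (r , s , t) → (r , s) , t) ((Ω ⊗ Ω′) ⊗ Ω″)
  mp-assoc Ω Ω′ Ω″ .law .transfer M g = M.≈ᵛ-trans (E.𝔼->>= Ω (λ _ → Ω′ ⊗ Ω″) _)
    (M.≈ᵛ-trans (E.𝔼-cong Ω λ r _ → E.𝔼->>= Ω′ (λ _ → Ω″) _)
    (M.≈ᵛ-sym (M.≈ᵛ-trans (E.𝔼->>= (Ω ⊗ Ω′) (λ _ → Ω″) g) (E.𝔼->>= Ω (λ _ → Ω′) _))))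
    where module M = OrderedModule M
          module E = Expectation M

  mp-⊗ : ∀ {S S′ T T′ : Set} {Ω : Space S} {Ω′ : Space S′} {φ : S → S′} (Λ : Space T) (Λ′ : Space T′) {ψ : T → T′} →
    MeasurePreserving Ω φ Ω′ → MeasurePreserving Λ ψ Λ′ →
    MeasurePreserving (Ω ⊗ Λ) (λ p → φ (proj₁ p) , ψ (proj₂ p)) (Ω′ ⊗ Λ′)
  mp-⊗ {Ω = Ω} {Ω′} {φ} Λ Λ′ p q .law .transfer M g = M.≈ᵛ-trans (E.𝔼->>= Ω (λ _ → Λ) _)
    (M.≈ᵛ-trans (E.𝔼-cong Ω λ s _ → transfer (law q) M (λ t → g (φ s , t)))
    (M.≈ᵛ-trans (transfer (law p) M (λ s → E.𝔼 Λ′ λ t → g (s , t))) (M.≈ᵛ-sym (E.𝔼->>= Ω′ (λ _ → Λ′) g))))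
    where module M = OrderedModule M
          module E = Expectation M

  mp-id : ∀ {S : Set} {Ω : Space S} → MeasurePreserving Ω id Ω
  mp-id .law .transfer M g = OrderedModule.≈ᵛ-refl M

  mp-interchange : ∀ {S : Set} (Ω : Space S) → MeasurePreserving ((Ω ⊗ Ω) ⊗ (Ω ⊗ Ω))
    (λ ((a , b) , (c , d)) → (a , c) , (b , d)) ((Ω ⊗ Ω) ⊗ (Ω ⊗ Ω))
  mp-interchange Ω .law .transfer M g = M.≈ᵛ-trans (E.𝔼->>= Ω² (λ _ → Ω²) _) (M.≈ᵛ-trans (E.𝔼->>= Ω (λ _ → Ω) _)
    (M.≈ᵛ-trans (E.𝔼-cong Ω λ a _ → M.≈ᵛ-trans
        (E.𝔼-cong Ω λ b _ → E.𝔼->>= Ω (λ _ → Ω) _)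
        (M.≈ᵛ-trans (E.𝔼-swap Ω Ω (λ b c → E.𝔼 Ω λ d → g ((a , c) , (b , d))))
          (E.𝔼-cong Ω λ c _ → M.≈ᵛ-sym (E.𝔼->>= Ω (λ _ → Ω) (λ bd → g ((a , c) , bd))))))
    (M.≈ᵛ-sym (M.≈ᵛ-trans (E.𝔼->>= Ω² (λ _ → Ω²) g) (E.𝔼->>= Ω (λ _ → Ω) _)))))
    where module M = OrderedModule M
          module E = Expectation M
          Ω² = Ω ⊗ Ω

  -- The entropic Balog-Szemerédi-Gowers inequality

  module _ {n : ℕ} where
    private G = Vec Bool n

    -- The Ruzsa distance from x to an independent copy of itself; over 𝔽₂ sums and differences
    -- agree.
    D₁ : ∀ {S} → Space S → (S → G) → Carrier
    D₁ Ω x = H (Ω ⊗ Ω) ⟨ (λ (s , t) → x s ⊞ x t) ⟩ -ᵛ H Ω ⟨ x ⟩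

    -- Given Q = (W, c), two independent copies u₁, u₂ of U are drawn, and v₁′, v₂′ are the matching
    -- values of V. The point is that t = u₁ + v₂′ is also u₂ + v₁′, so that it can be estimated in
    -- two ways.
    module BalogSzemerédiGowers {S C : Set} {{_ : DecEq C}} (Ω : Space S) (U V : S → G) (c : S → C) where
      W : S → G
      W s = U s ⊞ V s
      Q : S → G × C
      Q s = W s , c s
      open Conditioning Ω Q public using (cond; cond-disintegrates)
      private
        κ² = λ q → cond q ⊗ cond q
        Λ = Ω >>= κ² ∘ Q
        Point = S × (S × S)
        u₁ u₂ w v₁′ v₂′ t : Point → G
        u₁ (_ , a , _) = U a
        u₂ (_ , _ , b) = U b
        w  (s , _)     = W s
        v₁′ p = u₁ p ⊞ w p
        v₂′ p = u₂ p ⊞ w p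
        t p = u₁ p ⊞ v₂′ p
        c′ : Point → C
        c′ (s , _) = c s
        q′ : Point → G × C
        q′ (s , _) = Q s

        law₁ : SameLaw Λ (λ (s , a , b) → Q s , a) Ω (λ a → Q a , a)
        law₁ .transfer M g = M.≈ᵛ-trans (E.𝔼->>= Ω (κ² ∘ Q) _) (M.≈ᵛ-trans
          (E.𝔼-cong Ω λ s _ → transfer (law-proj₁ (cond (Q s)) (λ _ → cond (Q s))) M (λ a → g (Q s , a)))
          (M.≈ᵛ-trans (M.≈ᵛ-sym (E.𝔼->>= Ω (cond ∘ Q) _)) (transfer (disintegration cond-disintegrates) M g)))
          where module M = OrderedModule M
                module E = Expectation M

        law₂ : SameLaw Λ (λ (s , a , b) → Q s , b) Ω (λ a → Q a , a)
        law₂ .transfer M g = M.≈ᵛ-trans (E.𝔼->>= Ω (κ² ∘ Q) _) (M.≈ᵛ-trans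
          (E.𝔼-cong Ω λ s _ → transfer (law-proj₂ (cond (Q s)) (cond (Q s))) M (λ a → g (Q s , a)))
          (M.≈ᵛ-trans (M.≈ᵛ-sym (E.𝔼->>= Ω (cond ∘ Q) _)) (transfer (disintegration cond-disintegrates) M g)))
          where module M = OrderedModule M
                module E = Expectation M

        hQ = H Ω ⟨ Q ⟩
        hc = H Ω ⟨ c ⟩
        hUc = H Ω ⟨ (λ s → U s , c s) ⟩
        hVc = H Ω ⟨ (λ s → V s , c s) ⟩
        hQU = H Ω ⟨ (λ s → Q s , U s) ⟩
        hT = H Λ ⟨ (λ p → t p , c′ p) ⟩
        hTQ = H Λ ⟨ (λ p → q′ p , t p) ⟩
        hUTc = H Λ ⟨ (λ p → u₁ p , t p , c′ p) ⟩
        hVTc = H Λ ⟨ (λ p → v₁′ p , t p , c′ p) ⟩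
        hUUQ = H Λ ⟨ (λ p → q′ p , u₁ p , u₂ p) ⟩
        𝔼U = 𝔼 Ω (λ s → H (cond (Q s)) ⟨ U ⟩)
        𝔼UU = 𝔼 Ω (λ s → H (κ² (Q s)) ⟨ (λ (a , b) → U a ⊞ U b) ⟩)

        V≡ : ∀ s → U s ⊞ W s ≡ V s
        V≡ s = ⊞-cancelˡ (U s) (V s)

        marginal-Q : H Λ ⟨ q′ ⟩ ≈ᵛ hQ
        marginal-Q = mp-H (mp-proj₁ Ω (κ² ∘ Q)) ⟨ Q ⟩
        marginal-c : H Λ ⟨ c′ ⟩ ≈ᵛ hc
        marginal-c = mp-H (mp-proj₁ Ω (κ² ∘ Q)) ⟨ c ⟩
        marginal-U₁ : H Λ ⟨ (λ p → u₁ p , c′ p) ⟩ ≈ᵛ hUc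
        marginal-U₁ = H-law law₁ ⟨ (λ (q , a) → U a , proj₂ q) ⟩
        marginal-U₂ : H Λ ⟨ (λ p → u₂ p , c′ p) ⟩ ≈ᵛ hUc
        marginal-U₂ = H-law law₂ ⟨ (λ (q , a) → U a , proj₂ q) ⟩
        V-cong : H Ω ⟨ (λ s → U s ⊞ W s , c s) ⟩ ≈ᵛ hVc
        V-cong = H-cong Ω ⟨ (λ s → U s ⊞ W s , c s) ⟩ ⟨ (λ s → V s , c s) ⟩
          (det id λ s → cong (_, c s) (sym (V≡ s))) (det id λ s → cong (_, c s) (V≡ s))
        marginal-V₁ : H Λ ⟨ (λ p → v₁′ p , c′ p) ⟩ ≈ᵛ hVc
        marginal-V₁ = ≈ᵛ-trans (H-law law₁ ⟨ (λ (q , a) → U a ⊞ proj₁ q , proj₂ q) ⟩) V-cong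
        marginal-V₂ : H Λ ⟨ (λ p → v₂′ p , c′ p) ⟩ ≈ᵛ hVc
        marginal-V₂ = ≈ᵛ-trans (H-law law₂ ⟨ (λ (q , a) → U a ⊞ proj₁ q , proj₂ q) ⟩) V-cong

        fibre-U : hQ +ᵛ 𝔼U ≈ᵛ hQU
        fibre-U = 𝔼-fibre {S₀ = ⊤} Ω Q cond-disintegrates ⟨ U ⟩

        joint : hUUQ ≈ᵛ hQ +ᵛ (𝔼U +ᵛ 𝔼U)
        joint = ≈ᵛ-trans (H-chain Ω Q κ² ⟨ Q ⟩ (⟨ U ⟩ ⊠ ⟨ U ⟩) (λ _ _ p → p)) (+ᵛ-cong ≈ᵛ-refl
          (≈ᵛ-trans (𝔼-cong Ω λ s _ → H-⊗ (cond (Q s)) (cond (Q s)) ⟨ U ⟩ ⟨ U ⟩) (𝔼-+ Ω _ _)))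

        t≡ : ∀ p → t p ≡ u₂ p ⊞ v₁′ p
        t≡ p = trans (sym (⊞-assoc (u₁ p) (u₂ p) (w p))) (trans (cong (_⊞ w p) (⊞-comm (u₁ p) (u₂ p))) (⊞-assoc (u₂ p) (u₁ p) (w p)))

        sum : hTQ ≈ᵛ hQ +ᵛ 𝔼UU
        sum = ≈ᵛ-trans (H-cong Λ ⟨ (λ p → q′ p , t p) ⟩ ⟨ (λ p → q′ p , u₁ p ⊞ u₂ p) ⟩
            (det (λ (q , y) → q , y ⊞ proj₁ q) λ p → cong (q′ p ,_) (sym (trans (cong (_⊞ w p) (sym (⊞-assoc (u₁ p) (u₂ p) (w p)))) (⊞-cancelʳ (u₁ p ⊞ u₂ p) (w p)))))
            (det (λ (q , y) → q , y ⊞ proj₁ q) λ p → cong (q′ p ,_) (sym (⊞-assoc (u₁ p) (u₂ p) (w p)))))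
          (H-chain Ω Q κ² ⟨ Q ⟩ ⟨ (λ (a , b) → U a ⊞ U b) ⟩ (λ _ _ p → p))

        step-a : hTQ +ᵛ H Λ ⟨ c′ ⟩ ≤ᵛ hT +ᵛ H Λ ⟨ q′ ⟩
        step-a = submodular Λ ⟨ (λ p → t p , c′ p) ⟩ ⟨ q′ ⟩ ⟨ c′ ⟩ ⟨ (λ p → q′ p , t p) ⟩
          (det-refl proj₂) (det-refl proj₂) (det-refl λ ((t , _) , q) → q , t)

        -- u₁ and v₁′ together give w, hence Q; with t they give u₂ as well.
        step-b : hUUQ +ᵛ hT ≤ᵛ hUTc +ᵛ hVTc
        step-b = submodular Λ ⟨ (λ p → u₁ p , t p , c′ p) ⟩ ⟨ (λ p → v₁′ p , t p , c′ p) ⟩ ⟨ (λ p → t p , c′ p) ⟩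
          ⟨ (λ p → q′ p , u₁ p , u₂ p) ⟩ (det-refl proj₂) (det-refl proj₂)
          (det (λ ((u , t , c) , (v , _)) → (u ⊞ v , c) , u , v ⊞ t) λ p → cong₂ _,_
            (cong (_, c′ p) (sym (⊞-cancelˡ (u₁ p) (w p))))
            (cong (u₁ p ,_) (sym (trans (cong (v₁′ p ⊞_) (trans (t≡ p) (⊞-comm (u₂ p) (v₁′ p)))) (⊞-cancelˡ (v₁′ p) (u₂ p))))))

        step-c : hUTc +ᵛ H Λ ⟨ c′ ⟩ ≤ᵛ H Λ ⟨ (λ p → u₁ p , c′ p) ⟩ +ᵛ H Λ ⟨ (λ p → v₂′ p , c′ p) ⟩
        step-c = submodular Λ ⟨ (λ p → u₁ p , c′ p) ⟩ ⟨ (λ p → v₂′ p , c′ p) ⟩ ⟨ c′ ⟩ ⟨ (λ p → u₁ p , t p , c′ p) ⟩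
          (det-refl proj₂) (det-refl proj₂) (det-refl λ ((u , c) , (v , _)) → u , u ⊞ v , c)

        step-d : hVTc +ᵛ H Λ ⟨ c′ ⟩ ≤ᵛ H Λ ⟨ (λ p → v₁′ p , c′ p) ⟩ +ᵛ H Λ ⟨ (λ p → u₂ p , c′ p) ⟩
        step-d = submodular Λ ⟨ (λ p → v₁′ p , c′ p) ⟩ ⟨ (λ p → u₂ p , c′ p) ⟩ ⟨ c′ ⟩ ⟨ (λ p → v₁′ p , t p , c′ p) ⟩
          (det-refl proj₂) (det-refl proj₂)
          (det (λ ((v , c) , (u , _)) → v , u ⊞ v , c) λ p → cong (λ y → v₁′ p , y , c′ p) (t≡ p))

      -- In conditional form the mean of D₁ is at most 2 (H(U | c) + H(V | c) + H(W | c)) - 3 H(U, V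
      -- | c). When the three single entropies agree, this is three times the mutual information of
      -- U and V given c.
      𝔼-D₁-≤ : 𝔼 Ω (λ s → D₁ (cond (Q s)) U) +ᵛ 3 ×ᵛ hc +ᵛ 3 ×ᵛ hQU ≤ᵛ 2 ×ᵛ hUc +ᵛ 2 ×ᵛ hVc +ᵛ 2 ×ᵛ hQ
      𝔼-D₁-≤ = linear
        (𝔼 Ω (λ s → D₁ (cond (Q s)) U) ∷ hc ∷ hQU ∷ hUc ∷ hVc ∷ hQ ∷ 𝔼U ∷ 𝔼UU ∷ hTQ ∷ hT ∷
         hUTc ∷ hVTc ∷ hUUQ ∷ H Λ ⟨ c′ ⟩ ∷ H Λ ⟨ q′ ⟩ ∷ H Λ ⟨ (λ p → u₁ p , c′ p) ⟩ ∷ H Λ ⟨ (λ p → v₂′ p , c′ p) ⟩ ∷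
         H Λ ⟨ (λ p → v₁′ p , c′ p) ⟩ ∷ H Λ ⟨ (λ p → u₂ p , c′ p) ⟩ ∷ [])
        (v₀ ⊹ 3 ⊛ v₁ ⊹ 3 ⊛ v₂) (2 ⊛ v₃ ⊹ 2 ⊛ v₄ ⊹ 2 ⊛ v₅)
        (1 · v₀ ≦ v₇ ⊝ v₆ ∵ split ∷
         1 · v₅ ⊹ v₇ ≦ v₈ ∵ proj₂ sum ∷
         1 · v₈ ⊹ var 13 ≦ v₉ ⊹ var 14 ∵ step-a ∷
         1 · var 12 ⊹ v₉ ≦ var 10 ⊹ var 11 ∵ step-b ∷
         1 · var 10 ⊹ var 13 ≦ var 15 ⊹ var 16 ∵ step-c ∷
         1 · var 11 ⊹ var 13 ≦ var 17 ⊹ var 18 ∵ step-d ∷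
         3 · v₁ ≦ var 13 ∵ proj₂ marginal-c ∷
         1 · var 14 ≦ v₅ ∵ proj₁ marginal-Q ∷
         1 · var 15 ≦ v₃ ∵ proj₁ marginal-U₁ ∷
         1 · var 16 ≦ v₄ ∵ proj₁ marginal-V₂ ∷
         1 · var 17 ≦ v₄ ∵ proj₁ marginal-V₁ ∷
         1 · var 18 ≦ v₃ ∵ proj₁ marginal-U₂ ∷
         1 · v₅ ⊹ (v₆ ⊹ v₆) ≦ var 12 ∵ proj₂ joint ∷
         3 · v₂ ≦ v₅ ⊹ v₆ ∵ proj₂ fibre-U ∷ [])
        where
        split : 𝔼 Ω (λ s → D₁ (cond (Q s)) U) ≤ᵛ 𝔼UU -ᵛ 𝔼U
        split = proj₁ (≈ᵛ-trans (𝔼-+ Ω _ _) (+ᵛ-cong ≈ᵛ-refl (𝔼-neg Ω _)))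

  -- Families of random variables on 𝔽₂ⁿ and the entropy decrement

  -- A conditioned random variable: x given side information z. Keeping z as a variable makes `X⁺`
  -- and `X∣` of `Step` families again, so that a single fibre is chosen only in `endgame`.
  record Family (n : ℕ) : Set₁ where
    constructor family
    field
      {Point Side} : Set
      {{dec}} : DecEq Side
      space   : Space Point
      x       : Point → Vec Bool n
      z       : Point → Side

  single : ∀ {n S} → Space S → (S → Vec Bool n) → Family n
  single Ω x = family Ω x (λ _ → tt)

  module _ {n : ℕ} where
    private G = Vec Bool n

    -- The conditional Ruzsa distance of the family to itself, H(x + x′ | z, z′) - H(x | z), where
    -- one of the two terms H(z) of H(z, z′) has been cancelled against that of H(x | z).
    D : Family n → Carrier
    D (family Ω x z) = H (Ω ⊗ Ω) ⟨ (λ (s , t) → x s ⊞ x t , z s , z t) ⟩ -ᵛ H Ω ⟨ z ⟩ -ᵛ H Ω ⟨ (λ s → x s , z s) ⟩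

    module _ {S C : Set} {{_ : DecEq C}} (Ω : Space S) (x : S → G) (z : S → C) where
      private
        h-z = H Ω ⟨ z ⟩
        h-xz = H Ω ⟨ (λ s → x s , z s) ⟩
        h-sum = H (Ω ⊗ Ω) ⟨ (λ (s , t) → x s ⊞ x t , z s , z t) ⟩

      -- Revealing x′ lowers the entropy of x + x′ given z, z′, and what remains is the entropy of x
      -- given z.
      D-lower : h-z +ᵛ h-xz ≤ᵛ h-sum
      D-lower = linear (h-z ∷ h-xz ∷ h-sum ∷ H Ω² ⟨ (λ (s , t) → (x s , z s) , (x t , z t)) ⟩ ∷
          H Ω² ⟨ (λ (s , t) → z s , (x t , z t)) ⟩ ∷ H Ω² ⟨ (λ (s , t) → z s , z t) ⟩ ∷ [])
        (v₀ ⊹ v₁) v₂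
        (1 · v₃ ⊹ v₅ ≦ v₂ ⊹ v₄ ∵ sub ∷
         1 · v₁ ⊹ v₁ ≦ v₃ ∵ proj₂ (H-⊗ Ω Ω ⟨ (λ s → x s , z s) ⟩ ⟨ (λ s → x s , z s) ⟩) ∷
         1 · v₄ ≦ v₀ ⊹ v₁ ∵ proj₁ (H-⊗ Ω Ω ⟨ z ⟩ ⟨ (λ s → x s , z s) ⟩) ∷
         1 · v₀ ⊹ v₀ ≦ v₅ ∵ proj₂ (H-⊗ Ω Ω ⟨ z ⟩ ⟨ z ⟩) ∷ [])
        where
        Ω² = Ω ⊗ Ω
        sub = submodular Ω² ⟨ (λ (s , t) → x s ⊞ x t , z s , z t) ⟩ ⟨ (λ (s , t) → z s , (x t , z t)) ⟩
          ⟨ (λ (s , t) → z s , z t) ⟩ ⟨ (λ (s , t) → (x s , z s) , (x t , z t)) ⟩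
          (det-refl proj₂) (det-refl λ (a , _ , b) → a , b)
          (det (λ ((a , _) , (c , b , d)) → (a ⊞ b , c) , (b , d)) λ (s , t) → cong (λ y → (y , z s) , (x t , z t)) (sym (⊞-cancelʳ (x s) (x t))))

    D-nonNeg : ∀ X → 0ᵛ ≤ᵛ D X
    D-nonNeg (family Ω x z) = linear (_ ∷ _ ∷ _ ∷ []) 𝕠 (v₂ ⊝ v₀ ⊝ v₁) (1 · v₀ ⊹ v₁ ≦ v₂ ∵ D-lower Ω x z ∷ [])

    D-single : ∀ {S} (Ω : Space S) x → D (single Ω x) ≈ᵛ D₁ Ω x
    D-single Ω x = ≈ᵛ-trans (+ᵛ-cong (≈ᵛ-trans (+ᵛ-cong
        (H-cong (Ω ⊗ Ω) ⟨ (λ (s , t) → x s ⊞ x t , tt , tt) ⟩ ⟨ (λ (s , t) → x s ⊞ x t) ⟩ (det-refl proj₁) (det-refl (_, tt , tt)))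
        (≈ᵛ-trans (-ᵛ-cong (H-const Ω)) (≈ᵛ-trans (≈ᵛ-sym (neg-• 0ᵛ)) (•-zeroʳ (- 1ℚ))))) (+ᵛ-identityʳ _))
      (-ᵛ-cong (H-cong Ω ⟨ (λ s → x s , tt) ⟩ ⟨ x ⟩ (det-refl proj₁) (det-refl (_, tt)))))
      ≈ᵛ-refl

    D₁-nonNeg : ∀ {S} (Ω : Space S) x → 0ᵛ ≤ᵛ D₁ Ω x
    D₁-nonNeg Ω x = ≤ᵛ-trans (D-nonNeg (single Ω x)) (proj₁ (D-single Ω x))

    module Relative {S₀ : Set} (Ω₀ : Space S₀) (x₀ : S₀ → G) where
      h₀ : Carrier
      h₀ = H Ω₀ ⟨ x₀ ⟩

      -- Twice the Ruzsa distance to x₀.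
      R : Family n → Carrier
      R (family Ω x z) = 2 ×ᵛ H (Ω₀ ⊗ Ω) ⟨ (λ (r , s) → x₀ r ⊞ x s , z s) ⟩ -ᵛ H Ω ⟨ z ⟩ -ᵛ H Ω ⟨ (λ s → x s , z s) ⟩ -ᵛ h₀

      R₁ : ∀ {S} → Space S → (S → G) → Carrier
      R₁ Ω x = 2 ×ᵛ H (Ω₀ ⊗ Ω) ⟨ (λ (r , s) → x₀ r ⊞ x s) ⟩ -ᵛ H Ω ⟨ x ⟩ -ᵛ h₀

      -- R ties the variable to x₀; without it a constant variable would have D = 0 at once. The
      -- weight 16 is explained at `decrement`.
      τ : Family n → Carrier
      τ X = 16 ×ᵛ D X +ᵛ R X

      R-single : ∀ {S} (Ω : Space S) x → R (single Ω x) ≈ᵛ R₁ Ω x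
      R-single Ω x = +ᵛ-cong (≈ᵛ-trans (+ᵛ-cong (≈ᵛ-trans (+ᵛ-cong
          (•-congʳ (fromℕℚ 2) (H-cong (Ω₀ ⊗ Ω) ⟨ (λ (r , s) → x₀ r ⊞ x s , tt) ⟩ ⟨ (λ (r , s) → x₀ r ⊞ x s) ⟩ (det-refl proj₁) (det-refl (_, tt))))
          (≈ᵛ-trans (-ᵛ-cong (H-const Ω)) (≈ᵛ-trans (≈ᵛ-sym (neg-• 0ᵛ)) (•-zeroʳ (- 1ℚ))))) (+ᵛ-identityʳ _))
        (-ᵛ-cong (H-cong Ω ⟨ (λ s → x s , tt) ⟩ ⟨ x ⟩ (det-refl proj₁) (det-refl (_, tt)))))
        ≈ᵛ-refl) ≈ᵛ-refl

      R-nonNeg : ∀ X → 0ᵛ ≤ᵛ R X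
      R-nonNeg (family Ω x z) = linear
        (H (Ω₀ ⊗ Ω) ⟨ (λ (r , s) → x₀ r ⊞ x s , z s) ⟩ ∷ H Ω ⟨ z ⟩ ∷ H Ω ⟨ (λ s → x s , z s) ⟩ ∷ h₀ ∷
         H (Ω₀ ⊗ Ω) ⟨ (λ (r , s) → x₀ r , (x s , z s)) ⟩ ∷ H (Ω₀ ⊗ Ω) ⟨ (λ (r , s) → x₀ r , z s) ⟩ ∷
         H (Ω₀ ⊗ Ω) ⟨ (λ (r , s) → x s , z s) ⟩ ∷ H (Ω₀ ⊗ Ω) ⟨ (λ (r , s) → z s) ⟩ ∷ [])
        𝕠 (2 ⊛ v₀ ⊝ v₁ ⊝ v₂ ⊝ v₃)
        (1 · v₄ ⊹ v₇ ≦ v₀ ⊹ v₅ ∵ submodular Λ ⟨ (λ (r , s) → x₀ r ⊞ x s , z s) ⟩ ⟨ (λ (r , s) → x₀ r , z s) ⟩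
            ⟨ (λ (r , s) → z s) ⟩ ⟨ (λ (r , s) → x₀ r , (x s , z s)) ⟩ (det-refl proj₂) (det-refl proj₂)
            (det (λ ((a , c) , (b , _)) → b , (b ⊞ a , c)) λ (r , s) → cong (λ y → x₀ r , (y , z s)) (sym (⊞-cancelˡ (x₀ r) (x s)))) ∷
         1 · v₄ ⊹ v₇ ≦ v₀ ⊹ v₆ ∵ submodular Λ ⟨ (λ (r , s) → x₀ r ⊞ x s , z s) ⟩ ⟨ (λ (r , s) → x s , z s) ⟩
            ⟨ (λ (r , s) → z s) ⟩ ⟨ (λ (r , s) → x₀ r , (x s , z s)) ⟩ (det-refl proj₂) (det-refl proj₂)
            (det (λ ((a , c) , (b , _)) → a ⊞ b , (b , c)) λ (r , s) → cong (λ y → y , (x s , z s)) (sym (⊞-cancelʳ (x₀ r) (x s)))) ∷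
         2 · v₃ ⊹ v₂ ≦ v₄ ∵ proj₂ (H-⊗ Ω₀ Ω ⟨ x₀ ⟩ ⟨ (λ s → x s , z s) ⟩) ∷
         1 · v₅ ≦ v₃ ⊹ v₁ ∵ proj₁ (H-⊗ Ω₀ Ω ⟨ x₀ ⟩ ⟨ z ⟩) ∷
         1 · v₆ ≦ v₂ ∵ proj₁ (mp-H (mp-proj₂ Ω₀ Ω) ⟨ (λ s → x s , z s) ⟩) ∷
         2 · v₁ ≦ v₇ ∵ proj₂ (mp-H (mp-proj₂ Ω₀ Ω) ⟨ z ⟩) ∷ [])
        where Λ = Ω₀ ⊗ Ω

      R₁-nonNeg : ∀ {S} (Ω : Space S) x → 0ᵛ ≤ᵛ R₁ Ω x
      R₁-nonNeg Ω x = ≤ᵛ-trans (R-nonNeg (single Ω x)) (proj₁ (R-single Ω x))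

      -- Two independent copies are fibred along their sum: `X⁺` is x + x′ given the side
      -- information, `X∣` is x given x + x′ as well. Twice D X equals D X⁺ + D X∣ plus a mutual
      -- information `I`; so either one of the two families improves on X, or `I` is small and
      -- `endgame` applies.
      module Step {S C : Set} {{_ : DecEq C}} (Ω : Space S) (x : S → G) (z : S → C) where
        Ω² = Ω ⊗ Ω
        Ω⁴ = Ω² ⊗ Ω²
        P = S × S
        xz : S → G × C
        xz s = x s , z s
        u : P → G
        u (s , t) = x s ⊞ x t
        z² : P → C × C
        z² (s , t) = z s , z t
        uz : P → G × (C × C)
        uz p = u p , z² p

        X X⁺ X∣ : Family n
        X  = family Ω x z
        X⁺ = family Ω² u z²
        X∣ = family Ω² (x ∘ proj₁) uz

        k h-z h-xz h-uz r₁ : Carrier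
        k = D X
        h-z = H Ω ⟨ z ⟩
        h-xz = H Ω ⟨ xz ⟩
        h-uz = H Ω² ⟨ uz ⟩
        r₁ = H (Ω₀ ⊗ Ω) ⟨ (λ (r , s) → x₀ r ⊞ x s , z s) ⟩

        H-z² : H Ω² ⟨ z² ⟩ ≈ᵛ h-z +ᵛ h-z
        H-z² = H-⊗ Ω Ω ⟨ z ⟩ ⟨ z ⟩

        H-xuz : H Ω² ⟨ (λ p → x (proj₁ p) , uz p) ⟩ ≈ᵛ h-xz +ᵛ h-xz
        H-xuz = ≈ᵛ-trans (H-cong Ω² ⟨ (λ p → x (proj₁ p) , uz p) ⟩ (⟨ xz ⟩ ⊠ ⟨ xz ⟩)
            (det (λ (a , b , c , d) → (a , c) , (a ⊞ b , d)) λ (s , t) → cong (λ y → xz s , (y , z t)) (sym (⊞-cancelˡ (x s) (x t))))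
            (det-refl λ ((a , c) , (b , d)) → a , a ⊞ b , c , d))
          (H-⊗ Ω Ω ⟨ xz ⟩ ⟨ xz ⟩)

        -- For four independent copies x₁, ..., x₄: U = x₁ + x₂, V = x₁ + x₃ and W = x₂ + x₃. Over
        -- 𝔽₂ one has U + V = W, and by symmetry the three have equal entropy jointly with the total
        -- sum and the side information.
        U V W S̃ : P × P → G
        U (p , q) = u p
        V (p , q) = x (proj₁ p) ⊞ x (proj₁ q)
        W (p , q) = x (proj₂ p) ⊞ x (proj₁ q)
        S̃ (p , q) = u p ⊞ u q
        c : P × P → G × ((C × C) × (C × C))
        c (p , q) = u p ⊞ u q , z² p , z² q

        h-c h-UVc : Carrier
        h-c = H Ω⁴ ⟨ c ⟩
        h-UVc = H Ω⁴ ⟨ (λ (p , q) → x (proj₁ p) ⊞ x (proj₁ q) , uz p , uz q) ⟩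

        D⁺≈ : D X⁺ ≈ᵛ h-c -ᵛ (h-z +ᵛ h-z) -ᵛ h-uz
        D⁺≈ = +ᵛ-cong (+ᵛ-cong ≈ᵛ-refl (-ᵛ-cong H-z²)) ≈ᵛ-refl

        D∣≈ : D X∣ ≈ᵛ h-UVc -ᵛ h-uz -ᵛ (h-xz +ᵛ h-xz)
        D∣≈ = +ᵛ-cong ≈ᵛ-refl (-ᵛ-cong H-xuz)

        H-Uc : H Ω⁴ ⟨ (λ p → U p , c p) ⟩ ≈ᵛ h-uz +ᵛ h-uz
        H-Uc = ≈ᵛ-trans (H-cong Ω⁴ ⟨ (λ p → U p , c p) ⟩ (⟨ uz ⟩ ⊠ ⟨ uz ⟩)
            (det (λ (a , b , c , d) → (a , c) , (a ⊞ b , d)) λ (p , q) → cong (λ y → uz p , (y , z² q)) (sym (⊞-cancelˡ (u p) (u q))))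
            (det-refl λ ((a , c) , (b , d)) → a , a ⊞ b , c , d))
          (H-⊗ Ω² Ω² ⟨ uz ⟩ ⟨ uz ⟩)

        H-Vc : H Ω⁴ ⟨ (λ p → V p , c p) ⟩ ≈ᵛ h-uz +ᵛ h-uz
        H-Vc = ≈ᵛ-trans (H-cong Ω⁴ ⟨ (λ p → V p , c p) ⟩ ((⟨ uz ⟩ ⊠ ⟨ uz ⟩) ∘ʳ π)
            (det (λ (v , s , (a , b) , (c , d)) → (v , a , c) , (v ⊞ s , b , d)) λ ((a , b) , (c , d)) →
              cong (λ y → (x a ⊞ x c , z a , z c) , (y , z b , z d)) (sym (trans (cong ((x a ⊞ x c) ⊞_) (⊞-interchange (x a) (x b) (x c) (x d))) (⊞-cancelˡ _ _))))
            (det (λ ((v , a , c) , (w , b , d)) → v , v ⊞ w , (a , b) , (c , d)) λ ((a , b) , (c , d)) →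
              cong (λ y → x a ⊞ x c , y , (z a , z b) , (z c , z d)) (⊞-interchange (x a) (x b) (x c) (x d))))
          (≈ᵛ-trans (mp-H (mp-interchange Ω) (⟨ uz ⟩ ⊠ ⟨ uz ⟩)) (H-⊗ Ω² Ω² ⟨ uz ⟩ ⟨ uz ⟩))
          where
          π : P × P → P × P
          π ((a , b) , (c , d)) = (a , c) , (b , d)

        H-Wc : H Ω⁴ ⟨ (λ p → W p , c p) ⟩ ≈ᵛ h-uz +ᵛ h-uz
        H-Wc = ≈ᵛ-trans (H-cong Ω⁴ ⟨ (λ p → W p , c p) ⟩ ((⟨ uz ⟩ ⊠ ⟨ uz ⟩) ∘ʳ (π ∘ σ))
            (det (λ (v , s , (a , b) , (c , d)) → (v , b , c) , (v ⊞ s , a , d)) λ ((a , b) , (c , d)) →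
              cong (λ y → (x b ⊞ x c , z b , z c) , (y , z a , z d)) (sym (trans (cong ((x b ⊞ x c) ⊞_) (rearrange a b c d)) (⊞-cancelˡ _ _))))
            (det (λ ((v , b , c) , (w , a , d)) → v , v ⊞ w , (a , b) , (c , d)) λ ((a , b) , (c , d)) →
              cong (λ y → x b ⊞ x c , y , (z a , z b) , (z c , z d)) (rearrange a b c d)))
          (≈ᵛ-trans (mp-H (mp-∘ (mp-⊗ Ω² Ω² (mp-swap Ω Ω) mp-id) (mp-interchange Ω)) (⟨ uz ⟩ ⊠ ⟨ uz ⟩)) (H-⊗ Ω² Ω² ⟨ uz ⟩ ⟨ uz ⟩))
          where
          π σ : P × P → P × P
          π ((a , b) , (c , d)) = (a , c) , (b , d)
          σ (p , q) = (proj₂ p , proj₁ p) , q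
          rearrange : ∀ a b c d → (x a ⊞ x b) ⊞ (x c ⊞ x d) ≡ (x b ⊞ x c) ⊞ (x a ⊞ x d)
          rearrange a b c d = trans (cong (_⊞ (x c ⊞ x d)) (⊞-comm (x a) (x b))) (⊞-interchange (x b) (x a) (x c) (x d))

        UV≡W : ∀ p → U p ⊞ V p ≡ W p
        UV≡W ((a , b) , (c , d)) = trans (cong (_⊞ (x a ⊞ x c)) (⊞-comm (x a) (x b)))
          (trans (⊞-assoc (x b) (x a) (x a ⊞ x c)) (cong (x b ⊞_) (⊞-cancelˡ (x a) (x c))))

        module B = BalogSzemerédiGowers Ω⁴ U V c

        H-Q : H Ω⁴ ⟨ B.Q ⟩ ≈ᵛ h-uz +ᵛ h-uz
        H-Q = ≈ᵛ-trans (H-cong Ω⁴ ⟨ B.Q ⟩ ⟨ (λ p → W p , c p) ⟩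
          (det id λ p → cong (_, c p) (sym (UV≡W p))) (det id λ p → cong (_, c p) (UV≡W p))) H-Wc

        H-QU : H Ω⁴ ⟨ (λ p → B.Q p , U p) ⟩ ≈ᵛ h-UVc
        H-QU = H-cong Ω⁴ ⟨ (λ p → B.Q p , U p) ⟩ ⟨ (λ (p , q) → x (proj₁ p) ⊞ x (proj₁ q) , uz p , uz q) ⟩
          (det (λ ((w , s , zp , zq) , a) → a ⊞ w , (a , zp) , (a ⊞ s , zq)) λ (p , q) →
            cong₂ (λ v y → v , uz p , (y , z² q)) (sym (⊞-cancelˡ (u p) (V (p , q)))) (sym (⊞-cancelˡ (u p) (u q))))
          (det-refl λ (v , (a , zp) , (b , zq)) → (a ⊞ v , a ⊞ b , zp , zq) , a)

        Λ² = Ω₀ ⊗ Ω²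
        Λ⁴ = Ω₀ ⊗ Ω⁴
        r₂ r₃ : Carrier
        r₂ = H Λ² ⟨ (λ (r , p) → x₀ r ⊞ u p , z² p) ⟩
        r₃ = H Λ² ⟨ (λ (r , p) → x₀ r ⊞ x (proj₁ p) , uz p) ⟩

        -- The Kaimanovich-Vershik inequality with side information: adding x′ raises the entropy of
        -- x₀ + x by no more than it raises that of x.
        r₂-≤ : r₂ +ᵛ h-xz ≤ᵛ r₁ +ᵛ h-uz
        r₂-≤ = linear (r₁ ∷ r₂ ∷ h-xz ∷ h-uz ∷ h₀ ∷ H Λ² (⟨ x₀ ⟩ ⊠ (⟨ xz ⟩ ⊠ ⟨ xz ⟩)) ∷
            H Λ² ⟨ (λ (r , s , t) → (x₀ r ⊞ x s , z s) , xz t) ⟩ ∷ H Λ² (⟨ x₀ ⟩ ⊠ ⟨ uz ⟩) ∷ [])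
          (v₁ ⊹ v₂) (v₀ ⊹ v₃)
          (1 · v₅ ⊹ v₁ ≦ v₆ ⊹ v₇ ∵ submodular Λ² ⟨ (λ (r , s , t) → (x₀ r ⊞ x s , z s) , xz t) ⟩ (⟨ x₀ ⟩ ⊠ ⟨ uz ⟩)
              ⟨ (λ (r , p) → x₀ r ⊞ u p , z² p) ⟩ (⟨ x₀ ⟩ ⊠ (⟨ xz ⟩ ⊠ ⟨ xz ⟩))
              (det (λ ((a , c) , (b , d)) → a ⊞ b , c , d) λ (r , s , t) → cong (_, z s , z t) (sym (⊞-assoc (x₀ r) (x s) (x t))))
              (det-refl λ (a , b , c) → a ⊞ b , c)
              (det (λ (((b , c) , e) , (a , _)) → a , (a ⊞ b , c) , e) λ (r , s , t) → cong (λ y → x₀ r , (y , z s) , xz t) (sym (⊞-cancelˡ (x₀ r) (x s)))) ∷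
           1 · v₄ ⊹ (v₂ ⊹ v₂) ≦ v₅ ∵ proj₂ (≈ᵛ-trans (H-⊗ Ω₀ Ω² ⟨ x₀ ⟩ (⟨ xz ⟩ ⊠ ⟨ xz ⟩)) (+ᵛ-cong ≈ᵛ-refl (H-⊗ Ω Ω ⟨ xz ⟩ ⟨ xz ⟩))) ∷
           1 · v₆ ≦ v₀ ⊹ v₂ ∵ proj₁ (≈ᵛ-trans (mp-H (mp-assoc Ω₀ Ω Ω) (⟨ (λ (r , s) → x₀ r ⊞ x s , z s) ⟩ ⊠ ⟨ xz ⟩))
              (H-⊗ (Ω₀ ⊗ Ω) Ω ⟨ (λ (r , s) → x₀ r ⊞ x s , z s) ⟩ ⟨ xz ⟩)) ∷
           1 · v₇ ≦ v₄ ⊹ v₃ ∵ proj₁ (H-⊗ Ω₀ Ω² ⟨ x₀ ⟩ ⟨ uz ⟩) ∷ [])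

        -- Further conditioning on x + x′ and z′ does not increase the entropy of x₀ + x given z.
        r₃-≤ : r₃ +ᵛ h-z ≤ᵛ r₁ +ᵛ h-uz
        r₃-≤ = linear (r₁ ∷ r₃ ∷ h-z ∷ h-uz ∷ H Λ² (⟨ z² ⟩ ∘ʳ proj₂) ∷ H Λ² (⟨ uz ⟩ ∘ʳ proj₂) ∷
            H Λ² ⟨ (λ (r , s , t) → (x₀ r ⊞ x s , z s) , z t) ⟩ ∷ H Ω² ⟨ z² ⟩ ∷ [])
          (v₁ ⊹ v₂) (v₀ ⊹ v₃)
          (1 · v₁ ⊹ v₄ ≦ v₆ ⊹ v₅ ∵ submodular Λ² ⟨ (λ (r , s , t) → (x₀ r ⊞ x s , z s) , z t) ⟩ (⟨ uz ⟩ ∘ʳ proj₂) (⟨ z² ⟩ ∘ʳ proj₂)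
              ⟨ (λ (r , p) → x₀ r ⊞ x (proj₁ p) , uz p) ⟩ (det-refl λ ((_ , c) , d) → c , d) (det-refl proj₂)
              (det-refl λ (((a , _) , _) , b) → a , b) ∷
           1 · v₇ ≦ v₄ ∵ proj₂ (mp-H (mp-proj₂ Ω₀ Ω²) ⟨ z² ⟩) ∷
           1 · v₂ ⊹ v₂ ≦ v₇ ∵ proj₂ H-z² ∷
           1 · v₅ ≦ v₃ ∵ proj₁ (mp-H (mp-proj₂ Ω₀ Ω²) ⟨ uz ⟩) ∷
           1 · v₆ ≦ v₀ ⊹ v₂ ∵ proj₁ (≈ᵛ-trans (mp-H (mp-assoc Ω₀ Ω Ω) (⟨ (λ (r , s) → x₀ r ⊞ x s , z s) ⟩ ⊠ ⟨ z ⟩))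
              (H-⊗ (Ω₀ ⊗ Ω) Ω ⟨ (λ (r , s) → x₀ r ⊞ x s , z s) ⟩ ⟨ z ⟩)) ∷ [])

        R⁺-≤ : R X⁺ ≤ᵛ R X +ᵛ k
        R⁺-≤ = linear (r₁ ∷ r₂ ∷ h-z ∷ h-xz ∷ h-uz ∷ h₀ ∷ H Ω² ⟨ z² ⟩ ∷ [])
          (2 ⊛ v₁ ⊝ v₆ ⊝ v₄ ⊝ v₅) ((2 ⊛ v₀ ⊝ v₂ ⊝ v₃ ⊝ v₅) ⊹ (v₄ ⊝ v₂ ⊝ v₃))
          (2 · v₁ ⊹ v₃ ≦ v₀ ⊹ v₄ ∵ r₂-≤ ∷ 1 · v₂ ⊹ v₂ ≦ v₆ ∵ proj₂ H-z² ∷ [])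

        R∣-≤ : R X∣ ≤ᵛ R X +ᵛ k
        R∣-≤ = linear (r₁ ∷ r₃ ∷ h-z ∷ h-xz ∷ h-uz ∷ h₀ ∷ H Ω² ⟨ (λ p → x (proj₁ p) , uz p) ⟩ ∷ [])
          (2 ⊛ v₁ ⊝ v₄ ⊝ v₆ ⊝ v₅) ((2 ⊛ v₀ ⊝ v₂ ⊝ v₃ ⊝ v₅) ⊹ (v₄ ⊝ v₂ ⊝ v₃))
          (2 · v₁ ⊹ v₂ ≦ v₀ ⊹ v₄ ∵ r₃-≤ ∷ 1 · v₃ ⊹ v₃ ≦ v₆ ∵ proj₂ H-xuz ∷ [])

        -- The mutual information of any two of U, V, W given c.
        I : Carrier
        I = 2 ×ᵛ k -ᵛ D X⁺ -ᵛ D X∣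

        -- `H-Uc`, `H-Vc` and `H-Q` give the three variables the same entropy jointly with c, the
        -- case in which `𝔼-D₁-≤` bounds by three mutual informations.
        𝔼-D₁ : 𝔼 Ω⁴ (λ s → D₁ (B.cond (B.Q s)) U) ≤ᵛ 3 ×ᵛ I
        𝔼-D₁ = linear (_ ∷ h-c ∷ H Ω⁴ ⟨ (λ p → B.Q p , U p) ⟩ ∷ H Ω⁴ ⟨ (λ p → U p , c p) ⟩ ∷ H Ω⁴ ⟨ (λ p → V p , c p) ⟩ ∷
            H Ω⁴ ⟨ B.Q ⟩ ∷ h-uz ∷ h-UVc ∷ D X⁺ ∷ D X∣ ∷ h-z ∷ h-xz ∷ [])
          v₀ (3 ⊛ (2 ⊛ (v₆ ⊝ var 10 ⊝ var 11) ⊝ v₈ ⊝ v₉))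
          (1 · v₀ ⊹ 3 ⊛ v₁ ⊹ 3 ⊛ v₂ ≦ 2 ⊛ v₃ ⊹ 2 ⊛ v₄ ⊹ 2 ⊛ v₅ ∵ B.𝔼-D₁-≤ ∷
           3 · v₇ ≦ v₂ ∵ proj₂ H-QU ∷ 2 · v₃ ≦ v₆ ⊹ v₆ ∵ proj₁ H-Uc ∷ 2 · v₄ ≦ v₆ ⊹ v₆ ∵ proj₁ H-Vc ∷
           2 · v₅ ≦ v₆ ⊹ v₆ ∵ proj₁ H-Q ∷
           3 · v₈ ≦ v₁ ⊝ (var 10 ⊹ var 10) ⊝ v₆ ∵ proj₁ D⁺≈ ∷
           3 · v₉ ≦ v₇ ⊝ v₆ ⊝ (var 11 ⊹ var 11) ∵ proj₁ D∣≈ ∷ [])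

        -- Forgetting W and the total bounds the mean entropy of x₀ + U through `r₂-≤`, while D X∣ ≥
        -- 0 bounds the mean entropy of U from below.
        𝔼-R₁ : 𝔼 Ω⁴ (λ s → R₁ (B.cond (B.Q s)) U) ≤ᵛ R X +ᵛ 3 ×ᵛ k
        𝔼-R₁ = linear (_ ∷ 𝔼x₀U ∷ 𝔼U ∷ h₀ ∷ H Ω⁴ ⟨ B.Q ⟩ ∷ H Λ⁴ ⟨ (λ (r , p) → B.Q p , x₀ r ⊞ U p) ⟩ ∷
            H Ω⁴ ⟨ (λ p → B.Q p , U p) ⟩ ∷ h-UVc ∷ h-uz ∷ h-z ∷ h-xz ∷ r₁ ∷ r₂ ∷
            H Λ⁴ ⟨ (λ (r , p , q) → x₀ r ⊞ u p , z² p) ⟩ ∷ H Λ⁴ ⟨ (λ (r , p) → B.Q p) ⟩ ∷ H Λ⁴ ⟨ (λ (r , p , q) → z² p) ⟩ ∷ D X∣ ∷ [])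
          v₀ ((2 ⊛ var 11 ⊝ v₉ ⊝ var 10 ⊝ v₃) ⊹ 3 ⊛ (v₈ ⊝ v₉ ⊝ var 10))
          (1 · v₀ ≦ 2 ⊛ v₁ ⊝ v₂ ⊝ v₃ ∵ split ∷
           2 · v₄ ⊹ v₁ ≦ v₅ ∵ proj₁ (𝔼-fibre₂ Ω⁴ B.Q B.cond-disintegrates Ω₀ ⟨ (λ (r , p) → x₀ r ⊞ U p) ⟩) ∷
           1 · v₆ ≦ v₄ ⊹ v₂ ∵ proj₂ (𝔼-fibre {S₀ = ⊤} Ω⁴ B.Q B.cond-disintegrates ⟨ U ⟩) ∷
           1 · v₇ ≦ v₆ ∵ proj₂ H-QU ∷
           2 · v₅ ⊹ var 15 ≦ var 13 ⊹ var 14 ∵ submodular Λ⁴ ⟨ (λ (r , p , q) → x₀ r ⊞ u p , z² p) ⟩ ⟨ (λ (r , p) → B.Q p) ⟩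
              ⟨ (λ (r , p , q) → z² p) ⟩ ⟨ (λ (r , p) → B.Q p , x₀ r ⊞ U p) ⟩
              (det-refl proj₂) (det-refl λ (_ , _ , a , _) → a) (det-refl λ ((a , _) , q) → q , a) ∷
           2 · var 14 ≦ v₄ ∵ proj₁ (mp-H (mp-proj₂ Ω₀ Ω⁴) ⟨ B.Q ⟩) ∷
           2 · var 13 ≦ var 12 ∵ proj₁ (mp-H (mp-⊗ Ω⁴ Ω² (mp-id {Ω = Ω₀}) (mp-proj₁ Ω² (λ _ → Ω²))) ⟨ (λ (r , p) → x₀ r ⊞ u p , z² p) ⟩) ∷
           2 · v₉ ⊹ v₉ ≦ var 15 ∵ ≤ᵛ-trans (proj₂ H-z²) (proj₂ (mp-H (mp-∘ (mp-proj₂ Ω₀ Ω⁴) (mp-proj₁ Ω² (λ _ → Ω²))) ⟨ z² ⟩)) ∷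
           2 · var 12 ⊹ var 10 ≦ var 11 ⊹ v₈ ∵ r₂-≤ ∷
           1 · v₄ ≦ v₈ ⊹ v₈ ∵ proj₁ H-Q ∷
           1 · 𝕠 ≦ var 16 ∵ D-nonNeg X∣ ∷
           1 · var 16 ≦ v₇ ⊝ v₈ ⊝ (var 10 ⊹ var 10) ∵ proj₁ D∣≈ ∷ [])
          where
          𝔼x₀U = 𝔼 Ω⁴ (λ s → H (Ω₀ ⊗ B.cond (B.Q s)) ⟨ (λ (r , p) → x₀ r ⊞ U p) ⟩)
          𝔼U = 𝔼 Ω⁴ (λ s → H (B.cond (B.Q s)) ⟨ U ⟩)
          split : 𝔼 Ω⁴ (λ s → R₁ (B.cond (B.Q s)) U) ≤ᵛ 2 ×ᵛ 𝔼x₀U -ᵛ 𝔼U -ᵛ h₀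
          split = proj₁ (≈ᵛ-trans (𝔼-+ Ω⁴ _ _) (+ᵛ-cong (≈ᵛ-trans (𝔼-+ Ω⁴ _ _) (+ᵛ-cong (𝔼-• Ω⁴ _ _) (𝔼-neg Ω⁴ _))) (𝔼-const Ω⁴ _)))

        -- D₁ and R₁ have to be small on the same fibre, so a weighted sum of them is averaged. The
        -- weight is free: it is 16 in `decrement`, and in `halve-entropy` so large that D₁ falls
        -- below a prescribed tolerance.
        endgame : ∀ m → ¬ ¬ (Σ[ Ω′ ∈ Space (P × P) ] Σ[ x′ ∈ (P × P → G) ]
          m ×ᵛ D₁ Ω′ x′ +ᵛ R₁ Ω′ x′ ≤ᵛ m ×ᵛ 3 ×ᵛ I +ᵛ (R X +ᵛ 3 ×ᵛ k))
        endgame m none = 𝔼-pick Ω⁴ {g = λ s → m ×ᵛ D₁ (B.cond (B.Q s)) U +ᵛ R₁ (B.cond (B.Q s)) U}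
          (≤ᵛ-trans (proj₁ (≈ᵛ-trans (𝔼-+ Ω⁴ _ _) (+ᵛ-cong (𝔼-• Ω⁴ _ _) ≈ᵛ-refl)))
            (+ᵛ-mono (•-monoʳ (ℚₚ.nonNegative⁻¹ (fromℕℚ m) {{ℚₚ.normalize-nonNeg m 1}}) 𝔼-D₁) 𝔼-R₁))
          (λ (s , _ , p) → none (B.cond (B.Q s) , U , p))

      -- Write k = D X. If neither `X⁺` nor `X∣` works, then, R having grown by at most k, both 16 D
      -- X⁺ and 16 D X∣ are at least 14 k. Hence I ≤ k/4, and `endgame` yields at most R X + 48 I +
      -- 3 k ≤ R X + 15 k, which is τ X - k. This balance fixes the weight 16.
      decrement : ∀ X → ¬ ¬ (Σ[ X′ ∈ Family n ] τ X′ +ᵛ D X ≤ᵛ τ X)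
      decrement X@(family Ω x z) none = endgame 16 λ (Ω′ , x′ , le) → none (single Ω′ x′ ,
          linear (D X ∷ R X ∷ D X⁺ ∷ R X⁺ ∷ D X∣ ∷ R X∣ ∷ D (single Ω′ x′) ∷ R (single Ω′ x′) ∷ D₁ Ω′ x′ ∷ R₁ Ω′ x′ ∷ [])
            (16 ⊛ v₆ ⊹ v₇ ⊹ v₀) (16 ⊛ v₀ ⊹ v₁)
            (1 · 16 ⊛ v₈ ⊹ v₉ ≦ 16 ⊛ 3 ⊛ (2 ⊛ v₀ ⊝ v₂ ⊝ v₄) ⊹ (v₁ ⊹ 3 ⊛ v₀) ∵ le ∷
             16 · v₆ ≦ v₈ ∵ proj₁ (D-single Ω′ x′) ∷ 1 · v₇ ≦ v₉ ∵ proj₁ (R-single Ω′ x′) ∷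
             3 · 16 ⊛ v₀ ⊹ v₁ ≦ 16 ⊛ v₂ ⊹ v₃ ⊹ v₀ ∵ ≰⇒≥ (λ p → none (X⁺ , p)) ∷
             3 · 16 ⊛ v₀ ⊹ v₁ ≦ 16 ⊛ v₄ ⊹ v₅ ⊹ v₀ ∵ ≰⇒≥ (λ p → none (X∣ , p)) ∷
             3 · v₃ ≦ v₁ ⊹ v₀ ∵ R⁺-≤ ∷ 3 · v₅ ≦ v₁ ⊹ v₀ ∵ R∣-≤ ∷ []))
        where open Step Ω x z hiding (X)

  ×ᵛ-suc : ∀ n x → suc n ×ᵛ x ≈ᵛ x +ᵛ n ×ᵛ x
  ×ᵛ-suc n x = ≈ᵛ-trans (≡⇒≈ᵛ (cong (_• x) (fromℕℚ-suc n))) (≈ᵛ-trans (•-distribʳ 1ℚ (fromℕℚ n) x)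
    (+ᵛ-cong (•-identity x) ≈ᵛ-refl))

  ×ᵛ-* : ∀ m n x → (m ℕ.* n) ×ᵛ x ≈ᵛ m ×ᵛ n ×ᵛ x
  ×ᵛ-* m n x = ≈ᵛ-trans (≡⇒≈ᵛ (cong (_• x) (trans (cong (_/ 1) (ℤₚ.pos-* m n)) (/1-* (+ m) (+ n)))))
    (•-assoc (fromℕℚ m) (fromℕℚ n) x)

  ×ᵛ-mono : ∀ n {x y} → x ≤ᵛ y → n ×ᵛ x ≤ᵛ n ×ᵛ y
  ×ᵛ-mono n = •-monoʳ (fromℕℚ-nonNeg n)

  exceeds : ∀ {δ} → ¬ (δ ≤ᵛ 0ᵛ) → ∀ v → ¬ ¬ (Σ[ n ∈ ℕ ] ¬ (n ×ᵛ δ ≤ᵛ v))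
  exceeds {δ} δ≰0 v none with bounded v
  ... | b , v≤b = archimedes δ≰0 λ (m , 1≤mδ) → none (suc (b ℕ.* m) , λ le →
    δ≰0 (linear (δ ∷ v ∷ suc (b ℕ.* m) ×ᵛ δ ∷ (b ℕ.* m) ×ᵛ δ ∷ b ×ᵛ one ∷ b ×ᵛ m ×ᵛ δ ∷ []) v₀ 𝕠
      (1 · v₂ ≦ v₁ ∵ le ∷ 1 · v₁ ≦ v₄ ∵ v≤b ∷ 1 · v₄ ≦ v₅ ∵ ×ᵛ-mono b 1≤mδ ∷
       1 · v₅ ≦ v₃ ∵ proj₂ (×ᵛ-* b m δ) ∷ 1 · v₀ ⊹ v₃ ≦ v₂ ∵ proj₂ (×ᵛ-suc (b ℕ.* m) δ) ∷ [])))

  em : ∀ {a} {A : Set a} → ¬ ¬ (A ⊎ ¬ A)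
  em none = none (inj₂ λ a → none (inj₁ a))

  •one-cancel : ∀ {p q} → p • one ≤ᵛ q • one → p ≤ q
  •one-cancel {p} {q} le with p ℚₚ.≤? q
  ... | yes p≤q = p≤q
  ... | no  p≰q = contradiction (≤ᵛ-trans (proj₂ one≈) (≤ᵛ-trans (•-monoʳ (ℚₚ.<⇒≤ (recip-pos 0<d)) d≤0) (proj₁ (•-zeroʳ _)))) one≰0
    where
    d = p - q
    0<d : 0ℚ < d
    0<d = subst (_< d) (ℚₚ.+-inverseʳ q) (ℚₚ.+-monoˡ-< (- q) (ℚₚ.≰⇒> p≰q))
    d≤0 : d • one ≤ᵛ 0ᵛ
    d≤0 = +ᵛ-cancelʳ-≤ (q • one) (≤ᵛ-trans (proj₂ (•-distribʳ d q one)) (≤ᵛ-trans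
      (proj₁ (≡⇒≈ᵛ (cong (_• one) (sym (split-+ p q))))) (≤ᵛ-trans le (proj₂ (+ᵛ-identityˡ _)))))
    one≈ : recip d • d • one ≈ᵛ one
    one≈ = ≈ᵛ-trans (≈ᵛ-sym (•-assoc _ _ _)) (≈ᵛ-trans (≡⇒≈ᵛ (cong (_• one) (recip-inverseˡ 0<d))) (•-identity one))

  module _ {n : ℕ} {S₀ : Set} (Ω₀ : Space S₀) (x₀ : S₀ → Vec Bool n) where
    open Relative Ω₀ x₀

    -- As long as D exceeds δ, a decrement lowers τ by at least δ; since τ ≥ 0, the number of such
    -- steps is bounded. Whether D ≤ δ holds is undecidable, hence the double negation.
    small-family : ∀ {δ} → ¬ (δ ≤ᵛ 0ᵛ) → ∀ X₀ → ¬ ¬ (Σ[ X ∈ Family n ] (D X ≤ᵛ δ × τ X ≤ᵛ τ X₀))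
    small-family {δ} δ≰0 X₀ none = exceeds δ≰0 (τ X₀) λ (m , big) → iterate m λ where
        (X , le , inj₁ D≤δ) → none (X , D≤δ , le)
        (X , le , inj₂ low) → big (linear (m ×ᵛ δ ∷ τ X₀ ∷ D X ∷ R X ∷ []) v₀ v₁
          (1 · 16 ⊛ v₂ ⊹ v₃ ⊹ v₀ ≦ v₁ ∵ low ∷ 16 · 𝕠 ≦ v₂ ∵ D-nonNeg X ∷ 1 · 𝕠 ≦ v₃ ∵ R-nonNeg X ∷ []))
      where
      Reached : ℕ → Set₁
      Reached m = Σ[ X ∈ Family n ] (τ X ≤ᵛ τ X₀ × (D X ≤ᵛ δ ⊎ τ X +ᵛ m ×ᵛ δ ≤ᵛ τ X₀))
      iterate : ∀ m → ¬ ¬ Reached m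
      iterate zero    stop = stop (X₀ , ≤ᵛ-refl , inj₂ (proj₁ (≈ᵛ-trans (+ᵛ-cong ≈ᵛ-refl (•-zeroˡ δ)) (+ᵛ-identityʳ _))))
      iterate (suc m) stop = iterate m λ where
        (X , le , inj₁ D≤δ) → stop (X , le , inj₁ D≤δ)
        (X , le , inj₂ low) → em λ where
          (inj₁ D≤δ) → stop (X , le , inj₁ D≤δ)
          (inj₂ D≰δ) → decrement X λ (X′ , dec) → stop (X′ ,
            linear (τ X ∷ τ X₀ ∷ τ X′ ∷ D X ∷ []) v₂ v₁
              (1 · v₂ ⊹ v₃ ≦ v₀ ∵ dec ∷ 1 · 𝕠 ≦ v₃ ∵ D-nonNeg X ∷ 1 · v₀ ≦ v₁ ∵ le ∷ []) ,
            inj₂ (linear (τ X ∷ τ X₀ ∷ τ X′ ∷ D X ∷ δ ∷ m ×ᵛ δ ∷ suc m ×ᵛ δ ∷ []) (v₂ ⊹ v₆) v₁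
              (1 · v₂ ⊹ v₃ ≦ v₀ ∵ dec ∷ 1 · v₄ ≦ v₃ ∵ ≰⇒≥ D≰δ ∷ 1 · v₀ ⊹ v₅ ≦ v₁ ∵ low ∷
               1 · v₆ ≦ v₄ ⊹ v₅ ∵ proj₁ (×ᵛ-suc m δ) ∷ [])))

  -- A quadratic lower bound for mutual information

  module _ {S : Set} (Ω : Space S) where
    private
      1ℚ≡ℙ : ∀ s → ℙ Ω ⟨ (λ _ → tt) ⟩ s ≡ 1ℚ
      1ℚ≡ℙ s = total Ω

    -- With m the midpoint of P and Q, log P − log Q = (log P − log m) + (log m − log Q), and
    -- log t ≥ 1 − 1/t in both terms.
    log-gap : ∀ {P Q} → 0ℚ < P → P ≤ 1ℚ → 0ℚ < Q → Q ≤ 1ℚ →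
      ((1ℚ - Q * recip P) + (+ 1 / 4) * ((P - Q) * (P - Q)) * recip P) • one +ᵛ log Q ≤ᵛ log P
    log-gap {P} {Q} 0<P P≤1 0<Q Q≤1 =
      linear (c • one ∷ log Q ∷ log P ∷ log m ∷ log (m * rP) ∷ log (Q * rm) ∷ (m * rP - 1ℚ) • one ∷ (Q * rm - 1ℚ) • one ∷ log rP ∷ log rm ∷ [])
        (v₀ ⊹ v₁) v₂
        (1 · v₀ ⊹ v₆ ⊹ v₇ ≦ 𝕠 ∵ total≤0 ∷
         1 · v₄ ≦ v₆ ∵ log-≤ (*-pos 0<m 0<rP) ∷ 1 · v₅ ≦ v₇ ∵ log-≤ (*-pos 0<Q 0<rm) ∷
         1 · v₃ ⊹ v₈ ≦ v₄ ∵ proj₂ (log-* 0<m 0<rP) ∷ 1 · v₁ ⊹ v₉ ≦ v₅ ∵ proj₂ (log-* 0<Q 0<rm) ∷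
         1 · 𝕠 ≦ v₈ ⊹ v₂ ∵ proj₂ (≈ᵛ-trans (+ᵛ-comm _ _) (≈ᵛ-trans (+ᵛ-cong ≈ᵛ-refl (log-recip 0<P)) (+ᵛ-inverseʳ _))) ∷
         1 · 𝕠 ≦ v₉ ⊹ v₃ ∵ proj₂ (≈ᵛ-trans (+ᵛ-comm _ _) (≈ᵛ-trans (+ᵛ-cong ≈ᵛ-refl (log-recip 0<m)) (+ᵛ-inverseʳ _))) ∷ [])
      where
      open +-*-Solver
      m rP rm c : ℚ
      m = (P + Q) * ½
      rP = recip P
      rm = recip m
      c = (1ℚ - Q * rP) + (+ 1 / 4) * ((P - Q) * (P - Q)) * rP
      0<rP = recip-pos 0<P
      0<m : 0ℚ < m
      0<m = half>0 (ℚₚ.+-mono-< 0<P 0<Q)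
      m≤1 : m ≤ 1ℚ
      m≤1 = ℚₚ.≤-trans (ℚₚ.*-monoʳ-≤-nonNeg ½ (ℚₚ.+-mono-≤ P≤1 Q≤1)) ℚₚ.≤-refl
      0<rm = recip-pos 0<m
      a b e : ℚ
      a = m * rP
      b = Q * rm
      e = (+ 1 / 4) * ((P - Q) * (P - Q)) * rP
      e≥0 : 0ℚ ≤ e
      e≥0 = *-nonNeg (*-nonNeg (ℚₚ.nonNegative⁻¹ (+ 1 / 4)) (square-nonNeg (P - Q))) (ℚₚ.<⇒≤ 0<rP)
      1≤rm : 1ℚ ≤ rm
      1≤rm = subst₂ _≤_ (recip-inverseʳ 0<m) (ℚₚ.*-identityˡ rm) (ℚₚ.*-monoʳ-≤-nonNeg rm {{nonNegative (ℚₚ.<⇒≤ 0<rm)}} m≤1)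
      e≤ : e ≤ e * rm
      e≤ = subst (_≤ e * rm) (ℚₚ.*-identityʳ e) (ℚₚ.*-monoˡ-≤-nonNeg e {{nonNegative e≥0}} 1≤rm)
      -- 1 - Q/P + e·rm + (m/P - 1) + (Q/m - 1) = 0
      balance : (1ℚ - Q * rP) + e * rm ≡ - ((a - 1ℚ) + (b - 1ℚ))
      balance = begin
        (1ℚ - Q * rP) + e * rm
          ≡⟨ solve 4 (λ P Q rP rm → (con 1ℚ :- Q :* rP) :+ con (+ 1 / 4) :* ((P :- Q) :* (P :- Q)) :* rP :* rm :=
               (con 1ℚ :- Q :* rP) :+ (rm :* ((P :+ Q) :* con ½)) :* ((P :+ Q) :* con ½ :* rP) :- (P :* rP) :* (Q :* rm)) refl P Q rP rm ⟩
        (1ℚ - Q * rP) + (rm * m) * (m * rP) - (P * rP) * (Q * rm)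
          ≡⟨ cong₂ (λ u v → (1ℚ - Q * rP) + u * (m * rP) - v * (Q * rm)) (recip-inverseˡ 0<m) (recip-inverseʳ 0<P) ⟩
        (1ℚ - Q * rP) + 1ℚ * (m * rP) - 1ℚ * (Q * rm)
          ≡⟨ solve 4 (λ P Q rP rm → (con 1ℚ :- Q :* rP) :+ con 1ℚ :* ((P :+ Q) :* con ½ :* rP) :- con 1ℚ :* (Q :* rm) :=
               (con 1ℚ :+ P :* rP) :- ((P :+ Q) :* con ½ :* rP) :- Q :* rm) refl P Q rP rm ⟩
        (1ℚ + P * rP) - a - b
          ≡⟨ cong (λ u → (1ℚ + u) - a - b) (recip-inverseʳ 0<P) ⟩
        (1ℚ + 1ℚ) - a - b
          ≡⟨ solve 2 (λ a b → (con 1ℚ :+ con 1ℚ) :- a :- b := :- ((a :- con 1ℚ) :+ (b :- con 1ℚ))) refl a b ⟩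
        - ((a - 1ℚ) + (b - 1ℚ)) ∎
        where open ≡-Reasoning
      c+≤0 : c + (a - 1ℚ) + (b - 1ℚ) ≤ 0ℚ
      c+≤0 = ℚₚ.≤-trans (ℚₚ.≤-reflexive (ℚₚ.+-assoc c (a - 1ℚ) (b - 1ℚ))) (ℚₚ.≤-trans
        (ℚₚ.+-monoˡ-≤ ((a - 1ℚ) + (b - 1ℚ)) (ℚₚ.≤-trans (ℚₚ.+-monoʳ-≤ (1ℚ - Q * rP) e≤) (ℚₚ.≤-reflexive balance)))
        (ℚₚ.≤-reflexive (ℚₚ.+-inverseˡ ((a - 1ℚ) + (b - 1ℚ)))))
      total≤0 : c • one +ᵛ (a - 1ℚ) • one +ᵛ (b - 1ℚ) • one ≤ᵛ 0ᵛ
      total≤0 = ≤ᵛ-trans (proj₂ (≈ᵛ-trans (•-distribʳ _ _ one) (+ᵛ-cong (•-distribʳ _ _ one) ≈ᵛ-refl)))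
        (≤ᵛ-trans (•-monoˡ 0≤one c+≤0) (proj₁ (•-zeroˡ one)))

    -- Mutual information is the mean of log P - log Q, with P the joint probability and Q the
    -- product of the marginals. In the bound of `log-gap` the linear part 1 - Q/P has nonnegative
    -- mean, and of the quadratic part only the atom of s₀ is kept. The bound stays rational, as in
    -- Pinsker's inequality but for one atom.
    mutual-information-lower : ∀ A B {s₀} → s₀ ∈ supp Ω →
      let d = ℙ Ω (A & B) s₀ - ℙ Ω A s₀ * ℙ Ω B s₀ in
      ((+ 1 / 4) * (d * d)) • one +ᵛ H Ω (A & B) ≤ᵛ H Ω A +ᵛ H Ω B
    mutual-information-lower A B {s₀} s₀∈ =
      linear (((+ 1 / 4) * (d s₀ * d s₀)) • one ∷ H Ω (A & B) ∷ H Ω A ∷ H Ω B ∷ 𝔼 Ω (λ s → φ s • one) ∷ 𝔼 Ω (λ s → log (Q s)) ∷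
          𝔼 Ω (λ s → log (P s)) ∷ 𝔼 Ω (λ s → φ s • one +ᵛ log (Q s)) ∷ [])
        (v₀ ⊹ v₁) (v₂ ⊹ v₃)
        (1 · v₀ ≦ v₄ ∵ ≤ᵛ-trans (•-monoˡ 0≤one mass) (proj₂ (𝔼-scalar Ω φ one)) ∷
         1 · v₄ ⊹ v₅ ≦ v₇ ∵ proj₂ (𝔼-+ Ω _ _) ∷
         1 · v₇ ≦ v₆ ∵ 𝔼-mono Ω (λ s s∈ → log-gap (P-pos s∈) (ℙ≤1 Ω (A & B) s) (Q-pos s∈) (Q≤1 s)) ∷
         1 · 𝕠 ≦ v₅ ⊹ (v₂ ⊹ v₃) ∵ proj₂ Q-sum ∷
         1 · v₆ ⊹ v₁ ≦ 𝕠 ∵ proj₁ (≈ᵛ-trans (+ᵛ-cong ≈ᵛ-refl (𝔼-neg Ω _)) (+ᵛ-inverseʳ _)) ∷ [])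
      where
      P Q d φ : S → ℚ
      P s = ℙ Ω (A & B) s
      Q s = ℙ Ω A s * ℙ Ω B s
      d s = P s - Q s
      φ s = (1ℚ - Q s * recip (P s)) + (+ 1 / 4) * (d s * d s) * recip (P s)
      P-pos : ∀ {s} → s ∈ supp Ω → 0ℚ < P s
      P-pos = ℙ-pos Ω (A & B)
      Q-pos : ∀ {s} → s ∈ supp Ω → 0ℚ < Q s
      Q-pos s∈ = *-pos (ℙ-pos Ω A s∈) (ℙ-pos Ω B s∈)
      Q≤1 : ∀ s → Q s ≤ 1ℚ
      Q≤1 s = *-mono-≤-nn (ℚ𝔼.𝔼-nonNeg Ω λ t _ → 𝟙-nonNeg (same B t s)) 0≤1 (ℙ≤1 Ω A s) (ℙ≤1 Ω B s)
      Q-sum : 𝔼 Ω (λ s → log (Q s)) +ᵛ (H Ω A +ᵛ H Ω B) ≈ᵛ 0ᵛ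
      Q-sum = ≈ᵛ-trans (+ᵛ-cong (≈ᵛ-trans (𝔼-cong Ω λ s s∈ → log-* (ℙ-pos Ω A s∈) (ℙ-pos Ω B s∈)) (𝔼-+ Ω _ _))
          (+ᵛ-cong (𝔼-neg Ω _) (𝔼-neg Ω _)))
        (≈ᵛ-trans (+ᵛ-interchange _ _ _ _) (≈ᵛ-trans (+ᵛ-cong (+ᵛ-inverseʳ _) (+ᵛ-inverseʳ _)) (+ᵛ-identityˡ _)))
      Q/P≤1 : 𝔼ℚ Ω (λ s → Q s * recip (P s)) ≤ 1ℚ
      Q/P≤1 = ℚₚ.≤-trans (ℚₚ.≤-reflexive (ℚ𝔼.≡-cong Ω λ s _ → cong (Q s *_) (trans (sym (ℚₚ.*-identityʳ (recip (P s))))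
          (cong (λ q → recip (P s) * recip q) (sym (1ℚ≡ℙ s))))))
        (submodular-mass Ω A B ⟨ (λ _ → tt) ⟩ (A & B) (λ _ _ _ → refl) (λ _ _ _ → refl) (λ _ _ p → p))
      ψ : S → ℚ
      ψ s = (+ 1 / 4) * (d s * d s) * recip (P s)
      mass : (+ 1 / 4) * (d s₀ * d s₀) ≤ 𝔼ℚ Ω φ
      mass = begin
        (+ 1 / 4) * (d s₀ * d s₀)
          ≡⟨ ℚₚ.*-identityʳ _ ⟨
        (+ 1 / 4) * (d s₀ * d s₀) * 1ℚ
          ≡⟨ cong ((+ 1 / 4) * (d s₀ * d s₀) *_) (recip-inverseˡ (P-pos s₀∈)) ⟨
        (+ 1 / 4) * (d s₀ * d s₀) * (recip (P s₀) * P s₀)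
          ≡⟨ trans (sym (ℚₚ.*-assoc ((+ 1 / 4) * (d s₀ * d s₀)) (recip (P s₀)) (P s₀))) (ℚₚ.*-comm (ψ s₀) (P s₀)) ⟩
        P s₀ * ψ s₀
          ≡⟨ ℚ𝔼.*-distʳ Ω (ψ s₀) (λ s → 𝟙 (same (A & B) s s₀)) ⟨
        𝔼ℚ Ω (λ s → 𝟙 (same (A & B) s s₀) * ψ s₀)
          ≤⟨ ℚ𝔼.𝔼-mono Ω pointwise ⟩
        𝔼ℚ Ω ψ
          ≡⟨ ℚₚ.+-identityˡ _ ⟨
        0ℚ + 𝔼ℚ Ω ψ
          ≤⟨ ℚₚ.+-monoˡ-≤ (𝔼ℚ Ω ψ) rest ⟩
        𝔼ℚ Ω (λ s → 1ℚ - Q s * recip (P s)) + 𝔼ℚ Ω ψ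
          ≡⟨ ℚ-≈⇒≡ (ℚ𝔼.𝔼-+ Ω _ _) ⟨
        𝔼ℚ Ω φ ∎
        where
        open ℚₚ.≤-Reasoning
        pointwise : ∀ s → s ∈ supp Ω → 𝟙 (same (A & B) s s₀) * ψ s₀ ≤ ψ s
        pointwise s s∈ with same (A & B) s s₀ in p
        ... | false = ℚₚ.≤-trans (ℚₚ.≤-reflexive (ℚₚ.*-zeroˡ (ψ s₀)))
                (*-nonNeg (*-nonNeg (ℚₚ.nonNegative⁻¹ (+ 1 / 4)) (square-nonNeg (d s))) (ℚₚ.<⇒≤ (recip-pos (P-pos s∈))))
        ... | true = ℚₚ.≤-reflexive (trans (ℚₚ.*-identityˡ (ψ s₀)) ψ≡)
          where
          AB = same⇒≡ (A & B) {s} {s₀} p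
          ψ≡ : ψ s₀ ≡ ψ s
          ψ≡ = cong₂ (λ q r → (+ 1 / 4) * ((q - r) * (q - r)) * recip q) (sym (ℙ-cong Ω (A & B) AB))
            (sym (cong₂ _*_ (ℙ-cong Ω A (cong proj₁ AB)) (ℙ-cong Ω B (cong proj₂ AB))))
        rest : 0ℚ ≤ 𝔼ℚ Ω (λ s → 1ℚ - Q s * recip (P s))
        rest = ℚₚ.≤-trans (p≤q⇒0≤q-p Q/P≤1) (ℚₚ.≤-reflexive (sym (trans (ℚ-≈⇒≡ (ℚ𝔼.𝔼-+ Ω (λ _ → 1ℚ) _))
          (cong₂ _+_ (total Ω) (ℚ-≈⇒≡ (ℚ𝔼.𝔼-neg′ Ω (λ s → Q s * recip (P s))))))))

  -- Subgroups of 𝔽₂ⁿ and random variables of nearly trivial doubling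

  vectors : ∀ n → List (Vec Bool n)
  vectors zero    = [] ∷ []
  vectors (suc n) = List.map (true ∷_) (vectors n) ++ List.map (false ∷_) (vectors n)

  ∈-vectors : ∀ {n} (v : Vec Bool n) → v ∈ vectors n
  ∈-vectors []          = here refl
  ∈-vectors (true ∷ v)  = ∈ₚ.∈-++⁺ˡ (∈ₚ.∈-map⁺ (true ∷_) (∈-vectors v))
  ∈-vectors {suc n} (false ∷ v) = ∈ₚ.∈-++⁺ʳ (List.map (true ∷_) (vectors n)) (∈ₚ.∈-map⁺ (false ∷_) (∈-vectors v))

  length-doubled : ∀ {A B : Set} (f g : A → B) xs → length (List.map f xs ++ List.map g xs) ≡ 2 ℕ.* length xs
  length-doubled f g xs = trans (Listₚ.length-++ (List.map f xs)) (trans (cong₂ ℕ._+_ (Listₚ.length-map f xs) (Listₚ.length-map g xs))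
    (cong (length xs ℕ.+_) (sym (ℕₚ.+-identityʳ _))))

  length-vectors : ∀ n → length (vectors n) ≡ 2 ℕ.^ n
  length-vectors zero    = refl
  length-vectors (suc n) = trans (length-doubled (true ∷_) (false ∷_) (vectors n)) (cong (2 ℕ.*_) (length-vectors n))

  record Subgroup (n : ℕ) : Set where
    field
      member : Vec Bool n → Bool
      zero∈  : member 𝟎 ≡ true
      sum∈   : ∀ u v → member u ≡ true → member v ≡ true → member (u ⊞ v) ≡ true

  open Subgroup public

  -- `m≤n` and `injective` serve the descent in `structure`: a quotient that keeps the dimension is
  -- injective, so it cannot lower the entropy.
  record Surjection (n m : ℕ) : Set where
    field
      ψ         : Vec Bool n → Vec Bool m
      ψ-hom     : ∀ u v → ψ (u ⊞ v) ≡ ψ u ⊞ ψ v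
      section   : Vec Bool m → Vec Bool n
      ψ-section : ∀ v → ψ (section v) ≡ v
      m≤n       : m ℕ.≤ n
      injective : m ≡ n → ∀ u v → ψ u ≡ ψ v → u ≡ v

  open Surjection public

  -- `kills` makes the points of K collapse in the quotient; `kernel` lists 2 ^ (n - codim) distinct
  -- points of K, whose total mass will bound n - codim.
  record Quotient {n} (K : Subgroup n) : Set where
    field
      {codim} : ℕ
      map     : Surjection n codim
      kills   : ∀ u → member K u ≡ true → ψ map u ≡ 𝟎
      kernel  : List (Vec Bool n)
      kernel-unique : Unique kernel
      kernel∈ : All (λ u → member K u ≡ true) kernel
      kernel-length : length kernel ≡ 2 ℕ.^ (n ℕ.∸ codim)

  open Quotient public

  -- Gaussian elimination on the first coordinate. If some true ∷ h lies in K, the coordinate is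
  -- projected away along it, and adding this element doubles the kernel; otherwise the coordinate
  -- survives in the quotient.
  quotient-by : ∀ {n} (K : Subgroup n) → Quotient K
  quotient-by {zero} K = record
    { map = record { ψ = id ; ψ-hom = λ _ _ → refl ; section = id ; ψ-section = λ _ → refl ; m≤n = z≤n ; injective = λ _ _ _ p → p }
    ; kills = λ { [] _ → refl } ; kernel = [] ∷ [] ; kernel-unique = [] AllPairs.∷ AllPairs.[] ; kernel∈ = zero∈ K ∷ [] ; kernel-length = refl }
  quotient-by {suc n} K with Any.any? (λ h → member K (true ∷ h) Boolₚ.≟ true) (vectors n)
  ... | yes found = record
    { map = record
      { ψ = ψ (map q) ∘ π
      ; ψ-hom = λ u v → trans (cong (ψ (map q)) (π-hom u v)) (ψ-hom (map q) (π u) (π v))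
      ; section = λ v → false ∷ section (map q) v
      ; ψ-section = ψ-section (map q)
      ; m≤n = ℕₚ.m≤n⇒m≤1+n (m≤n (map q))
      ; injective = λ m≡ → contradiction (subst (ℕ._≤ n) m≡ (m≤n (map q))) ℕₚ.1+n≰n }
    ; kills = λ u u∈ → kills q (π u) (π∈ u u∈)
    ; kernel = List.map (false ∷_) (kernel q) ++ List.map (λ v → true ∷ (v ⊞ h)) (kernel q)
    ; kernel-unique = Uniqueₚ.++⁺ (Uniqueₚ.map⁺ (λ { refl → refl }) (kernel-unique q))
        (Uniqueₚ.map⁺ (λ {u} {v} p → trans (sym (⊞-cancelʳ u h)) (trans (cong (_⊞ h) (Vecₚ.∷-injectiveʳ p)) (⊞-cancelʳ v h))) (kernel-unique q))
        disjoint
    ; kernel∈ = Allₚ.++⁺ (Allₚ.map⁺ (kernel∈ q)) (Allₚ.map⁺ (All.map (λ {v} v∈ → sum∈ K (false ∷ v) (true ∷ h) v∈ h∈) (kernel∈ q)))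
    ; kernel-length = trans (length-doubled (false ∷_) (λ v → true ∷ (v ⊞ h)) (kernel q))
        (trans (cong (2 ℕ.*_) (kernel-length q)) (cong (2 ℕ.^_) (sym (ℕₚ.+-∸-assoc 1 (m≤n (map q))))))
    }
    where
    h = proj₁ (Any.satisfied found)
    h∈ = proj₂ (Any.satisfied found)
    π : Vec Bool (suc n) → Vec Bool n
    π (true ∷ v)  = v ⊞ h
    π (false ∷ v) = v
    π-hom : ∀ u v → π (u ⊞ v) ≡ π u ⊞ π v
    π-hom (true ∷ u)  (true ∷ v)  = sym (trans (⊞-interchange u h v h) (trans (cong ((u ⊞ v) ⊞_) (⊞-self h)) (⊞-identityʳ (u ⊞ v))))
    π-hom (true ∷ u)  (false ∷ v) = trans (⊞-assoc u v h) (trans (cong (u ⊞_) (⊞-comm v h)) (sym (⊞-assoc u h v)))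
    π-hom (false ∷ u) (true ∷ v)  = ⊞-assoc u v h
    π-hom (false ∷ u) (false ∷ v) = refl
    K′ : Subgroup n
    K′ = record { member = λ v → member K (false ∷ v) ; zero∈ = zero∈ K ; sum∈ = λ u v → sum∈ K (false ∷ u) (false ∷ v) }
    q = quotient-by K′
    π∈ : ∀ u → member K u ≡ true → member K (false ∷ π u) ≡ true
    π∈ (true ∷ u)  u∈ = sum∈ K (true ∷ u) (true ∷ h) u∈ h∈
    π∈ (false ∷ u) u∈ = u∈
    disjoint : ∀ {v} → (v ∈ List.map (false ∷_) (kernel q) × v ∈ List.map (λ v → true ∷ (v ⊞ h)) (kernel q)) → ⊥
    disjoint (p , p′) with ∈ₚ.∈-map⁻ (false ∷_) p | ∈ₚ.∈-map⁻ (λ v → true ∷ (v ⊞ h)) p′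
    ... | _ , _ , refl | _ , _ , ()
  ... | no none = record
    { map = record
      { ψ = λ { (b ∷ v) → b ∷ ψ (map q) v }
      ; ψ-hom = λ { (a ∷ u) (b ∷ v) → cong ((a xor b) ∷_) (ψ-hom (map q) u v) }
      ; section = λ { (b ∷ v) → b ∷ section (map q) v }
      ; ψ-section = λ { (b ∷ v) → cong (b ∷_) (ψ-section (map q) v) }
      ; m≤n = s≤s (m≤n (map q))
      ; injective = λ { m≡ (a ∷ u) (b ∷ v) p → cong₂ _∷_ (Vecₚ.∷-injectiveˡ p) (injective (map q) (ℕₚ.suc-injective m≡) u v (Vecₚ.∷-injectiveʳ p)) } }
    ; kills = λ { (true ∷ u) u∈ → contradiction (Any.map (λ { refl → u∈ }) (∈-vectors u)) none
                ; (false ∷ u) u∈ → cong (false ∷_) (kills q u u∈) }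
    ; kernel = List.map (false ∷_) (kernel q)
    ; kernel-unique = Uniqueₚ.map⁺ (λ { refl → refl }) (kernel-unique q)
    ; kernel∈ = Allₚ.map⁺ (kernel∈ q)
    ; kernel-length = trans (Listₚ.length-map (false ∷_) (kernel q)) (kernel-length q)
    }
    where
    K′ : Subgroup n
    K′ = record { member = λ v → member K (false ∷ v) ; zero∈ = zero∈ K ; sum∈ = λ u v → sum∈ K (false ∷ u) (false ∷ v) }
    q = quotient-by K′

  recip-≤ : ∀ {p q} → 0ℚ < p → 1ℚ ≤ q * p → recip p ≤ q
  recip-≤ {p} {q} 0<p 1≤qp = subst₂ _≤_ (ℚₚ.*-identityˡ (recip p))
    (trans (ℚₚ.*-assoc q p (recip p)) (trans (cong (q *_) (recip-inverseʳ 0<p)) (ℚₚ.*-identityʳ q)))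
    (ℚₚ.*-monoʳ-≤-nonNeg (recip p) {{nonNegative (ℚₚ.<⇒≤ (recip-pos 0<p))}} 1≤qp)

  recip-antitone : ∀ {p q} → 0ℚ < p → p ≤ q → recip q ≤ recip p
  recip-antitone {p} {q} 0<p p≤q = recip-≤ (ℚₚ.<-≤-trans 0<p p≤q)
    (subst (_≤ recip p * q) (recip-inverseˡ 0<p) (ℚₚ.*-monoˡ-≤-nonNeg (recip p) {{nonNegative (ℚₚ.<⇒≤ (recip-pos 0<p))}} p≤q))

  argmax : ∀ {S : Set} (f : S → ℚ) (xs : List S) → xs ≢ [] → Σ[ s ∈ S ] (s ∈ xs × (∀ t → t ∈ xs → f t ≤ f s))
  argmax f []           ne = contradiction refl ne
  argmax f (s ∷ [])     ne = s , here refl , λ { t (here refl) → ℚₚ.≤-refl }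
  argmax f (s ∷ t ∷ xs) ne with argmax f (t ∷ xs) (λ ())
  ... | u , u∈ , max with ℚₚ.≤-total (f s) (f u)
  ...   | inj₁ fs≤fu = u , there u∈ , λ { v (here refl) → fs≤fu ; v (there v∈) → max v v∈ }
  ...   | inj₂ fu≤fs = s , here refl , λ { v (here refl) → ℚₚ.≤-refl ; v (there v∈) → ℚₚ.≤-trans (max v v∈) fu≤fs }

  supp-nonempty : ∀ {S} (Ω : Space S) → supp Ω ≢ []
  supp-nonempty Ω eq with points Ω | total Ω
  supp-nonempty Ω () | _ ∷ _ | _
  supp-nonempty Ω eq | [] | ()

  module Counting {S T : Set} {{_ : DecEq T}} (Ω : Space S) (Y : S → T) where
    multiplicity : List T → T → ℚ
    multiplicity []       t = 0ℚ
    multiplicity (u ∷ us) t = 𝟙 (does (t ≟ u)) + multiplicity us t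

    multiplicity-nonNeg : ∀ us t → 0ℚ ≤ multiplicity us t
    multiplicity-nonNeg []       t = ℚₚ.≤-refl
    multiplicity-nonNeg (u ∷ us) t = ℚₚ.+-mono-≤ (𝟙-nonNeg (does (t ≟ u))) (multiplicity-nonNeg us t)

    multiplicity-∈ : ∀ {us t} → t ∈ us → 1ℚ ≤ multiplicity us t
    multiplicity-∈ {u ∷ us} {t} (here refl) rewrite dec-true (t ≟ t) refl =
      ℚₚ.≤-trans (ℚₚ.≤-reflexive (sym (ℚₚ.+-identityʳ 1ℚ))) (ℚₚ.+-monoʳ-≤ 1ℚ (multiplicity-nonNeg us t))
    multiplicity-∈ {u ∷ us} {t} (there t∈) = ℚₚ.≤-trans (multiplicity-∈ t∈)
      (ℚₚ.≤-trans (ℚₚ.≤-reflexive (sym (ℚₚ.+-identityˡ (multiplicity us t)))) (ℚₚ.+-monoˡ-≤ (multiplicity us t) (𝟙-nonNeg (does (t ≟ u)))))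

    multiplicity-∉ : ∀ us t → All (t ≢_) us → multiplicity us t ≡ 0ℚ
    multiplicity-∉ []       t []          = refl
    multiplicity-∉ (u ∷ us) t (t≢u ∷ rest) rewrite dec-false (t ≟ u) t≢u | multiplicity-∉ us t rest = refl

    multiplicity-unique : ∀ us t → Unique us → multiplicity us t ≤ 1ℚ
    multiplicity-unique []       t _ = 0≤1
    multiplicity-unique (u ∷ us) t (u∉ AllPairs.∷ uniq) with t ≟ u
    ... | yes refl rewrite multiplicity-∉ us t u∉ = ℚₚ.≤-refl
    ... | no _ = ℚₚ.≤-trans (ℚₚ.≤-reflexive (ℚₚ.+-identityˡ (multiplicity us t))) (multiplicity-unique us t uniq)

    mass : T → ℚ
    mass t = 𝔼ℚ Ω (λ s → 𝟙 (does (Y s ≟ t)))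

    𝔼-multiplicity-≥ : ∀ us q → All (λ u → q ≤ mass u) us → fromℕℚ (length us) * q ≤ 𝔼ℚ Ω (λ s → multiplicity us (Y s))
    𝔼-multiplicity-≥ []       q [] = ℚₚ.≤-reflexive (trans (ℚₚ.*-zeroˡ q) (sym (ℚ-≈⇒≡ (ℚ𝔼.𝔼-const Ω 0ℚ))))
    𝔼-multiplicity-≥ (u ∷ us) q (q≤ ∷ qs) = begin
      fromℕℚ (suc (length us)) * q                ≡⟨ cong (_* q) (fromℕℚ-suc (length us)) ⟩
      (1ℚ + fromℕℚ (length us)) * q               ≡⟨ ℚₚ.*-distribʳ-+ q 1ℚ (fromℕℚ (length us)) ⟩
      1ℚ * q + fromℕℚ (length us) * q             ≤⟨ ℚₚ.+-mono-≤ (ℚₚ.≤-trans (ℚₚ.≤-reflexive (ℚₚ.*-identityˡ q)) q≤) (𝔼-multiplicity-≥ us q qs) ⟩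
      mass u + 𝔼ℚ Ω (λ s → multiplicity us (Y s)) ≡⟨ ℚ-≈⇒≡ (ℚ𝔼.𝔼-+ Ω _ _) ⟨
      𝔼ℚ Ω (λ s → multiplicity (u ∷ us) (Y s))    ∎
      where open ℚₚ.≤-Reasoning

    unique-mass : ∀ us q → Unique us → All (λ u → q ≤ mass u) us → fromℕℚ (length us) * q ≤ 1ℚ
    unique-mass us q uniq qs = ℚₚ.≤-trans (𝔼-multiplicity-≥ us q qs) (ℚ𝔼.𝔼-≤-const Ω λ s _ → multiplicity-unique us (Y s) uniq)

    -- Each value of Y contributes its probability times the reciprocal, so the mean of 1/ℙ counts
    -- the values taken.
    𝔼-recip-≤ : ∀ us → (∀ s → s ∈ supp Ω → Y s ∈ us) → 𝔼ℚ Ω (λ s → recip (ℙ Ω ⟨ Y ⟩ s)) ≤ fromℕℚ (length us)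
    𝔼-recip-≤ us cover = ℚₚ.≤-trans (ℚ𝔼.𝔼-mono Ω λ s s∈ → ℚₚ.≤-trans (ℚₚ.≤-reflexive (sym (ℚₚ.*-identityˡ _)))
        (ℚₚ.*-monoʳ-≤-nonNeg (recip (ℙ Ω ⟨ Y ⟩ s)) {{nonNegative (ℚₚ.<⇒≤ (recip-pos (ℙ-pos Ω ⟨ Y ⟩ s∈)))}} (multiplicity-∈ (cover s s∈))))
      (count us)
      where
      open ℚₚ.≤-Reasoning
      r : S → ℚ
      r s = recip (ℙ Ω ⟨ Y ⟩ s)
      count : ∀ us → 𝔼ℚ Ω (λ s → multiplicity us (Y s) * r s) ≤ fromℕℚ (length us)
      count [] = ℚₚ.≤-reflexive (trans (ℚ𝔼.≡-cong Ω λ s _ → ℚₚ.*-zeroˡ (r s)) (ℚ-≈⇒≡ (ℚ𝔼.𝔼-const Ω 0ℚ)))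
      count (u ∷ us) = begin
        𝔼ℚ Ω (λ s → (𝟙 (does (Y s ≟ u)) + multiplicity us (Y s)) * r s)
          ≡⟨ ℚ𝔼.≡-cong Ω (λ s _ → ℚₚ.*-distribʳ-+ (r s) (𝟙 (does (Y s ≟ u))) (multiplicity us (Y s))) ⟩
        𝔼ℚ Ω (λ s → 𝟙 (does (Y s ≟ u)) * r s + multiplicity us (Y s) * r s)
          ≡⟨ ℚ-≈⇒≡ (ℚ𝔼.𝔼-+ Ω _ _) ⟩
        𝔼ℚ Ω (λ s → 𝟙 (does (Y s ≟ u)) * r s) + 𝔼ℚ Ω (λ s → multiplicity us (Y s) * r s)
          ≤⟨ ℚₚ.+-mono-≤ (ℙ-atom Ω ⟨ Y ⟩ (λ s → does (Y s ≟ u)) λ s t p q → trans (hit s p) (sym (hit t q))) (count us) ⟩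
        1ℚ + fromℕℚ (length us)
          ≡⟨ fromℕℚ-suc (length us) ⟨
        fromℕℚ (suc (length us)) ∎
        where
        hit : ∀ s → does (Y s ≟ u) ≡ true → Y s ≡ u
        hit s = does-true (Y s ≟ u)

    0<mass⇒∈ : ∀ {t} → 0ℚ < mass t → Σ[ s ∈ S ] (s ∈ supp Ω × Y s ≡ t)
    0<mass⇒∈ {t} = go (points Ω)
      where
      go : ∀ ps → 0ℚ < ℚ∫.∫ ps (λ s → 𝟙 (does (Y s ≟ t))) → Σ[ s ∈ S ] (s ∈ support ps × Y s ≡ t)
      go []             0<0 = contradiction 0<0 (ℚₚ.<-irrefl refl)
      go ((w , s) ∷ ps) 0<m with Y s ≟ t
      ... | yes p = s , here refl , p
      ... | no  _ with go ps (subst (0ℚ <_) (trans (cong (_+ ℚ∫.∫ ps (λ s → 𝟙 (does (Y s ≟ t)))) (ℚₚ.*-zeroʳ w)) (ℚₚ.+-identityˡ _)) 0<m)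
      ...   | u , u∈ , p = u , there u∈ , p

    -- On the rare event Y ≠ y₀ one uses −log P ≤ 1/(PK) + K.
    concentrated-entropy : ∀ us → (∀ s → s ∈ supp Ω → Y s ∈ us) → ∀ y₀ K → 0ℚ < K →
      let u = 𝔼ℚ Ω (λ s → 𝟙 (not (does (Y s ≟ y₀)))) in
      u ≤ ½ → H Ω ⟨ Y ⟩ ≤ᵛ ((u + u) + (fromℕℚ (length us) * recip K + K * u)) • one
    concentrated-entropy us cover y₀ K 0<K u≤½ = ≤ᵛ-trans (𝔼-mono Ω pointwise) (≤ᵛ-trans (proj₁ (𝔼-scalar Ω bound one))
        (•-monoˡ 0≤one 𝔼bound))
      where
      u : ℚ
      u = 𝔼ℚ Ω (λ s → 𝟙 (not (does (Y s ≟ y₀))))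
      e : S → ℚ
      e s = 𝟙 (not (does (Y s ≟ y₀)))
      P r bound : S → ℚ
      P = ℙ Ω ⟨ Y ⟩
      r s = recip (P s)
      bound s = (u + u) + (r s * recip K + K * e s)
      0≤u : 0ℚ ≤ u
      0≤u = ℚ𝔼.𝔼-nonNeg Ω λ s _ → 𝟙-nonNeg (not (does (Y s ≟ y₀)))
      𝔼bound : 𝔼ℚ Ω bound ≤ (u + u) + (fromℕℚ (length us) * recip K + K * u)
      𝔼bound = begin
        𝔼ℚ Ω bound
          ≡⟨ ℚ-≈⇒≡ (ℚ𝔼.𝔼-+ Ω _ _) ⟩
        𝔼ℚ Ω (λ _ → u + u) + 𝔼ℚ Ω (λ s → r s * recip K + K * e s)
          ≡⟨ cong₂ _+_ (ℚ-≈⇒≡ (ℚ𝔼.𝔼-const Ω (u + u))) (ℚ-≈⇒≡ (ℚ𝔼.𝔼-+ Ω _ _)) ⟩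
        (u + u) + (𝔼ℚ Ω (λ s → r s * recip K) + 𝔼ℚ Ω (λ s → K * e s))
          ≡⟨ cong₂ (λ a b → (u + u) + (a + b)) (ℚ𝔼.*-distʳ Ω (recip K) r) (ℚ𝔼.*-distˡ Ω K e) ⟩
        (u + u) + (𝔼ℚ Ω r * recip K + K * u)
          ≤⟨ ℚₚ.+-monoʳ-≤ (u + u) (ℚₚ.+-monoˡ-≤ (K * u) (ℚₚ.*-monoʳ-≤-nonNeg (recip K)
               {{nonNegative (ℚₚ.<⇒≤ (recip-pos 0<K))}} (𝔼-recip-≤ us cover))) ⟩
        (u + u) + (fromℕℚ (length us) * recip K + K * u) ∎
        where open ℚₚ.≤-Reasoning
      log-recip-P : ∀ {s} → s ∈ supp Ω → -ᵛ log (P s) ≈ᵛ log (r s)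
      log-recip-P s∈ = ≈ᵛ-sym (log-recip (ℙ-pos Ω ⟨ Y ⟩ s∈))
      pointwise : ∀ s → s ∈ supp Ω → -ᵛ log (P s) ≤ᵛ bound s • one
      pointwise s s∈ with Y s ≟ y₀
      ... | yes Ys≡y₀ = ≤ᵛ-trans (proj₁ (log-recip-P s∈)) (≤ᵛ-trans (log-≤ (recip-pos 0<P)) (•-monoˡ 0≤one small))
        where
        0<P = ℙ-pos Ω ⟨ Y ⟩ s∈
        P≡ : P s ≡ 1ℚ - u
        P≡ = trans (ℚ𝔼.≡-cong Ω λ t _ → trans (cong (λ v → 𝟙 (does (Y t ≟ v))) Ys≡y₀) (flip (does (Y t ≟ y₀))))
          (trans (ℚ-≈⇒≡ (ℚ𝔼.𝔼-+ Ω (λ _ → 1ℚ) (λ t → - e t))) (cong₂ _+_ (total Ω) (ℚ-≈⇒≡ (ℚ𝔼.𝔼-neg′ Ω e))))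
          where
          flip : ∀ b → 𝟙 b ≡ 1ℚ - 𝟙 (not b)
          flip true  = refl
          flip false = refl
        r≤2 : r s ≤ 1ℚ + 1ℚ
        r≤2 = recip-≤ 0<P (ℚₚ.≤-trans (ℚₚ.≤-reflexive refl) (ℚₚ.*-monoˡ-≤-nonNeg (1ℚ + 1ℚ)
          (ℚₚ.≤-trans (ℚₚ.≤-reflexive (refl {x = ½})) (subst (½ ≤_) (sym P≡) (ℚₚ.≤-trans (ℚₚ.≤-reflexive refl) (ℚₚ.+-monoʳ-≤ 1ℚ (ℚₚ.neg-antimono-≤ u≤½)))))))
        r-1≡ : r s - 1ℚ ≡ r s * u
        r-1≡ = trans (cong (λ q → r s - q) (sym (recip-inverseˡ 0<P))) (trans (cong (λ q → r s - r s * q) P≡) (ring (r s) u))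
          where
          open +-*-Solver
          ring : ∀ r u → r - r * (1ℚ - u) ≡ r * u
          ring = solve 2 (λ r u → r :- r :* (con 1ℚ :- u) := r :* u) refl
        0≤rest : 0ℚ ≤ r s * recip K + K * 0ℚ
        0≤rest = ℚₚ.+-mono-≤ (*-nonNeg (ℚₚ.<⇒≤ (recip-pos 0<P)) (ℚₚ.<⇒≤ (recip-pos 0<K))) (*-nonNeg (ℚₚ.<⇒≤ 0<K) ℚₚ.≤-refl)
        small : r s - 1ℚ ≤ (u + u) + (r s * recip K + K * 0ℚ)
        small = begin
          r s - 1ℚ                                ≡⟨ r-1≡ ⟩
          r s * u                                 ≤⟨ ℚₚ.*-monoʳ-≤-nonNeg u {{nonNegative 0≤u}} r≤2 ⟩
          (1ℚ + 1ℚ) * u                           ≡⟨ trans (ℚₚ.*-distribʳ-+ u 1ℚ 1ℚ) (cong₂ _+_ (ℚₚ.*-identityˡ u) (ℚₚ.*-identityˡ u)) ⟩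
          u + u                                   ≡⟨ ℚₚ.+-identityʳ (u + u) ⟨
          (u + u) + 0ℚ                            ≤⟨ ℚₚ.+-monoʳ-≤ (u + u) 0≤rest ⟩
          (u + u) + (r s * recip K + K * 0ℚ)      ∎
          where open ℚₚ.≤-Reasoning
      ... | no _ = ≤ᵛ-trans (proj₁ (log-recip-P s∈)) (≤ᵛ-trans (proj₁ (≡⇒≈ᵛ (cong log r≡)))
          (≤ᵛ-trans (proj₁ (log-* 0<rK 0<K)) (≤ᵛ-trans (+ᵛ-mono (log-≤ 0<rK) (log-≤ 0<K))
            (≤ᵛ-trans (proj₂ (•-distribʳ _ _ one)) (•-monoˡ 0≤one large)))))
        where
        0<P = ℙ-pos Ω ⟨ Y ⟩ s∈
        0<rK = *-pos (recip-pos 0<P) (recip-pos 0<K)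
        r≡ : r s ≡ r s * recip K * K
        r≡ = sym (trans (ℚₚ.*-assoc (r s) (recip K) K) (trans (cong (r s *_) (recip-inverseˡ 0<K)) (ℚₚ.*-identityʳ (r s))))
        large : (r s * recip K - 1ℚ) + (K - 1ℚ) ≤ (u + u) + (r s * recip K + K * 1ℚ)
        large = begin
          (a - 1ℚ) + (K - 1ℚ)        ≤⟨ ℚₚ.+-mono-≤ (drop a) (drop K) ⟩
          a + K                      ≡⟨ trans (sym (ℚₚ.+-identityˡ (a + K))) (cong (λ q → 0ℚ + (a + q)) (sym (ℚₚ.*-identityʳ K))) ⟩
          0ℚ + (a + K * 1ℚ)          ≤⟨ ℚₚ.+-monoˡ-≤ (a + K * 1ℚ) (ℚₚ.+-mono-≤ 0≤u 0≤u) ⟩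
          (u + u) + (a + K * 1ℚ)     ∎
          where
          open ℚₚ.≤-Reasoning
          a = r s * recip K
          drop : ∀ q → q - 1ℚ ≤ q
          drop q = ℚₚ.≤-trans (ℚₚ.+-monoʳ-≤ q (ℚₚ.nonPositive⁻¹ (- 1ℚ))) (ℚₚ.≤-reflexive (ℚₚ.+-identityʳ q))

  module NearSubgroup {n : ℕ} {S : Set} (Ω : Space S) (x : S → Vec Bool n) {ε : ℚ} (D₁≤ε : D₁ Ω x ≤ᵛ ε • one) where
    open Counting Ω x public using () renaming (mass to p)

    module _ (y : Vec Bool n) where
      private
        Ω² = Ω ⊗ Ω
        A B : RV (S × S)
        A = ⟨ x ∘ proj₁ ⟩
        hits : S × S → Bool
        hits (s , t) = does (x s ⊞ x t ≟ y)
        B = ⟨ hits ⟩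

      r : ℚ
      r = 𝔼ℚ Ω² (λ q → 𝟙 (hits q))

      private
        -- The mutual information of x and x + x′ is H(x + x′) - H(x), that is D₁; replacing x + x′
        -- by the indicator of the value y only lowers it.
        information : H Ω² A +ᵛ H Ω² B ≤ᵛ D₁ Ω x +ᵛ H Ω² (A & B)
        information = linear (H Ω² A ∷ H Ω² B ∷ H Ω² (A & B) ∷ H Ω ⟨ x ⟩ ∷ H Ω² (⟨ x ⟩ ⊠ ⟨ x ⟩) ∷ H Ω² ⟨ (λ (s , t) → x s ⊞ x t) ⟩ ∷ [])
          (v₀ ⊹ v₁) ((v₅ ⊝ v₃) ⊹ v₂)
          (1 · v₄ ⊹ v₁ ≦ v₂ ⊹ v₅ ∵ submodular Ω² (A & B) ⟨ (λ (s , t) → x s ⊞ x t) ⟩ B (⟨ x ⟩ ⊠ ⟨ x ⟩)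
              (det-refl proj₂) (det-refl λ v → does (v ≟ y))
              (det (λ ((a , _) , v) → a , a ⊞ v) λ (s , t) → cong (x s ,_) (sym (⊞-cancelˡ (x s) (x t)))) ∷
           1 · v₃ ⊹ v₃ ≦ v₄ ∵ proj₂ (H-⊗ Ω Ω ⟨ x ⟩ ⟨ x ⟩) ∷
           1 · v₀ ≦ v₃ ∵ proj₁ (mp-H (mp-proj₁ Ω (λ _ → Ω)) ⟨ x ⟩) ∷ [])

        indicator : Bool → ℚ → ℚ
        indicator true  q = q
        indicator false q = 1ℚ - q

        𝟙-≟ : ∀ b β → 𝟙 (does (b Boolₚ.≟ β)) ≡ indicator β (𝟙 b)
        𝟙-≟ true  true  = refl
        𝟙-≟ true  false = refl
        𝟙-≟ false true  = refl
        𝟙-≟ false false = refl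

        𝔼-indicator : ∀ {S′ : Set} (Λ : Space S′) β (f : S′ → ℚ) → 𝔼ℚ Λ (λ s → indicator β (f s)) ≡ indicator β (𝔼ℚ Λ f)
        𝔼-indicator Λ true  f = refl
        𝔼-indicator Λ false f = trans (ℚ-≈⇒≡ (ℚ𝔼.𝔼-+ Λ (λ _ → 1ℚ) (λ s → - f s))) (cong₂ _+_ (total Λ) (ℚ-≈⇒≡ (ℚ𝔼.𝔼-neg′ Λ f)))

        ℙA : ∀ q → ℙ Ω² A q ≡ p (x (proj₁ q))
        ℙA q = trans (ℚ𝔼.≡->>= Ω (λ _ → Ω) (λ w → 𝟙 (same A w q))) (ℚ𝔼.≡-cong Ω λ s _ → ℚ-≈⇒≡ (ℚ𝔼.𝔼-const Ω _))

        ℙB : ∀ q → ℙ Ω² B q ≡ indicator (hits q) r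
        ℙB q = trans (ℚ𝔼.≡-cong Ω² λ w _ → 𝟙-≟ (hits w) (hits q)) (𝔼-indicator Ω² (hits q) (λ w → 𝟙 (hits w)))

        shifted : ∀ s t → does (x s ⊞ x t ≟ y) ≡ does (x t ≟ x s ⊞ y)
        shifted s t with x s ⊞ x t ≟ y | x t ≟ x s ⊞ y
        ... | yes _ | yes _ = refl
        ... | no _  | no _  = refl
        ... | yes a | no b  = contradiction (trans (sym (⊞-cancelˡ (x s) (x t))) (cong (x s ⊞_) a)) b
        ... | no a  | yes b = contradiction (trans (cong (x s ⊞_) b) (⊞-cancelˡ (x s) y)) a

        ℙAB : ∀ s t → ℙ Ω² (A & B) (s , t) ≡ p (x s) * indicator (hits (s , t)) (p (x s ⊞ y))
        ℙAB s t = trans (ℚ𝔼.≡->>= Ω (λ _ → Ω) (λ w → 𝟙 (same (A & B) w (s , t)))) (trans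
          (ℚ𝔼.≡-cong Ω λ s′ _ → trans (ℚ𝔼.≡-cong Ω λ t′ _ → trans (cong 𝟙 (split s′ t′)) (𝟙-∧ (same ⟨ x ⟩ s′ s) _))
            (ℚ𝔼.*-distˡ Ω (𝟙 (same ⟨ x ⟩ s′ s)) _))
          (trans (ℚ𝔼.*-distʳ Ω _ (λ s′ → 𝟙 (same ⟨ x ⟩ s′ s)))
            (cong (p (x s) *_) (trans (ℚ𝔼.≡-cong Ω λ t′ _ → trans (𝟙-≟ (hits (s , t′)) β) (cong (λ b → indicator β (𝟙 b)) (shifted s t′)))
              (𝔼-indicator Ω β (λ t′ → 𝟙 (does (x t′ ≟ x s ⊞ y))))))))
          where
          β = hits (s , t)
          split : ∀ s′ t′ → same (A & B) (s′ , t′) (s , t) ≡ same ⟨ x ⟩ s′ s ∧ does (hits (s , t′) Boolₚ.≟ β)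
          split s′ t′ = bool-ext
            (λ e → let f = same⇒≡ (A & B) {s′ , t′} {s , t} e in
              cong₂ _∧_ (same-true ⟨ x ⟩ (cong proj₁ f)) (dec-true (hits (s , t′) Boolₚ.≟ β) (trans (cong (λ v → does (v ⊞ x t′ ≟ y)) (sym (cong proj₁ f))) (cong proj₂ f))))
            (λ e → let a , b = ∧-true e ; c = same⇒≡ ⟨ x ⟩ {s′} {s} a in
              same-true (A & B) {s′ , t′} {s , t} (cong₂ _,_ c (trans (cong (λ v → does (v ⊞ x t′ ≟ y)) c) (does-true (hits (s , t′) Boolₚ.≟ β) b))))

      -- `mutual-information-lower` at the atom of (s , s): the event x + x′ = y has probability p
      -- (x s ⊞ y) given x = x s, and r y without conditioning. The indicator may be true or false
      -- at (s , s), but both cases give the same square.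
      translates-close : ∀ s → s ∈ supp Ω → let d = p (x s) * (p (x s ⊞ y) - r) in (+ 1 / 4) * (d * d) ≤ ε
      translates-close s s∈ = subst (λ d² → (+ 1 / 4) * d² ≤ ε) (squares β)
        (•one-cancel (linear (_ ∷ H Ω² (A & B) ∷ H Ω² A ∷ H Ω² B ∷ D₁ Ω x ∷ ε • one ∷ []) v₀ v₅
          (1 · v₀ ⊹ v₁ ≦ v₂ ⊹ v₃ ∵ mi ∷ 1 · v₂ ⊹ v₃ ≦ v₄ ⊹ v₁ ∵ information ∷ 1 · v₄ ≦ v₅ ∵ D₁≤ε ∷ [])))
        where
        β = hits (s , s)
        e : ℚ
        e = p (x s) * indicator β (p (x s ⊞ y)) - p (x s) * indicator β r
        mi : ((+ 1 / 4) * (e * e)) • one +ᵛ H Ω² (A & B) ≤ᵛ H Ω² A +ᵛ H Ω² B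
        mi = subst (λ d → ((+ 1 / 4) * (d * d)) • one +ᵛ H Ω² (A & B) ≤ᵛ H Ω² A +ᵛ H Ω² B)
          (cong₂ _-_ (ℙAB s s) (cong₂ _*_ (ℙA (s , s)) (ℙB (s , s))))
          (mutual-information-lower Ω² A B {s , s} (∈-⊗ s∈))
          where
          ∈-⊗ : s ∈ supp Ω → (s , s) ∈ supp Ω²
          ∈-⊗ s∈ = go (points Ω) s∈
            where
            go : ∀ ps → s ∈ support ps → (s , s) ∈ support (bind ps (λ _ → points Ω))
            go ((w , t) ∷ ps) s∈ps = subst ((s , s) ∈_) (sym (Listₚ.map-++ proj₂ (scale w (t ,_) (points Ω)) (bind ps (λ _ → points Ω))))
              (step s∈ps)
              where
              scale∈ : ∀ ps → s ∈ support ps → (t , s) ∈ support (scale w (t ,_) ps)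
              scale∈ (_ ∷ ps) (here refl) = here refl
              scale∈ (_ ∷ ps) (there p)   = there (scale∈ ps p)
              step : s ∈ support ((w , t) ∷ ps) → (s , s) ∈ support (scale w (t ,_) (points Ω)) ++ support (bind ps (λ _ → points Ω))
              step (here refl) = ∈ₚ.∈-++⁺ˡ (scale∈ (points Ω) s∈)
              step (there p)   = ∈ₚ.∈-++⁺ʳ (support (scale w (t ,_) (points Ω))) (go ps p)
        squares : ∀ β → (p (x s) * indicator β (p (x s ⊞ y)) - p (x s) * indicator β r) * (p (x s) * indicator β (p (x s ⊞ y)) - p (x s) * indicator β r)
          ≡ (p (x s) * (p (x s ⊞ y) - r)) * (p (x s) * (p (x s ⊞ y) - r))
        squares true  = ring₁ (p (x s)) (p (x s ⊞ y)) r
          where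
          open +-*-Solver
          ring₁ : ∀ a b c → (a * b - a * c) * (a * b - a * c) ≡ (a * (b - c)) * (a * (b - c))
          ring₁ = solve 3 (λ a b c → (a :* b :- a :* c) :* (a :* b :- a :* c) := (a :* (b :- c)) :* (a :* (b :- c))) refl
        squares false = ring₂ (p (x s)) (p (x s ⊞ y)) r
          where
          open +-*-Solver
          ring₂ : ∀ a b c → (a * (1ℚ - b) - a * (1ℚ - c)) * (a * (1ℚ - b) - a * (1ℚ - c)) ≡ (a * (b - c)) * (a * (b - c))
          ring₂ = solve 3 (λ a b c → (a :* (con 1ℚ :- b) :- a :* (con 1ℚ :- c)) :* (a :* (con 1ℚ :- b) :- a :* (con 1ℚ :- c)) := (a :* (b :- c)) :* (a :* (b :- c))) refl

    -- With y = x a + x g, the translates seen from a and from b have masses p (x g) and p (x b +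
    -- y), and both must be close to r y. If the second were below 3/4 of the first, r y would be at
    -- distance at least p (x g)/8 from one of them; the two cases are split at 7/8.
    sum-popular : ∀ {θ q} → 0ℚ < θ → 0ℚ < q → ε < (+ 1 / 4) * ((θ * (q * (+ 1 / 8))) * (θ * (q * (+ 1 / 8)))) →
      ∀ a b g → a ∈ supp Ω → b ∈ supp Ω → q ≤ p (x g) → θ ≤ p (x a) → θ ≤ p (x b) →
      p (x g) * (+ 3 / 4) ≤ p (x b ⊞ (x a ⊞ x g))
    sum-popular {θ} {q} 0<θ 0<q ε< a b g a∈ b∈ q≤pg θ≤pa θ≤pb with p (x g) * (+ 3 / 4) ℚₚ.≤? p (x b ⊞ (x a ⊞ x g))
    ... | yes le = le
    ... | no ≰ with r y ℚₚ.≤? pg * (+ 7 / 8)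
      where
      pg = p (x g)
      y = x a ⊞ x g
    ...   | yes r≤ = contradiction (ℚₚ.<-≤-trans ε< (ℚₚ.≤-trans (far a 0≤ θ≤pa) (translates-close y a a∈))) (ℚₚ.<-irrefl refl)
      where
      pg = p (x g)
      y = x a ⊞ x g
      gap : q * (+ 1 / 8) ≤ p (x a ⊞ y) - r y
      gap = begin
        q * (+ 1 / 8)          ≤⟨ ℚₚ.*-monoʳ-≤-nonNeg (+ 1 / 8) q≤pg ⟩
        pg * (+ 1 / 8)         ≡⟨ ring pg ⟩
        pg - pg * (+ 7 / 8)    ≤⟨ ℚₚ.+-monoʳ-≤ pg (ℚₚ.neg-antimono-≤ r≤) ⟩
        pg - r y               ≡⟨ cong (λ v → p v - r y) (⊞-cancelˡ (x a) (x g)) ⟨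
        p (x a ⊞ y) - r y      ∎
        where
        open ℚₚ.≤-Reasoning
        open +-*-Solver
        ring : ∀ g → g * (+ 1 / 8) ≡ g - g * (+ 7 / 8)
        ring = solve 1 (λ g → g :* con (+ 1 / 8) := g :- g :* con (+ 7 / 8)) refl
      0≤ : 0ℚ ≤ q * (+ 1 / 8)
      0≤ = *-nonNeg (ℚₚ.<⇒≤ 0<q) (ℚₚ.nonNegative⁻¹ (+ 1 / 8))
      far : ∀ s → 0ℚ ≤ q * (+ 1 / 8) → θ ≤ p (x s) → let d = p (x a) * (p (x a ⊞ y) - r y) in
        (+ 1 / 4) * ((θ * (q * (+ 1 / 8))) * (θ * (q * (+ 1 / 8)))) ≤ (+ 1 / 4) * (d * d)
      far s 0≤q _ = ℚₚ.*-monoˡ-≤-nonNeg (+ 1 / 4) (*-mono-≤-nn 0≤l (ℚₚ.≤-trans 0≤l l≤) l≤ l≤)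
        where
        0≤l = *-nonNeg (ℚₚ.<⇒≤ 0<θ) 0≤q
        l≤ = *-mono-≤-nn 0≤q (ℚₚ.≤-trans (ℚₚ.<⇒≤ 0<θ) θ≤pa) θ≤pa gap
    ...   | no r≰ = contradiction (ℚₚ.<-≤-trans ε< (ℚₚ.≤-trans far (translates-close y b b∈))) (ℚₚ.<-irrefl refl)
      where
      pg = p (x g)
      y = x a ⊞ x g
      pc = p (x b ⊞ y)
      gap : q * (+ 1 / 8) ≤ r y - pc
      gap = begin
        q * (+ 1 / 8)                      ≤⟨ ℚₚ.*-monoʳ-≤-nonNeg (+ 1 / 8) q≤pg ⟩
        pg * (+ 1 / 8)                     ≡⟨ ring pg ⟩
        pg * (+ 7 / 8) - pg * (+ 3 / 4)    ≤⟨ ℚₚ.+-mono-≤ (ℚₚ.<⇒≤ (ℚₚ.≰⇒> r≰)) (ℚₚ.neg-antimono-≤ (ℚₚ.<⇒≤ (ℚₚ.≰⇒> ≰))) ⟩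
        r y - pc                           ∎
        where
        open ℚₚ.≤-Reasoning
        open +-*-Solver
        ring : ∀ g → g * (+ 1 / 8) ≡ g * (+ 7 / 8) - g * (+ 3 / 4)
        ring = solve 1 (λ g → g :* con (+ 1 / 8) := g :* con (+ 7 / 8) :- g :* con (+ 3 / 4)) refl
      0≤ : 0ℚ ≤ q * (+ 1 / 8)
      0≤ = *-nonNeg (ℚₚ.<⇒≤ 0<q) (ℚₚ.nonNegative⁻¹ (+ 1 / 8))
      far : let d = p (x b) * (pc - r y) in
        (+ 1 / 4) * ((θ * (q * (+ 1 / 8))) * (θ * (q * (+ 1 / 8)))) ≤ (+ 1 / 4) * (d * d)
      far = ℚₚ.*-monoˡ-≤-nonNeg (+ 1 / 4) (ℚₚ.≤-trans (*-mono-≤-nn 0≤l (ℚₚ.≤-trans 0≤l l≤) l≤ l≤) (ℚₚ.≤-reflexive (ring (p (x b)) (r y) pc)))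
        where
        open +-*-Solver
        0≤l = *-nonNeg (ℚₚ.<⇒≤ 0<θ) 0≤
        l≤ = *-mono-≤-nn 0≤ (ℚₚ.≤-trans (ℚₚ.<⇒≤ 0<θ) θ≤pb) θ≤pb gap
        ring : ∀ b r c → (b * (r - c)) * (b * (r - c)) ≡ (b * (c - r)) * (b * (c - r))
        ring = solve 3 (λ b r c → (b :* (r :- c)) :* (b :* (r :- c)) := (b :* (c :- r)) :* (b :* (c :- r))) refl

  ×ᵛ-+ : ∀ m n x → (m ℕ.+ n) ×ᵛ x ≈ᵛ m ×ᵛ x +ᵛ n ×ᵛ x
  ×ᵛ-+ m n x = ≈ᵛ-trans (≡⇒≈ᵛ (cong (_• x) (fromℕℚ-+ m n))) (•-distribʳ (fromℕℚ m) (fromℕℚ n) x)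

  recip-•-cancel : ∀ {q} → 0ℚ < q → ∀ x → recip q • q • x ≈ᵛ x
  recip-•-cancel {q} 0<q x = ≈ᵛ-trans (≈ᵛ-sym (•-assoc (recip q) q x))
    (≈ᵛ-trans (≡⇒≈ᵛ (cong (_• x) (recip-inverseˡ 0<q))) (•-identity x))

  •-recip-cancel : ∀ {q} → 0ℚ < q → ∀ x → q • recip q • x ≈ᵛ x
  •-recip-cancel {q} 0<q x = ≈ᵛ-trans (≈ᵛ-sym (•-assoc q (recip q) x))
    (≈ᵛ-trans (≡⇒≈ᵛ (cong (_• x) (recip-inverseʳ 0<q))) (•-identity x))

  •-cancel-≤ : ∀ {q} → 0ℚ < q → ∀ {x y} → q • x ≤ᵛ q • y → x ≤ᵛ y
  •-cancel-≤ {q} 0<q le = ≤ᵛ-trans (proj₂ (recip-•-cancel 0<q _)) (≤ᵛ-trans (•-monoʳ (ℚₚ.<⇒≤ (recip-pos 0<q)) le)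
    (proj₁ (recip-•-cancel 0<q _)))

  log₂ : Carrier
  log₂ = log (fromℕℚ 2)

  log-2^ : ∀ j → log (fromℕℚ (2 ℕ.^ j)) ≈ᵛ j ×ᵛ log₂
  log-2^ zero    = ≈ᵛ-trans log-1 (≈ᵛ-sym (•-zeroˡ log₂))
  log-2^ (suc j) = ≈ᵛ-trans (≡⇒≈ᵛ (cong log (fromℕℚ-* 2 (2 ℕ.^ j))))
    (≈ᵛ-trans (log-* (fromℕℚ-pos 2 (s≤s z≤n)) (fromℕℚ-pos (2 ℕ.^ j) (ℕₚ.m^n>0 2 j)))
    (≈ᵛ-trans (+ᵛ-cong ≈ᵛ-refl (log-2^ j)) (≈ᵛ-sym (×ᵛ-suc j log₂))))

  -- N = 2ⁿ counts the points, and 1/W is the entropy allowed to remain. K = 2NW spends half of it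
  -- on N/K. The popularity threshold θ = 1/c is chosen so that mass θN of unpopular points,
  -- weighted by 2 + K as in `concentrated-entropy`, spends the other half. `tolerance` is half of
  -- the bound in `sum-popular`, to have a strict inequality.
  module Thresholds (N W : ℚ) (1≤N : 1ℚ ≤ N) (1≤W : 1ℚ ≤ W) where
    K c θ q tolerance : ℚ
    K = (1ℚ + 1ℚ) * (N * W)
    c = ((1ℚ + 1ℚ) + K) * (N * ((1ℚ + 1ℚ) * W))
    θ = recip c
    q = recip N
    tolerance = ½ * ((+ 1 / 4) * ((θ * (q * (+ 1 / 8))) * (θ * (q * (+ 1 / 8)))))

    0<N : 0ℚ < N
    0<N = ℚₚ.<-≤-trans (ℚₚ.positive⁻¹ 1ℚ) 1≤N
    0<W : 0ℚ < W
    0<W = ℚₚ.<-≤-trans (ℚₚ.positive⁻¹ 1ℚ) 1≤W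
    0<2 : 0ℚ < 1ℚ + 1ℚ
    0<2 = ℚₚ.positive⁻¹ (1ℚ + 1ℚ)
    0<2W : 0ℚ < (1ℚ + 1ℚ) * W
    0<2W = *-pos 0<2 0<W
    0<K : 0ℚ < K
    0<K = *-pos 0<2 (*-pos 0<N 0<W)
    0<2+K : 0ℚ < (1ℚ + 1ℚ) + K
    0<2+K = ℚₚ.+-mono-< 0<2 0<K
    0<c : 0ℚ < c
    0<c = *-pos 0<2+K (*-pos 0<N 0<2W)
    0<θ : 0ℚ < θ
    0<θ = recip-pos 0<c
    0<q : 0ℚ < q
    0<q = recip-pos 0<N

    private
      t = (+ 1 / 4) * ((θ * (q * (+ 1 / 8))) * (θ * (q * (+ 1 / 8))))
      0<θq/8 = *-pos 0<θ (*-pos 0<q (ℚₚ.positive⁻¹ (+ 1 / 8)))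
      0<t : 0ℚ < t
      0<t = *-pos (ℚₚ.positive⁻¹ (+ 1 / 4)) (*-pos 0<θq/8 0<θq/8)

    0<tolerance : 0ℚ < tolerance
    0<tolerance = *-pos (ℚₚ.positive⁻¹ ½) 0<t

    tolerance< : tolerance < t
    tolerance< = subst (tolerance <_) (ℚₚ.*-identityˡ t) (ℚₚ.*-monoˡ-<-pos t {{positive 0<t}} {½} {1ℚ} (ℚₚ.positive⁻¹ ½ ∋′ ½<1))
      where
      _∋′_ : ∀ {A B : Set} → A → B → B
      _ ∋′ b = b
      ½<1 : ½ < 1ℚ
      ½<1 = subst (½ <_) (refl {x = 1ℚ}) (ℚₚ.+-monoʳ-< ½ (ℚₚ.positive⁻¹ ½))

    θN≤½ : θ * N ≤ ½
    θN≤½ = begin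
      θ * N                       ≡⟨ trans (sym (ℚₚ.*-identityʳ (θ * N))) (ring θ N) ⟩
      ½ * (θ * ((1ℚ + 1ℚ) * (N * 1ℚ)))   ≤⟨ ℚₚ.*-monoˡ-≤-nonNeg ½ (ℚₚ.*-monoˡ-≤-nonNeg θ {{nonNegative (ℚₚ.<⇒≤ 0<θ)}} bound) ⟩
      ½ * (θ * c)                 ≡⟨ cong (½ *_) (recip-inverseˡ 0<c) ⟩
      ½ * 1ℚ                      ≡⟨ ℚₚ.*-identityʳ ½ ⟩
      ½ ∎
      where
      open ℚₚ.≤-Reasoning
      open +-*-Solver
      ring : ∀ a b → a * b * 1ℚ ≡ ½ * (a * ((1ℚ + 1ℚ) * (b * 1ℚ)))
      ring = solve 2 (λ a b → a :* b :* con 1ℚ := con ½ :* (a :* ((con 1ℚ :+ con 1ℚ) :* (b :* con 1ℚ)))) refl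
      1≤2W : 1ℚ ≤ (1ℚ + 1ℚ) * W
      1≤2W = ℚₚ.≤-trans (ℚₚ.<⇒≤ (subst (_< 1ℚ + 1ℚ) (ℚₚ.+-identityʳ 1ℚ) (ℚₚ.+-monoʳ-< 1ℚ (ℚₚ.positive⁻¹ 1ℚ))))
        (ℚₚ.*-monoˡ-≤-nonNeg (1ℚ + 1ℚ) 1≤W)
      bound : (1ℚ + 1ℚ) * (N * 1ℚ) ≤ c
      bound = *-mono-≤-nn (*-nonNeg (ℚₚ.<⇒≤ 0<N) 0≤1) (ℚₚ.<⇒≤ 0<2+K)
        (ℚₚ.≤-trans (ℚₚ.≤-reflexive (sym (ℚₚ.+-identityʳ (1ℚ + 1ℚ)))) (ℚₚ.+-monoʳ-≤ (1ℚ + 1ℚ) (ℚₚ.<⇒≤ 0<K)))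
        (ℚₚ.*-monoˡ-≤-nonNeg N {{nonNegative (ℚₚ.<⇒≤ 0<N)}} 1≤2W)

    θ≤½q : θ ≤ ½ * q
    θ≤½q = subst₂ _≤_ (trans (ℚₚ.*-assoc θ N q) (trans (cong (θ *_) (recip-inverseʳ 0<N)) (ℚₚ.*-identityʳ θ))) refl
      (ℚₚ.*-monoʳ-≤-nonNeg q {{nonNegative (ℚₚ.<⇒≤ 0<q)}} θN≤½)

    private
      half-W : ∀ a → a * ((1ℚ + 1ℚ) * W) ≡ 1ℚ → a ≡ ½ * recip W
      half-W a eq = begin
        a                                        ≡⟨ trans (sym (ℚₚ.*-identityʳ a)) (cong (a *_) (sym (recip-inverseʳ 0<W))) ⟩
        a * (W * recip W)                        ≡⟨ ring a W (recip W) ⟩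
        (a * ((1ℚ + 1ℚ) * W)) * (½ * recip W)    ≡⟨ cong (_* (½ * recip W)) eq ⟩
        1ℚ * (½ * recip W)                       ≡⟨ ℚₚ.*-identityˡ (½ * recip W) ⟩
        ½ * recip W                              ∎
        where
        open ≡-Reasoning
        open +-*-Solver
        ring : ∀ a b r → a * (b * r) ≡ (a * ((1ℚ + 1ℚ) * b)) * (½ * r)
        ring = solve 3 (λ a b r → a :* (b :* r) := (a :* ((con 1ℚ :+ con 1ℚ) :* b)) :* (con ½ :* r)) refl

    budget : ∀ {u L} → 0ℚ ≤ u → u ≤ θ * N → L ≤ N → (u + u) + (L * recip K + K * u) ≤ recip W
    budget {u} {L} 0≤u u≤ L≤N = begin
      (u + u) + (L * recip K + K * u)                     ≡⟨ ring₁ u K (L * recip K) ⟩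
      ((1ℚ + 1ℚ) + K) * u + L * recip K                   ≤⟨ ℚₚ.+-mono-≤ (ℚₚ.*-monoˡ-≤-nonNeg ((1ℚ + 1ℚ) + K) {{nonNegative (ℚₚ.<⇒≤ 0<2+K)}} u≤)
                                                               (ℚₚ.*-monoʳ-≤-nonNeg (recip K) {{nonNegative (ℚₚ.<⇒≤ (recip-pos 0<K))}} L≤N) ⟩
      ((1ℚ + 1ℚ) + K) * (θ * N) + N * recip K             ≡⟨ cong₂ _+_ (half-W (((1ℚ + 1ℚ) + K) * (θ * N)) first) (half-W (N * recip K) second) ⟩
      ½ * recip W + ½ * recip W                           ≡⟨ trans (cong₂ _+_ (ℚₚ.*-comm ½ (recip W)) (ℚₚ.*-comm ½ (recip W))) (halves (recip W)) ⟩
      recip W                                             ∎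
      where
      open ℚₚ.≤-Reasoning
      open +-*-Solver
      ring₁ : ∀ u k b → (u + u) + (b + k * u) ≡ ((1ℚ + 1ℚ) + k) * u + b
      ring₁ = solve 3 (λ u k b → (u :+ u) :+ (b :+ k :* u) := ((con 1ℚ :+ con 1ℚ) :+ k) :* u :+ b) refl
      ring₂ : ∀ k θ n w → k * (θ * n) * w ≡ θ * (k * (n * w))
      ring₂ = solve 4 (λ k θ n w → k :* (θ :* n) :* w := θ :* (k :* (n :* w))) refl
      ring₃ : ∀ n r w → n * r * ((1ℚ + 1ℚ) * w) ≡ r * ((1ℚ + 1ℚ) * (n * w))
      ring₃ = solve 3 (λ n r w → n :* r :* ((con 1ℚ :+ con 1ℚ) :* w) := r :* ((con 1ℚ :+ con 1ℚ) :* (n :* w))) refl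
      first : ((1ℚ + 1ℚ) + K) * (θ * N) * ((1ℚ + 1ℚ) * W) ≡ 1ℚ
      first = trans (ring₂ ((1ℚ + 1ℚ) + K) θ N ((1ℚ + 1ℚ) * W)) (recip-inverseˡ 0<c)
      second : N * recip K * ((1ℚ + 1ℚ) * W) ≡ 1ℚ
      second = trans (ring₃ N (recip K) W) (recip-inverseˡ 0<K)

  module _ {n : ℕ} {S : Set} (Ω : Space S) (x : S → Vec Bool n)
           {N W : ℚ} (N≡ : fromℕℚ (2 ℕ.^ n) ≡ N) (1≤N : 1ℚ ≤ N) (1≤W : 1ℚ ≤ W) where
    open Thresholds N W 1≤N 1≤W

    -- The translates of the most likely value that are still likely form an exact subgroup: by
    -- `sum-popular` the sum of two of them has at least 3/4 of the top probability, which exceeds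
    -- the threshold θ. Modulo this subgroup x is concentrated at one point.
    near-uniform : D₁ Ω x ≤ᵛ tolerance • one → Σ[ m ∈ ℕ ] Σ[ φ ∈ Surjection n m ]
      (H Ω ⟨ ψ φ ∘ x ⟩ ≤ᵛ recip W • one × (n ℕ.∸ m) ×ᵛ log₂ ≤ᵛ 2 ×ᵛ H Ω ⟨ x ⟩)
    near-uniform D₁≤ = codim Q , map Q , entropy-small , dimension-bound
      where
      open NearSubgroup Ω x D₁≤
      open Counting Ω x using (𝔼-recip-≤; 0<mass⇒∈; unique-mass)
      top = argmax (ℙ Ω ⟨ x ⟩) (supp Ω) (supp-nonempty Ω)
      g = proj₁ top
      g∈ = proj₁ (proj₂ top)
      max = proj₂ (proj₂ top)
      pg = p (x g)
      0<pg : 0ℚ < pg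
      0<pg = ℙ-pos Ω ⟨ x ⟩ g∈
      𝔼recip≤N : 𝔼ℚ Ω (λ s → recip (ℙ Ω ⟨ x ⟩ s)) ≤ N
      𝔼recip≤N = subst (λ l → 𝔼ℚ Ω (λ s → recip (ℙ Ω ⟨ x ⟩ s)) ≤ l) (trans (cong fromℕℚ (length-vectors n)) N≡) (𝔼-recip-≤ (vectors n) λ s _ → ∈-vectors (x s))
      q≤pg : q ≤ pg
      q≤pg = recip-≤ 0<N (ℚₚ.≤-trans (ℚₚ.≤-reflexive (sym (recip-inverseʳ 0<pg)))
        (ℚₚ.*-monoˡ-≤-nonNeg pg {{nonNegative (ℚₚ.<⇒≤ 0<pg)}} (ℚₚ.≤-trans (ℚₚ.≤-reflexive (sym (ℚ-≈⇒≡ (ℚ𝔼.𝔼-const Ω (recip pg)))))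
          (ℚₚ.≤-trans (ℚ𝔼.𝔼-mono Ω λ s s∈ → recip-antitone (ℙ-pos Ω ⟨ x ⟩ s∈) (max s s∈)) 𝔼recip≤N))))
      ½pg≤¾pg : ½ * pg ≤ pg * (+ 3 / 4)
      ½pg≤¾pg = ℚₚ.≤-trans (ℚₚ.≤-reflexive (ℚₚ.*-comm ½ pg)) (ℚₚ.*-monoˡ-≤-nonNeg pg {{nonNegative (ℚₚ.<⇒≤ 0<pg)}}
        (ℚₚ.≤-trans (ℚₚ.≤-reflexive (sym (ℚₚ.+-identityʳ ½))) (ℚₚ.+-monoʳ-≤ ½ (ℚₚ.nonNegative⁻¹ (+ 1 / 4)))))
      θ≤½pg : θ ≤ ½ * pg
      θ≤½pg = ℚₚ.≤-trans θ≤½q (ℚₚ.*-monoˡ-≤-nonNeg ½ q≤pg)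
      θ≤¾pg : θ ≤ pg * (+ 3 / 4)
      θ≤¾pg = ℚₚ.≤-trans θ≤½pg ½pg≤¾pg
      θ≤pg : θ ≤ pg
      θ≤pg = ℚₚ.≤-trans θ≤¾pg (ℚₚ.≤-trans (ℚₚ.*-monoˡ-≤-nonNeg pg {{nonNegative (ℚₚ.<⇒≤ 0<pg)}} {+ 3 / 4} {1ℚ}
        (ℚₚ.≤-trans (ℚₚ.≤-reflexive (sym (ℚₚ.+-identityʳ (+ 3 / 4)))) (ℚₚ.+-monoʳ-≤ (+ 3 / 4) (ℚₚ.nonNegative⁻¹ (+ 1 / 4)))))
        (ℚₚ.≤-reflexive (ℚₚ.*-identityʳ pg)))

      popular : Vec Bool n → Bool
      popular v = does (θ ℚₚ.≤? p (v ⊞ x g))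
      popular⇒ : ∀ v → popular v ≡ true → θ ≤ p (v ⊞ x g)
      popular⇒ v = does-true (θ ℚₚ.≤? p (v ⊞ x g))
      witness : ∀ v → popular v ≡ true → Σ[ s ∈ S ] (s ∈ supp Ω × x s ≡ v ⊞ x g)
      witness v e = 0<mass⇒∈ (ℚₚ.<-≤-trans 0<θ (popular⇒ v e))
      sum-large : ∀ u v → popular u ≡ true → popular v ≡ true → pg * (+ 3 / 4) ≤ p ((u ⊞ v) ⊞ x g)
      sum-large u v u∈ v∈ with witness u u∈ | witness v v∈
      ... | a , a∈ , xa≡ | b , b∈ , xb≡ = subst (λ y → pg * (+ 3 / 4) ≤ p y)
        (trans (cong₂ (λ y z → y ⊞ (z ⊞ x g)) xb≡ xa≡) (trans (cong ((v ⊞ x g) ⊞_) (⊞-cancelʳ u (x g)))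
          (trans (⊞-comm (v ⊞ x g) u) (sym (⊞-assoc u v (x g))))))
        (sum-popular 0<θ 0<q tolerance< a b g a∈ b∈ q≤pg (subst (λ y → θ ≤ p y) (sym xa≡) (popular⇒ u u∈))
          (subst (λ y → θ ≤ p y) (sym xb≡) (popular⇒ v v∈)))
      𝟎-popular : popular 𝟎 ≡ true
      𝟎-popular = dec-true (θ ℚₚ.≤? p (𝟎 ⊞ x g)) (subst (λ y → θ ≤ p y) (sym (⊞-identityˡ (x g))) θ≤pg)
      K̂ : Subgroup n
      K̂ = record { member = popular ; zero∈ = 𝟎-popular
        ; sum∈ = λ u v u∈ v∈ → dec-true (θ ℚₚ.≤? p ((u ⊞ v) ⊞ x g)) (ℚₚ.≤-trans θ≤¾pg (sum-large u v u∈ v∈)) }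
      Q = quotient-by K̂
      φ = map Q

      u : ℚ
      u = 𝔼ℚ Ω (λ s → 𝟙 (not (does (ψ φ (x s) ≟ ψ φ (x g)))))
      -- A point whose image differs from that of the mode is unpopular, so 1 ≤ θ/ℙ there, while 1/ℙ
      -- has mean at most N.
      u≤ : u ≤ θ * N
      u≤ = ℚₚ.≤-trans (ℚ𝔼.𝔼-mono Ω pointwise) (ℚₚ.≤-trans (ℚₚ.≤-reflexive (ℚ𝔼.*-distˡ Ω θ _))
        (ℚₚ.*-monoˡ-≤-nonNeg θ {{nonNegative (ℚₚ.<⇒≤ 0<θ)}} 𝔼recip≤N))
        where
        pointwise : ∀ s → s ∈ supp Ω → 𝟙 (not (does (ψ φ (x s) ≟ ψ φ (x g)))) ≤ θ * recip (ℙ Ω ⟨ x ⟩ s)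
        pointwise s s∈ with ψ φ (x s) ≟ ψ φ (x g)
        ... | yes _ = *-nonNeg (ℚₚ.<⇒≤ 0<θ) (ℚₚ.<⇒≤ (recip-pos (ℙ-pos Ω ⟨ x ⟩ s∈)))
        ... | no ≢ = subst (_≤ θ * recip (ℙ Ω ⟨ x ⟩ s)) (recip-inverseʳ (ℙ-pos Ω ⟨ x ⟩ s∈))
            (ℚₚ.*-monoʳ-≤-nonNeg (recip (ℙ Ω ⟨ x ⟩ s)) {{nonNegative (ℚₚ.<⇒≤ (recip-pos (ℙ-pos Ω ⟨ x ⟩ s∈)))}} (ℚₚ.<⇒≤ (ℚₚ.≰⇒> rare)))
          where
          rare : ¬ (θ ≤ ℙ Ω ⟨ x ⟩ s)
          rare le = ≢ (trans (sym (⊞-cancelʳ (ψ φ (x s)) (ψ φ (x g)))) (trans (cong (_⊞ ψ φ (x g))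
            (trans (sym (ψ-hom φ (x s) (x g))) (kills Q (x s ⊞ x g) (dec-true (θ ℚₚ.≤? p ((x s ⊞ x g) ⊞ x g))
              (subst (λ y → θ ≤ p y) (sym (⊞-cancelʳ (x s) (x g))) le))))) (⊞-identityˡ (ψ φ (x g)))))
      0≤u : 0ℚ ≤ u
      0≤u = ℚ𝔼.𝔼-nonNeg Ω λ s _ → 𝟙-nonNeg (not (does (ψ φ (x s) ≟ ψ φ (x g))))
      L≤N : fromℕℚ (length (vectors (codim Q))) ≤ N
      L≤N = subst (fromℕℚ (length (vectors (codim Q))) ≤_) N≡ (fromℕℚ-mono (subst (ℕ._≤ 2 ℕ.^ n) (sym (length-vectors (codim Q))) (ℕₚ.^-monoʳ-≤ 2 (m≤n φ))))
      entropy-small : H Ω ⟨ ψ φ ∘ x ⟩ ≤ᵛ recip W • one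
      entropy-small = ≤ᵛ-trans (Counting.concentrated-entropy Ω (ψ φ ∘ x) (vectors (codim Q)) (λ s _ → ∈-vectors (ψ φ (x s))) (ψ φ (x g)) K 0<K
        (ℚₚ.≤-trans u≤ θN≤½)) (•-monoˡ 0≤one (budget 0≤u u≤ L≤N))

      j = n ℕ.∸ codim Q
      shifted-kernel = List.map (_⊞ x g) (kernel Q)
      -- Each v in the subgroup is the sum v + 𝟎 of popular vectors, so its translate of the mode
      -- has mass at least 3/4 of pg and not merely θ. This frees the size bound from any dependence
      -- on n.
      kernel-mass : fromℕℚ (2 ℕ.^ j) * (pg * (+ 3 / 4)) ≤ 1ℚ
      kernel-mass = subst (λ l → fromℕℚ l * (pg * (+ 3 / 4)) ≤ 1ℚ) (trans (Listₚ.length-map (_⊞ x g) (kernel Q)) (kernel-length Q))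
        (unique-mass shifted-kernel (pg * (+ 3 / 4))
          (Uniqueₚ.map⁺ (λ {a} {b} e → trans (sym (⊞-cancelʳ a (x g))) (trans (cong (_⊞ x g) e) (⊞-cancelʳ b (x g)))) (kernel-unique Q))
          (Allₚ.map⁺ (All.map (λ {v} v∈ → subst (λ y → pg * (+ 3 / 4) ≤ p (y ⊞ x g)) (⊞-identityʳ v) (sum-large v 𝟎 v∈ 𝟎-popular)) (kernel∈ Q))))
      min-entropy : -ᵛ log pg ≤ᵛ H Ω ⟨ x ⟩
      min-entropy = ≤ᵛ-trans (proj₂ (𝔼-const Ω _)) (𝔼-mono Ω λ s s∈ → -ᵛ-mono (log-mono (ℙ-pos Ω ⟨ x ⟩ s∈) (max s s∈)))
      -- With y = 2 ^ j and z = 3y/4, y ≥ 2 gives y ≤ z², and z · pg ≤ 1, so log y ≤ 2 log z ≤ - 2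
      -- log pg ≤ 2 H(x). The factor 2 absorbs 4/3; for j = 0 one has y = 1 and argues apart.
      bound : ∀ j → fromℕℚ (2 ℕ.^ j) * (pg * (+ 3 / 4)) ≤ 1ℚ → j ×ᵛ log₂ ≤ᵛ 2 ×ᵛ H Ω ⟨ x ⟩
      bound zero    _ = ≤ᵛ-trans (proj₁ (•-zeroˡ log₂)) (•-nonNeg (fromℕℚ-nonNeg 2) (H-nonNeg Ω ⟨ x ⟩))
      bound (suc j) mass≤1 = ≤ᵛ-trans (proj₂ (log-2^ (suc j)))
        (linear (log y ∷ log z ∷ log pg ∷ H Ω ⟨ x ⟩ ∷ -ᵛ log pg ∷ log (z * z) ∷ log (z * pg) ∷ []) v₀ (2 ⊛ v₃)
          (1 · v₀ ≦ v₅ ∵ log-mono 0<y y≤z² ∷ 1 · v₅ ≦ v₁ ⊹ v₁ ∵ proj₁ (log-* 0<z 0<z) ∷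
           2 · v₁ ⊹ v₂ ≦ v₆ ∵ proj₂ (log-* 0<z 0<pg) ∷
           2 · v₆ ≦ 𝕠 ∵ p≤1⇒log≤0 (*-pos 0<z 0<pg) (subst (_≤ 1ℚ) (ring₁ y pg) mass≤1) ∷
           2 · v₄ ≦ v₃ ∵ min-entropy ∷ 2 · 𝕠 ≦ v₂ ⊹ v₄ ∵ proj₂ (+ᵛ-inverseʳ _) ∷ []))
        where
        open +-*-Solver using (solve; _:*_; _:=_; con)
        y z : ℚ
        y = fromℕℚ (2 ℕ.^ suc j)
        z = y * (+ 3 / 4)
        0<y = fromℕℚ-pos (2 ℕ.^ suc j) (ℕₚ.m^n>0 2 (suc j))
        0<z = *-pos 0<y (ℚₚ.positive⁻¹ (+ 3 / 4))
        ring₁ : ∀ y p → y * (p * (+ 3 / 4)) ≡ y * (+ 3 / 4) * p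
        ring₁ = solve 2 (λ y p → y :* (p :* con (+ 3 / 4)) := y :* con (+ 3 / 4) :* p) refl
        ring₂ : ∀ y → y * (+ 9 / 16) * y ≡ y * (+ 3 / 4) * (y * (+ 3 / 4))
        ring₂ = solve 1 (λ y → y :* con (+ 9 / 16) :* y := y :* con (+ 3 / 4) :* (y :* con (+ 3 / 4))) refl
        2≤y : fromℕℚ 2 ≤ y
        2≤y = fromℕℚ-mono (ℕₚ.≤-trans (ℕₚ.≤-reflexive (sym (ℕₚ.*-identityʳ 2))) (ℕₚ.*-monoʳ-≤ 2 (ℕₚ.m^n>0 2 j)))
        y≤z² : y ≤ z * z
        y≤z² = subst₂ _≤_ (ℚₚ.*-identityˡ y) (ring₂ y) (ℚₚ.*-monoʳ-≤-nonNeg y {{nonNegative (ℚₚ.<⇒≤ 0<y)}}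
          (ℚₚ.≤-trans 1≤9/8 (ℚₚ.*-monoʳ-≤-nonNeg (+ 9 / 16) 2≤y)))
          where
          1≤9/8 : 1ℚ ≤ fromℕℚ 2 * (+ 9 / 16)
          1≤9/8 = ℚₚ.≤-trans (ℚₚ.≤-reflexive (sym (ℚₚ.+-identityʳ 1ℚ))) (ℚₚ.+-monoʳ-≤ 1ℚ (ℚₚ.nonNegative⁻¹ (+ 1 / 8)))
      dimension-bound : j ×ᵛ log₂ ≤ᵛ 2 ×ᵛ H Ω ⟨ x ⟩
      dimension-bound = bound j kernel-mass

  NearSubspace : (n w : ℕ) → ℚ → Set₁
  NearSubspace n w ε = ∀ {S} (Ω : Space S) (x : S → Vec Bool n) → D₁ Ω x ≤ᵛ ε • one →
    Σ[ m ∈ ℕ ] Σ[ φ ∈ Surjection n m ] (w ×ᵛ H Ω ⟨ ψ φ ∘ x ⟩ ≤ᵛ one × (n ℕ.∸ m) ×ᵛ log₂ ≤ᵛ 2 ×ᵛ H Ω ⟨ x ⟩)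

  abstract
    near-subspace : ∀ n w → 1 ℕ.≤ w → Σ[ ε ∈ ℚ ] (0ℚ < ε × NearSubspace n w ε)
    near-subspace n w 1≤w = tolerance , 0<tolerance , λ Ω x D₁≤ → wrap Ω x (near-uniform Ω x refl 1≤N 1≤W D₁≤)
      where
      1≤N : 1ℚ ≤ fromℕℚ (2 ℕ.^ n)
      1≤N = fromℕℚ-mono {1} {2 ℕ.^ n} (ℕₚ.m^n>0 2 n)
      1≤W : 1ℚ ≤ fromℕℚ w
      1≤W = fromℕℚ-mono {1} {w} 1≤w
      open Thresholds (fromℕℚ (2 ℕ.^ n)) (fromℕℚ w) 1≤N 1≤W
      wrap : ∀ {S} (Ω : Space S) (x : S → Vec Bool n) →
        Σ[ m ∈ ℕ ] Σ[ φ ∈ Surjection n m ] (H Ω ⟨ ψ φ ∘ x ⟩ ≤ᵛ recip (fromℕℚ w) • one × (n ℕ.∸ m) ×ᵛ log₂ ≤ᵛ 2 ×ᵛ H Ω ⟨ x ⟩) →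
        Σ[ m ∈ ℕ ] Σ[ φ ∈ Surjection n m ] (w ×ᵛ H Ω ⟨ ψ φ ∘ x ⟩ ≤ᵛ one × (n ℕ.∸ m) ×ᵛ log₂ ≤ᵛ 2 ×ᵛ H Ω ⟨ x ⟩)
      wrap Ω x (m , φ , small , dim) = m , φ , ≤ᵛ-trans (×ᵛ-mono w small) (proj₁ (•-recip-cancel (fromℕℚ-pos w 1≤w) one)) , dim

  module _ {n : ℕ} {S₀ : Set} (Ω₀ : Space S₀) (x₀ : S₀ → Vec Bool n) where
    open Relative Ω₀ x₀

    module _ {S : Set} (Ω : Space S) (x : S → Vec Bool n) where
      H-≤-h₀+R₁ : H Ω ⟨ x ⟩ ≤ᵛ h₀ +ᵛ R₁ Ω x
      H-≤-h₀+R₁ = linear (H Ω ⟨ x ⟩ ∷ h₀ ∷ H Λ ⟨ (λ (r , s) → x₀ r ⊞ x s) ⟩ ∷ H Λ (⟨ x₀ ⟩ ⊠ ⟨ x ⟩) ∷ H Λ (⟨ x₀ ⟩ ∘ʳ proj₁) ∷ [])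
        v₀ (v₁ ⊹ (2 ⊛ v₂ ⊝ v₀ ⊝ v₁))
        (2 · v₃ ≦ v₂ ⊹ v₄ ∵ subadditive Λ ⟨ (λ (r , s) → x₀ r ⊞ x s) ⟩ (⟨ x₀ ⟩ ∘ʳ proj₁) (⟨ x₀ ⟩ ⊠ ⟨ x ⟩)
           (det (λ (y , a) → a , a ⊞ y) λ (r , s) → cong (x₀ r ,_) (sym (⊞-cancelˡ (x₀ r) (x s)))) ∷
         2 · v₁ ⊹ v₀ ≦ v₃ ∵ proj₂ (H-⊗ Ω₀ Ω ⟨ x₀ ⟩ ⟨ x ⟩) ∷
         2 · v₄ ≦ v₁ ∵ proj₁ (mp-H (mp-proj₁ Ω₀ (λ _ → Ω)) ⟨ x₀ ⟩) ∷ [])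
        where Λ = Ω₀ ⊗ Ω

      -- A homomorphism does not increase the Ruzsa distance: 2 H(ψ(x₀ + x)) - H(ψ x₀) - H(ψ x) ≤
      -- R₁, by submodularity twice. Moreover H(ψ x₀) ≤ H(ψ(x₀ + x)).
      H-ψ-≤ : ∀ {m} (φ : Surjection n m) → H Ω₀ ⟨ ψ φ ∘ x₀ ⟩ ≤ᵛ R₁ Ω x +ᵛ H Ω ⟨ ψ φ ∘ x ⟩
      H-ψ-≤ φ = linear
        (H Ω₀ ⟨ ψ φ ∘ x₀ ⟩ ∷ H Ω ⟨ ψ φ ∘ x ⟩ ∷ h₀ ∷ H Ω ⟨ x ⟩ ∷ H Λ sum ∷ H Λ (⟨ x₀ ⟩ ⊠ ⟨ ψ φ ∘ x ⟩) ∷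
         H Λ (⟨ ψ φ ∘ x₀ ⟩ ⊠ ⟨ x ⟩) ∷ H Λ ψsum ∷ H Λ (⟨ x₀ ⟩ ⊠ ⟨ x ⟩) ∷ H Λ (⟨ ψ φ ∘ x₀ ⟩ ⊠ ⟨ ψ φ ∘ x ⟩) ∷ H Λ (⟨ ψ φ ∘ x ⟩ ∘ʳ proj₂) ∷ [])
        v₀ ((2 ⊛ v₄ ⊝ v₃ ⊝ v₂) ⊹ v₁)
        (1 · v₈ ⊹ v₇ ≦ v₄ ⊹ v₅ ∵ submodular Λ sum (⟨ x₀ ⟩ ⊠ ⟨ ψ φ ∘ x ⟩) ψsum (⟨ x₀ ⟩ ⊠ ⟨ x ⟩)
            (det-refl (ψ φ)) (det (λ (a , b) → ψ φ a ⊞ b) λ (r , s) → ψ-hom φ (x₀ r) (x s))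
            (det (λ (y , a , _) → a , a ⊞ y) λ (r , s) → cong (x₀ r ,_) (sym (⊞-cancelˡ (x₀ r) (x s)))) ∷
         1 · v₈ ⊹ v₇ ≦ v₄ ⊹ v₆ ∵ submodular Λ sum (⟨ ψ φ ∘ x₀ ⟩ ⊠ ⟨ x ⟩) ψsum (⟨ x₀ ⟩ ⊠ ⟨ x ⟩)
            (det-refl (ψ φ)) (det (λ (a , b) → a ⊞ ψ φ b) λ (r , s) → ψ-hom φ (x₀ r) (x s))
            (det (λ (y , _ , b) → y ⊞ b , b) λ (r , s) → cong (_, x s) (sym (⊞-cancelʳ (x₀ r) (x s)))) ∷
         2 · v₂ ⊹ v₃ ≦ v₈ ∵ proj₂ (H-⊗ Ω₀ Ω ⟨ x₀ ⟩ ⟨ x ⟩) ∷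
         1 · v₅ ≦ v₂ ⊹ v₁ ∵ proj₁ (H-⊗ Ω₀ Ω ⟨ x₀ ⟩ ⟨ ψ φ ∘ x ⟩) ∷
         1 · v₆ ≦ v₀ ⊹ v₃ ∵ proj₁ (H-⊗ Ω₀ Ω ⟨ ψ φ ∘ x₀ ⟩ ⟨ x ⟩) ∷
         2 · v₉ ≦ v₇ ⊹ var 10 ∵ subadditive Λ ψsum (⟨ ψ φ ∘ x ⟩ ∘ʳ proj₂) (⟨ ψ φ ∘ x₀ ⟩ ⊠ ⟨ ψ φ ∘ x ⟩)
            (det (λ (y , b) → y ⊞ b , b) λ (r , s) → cong (_, ψ φ (x s)) (sym (trans (cong (_⊞ ψ φ (x s)) (ψ-hom φ (x₀ r) (x s))) (⊞-cancelʳ (ψ φ (x₀ r)) (ψ φ (x s)))))) ∷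
         2 · v₀ ⊹ v₁ ≦ v₉ ∵ proj₂ (H-⊗ Ω₀ Ω ⟨ ψ φ ∘ x₀ ⟩ ⟨ ψ φ ∘ x ⟩) ∷
         2 · var 10 ≦ v₁ ∵ proj₁ (mp-H (mp-proj₂ Ω₀ Ω) ⟨ ψ φ ∘ x ⟩) ∷ [])
        where
        Λ = Ω₀ ⊗ Ω
        sum ψsum : RV (S₀ × S)
        sum = ⟨ (λ (r , s) → x₀ r ⊞ x s) ⟩
        ψsum = ⟨ (λ (r , s) → ψ φ (x₀ r ⊞ x s)) ⟩

    private
      k = D₁ Ω₀ x₀

    -- κ = h₀/100.
    halve-entropy : ¬ (h₀ ≤ᵛ 50 ×ᵛ k) → ¬ ¬ (Σ[ m ∈ ℕ ] Σ[ φ ∈ Surjection n m ]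
      (2 ×ᵛ H Ω₀ ⟨ ψ φ ∘ x₀ ⟩ ≤ᵛ h₀ × (n ℕ.∸ m) ×ᵛ log₂ ≤ᵛ 5 ×ᵛ h₀))
    halve-entropy h₀≰50k none = archimedes κ≰0 use-w
      where
      0<100 = fromℕℚ-pos 100 (s≤s z≤n)
      κ : Carrier
      κ = recip (fromℕℚ 100) • h₀
      h₀≈ : 100 ×ᵛ κ ≈ᵛ h₀
      h₀≈ = •-recip-cancel 0<100 h₀
      0≤k : 0ᵛ ≤ᵛ k
      0≤k = D₁-nonNeg Ω₀ x₀
      50k≤h₀ : 50 ×ᵛ k ≤ᵛ h₀
      50k≤h₀ = ≰⇒≥ h₀≰50k
      κ≰0 : ¬ (κ ≤ᵛ 0ᵛ)
      κ≰0 κ≤0 = h₀≰50k (linear (κ ∷ h₀ ∷ k ∷ []) v₁ (50 ⊛ v₂)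
        (100 · v₀ ≦ 𝕠 ∵ κ≤0 ∷ 1 · v₁ ≦ 100 ⊛ v₀ ∵ proj₂ h₀≈ ∷ 50 · 𝕠 ≦ v₂ ∵ 0≤k ∷ []))
      0≤κ : 0ᵛ ≤ᵛ κ
      0≤κ = ≰⇒≥ κ≰0
      k≤2κ : k ≤ᵛ 2 ×ᵛ κ
      k≤2κ = •-cancel-≤ (fromℕℚ-pos 50 (s≤s z≤n)) (linear (κ ∷ h₀ ∷ k ∷ []) (50 ⊛ v₂) (50 ⊛ 2 ⊛ v₀)
        (1 · 50 ⊛ v₂ ≦ v₁ ∵ 50k≤h₀ ∷ 1 · v₁ ≦ 100 ⊛ v₀ ∵ proj₂ h₀≈ ∷ []))
      use-w : ¬ (Σ[ w ∈ ℕ ] one ≤ᵛ w ×ᵛ κ)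
      use-w (zero  , one≤) = one≰0 (≤ᵛ-trans one≤ (proj₁ (•-zeroˡ κ)))
      use-w (suc w′ , one≤) = small-family Ω₀ x₀ δ≰0 X₀ λ (X , D≤δ , τ≤) → use-family X D≤δ τ≤
        where
        w = suc w′
        sub = near-subspace n w (s≤s z≤n)
        ε = proj₁ sub
        0<ε = proj₁ (proj₂ sub)
        bound : Σ[ b ∈ ℕ ] (18 ×ᵛ k +ᵛ κ ≤ᵛ b ×ᵛ one)
        bound = bounded (18 ×ᵛ k +ᵛ κ)
        b = proj₁ bound
        big : Σ[ m ∈ ℕ ] (fromℕℚ b * recip ε ≤ fromℕℚ m)
        big = archimedean (fromℕℚ b * recip ε)
        -- M ε is at least b, a bound for the right-hand side of the endgame, so that the weight M
        -- forces D₁ ≤ ε.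
        M = suc (proj₁ big)
        0<M = fromℕℚ-pos M (s≤s z≤n)
        b≤Mε : fromℕℚ b ≤ fromℕℚ M * ε
        b≤Mε = subst (_≤ fromℕℚ M * ε) (trans (ℚₚ.*-assoc (fromℕℚ b) (recip ε) ε) (trans (cong (fromℕℚ b *_) (recip-inverseˡ 0<ε)) (ℚₚ.*-identityʳ (fromℕℚ b))))
          (ℚₚ.*-monoʳ-≤-nonNeg ε {{nonNegative (ℚₚ.<⇒≤ 0<ε)}} (ℚₚ.≤-trans (proj₂ big) (fromℕℚ-mono (ℕₚ.n≤1+n (proj₁ big)))))
        -- The endgame costs M · 3 I + 3 D with I ≤ 2δ and D ≤ δ. With δ = κ/(6M + 3) this is at
        -- most κ.
        c = M ℕ.* 6 ℕ.+ 3
        0<c = fromℕℚ-pos c (ℕₚ.≤-trans (s≤s z≤n) (ℕₚ.m≤n+m 3 (M ℕ.* 6)))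
        δ : Carrier
        δ = recip (fromℕℚ c) • κ
        cδ : M ×ᵛ 6 ×ᵛ δ +ᵛ 3 ×ᵛ δ ≈ᵛ κ
        cδ = ≈ᵛ-trans (+ᵛ-cong (≈ᵛ-sym (×ᵛ-* M 6 δ)) ≈ᵛ-refl) (≈ᵛ-trans (≈ᵛ-sym (×ᵛ-+ (M ℕ.* 6) 3 δ)) (•-recip-cancel 0<c κ))
        δ≰0 : ¬ (δ ≤ᵛ 0ᵛ)
        δ≰0 δ≤0 = κ≰0 (≤ᵛ-trans (proj₂ (•-recip-cancel 0<c κ)) (≤ᵛ-trans (×ᵛ-mono c δ≤0) (proj₁ (•-zeroʳ (fromℕℚ c)))))
        X₀ : Family n
        X₀ = single Ω₀ x₀
        -- For x₀ relative to itself D = k and R = 2k, whence 16 + 2 = 18.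
        τX₀ : τ X₀ ≤ᵛ 18 ×ᵛ k
        τX₀ = linear (D X₀ ∷ R X₀ ∷ H (Ω₀ ⊗ Ω₀) ⟨ (λ (s , t) → x₀ s ⊞ x₀ t) ⟩ ∷ h₀ ∷ []) (16 ⊛ v₀ ⊹ v₁) (18 ⊛ (v₂ ⊝ v₃))
          (16 · v₀ ≦ v₂ ⊝ v₃ ∵ proj₁ (D-single Ω₀ x₀) ∷ 1 · v₁ ≦ 2 ⊛ v₂ ⊝ v₃ ⊝ v₃ ∵ proj₁ (R-single Ω₀ x₀) ∷ [])
        use-family : ∀ X → D X ≤ᵛ δ → τ X ≤ᵛ τ X₀ → ⊥
        use-family X@(family Ω x z) D≤δ τ≤ = St.endgame M λ (Ω′ , x′ , le) → finish Ω′ x′ le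
          where
          module St = Step Ω x z
          R≤ : R X ≤ᵛ 18 ×ᵛ k
          R≤ = linear (D X ∷ R X ∷ τ X₀ ∷ k ∷ []) v₁ (18 ⊛ v₃)
            (1 · 16 ⊛ v₀ ⊹ v₁ ≦ v₂ ∵ τ≤ ∷ 1 · v₂ ≦ 18 ⊛ v₃ ∵ τX₀ ∷ 16 · 𝕠 ≦ v₀ ∵ D-nonNeg X ∷ [])
          I≤ : 3 ×ᵛ St.I ≤ᵛ 6 ×ᵛ δ
          I≤ = linear (D X ∷ D St.X⁺ ∷ D St.X∣ ∷ δ ∷ []) (3 ⊛ (2 ⊛ v₀ ⊝ v₁ ⊝ v₂)) (6 ⊛ v₃)
            (6 · v₀ ≦ v₃ ∵ D≤δ ∷ 3 · 𝕠 ≦ v₁ ∵ D-nonNeg St.X⁺ ∷ 3 · 𝕠 ≦ v₂ ∵ D-nonNeg St.X∣ ∷ [])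
          finish : ∀ {S} (Ω′ : Space S) x′ → M ×ᵛ D₁ Ω′ x′ +ᵛ R₁ Ω′ x′ ≤ᵛ M ×ᵛ 3 ×ᵛ St.I +ᵛ (R X +ᵛ 3 ×ᵛ D X) → ⊥
          finish Ω′ x′ le = conclude (proj₂ (proj₂ sub) Ω′ x′ D₁≤ε)
            where
            total≤ : M ×ᵛ D₁ Ω′ x′ +ᵛ R₁ Ω′ x′ ≤ᵛ 18 ×ᵛ k +ᵛ κ
            total≤ = linear (M ×ᵛ D₁ Ω′ x′ ∷ R₁ Ω′ x′ ∷ k ∷ κ ∷ M ×ᵛ 3 ×ᵛ St.I ∷ R X ∷ D X ∷ M ×ᵛ 6 ×ᵛ δ ∷ δ ∷ []) (v₀ ⊹ v₁) (18 ⊛ v₂ ⊹ v₃)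
              (1 · v₀ ⊹ v₁ ≦ v₄ ⊹ (v₅ ⊹ 3 ⊛ v₆) ∵ le ∷ 1 · v₄ ≦ v₇ ∵ ×ᵛ-mono M I≤ ∷ 1 · v₅ ≦ 18 ⊛ v₂ ∵ R≤ ∷ 3 · v₆ ≦ v₈ ∵ D≤δ ∷
               1 · v₇ ⊹ 3 ⊛ v₈ ≦ v₃ ∵ proj₁ cδ ∷ [])
            R₁≤ : R₁ Ω′ x′ ≤ᵛ 18 ×ᵛ k +ᵛ κ
            R₁≤ = linear (M ×ᵛ D₁ Ω′ x′ ∷ R₁ Ω′ x′ ∷ 18 ×ᵛ k +ᵛ κ ∷ []) v₁ v₂
              (1 · v₀ ⊹ v₁ ≦ v₂ ∵ total≤ ∷ 1 · 𝕠 ≦ v₀ ∵ •-nonNeg (fromℕℚ-nonNeg M) (D₁-nonNeg Ω′ x′) ∷ [])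
            D₁≤ε : D₁ Ω′ x′ ≤ᵛ ε • one
            D₁≤ε = •-cancel-≤ 0<M (≤ᵛ-trans (linear (M ×ᵛ D₁ Ω′ x′ ∷ R₁ Ω′ x′ ∷ 18 ×ᵛ k +ᵛ κ ∷ b ×ᵛ one ∷ []) v₀ v₃
                (1 · v₀ ⊹ v₁ ≦ v₂ ∵ total≤ ∷ 1 · 𝕠 ≦ v₁ ∵ R₁-nonNeg Ω′ x′ ∷ 1 · v₂ ≦ v₃ ∵ proj₂ bound ∷ []))
              (≤ᵛ-trans (•-monoˡ 0≤one b≤Mε) (proj₁ (•-assoc (fromℕℚ M) ε one))))
            conclude : ¬ (Σ[ m ∈ ℕ ] Σ[ φ ∈ Surjection n m ] (w ×ᵛ H Ω′ ⟨ ψ φ ∘ x′ ⟩ ≤ᵛ one × (n ℕ.∸ m) ×ᵛ log₂ ≤ᵛ 2 ×ᵛ H Ω′ ⟨ x′ ⟩))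
            -- As k ≤ 2κ, R₁ ≤ 18k + κ ≤ 37κ. Then 2 H(ψ x₀) ≤ 2 (37κ + κ) ≤ 100κ = h₀, and (n - m)
            -- log 2 ≤ 2 (100κ + 37κ) ≤ 500κ = 5 h₀; the multiples of 0 ≤ κ fill the remainders.
            conclude (m , φ , wHψ≤ , dim) = none (m , φ ,
                linear (H Ω₀ ⟨ ψ φ ∘ x₀ ⟩ ∷ h₀ ∷ R₁ Ω′ x′ ∷ H Ω′ ⟨ ψ φ ∘ x′ ⟩ ∷ k ∷ κ ∷ []) (2 ⊛ v₀) v₁
                  (2 · v₀ ≦ v₂ ⊹ v₃ ∵ H-ψ-≤ Ω′ x′ φ ∷ 2 · v₂ ≦ 18 ⊛ v₄ ⊹ v₅ ∵ R₁≤ ∷ 2 · v₃ ≦ v₅ ∵ Hψ≤κ ∷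
                   36 · v₄ ≦ 2 ⊛ v₅ ∵ k≤2κ ∷ 24 · 𝕠 ≦ v₅ ∵ 0≤κ ∷ 1 · 100 ⊛ v₅ ≦ v₁ ∵ proj₁ h₀≈ ∷ []) ,
                linear ((n ℕ.∸ m) ×ᵛ log₂ ∷ H Ω′ ⟨ x′ ⟩ ∷ R₁ Ω′ x′ ∷ h₀ ∷ k ∷ κ ∷ []) v₀ (5 ⊛ v₃)
                  (1 · v₀ ≦ 2 ⊛ v₁ ∵ dim ∷ 2 · v₁ ≦ v₃ ⊹ v₂ ∵ H-≤-h₀+R₁ Ω′ x′ ∷ 2 · v₂ ≦ 18 ⊛ v₄ ⊹ v₅ ∵ R₁≤ ∷
                   36 · v₄ ≦ 2 ⊛ v₅ ∵ k≤2κ ∷ 3 · 100 ⊛ v₅ ≦ v₃ ∵ proj₁ h₀≈ ∷ 226 · 𝕠 ≦ v₅ ∵ 0≤κ ∷ []))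
              where
              Hψ≤κ : H Ω′ ⟨ ψ φ ∘ x′ ⟩ ≤ᵛ κ
              Hψ≤κ = •-cancel-≤ (fromℕℚ-pos w (s≤s z≤n)) (≤ᵛ-trans wHψ≤ one≤)

  identity-surjection : ∀ n → Surjection n n
  identity-surjection n = record { ψ = id ; ψ-hom = λ _ _ → refl ; section = id ; ψ-section = λ _ → refl
    ; m≤n = ℕₚ.≤-refl ; injective = λ _ _ _ p → p }

  compose-surjection : ∀ {n m l} → Surjection n m → Surjection m l → Surjection n l
  compose-surjection {n} {m} {l} φ χ = record
    { ψ = ψ χ ∘ ψ φ
    ; ψ-hom = λ u v → trans (cong (ψ χ) (ψ-hom φ u v)) (ψ-hom χ (ψ φ u) (ψ φ v))
    ; section = section φ ∘ section χ
    ; ψ-section = λ v → trans (cong (ψ χ) (ψ-section φ (section χ v))) (ψ-section χ v)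
    ; m≤n = ℕₚ.≤-trans (m≤n χ) (m≤n φ)
    ; injective = λ l≡n u v p → let m≡n = ℕₚ.≤-antisym (m≤n φ) (subst (ℕ._≤ m) l≡n (m≤n χ)) in
        injective φ m≡n u v (injective χ (trans l≡n (sym m≡n)) (ψ φ u) (ψ φ v) p) }

  -- A form of Marton's conjecture: modulo a subgroup of size exp O(H x), x does not look like a group.
  structure : ∀ fuel {n S} → n ℕ.≤ fuel → (Ω : Space S) (x : S → Vec Bool n) → ¬ ¬ (Σ[ m ∈ ℕ ] Σ[ φ ∈ Surjection n m ]
    ((n ℕ.∸ m) ×ᵛ log₂ ≤ᵛ 10 ×ᵛ H Ω ⟨ x ⟩ × H Ω ⟨ ψ φ ∘ x ⟩ ≤ᵛ 50 ×ᵛ D₁ Ω (ψ φ ∘ x)))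
  structure fuel {n} n≤ Ω x none = em λ where
      (inj₁ H≤50D) → none (n , identity-surjection n , linear ((n ℕ.∸ n) ×ᵛ log₂ ∷ H Ω ⟨ x ⟩ ∷ []) v₀ (10 ⊛ v₁)
          (1 · v₀ ≦ 𝕠 ∵ proj₁ (≈ᵛ-trans (≡⇒≈ᵛ (cong (_×ᵛ log₂) (ℕₚ.n∸n≡0 n))) (•-zeroˡ log₂)) ∷ 10 · 𝕠 ≦ v₁ ∵ H-nonNeg Ω ⟨ x ⟩ ∷ []) , H≤50D)
      (inj₂ H≰50D) → halve-entropy Ω x H≰50D λ (m , φ , half , dim) → descend fuel n≤ H≰50D m φ half dim
    where
    descend : ∀ fuel → n ℕ.≤ fuel → ¬ (H Ω ⟨ x ⟩ ≤ᵛ 50 ×ᵛ D₁ Ω x) → ∀ m (φ : Surjection n m) →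
      2 ×ᵛ H Ω ⟨ ψ φ ∘ x ⟩ ≤ᵛ H Ω ⟨ x ⟩ → (n ℕ.∸ m) ×ᵛ log₂ ≤ᵛ 5 ×ᵛ H Ω ⟨ x ⟩ → ⊥
    descend fuel n≤ H≰50D m φ half dim with ℕₚ.m≤n⇒m<n∨m≡n (m≤n φ)
    -- An injective φ keeps the entropy, so halving it means H(x) ≤ 0, which contradicts H(x) > 50
    -- D₁ ≥ 0.
    ... | inj₂ m≡n = H≰50D (linear (H Ω ⟨ x ⟩ ∷ H Ω ⟨ ψ φ ∘ x ⟩ ∷ D₁ Ω x ∷ []) v₀ (50 ⊛ v₂)
          (1 · 2 ⊛ v₁ ≦ v₀ ∵ half ∷ 2 · v₀ ≦ v₁ ∵ H-mono Ω ⟨ ψ φ ∘ x ⟩ ⟨ x ⟩ (λ s t → injective φ m≡n (x s) (x t)) ∷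
           50 · 𝕠 ≦ v₂ ∵ D₁-nonNeg Ω x ∷ []))
    descend zero       z≤n H≰50D m φ half dim | inj₁ ()
    descend (suc fuel) n≤  H≰50D m φ half dim | inj₁ m<n =
      structure fuel (ℕₚ.≤-pred (ℕₚ.≤-trans m<n n≤)) Ω (ψ φ ∘ x) λ (l , χ , dim′ , H≤) →
        none (l , compose-surjection φ χ ,
          -- The costs form a geometric series: 5 H(x) now, and 10 H(ψ x) ≤ 5 H(x) for the rest.
          linear ((n ℕ.∸ l) ×ᵛ log₂ ∷ (n ℕ.∸ m) ×ᵛ log₂ ∷ (m ℕ.∸ l) ×ᵛ log₂ ∷ H Ω ⟨ x ⟩ ∷ H Ω ⟨ ψ φ ∘ x ⟩ ∷ []) v₀ (10 ⊛ v₃)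
            (1 · v₀ ≦ v₁ ⊹ v₂ ∵ proj₁ (≈ᵛ-trans (≡⇒≈ᵛ (cong (_×ᵛ log₂) (telescope (m≤n φ) (m≤n χ)))) (×ᵛ-+ (n ℕ.∸ m) (m ℕ.∸ l) log₂)) ∷
             1 · v₁ ≦ 5 ⊛ v₃ ∵ dim ∷ 1 · v₂ ≦ 10 ⊛ v₄ ∵ dim′ ∷ 5 · 2 ⊛ v₄ ≦ v₃ ∵ half ∷ []) ,
          H≤)
      where
      telescope : ∀ {n m l} → m ℕ.≤ n → l ℕ.≤ m → n ℕ.∸ l ≡ (n ℕ.∸ m) ℕ.+ (m ℕ.∸ l)
      telescope {n} {m} {l} m≤n l≤m = trans (cong (ℕ._∸ l) (sym (ℕₚ.m∸n+n≡m m≤n))) (ℕₚ.+-∸-assoc (n ℕ.∸ m) l≤m)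

  -- Random variables on ℤⁿ

  mp-exchange : ∀ {S S′ S″ : Set} (Ω : Space S) (Ω′ : Space S′) (Ω″ : Space S″) →
    MeasurePreserving (Ω ⊗ (Ω′ ⊗ Ω″)) (λ (r , s , t) → s , r , t) (Ω′ ⊗ (Ω ⊗ Ω″))
  mp-exchange Ω Ω′ Ω″ .law .transfer M g = M.≈ᵛ-trans (E.𝔼->>= Ω (λ _ → Ω′ ⊗ Ω″) _)
    (M.≈ᵛ-trans (E.𝔼-cong Ω λ r _ → E.𝔼->>= Ω′ (λ _ → Ω″) _)
    (M.≈ᵛ-trans (E.𝔼-swap Ω Ω′ (λ r s → E.𝔼 Ω″ λ t → g (s , r , t)))
    (M.≈ᵛ-sym (M.≈ᵛ-trans (E.𝔼->>= Ω′ (λ _ → Ω ⊗ Ω″) g) (E.𝔼-cong Ω′ λ s _ → E.𝔼->>= Ω (λ _ → Ω″) _)))))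
    where module M = OrderedModule M
          module E = Expectation M

  module _ {r : ℕ} where
    private Z = Vec ℤ r

    -- Twice the Ruzsa distance between x and −y.
    δ : ∀ {S S′} → Space S → (S → Z) → Space S′ → (S′ → Z) → Carrier
    δ Ω x Ω′ y = 2 ×ᵛ H (Ω ⊗ Ω′) ⟨ (λ (a , b) → x a ⊞ᶻ y b) ⟩ -ᵛ H Ω ⟨ x ⟩ -ᵛ H Ω′ ⟨ y ⟩

    module _ {S S′ : Set} (Ω : Space S) (x : S → Z) (Ω′ : Space S′) (y : S′ → Z) where
      private
        Λ = Ω ⊗ Ω′
        Γ = Ω ⊗ (Ω′ ⊗ Ω′)
        hx = H Ω ⟨ x ⟩
        hy = H Ω′ ⟨ y ⟩
        sum : RV (S × S′)
        sum = ⟨ (λ (a , b) → x a ⊞ᶻ y b) ⟩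
        hs = H Λ sum

      δ-nonNeg : 0ᵛ ≤ᵛ δ Ω x Ω′ y
      δ-nonNeg = linear (hs ∷ hx ∷ hy ∷ H Λ (⟨ x ⟩ ⊠ ⟨ y ⟩) ∷ H Λ (⟨ x ⟩ ∘ʳ proj₁) ∷ H Λ (⟨ y ⟩ ∘ʳ proj₂) ∷ []) 𝕠 (2 ⊛ v₀ ⊝ v₁ ⊝ v₂)
        (1 · v₃ ≦ v₀ ⊹ v₄ ∵ subadditive Λ sum (⟨ x ⟩ ∘ʳ proj₁) (⟨ x ⟩ ⊠ ⟨ y ⟩)
           (det (λ (s , a) → a , (-ᶻ a) ⊞ᶻ s) λ (a , b) → cong (x a ,_) (sym (⊞ᶻ-cancelˡ (x a) (y b)))) ∷
         1 · v₃ ≦ v₀ ⊹ v₅ ∵ subadditive Λ sum (⟨ y ⟩ ∘ʳ proj₂) (⟨ x ⟩ ⊠ ⟨ y ⟩)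
           (det (λ (s , b) → s ⊞ᶻ (-ᶻ b) , b) λ (a , b) → cong (_, y b) (sym (⊞ᶻ-cancelʳ (x a) (y b)))) ∷
         2 · v₁ ⊹ v₂ ≦ v₃ ∵ proj₂ (H-⊗ Ω Ω′ ⟨ x ⟩ ⟨ y ⟩) ∷
         1 · v₄ ≦ v₁ ∵ proj₁ (mp-H (mp-proj₁ Ω (λ _ → Ω′)) ⟨ x ⟩) ∷
         1 · v₅ ≦ v₂ ∵ proj₁ (mp-H (mp-proj₂ Ω Ω′) ⟨ y ⟩) ∷ [])

      -- x + 2y has the parity of x, and it equals (x + y + y′) + (y − y′) for any y′.
      parity-entropy : H Ω ⟨ parity ∘ x ⟩ ≤ᵛ 2 ×ᵛ δ Ω x Ω′ y
      parity-entropy = linear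
        (H Ω ⟨ parity ∘ x ⟩ ∷ hs ∷ hx ∷ hy ∷ H Λ t ∷ H Γ (t ∘ʳ π₁₂) ∷ H Γ xyy′ ∷ H Γ y-y′ ∷ H Γ all ∷ H Λ (⟨ x ⟩ ⊠ ⟨ y ⟩) ∷
         H Λ (⟨ parity ∘ x ⟩ ∘ʳ proj₁) ∷ H Λ (⟨ x ⟩ ∘ʳ proj₁) ∷ H Γ (xyy′ & y-y′) ∷ H Γ ((⟨ x ⟩ ⊠ ⟨ y ⟩) ∘ʳ π₁₂) ∷
         H Γ (sum ∘ʳ π₁₂) ∷ H Γ (sum ∘ʳ π₁₃) ∷ H Γ ((sum ⊠ ⟨ y ⟩) ∘ʳ assoc) ∷ H Γ ((⟨ y ⟩ ⊠ sum) ∘ʳ exch) ∷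
         H Γ (sum ∘ʳ π₁₂ & sum ∘ʳ π₁₃) ∷ H Γ ((⟨ y ⟩ ⊠ ⟨ y ⟩) ∘ʳ proj₂) ∷ [])
        v₀ (2 ⊛ (2 ⊛ v₁ ⊝ v₂ ⊝ v₃))
        -- x + 2y and x both determine the parity and together determine y, so H(parity x) ≤ H(x +
        -- 2y) - H(y). The other lines bound H(x + y + y′) and H(y - y′) by 2 H(x + y) - H(x) each,
        -- and H(x + 2y) by their sum less H(y).
        (1 · v₉ ⊹ var 10 ≦ v₄ ⊹ var 11 ∵ submodular Λ t (⟨ x ⟩ ∘ʳ proj₁) (⟨ parity ∘ x ⟩ ∘ʳ proj₁) (⟨ x ⟩ ⊠ ⟨ y ⟩)
             (det parity λ (a , b) → sym (parity-t a b)) (det-refl parity) t,x⇒y ∷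
         1 · v₂ ⊹ v₃ ≦ v₉ ∵ proj₂ (H-⊗ Ω Ω′ ⟨ x ⟩ ⟨ y ⟩) ∷
         1 · v₀ ≦ var 10 ∵ proj₂ (mp-H (mp-proj₁ Ω (λ _ → Ω′)) ⟨ parity ∘ x ⟩) ∷
         1 · var 11 ≦ v₂ ∵ proj₁ (mp-H (mp-proj₁ Ω (λ _ → Ω′)) ⟨ x ⟩) ∷
         1 · v₄ ≦ v₅ ∵ proj₂ (mp-H mp₁₂ t) ∷
         1 · v₈ ⊹ v₅ ≦ var 12 ⊹ var 13 ∵ submodular Γ (xyy′ & y-y′) ((⟨ x ⟩ ⊠ ⟨ y ⟩) ∘ʳ π₁₂) (t ∘ʳ π₁₂) all
             (det (λ (p , q) → p ⊞ᶻ q) λ (a , b , c) → recombine (x a) (y b) (y c))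
             (det-refl λ (a , b) → a ⊞ᶻ (b ⊞ᶻ b))
             (det (λ ((p , _) , (a , b)) → a , b , (-ᶻ b) ⊞ᶻ ((-ᶻ a) ⊞ᶻ p)) λ (a , b , c) →
               cong (λ v → x a , y b , v) (sym (trans (cong ((-ᶻ y b) ⊞ᶻ_) (⊞ᶻ-cancelˡ (x a) (y b ⊞ᶻ y c))) (⊞ᶻ-cancelˡ (y b) (y c))))) ∷
         1 · var 12 ≦ v₆ ⊹ v₇ ∵ subadditive Γ xyy′ y-y′ (xyy′ & y-y′) (λ _ _ p → p) ∷
         1 · var 13 ≦ v₉ ∵ proj₁ (mp-H mp₁₂ (⟨ x ⟩ ⊠ ⟨ y ⟩)) ∷
         1 · v₉ ≦ v₂ ⊹ v₃ ∵ proj₁ (H-⊗ Ω Ω′ ⟨ x ⟩ ⟨ y ⟩) ∷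
         1 · v₈ ⊹ v₆ ≦ var 16 ⊹ var 17 ∵ submodular Γ ((sum ⊠ ⟨ y ⟩) ∘ʳ assoc) ((⟨ y ⟩ ⊠ sum) ∘ʳ exch) xyy′ all
             (det (λ (p , c) → p ⊞ᶻ c) λ (a , b , c) → sym (⊞ᶻ-assoc (x a) (y b) (y c)))
             (det (λ (b , p) → b ⊞ᶻ p) λ (a , b , c) → trans (sym (⊞ᶻ-assoc (x a) (y b) (y c))) (trans (cong (_⊞ᶻ y c) (⊞ᶻ-comm (x a) (y b))) (⊞ᶻ-assoc (y b) (x a) (y c))))
             (det (λ ((p , c) , (b , _)) → p ⊞ᶻ (-ᶻ b) , b , c) λ (a , b , c) → cong (_, y b , y c) (sym (⊞ᶻ-cancelʳ (x a) (y b)))) ∷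
         1 · var 16 ≦ v₁ ⊹ v₃ ∵ proj₁ (≈ᵛ-trans (mp-H (mp-assoc Ω Ω′ Ω′) (sum ⊠ ⟨ y ⟩)) (H-⊗ Λ Ω′ sum ⟨ y ⟩)) ∷
         1 · var 17 ≦ v₃ ⊹ v₁ ∵ proj₁ (≈ᵛ-trans (mp-H (mp-exchange Ω Ω′ Ω′) (⟨ y ⟩ ⊠ sum)) (H-⊗ Ω′ Λ ⟨ y ⟩ sum)) ∷
         1 · v₈ ⊹ v₇ ≦ var 18 ⊹ var 19 ∵ submodular Γ (sum ∘ʳ π₁₂ & sum ∘ʳ π₁₃) ((⟨ y ⟩ ⊠ ⟨ y ⟩) ∘ʳ proj₂) y-y′ all
             (det (λ (p , q) → p ⊞ᶻ (-ᶻ q)) λ (a , b , c) → difference (x a) (y b) (y c))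
             (det-refl λ (b , c) → b ⊞ᶻ (-ᶻ c))
             (det (λ ((p , _) , (b , c)) → p ⊞ᶻ (-ᶻ b) , b , c) λ (a , b , c) → cong (_, y b , y c) (sym (⊞ᶻ-cancelʳ (x a) (y b)))) ∷
         1 · var 18 ≦ var 14 ⊹ var 15 ∵ subadditive Γ (sum ∘ʳ π₁₂) (sum ∘ʳ π₁₃) (sum ∘ʳ π₁₂ & sum ∘ʳ π₁₃) (λ _ _ p → p) ∷
         1 · var 14 ≦ v₁ ∵ proj₁ (mp-H mp₁₂ sum) ∷
         1 · var 15 ≦ v₁ ∵ proj₁ (mp-H mp₁₃ sum) ∷
         1 · var 19 ≦ v₃ ⊹ v₃ ∵ proj₁ (≈ᵛ-trans (mp-H (mp-proj₂ Ω (Ω′ ⊗ Ω′)) (⟨ y ⟩ ⊠ ⟨ y ⟩)) (H-⊗ Ω′ Ω′ ⟨ y ⟩ ⟨ y ⟩)) ∷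
         3 · v₂ ⊹ (v₃ ⊹ v₃) ≦ v₈ ∵ proj₂ (≈ᵛ-trans (H-⊗ Ω (Ω′ ⊗ Ω′) ⟨ x ⟩ (⟨ y ⟩ ⊠ ⟨ y ⟩)) (+ᵛ-cong ≈ᵛ-refl (H-⊗ Ω′ Ω′ ⟨ y ⟩ ⟨ y ⟩))) ∷ [])
        where
        t : RV (S × S′)
        t = ⟨ (λ (a , b) → x a ⊞ᶻ (y b ⊞ᶻ y b)) ⟩
        xyy′ y-y′ all : RV (S × (S′ × S′))
        xyy′ = ⟨ (λ (a , b , c) → x a ⊞ᶻ (y b ⊞ᶻ y c)) ⟩
        y-y′ = ⟨ (λ (a , b , c) → y b ⊞ᶻ (-ᶻ y c)) ⟩
        all = ⟨ x ⟩ ⊠ (⟨ y ⟩ ⊠ ⟨ y ⟩)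
        π₁₂ π₁₃ : S × (S′ × S′) → S × S′
        π₁₂ (a , b , c) = a , b
        π₁₃ (a , b , c) = a , c
        assoc : S × (S′ × S′) → (S × S′) × S′
        assoc (a , b , c) = (a , b) , c
        exch : S × (S′ × S′) → S′ × (S × S′)
        exch (a , b , c) = b , a , c
        mp₁₂ : MeasurePreserving Γ π₁₂ Λ
        mp₁₂ = mp-∘ (mp-assoc Ω Ω′ Ω′) (mp-proj₁ Λ (λ _ → Ω′))
        mp₁₃ : MeasurePreserving Γ π₁₃ Λ
        mp₁₃ = mp-⊗ (Ω′ ⊗ Ω′) Ω′ (mp-id {Ω = Ω}) (mp-proj₂ Ω′ Ω′)
        parity-t : ∀ a b → parity (x a ⊞ᶻ (y b ⊞ᶻ y b)) ≡ parity (x a)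
        parity-t a b = trans (parity-+ (x a) (y b ⊞ᶻ y b)) (trans (cong (parity (x a) ⊞_) (trans (parity-+ (y b) (y b)) (⊞-self (parity (y b)))))
          (⊞-identityʳ (parity (x a))))
        t,x⇒y : (t & ⟨ x ⟩ ∘ʳ proj₁) ⇒ ⟨ x ⟩ ⊠ ⟨ y ⟩
        t,x⇒y (a , b) (a′ , b′) p = cong₂ _,_ x≡ (double-injective (y b) (y b′)
          (trans (sym (⊞ᶻ-cancelˡ (x a) (y b ⊞ᶻ y b))) (trans (cong₂ (λ u v → (-ᶻ u) ⊞ᶻ v) x≡ (cong proj₁ p)) (⊞ᶻ-cancelˡ (x a′) (y b′ ⊞ᶻ y b′)))))
          where x≡ = cong proj₂ p
        recombine : ∀ (a b c : Z) → a ⊞ᶻ (b ⊞ᶻ b) ≡ (a ⊞ᶻ (b ⊞ᶻ c)) ⊞ᶻ (b ⊞ᶻ (-ᶻ c))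
        recombine a b c = trans (cong (a ⊞ᶻ_) (trans (sym (⊞ᶻ-identityʳ (b ⊞ᶻ b))) (trans (cong ((b ⊞ᶻ b) ⊞ᶻ_) (sym (⊞ᶻ-inverseʳ c)))
          (⊞ᶻ-interchange b b c (-ᶻ c))))) (sym (⊞ᶻ-assoc a (b ⊞ᶻ c) (b ⊞ᶻ (-ᶻ c))))
        difference : ∀ (a b c : Z) → b ⊞ᶻ (-ᶻ c) ≡ (a ⊞ᶻ b) ⊞ᶻ (-ᶻ (a ⊞ᶻ c))
        difference a b c = trans (sym (⊞ᶻ-identityˡ (b ⊞ᶻ (-ᶻ c)))) (trans (cong (_⊞ᶻ (b ⊞ᶻ (-ᶻ c))) (sym (⊞ᶻ-inverseʳ a)))
          (trans (⊞ᶻ-interchange a (-ᶻ a) b (-ᶻ c)) (cong ((a ⊞ᶻ b) ⊞ᶻ_) (sym (neg-+ a c)))))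
          where
          neg-+ : ∀ {n} (x y : Vec ℤ n) → -ᶻ (x ⊞ᶻ y) ≡ (-ᶻ x) ⊞ᶻ (-ᶻ y)
          neg-+ []      []      = refl
          neg-+ (a ∷ x) (b ∷ y) = cong₂ _∷_ (ℤₚ.neg-distrib-+ a b) (neg-+ x y)

      -- The subtracted entropies keep the pieces dense while δ is controlled. The weight is 2 · 50
      -- + 1, with the 50 of `structure`; `𝔼Φ` shows the balance.
      Φ : Carrier
      Φ = 101 ×ᵛ δ Ω x Ω′ y -ᵛ hx -ᵛ hy

    module _ {m : ℕ} (χ : Z → Vec Bool m) (χ-hom : ∀ u v → χ (u ⊞ᶻ v) ≡ χ u ⊞ χ v)
             {S S′ : Set} (Ω : Space S) (x : S → Z) (Ω′ : Space S′) (y : S′ → Z)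
             {κ : Vec Bool m → Space S} {κ′ : Vec Bool m → Space S′}
             (dis : Disintegrates Ω (χ ∘ x) κ) (dis′ : Disintegrates Ω′ (χ ∘ y) κ′)
             (structured : H Ω ⟨ χ ∘ x ⟩ ≤ᵛ 50 ×ᵛ D₁ Ω (χ ∘ x)) where
      private
        f = χ ∘ x
        g = χ ∘ y
        Λ = Ω ⊗ Ω′
        Γ = Ω′ ⊗ (Ω ⊗ Ω)
        sum : RV (S × S′)
        sum = ⟨ (λ (a , b) → x a ⊞ᶻ y b) ⟩
        fsum : RV (S × S′)
        fsum = ⟨ (λ (a , b) → f a ⊞ g b) ⟩
        Q : S × S′ → Vec Bool m × Vec Bool m
        Q (a , b) = f a , g b
        κ² : Vec Bool m × Vec Bool m → Space (S × S′)
        κ² (u , v) = κ u ⊗ κ′ v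

        dis² : Disintegrates Λ Q κ²
        dis² .disintegration .transfer M h = M.≈ᵛ-trans (E.𝔼->>= Λ (κ² ∘ Q) _) (M.≈ᵛ-trans (E.𝔼->>= Ω (λ _ → Ω′) _)
          (M.≈ᵛ-trans (E.𝔼-cong Ω λ a _ → M.≈ᵛ-trans
              (E.𝔼-cong Ω′ λ b _ → E.𝔼->>= (κ (f a)) (λ _ → κ′ (g b)) _)
              (M.≈ᵛ-trans (E.𝔼-swap Ω′ (κ (f a)) (λ b a′ → E.𝔼 (κ′ (g b)) λ b′ → h ((f a , g b) , (a′ , b′))))
                (E.𝔼-cong (κ (f a)) λ a′ _ → M.≈ᵛ-trans (M.≈ᵛ-sym (E.𝔼->>= Ω′ (κ′ ∘ g) _))
                  (transfer (disintegration dis′) M (λ p → h ((f a , proj₁ p) , (a′ , proj₂ p)))))))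
          (M.≈ᵛ-trans (M.≈ᵛ-sym (E.𝔼->>= Ω (κ ∘ f) _)) (M.≈ᵛ-trans
            (transfer (disintegration dis) M (λ p → E.𝔼 Ω′ λ b → h ((proj₁ p , g b) , (proj₂ p , b))))
            (M.≈ᵛ-sym (E.𝔼->>= Ω (λ _ → Ω′) _))))))
          where module M = OrderedModule M
                module E = Expectation M

        hx = H Ω ⟨ x ⟩
        hy = H Ω′ ⟨ y ⟩
        hf = H Ω ⟨ f ⟩
        hg = H Ω′ ⟨ g ⟩
        hs = H Λ sum
        hfs = H Λ fsum
        𝔼s = 𝔼 Λ (λ p → H (κ² (Q p)) sum)
        𝔼x = 𝔼 Ω (λ a → H (κ (f a)) ⟨ x ⟩)
        𝔼y = 𝔼 Ω′ (λ b → H (κ′ (g b)) ⟨ y ⟩)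

        fibre-x : hf +ᵛ 𝔼x ≈ᵛ hx
        fibre-x = ≈ᵛ-trans (𝔼-fibre {S₀ = ⊤} Ω f dis ⟨ x ⟩) (H-cong Ω (⟨ f ⟩ & ⟨ x ⟩) ⟨ x ⟩ (det-refl proj₂) (det-refl λ v → χ v , v))
        fibre-y : hg +ᵛ 𝔼y ≈ᵛ hy
        fibre-y = ≈ᵛ-trans (𝔼-fibre {S₀ = ⊤} Ω′ g dis′ ⟨ y ⟩) (H-cong Ω′ (⟨ g ⟩ & ⟨ y ⟩) ⟨ y ⟩ (det-refl proj₂) (det-refl λ v → χ v , v))

        -- On a fibre both f and g are known, which is more than f + g, itself a function of x + y.
        fibre-s : 𝔼s +ᵛ hfs ≤ᵛ hs
        fibre-s = linear (𝔼s ∷ hfs ∷ hs ∷ H Λ ⟨ Q ⟩ ∷ H Λ (⟨ Q ⟩ & sum) ∷ []) (v₀ ⊹ v₁) v₂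
          (1 · v₃ ⊹ v₀ ≦ v₄ ∵ proj₁ (𝔼-fibre {S₀ = ⊤} Λ Q dis² sum) ∷
           1 · v₄ ⊹ v₁ ≦ v₂ ⊹ v₃ ∵ submodular Λ sum ⟨ Q ⟩ fsum (⟨ Q ⟩ & sum)
             (det χ λ (a , b) → sym (χ-hom (x a) (y b))) (det-refl λ (u , v) → u ⊞ v) (det-refl λ (s , q) → q , s) ∷ [])

        hff = H (Ω ⊗ Ω) ⟨ (λ (a , a′) → f a ⊞ f a′) ⟩

        -- Ruzsa's triangle inequality: f + f′ = (f + g) + (f′ + g) with one common copy of g.
        triangle-f : hff +ᵛ hg ≤ᵛ hfs +ᵛ hfs
        triangle-f = linear (hff ∷ hg ∷ hfs ∷ hf ∷ H Γ (⟨ g ⟩ ⊠ (⟨ f ⟩ ⊠ ⟨ f ⟩)) ∷ H Γ (⟨ (λ (a , a′) → f a ⊞ f a′) ⟩ ∘ʳ proj₂) ∷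
            H Γ (fsum ∘ʳ π₁ & fsum ∘ʳ π₂) ∷ H Γ ((⟨ f ⟩ ⊠ ⟨ f ⟩) ∘ʳ proj₂) ∷ H Γ (fsum ∘ʳ π₁) ∷ H Γ (fsum ∘ʳ π₂) ∷ [])
          (v₀ ⊹ v₁) (v₂ ⊹ v₂)
          (1 · v₀ ≦ v₅ ∵ proj₂ (mp-H (mp-proj₂ Ω′ (Ω ⊗ Ω)) ⟨ (λ (a , a′) → f a ⊞ f a′) ⟩) ∷
           1 · v₄ ⊹ v₅ ≦ v₆ ⊹ v₇ ∵ submodular Γ (fsum ∘ʳ π₁ & fsum ∘ʳ π₂) ((⟨ f ⟩ ⊠ ⟨ f ⟩) ∘ʳ proj₂) (⟨ (λ (a , a′) → f a ⊞ f a′) ⟩ ∘ʳ proj₂)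
             (⟨ g ⟩ ⊠ (⟨ f ⟩ ⊠ ⟨ f ⟩))
             (det (λ (u , v) → u ⊞ v) λ (b , a , a′) → sym (trans (⊞-interchange (f a) (g b) (f a′) (g b))
               (trans (cong ((f a ⊞ f a′) ⊞_) (⊞-self (g b))) (⊞-identityʳ (f a ⊞ f a′)))))
             (det-refl λ (u , v) → u ⊞ v)
             (det (λ ((u , _) , (a , a′)) → a ⊞ u , a , a′) λ (b , a , a′) → cong (_, f a , f a′) (sym (⊞-cancelˡ (f a) (g b)))) ∷
           1 · v₆ ≦ v₈ ⊹ v₉ ∵ subadditive Γ (fsum ∘ʳ π₁) (fsum ∘ʳ π₂) (fsum ∘ʳ π₁ & fsum ∘ʳ π₂) (λ _ _ p → p) ∷
           1 · v₇ ≦ v₃ ⊹ v₃ ∵ proj₁ (≈ᵛ-trans (mp-H (mp-proj₂ Ω′ (Ω ⊗ Ω)) (⟨ f ⟩ ⊠ ⟨ f ⟩)) (H-⊗ Ω Ω ⟨ f ⟩ ⟨ f ⟩)) ∷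
           1 · v₁ ⊹ (v₃ ⊹ v₃) ≦ v₄ ∵ proj₂ (≈ᵛ-trans (H-⊗ Ω′ (Ω ⊗ Ω) ⟨ g ⟩ (⟨ f ⟩ ⊠ ⟨ f ⟩)) (+ᵛ-cong ≈ᵛ-refl (H-⊗ Ω Ω ⟨ f ⟩ ⟨ f ⟩))) ∷
           1 · v₈ ≦ v₂ ∵ proj₁ (mp-H (mp-∘ (mp-⊗ (Ω ⊗ Ω) Ω (mp-id {Ω = Ω′}) (mp-proj₁ Ω (λ _ → Ω))) (mp-swap Ω′ Ω)) fsum) ∷
           1 · v₉ ≦ v₂ ∵ proj₁ (mp-H (mp-∘ (mp-⊗ (Ω ⊗ Ω) Ω (mp-id {Ω = Ω′}) (mp-proj₂ Ω Ω)) (mp-swap Ω′ Ω)) fsum) ∷ [])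
          where
          π₁ π₂ : S′ × (S × S) → S × S′
          π₁ (b , a , a′) = a , b
          π₂ (b , a , a′) = a′ , b

        sum-g : hg ≤ᵛ hfs
        sum-g = linear (hg ∷ hfs ∷ hf ∷ H Λ (⟨ f ⟩ ⊠ ⟨ g ⟩) ∷ H Λ (⟨ f ⟩ ∘ʳ proj₁) ∷ []) v₀ v₁
          (1 · v₂ ⊹ v₀ ≦ v₃ ∵ proj₂ (H-⊗ Ω Ω′ ⟨ f ⟩ ⟨ g ⟩) ∷
           1 · v₃ ≦ v₁ ⊹ v₄ ∵ subadditive Λ fsum (⟨ f ⟩ ∘ʳ proj₁) (⟨ f ⟩ ⊠ ⟨ g ⟩)
             (det (λ (s , a) → a , a ⊞ s) λ (a , b) → cong (f a ,_) (sym (⊞-cancelˡ (f a) (g b)))) ∷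
           1 · v₄ ≦ v₂ ∵ proj₁ (mp-H (mp-proj₁ Ω (λ _ → Ω′)) ⟨ f ⟩) ∷ [])

        -- On average, passing to fibres lowers 202 H(x + y) by at least 202 H(f + g), and 102 (H(x)
        -- + H(y)) by 102 (H(f) + H(g)). What remains is 102 (H(f) + H(g)) ≤ 202 H(f + g):
        -- `structured` gives 102 H(f) ≤ 100 H(f + f′), `triangle-f` gives 100 H(f + f′) + 100 H(g)
        -- ≤ 200 H(f + g), and `sum-g` pays for 2 H(g).
        𝔼Φ : 𝔼 Λ (λ (a , b) → Φ (κ (f a)) x (κ′ (g b)) y) ≤ᵛ Φ Ω x Ω′ y
        𝔼Φ = linear (_ ∷ hx ∷ hy ∷ hs ∷ hf ∷ hg ∷ hfs ∷ hff ∷ 𝔼s ∷ 𝔼x ∷ 𝔼y ∷ [])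
          v₀ (101 ⊛ (2 ⊛ v₃ ⊝ v₁ ⊝ v₂) ⊝ v₁ ⊝ v₂)
          (1 · v₀ ≦ 101 ⊛ (2 ⊛ v₈ ⊝ v₉ ⊝ var 10) ⊝ v₉ ⊝ var 10 ∵ split ∷
           202 · v₈ ⊹ v₆ ≦ v₃ ∵ fibre-s ∷ 102 · v₁ ≦ v₄ ⊹ v₉ ∵ proj₂ fibre-x ∷ 102 · v₂ ≦ v₅ ⊹ var 10 ∵ proj₂ fibre-y ∷
           2 · v₄ ≦ 50 ⊛ (v₇ ⊝ v₄) ∵ structured ∷ 100 · v₇ ⊹ v₅ ≦ v₆ ⊹ v₆ ∵ triangle-f ∷ 2 · v₅ ≦ v₆ ∵ sum-g ∷ [])
          where
          on-x : 𝔼 Λ (λ (a , b) → H (κ (f a)) ⟨ x ⟩) ≈ᵛ 𝔼x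
          on-x = transfer (law-proj₁ Ω (λ _ → Ω′)) orderedModule _
          on-y : 𝔼 Λ (λ (a , b) → H (κ′ (g b)) ⟨ y ⟩) ≈ᵛ 𝔼y
          on-y = transfer (law-proj₂ Ω Ω′) orderedModule _
          split : 𝔼 Λ (λ (a , b) → Φ (κ (f a)) x (κ′ (g b)) y) ≤ᵛ 101 ×ᵛ (2 ×ᵛ 𝔼s -ᵛ 𝔼x -ᵛ 𝔼y) -ᵛ 𝔼x -ᵛ 𝔼y
          split = proj₁ (≈ᵛ-trans (𝔼-+ Λ _ _) (+ᵛ-cong (≈ᵛ-trans (𝔼-+ Λ _ _) (+ᵛ-cong
              (≈ᵛ-trans (𝔼-• Λ _ _) (•-congʳ _ (≈ᵛ-trans (𝔼-+ Λ _ _) (+ᵛ-cong (≈ᵛ-trans (𝔼-+ Λ _ _) (+ᵛ-cong (𝔼-• Λ _ _) neg-x)) neg-y))))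
              neg-x)) neg-y))
            where
            neg-x = ≈ᵛ-trans (𝔼-neg Λ (λ (a , b) → H (κ (f a)) ⟨ x ⟩)) (-ᵛ-cong on-x)
            neg-y = ≈ᵛ-trans (𝔼-neg Λ (λ (a , b) → H (κ′ (g b)) ⟨ y ⟩)) (-ᵛ-cong on-y)

      fibre-pick : ¬ ¬ (Σ[ a ∈ S ] Σ[ b ∈ S′ ] (a ∈ supp Ω × b ∈ supp Ω′ × Φ (κ (f a)) x (κ′ (g b)) y ≤ᵛ Φ Ω x Ω′ y))
      fibre-pick none = 𝔼-pick Λ 𝔼Φ λ ((a , b) , ab∈ , le) → none (a , b , proj₁ (supp->>= Ω (λ _ → Ω′) ab∈) , proj₂ (supp->>= Ω (λ _ → Ω′) ab∈) , le)

  -- Uniform distributions on lists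

  unit : ∀ {S : Set} → List S → Weighted S
  unit = List.map (1ℚ ,_)

  module _ (M : OrderedModule) where
    private
      module M = OrderedModule M
      module E = Expectation M

    ∫-unit-filter : ∀ {S : Set} {P : S → Set} (P? : ∀ s → Dec (P s)) L g →
      E.∫ (unit (List.filter P? L)) g M.≈ᵛ E.∫ (unit L) (λ s → 𝟙 (does (P? s)) M.• g s)
    ∫-unit-filter P? []      g = M.≈ᵛ-refl
    ∫-unit-filter P? (s ∷ L) g with does (P? s)
    ... | true  = M.+ᵛ-cong (M.•-congʳ 1ℚ (M.≈ᵛ-sym (M.•-identity _))) (∫-unit-filter P? L g)
    ... | false = M.≈ᵛ-trans (∫-unit-filter P? L g) (M.≈ᵛ-trans (M.≈ᵛ-sym (M.+ᵛ-identityˡ _))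
      (M.+ᵛ-cong (M.≈ᵛ-sym (M.≈ᵛ-trans (M.•-congʳ 1ℚ (M.•-zeroˡ _)) (M.•-zeroʳ 1ℚ))) M.≈ᵛ-refl))

    ∫-unit-map : ∀ {S T : Set} (f : S → T) L g → E.∫ (unit (List.map f L)) g M.≈ᵛ E.∫ (unit L) (g ∘ f)
    ∫-unit-map f []      g = M.≈ᵛ-refl
    ∫-unit-map f (s ∷ L) g = M.+ᵛ-cong M.≈ᵛ-refl (∫-unit-map f L g)

  ∫-unit-1 : ∀ {S : Set} (L : List S) → ℚ∫.∫ (unit L) (λ _ → 1ℚ) ≡ fromℕℚ (length L)
  ∫-unit-1 []      = refl
  ∫-unit-1 (s ∷ L) = trans (cong₂ _+_ (ℚₚ.*-identityʳ 1ℚ) (∫-unit-1 L)) (sym (fromℕℚ-suc (length L)))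

  unit-positive : ∀ {S : Set} (L : List S) → Positive-weights (unit L)
  unit-positive []      = []
  unit-positive (s ∷ L) = ℚₚ.positive⁻¹ 1ℚ ∷ unit-positive L

  -- Opaque, so that the unifier never computes with it.
  abstract
    density : ℕ → ℚ
    density n = recip (fromℕℚ n)

    density≡ : ∀ n → density n ≡ recip (fromℕℚ n)
    density≡ n = refl

  density-inverseˡ : ∀ {S : Set} (L : List S) → L ≢ [] → density (length L) * fromℕℚ (length L) ≡ 1ℚ
  density-inverseˡ L ne = trans (cong (_* fromℕℚ (length L)) (density≡ (length L))) (recip-inverseˡ (card-pos L ne))

  density-pos : ∀ {S : Set} (L : List S) → L ≢ [] → 0ℚ < density (length L)
  density-pos L ne = subst (0ℚ <_) (sym (density≡ (length L))) (recip-pos (card-pos L ne))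

  uniform : ∀ {S : Set} (L : List S) → L ≢ [] → Space S
  uniform L ne = record
    { points = scale (density (length L)) id (unit L)
    ; weights-positive = scale-positive (density-pos L ne) (unit-positive L)
    ; total = trans (ℚ-≈⇒≡ (ℚ∫.∫-scale (density (length L)) id (unit L) (λ _ → 1ℚ)))
        (trans (cong (density (length L) *_) (∫-unit-1 L)) (density-inverseˡ L ne)) }

  𝔼-uniform : ∀ (M : OrderedModule) {S : Set} (L : List S) ne g →
    OrderedModule._≈ᵛ_ M (Expectation.𝔼 M (uniform L ne) g) (OrderedModule._•_ M (density (length L)) (Expectation.∫ M (unit L) g))
  𝔼-uniform M L ne g = Expectation.∫-scale M (density (length L)) id (unit L) g

  support-unit : ∀ {S : Set} (L : List S) → support (unit L) ≡ L
  support-unit []      = refl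
  support-unit (s ∷ L) = cong (s ∷_) (support-unit L)

  supp-uniform : ∀ {S : Set} (L : List S) ne {s} → s ∈ supp (uniform L ne) → s ∈ L
  supp-uniform L ne s∈ with supp-scale (density (length L)) id (unit L) s∈
  ... | t , t∈ , refl = subst (t ∈_) (support-unit L) t∈

  mp-map : ∀ {S T : Set} (f : S → T) L ne ne′ → MeasurePreserving (uniform L ne) f (uniform (List.map f L) ne′)
  mp-map f L ne ne′ .law .transfer M g = M.≈ᵛ-trans (𝔼-uniform M L ne (g ∘ f)) (M.≈ᵛ-trans (M.•-congʳ _ (M.≈ᵛ-sym (∫-unit-map M f L g)))
    (M.≈ᵛ-trans (M.≡⇒≈ᵛ (cong (λ l → density l M.• Expectation.∫ M (unit (List.map f L)) g) (sym (Listₚ.length-map f L)))) (M.≈ᵛ-sym (𝔼-uniform M (List.map f L) ne′ g))))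
    where module M = OrderedModule M

  -- The default makes a kernel total: the fibre over a value not taken is empty.
  uniform-or : ∀ {S : Set} → List S → Space S → Space S
  uniform-or []       Ω = Ω
  uniform-or (s ∷ L)  Ω = uniform (s ∷ L) (λ ())

  uniform-or≡ : ∀ {S : Set} L (Ω : Space S) ne → uniform-or L Ω ≡ uniform L ne
  uniform-or≡ []      Ω ne = contradiction refl ne
  uniform-or≡ (s ∷ L) Ω ne = refl

  recip-unique : ∀ {p q} → 0ℚ < p → q * p ≡ 1ℚ → q ≡ recip p
  recip-unique {p} {q} 0<p qp≡1 = trans (sym (ℚₚ.*-identityʳ q)) (trans (cong (q *_) (sym (recip-inverseʳ 0<p)))
    (trans (sym (ℚₚ.*-assoc q p (recip p))) (trans (cong (_* recip p) qp≡1) (ℚₚ.*-identityˡ (recip p)))))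

  -- Conditioning a uniform distribution on a fibre gives the uniform distribution on the sublist,
  -- so the iteration stays among sublists of A and B.
  module Fibres {S T : Set} {{_ : DecEq T}} (L : List S) (ne : L ≢ []) (Q : S → T) where
    open Conditioning (uniform L ne) Q using (mass; IntegratesFibres; disintegrates)

    fibre : T → List S
    fibre q = List.filter (λ s → Q s ≟ q) L

    κ : T → Space S
    κ q = uniform-or (fibre q) (uniform L ne)

    fibre-nonempty : ∀ {s} → s ∈ L → fibre (Q s) ≢ []
    fibre-nonempty {s} s∈ = ∈⇒nonempty (∈ₚ.∈-filter⁺ (λ t → Q t ≟ Q s) s∈ refl)

    integrates : IntegratesFibres κ
    integrates M s s∈ g rewrite uniform-or≡ (fibre (Q s)) (uniform L ne) (fibre-nonempty (supp-uniform L ne s∈)) =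
      M.≈ᵛ-trans (𝔼-uniform M F F≢[] g) (M.≈ᵛ-trans (M.≡⇒≈ᵛ (cong (M._• E.∫ (unit F) g) (sym weights)))
        (M.≈ᵛ-trans (M.•-assoc _ _ _) (M.•-congʳ _ (M.≈ᵛ-trans (M.•-congʳ _ (∫-unit-filter M (λ t → Q t ≟ Q s) L g))
          (M.≈ᵛ-sym (𝔼-uniform M L ne _))))))
      where
      module M = OrderedModule M
      module E = Expectation M
      F = fibre (Q s)
      F≢[] = fibre-nonempty (supp-uniform L ne s∈)
      d f : ℚ
      d = density (length L)
      f = fromℕℚ (length F)
      mass≡ : mass (Q s) ≡ d * f
      mass≡ = trans (ℚ-≈⇒≡ (𝔼-uniform ℚ-module L ne (λ t → 𝟙 (does (Q t ≟ Q s))))) (cong (d *_) (trans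
        (ℚ-≈⇒≡ (ℚ∫.∫-cong (unit L) λ t _ → ℚᴹ.≡⇒≈ᵛ (sym (ℚₚ.*-identityʳ (𝟙 (does (Q t ≟ Q s)))))))
        (trans (sym (ℚ-≈⇒≡ (∫-unit-filter ℚ-module (λ t → Q t ≟ Q s) L (λ _ → 1ℚ)))) (∫-unit-1 F))))
      0<mass : 0ℚ < mass (Q s)
      0<mass = ℙ-pos (uniform L ne) ⟨ Q ⟩ s∈
      weights : recip (mass (Q s)) * d ≡ density (length F)
      weights = trans (recip-unique (card-pos F F≢[]) (trans (ℚₚ.*-assoc (recip (mass (Q s))) d f)
        (trans (cong (recip (mass (Q s)) *_) (sym mass≡)) (recip-inverseˡ 0<mass)))) (sym (density≡ (length F)))

    fibres-disintegrate : Disintegrates (uniform L ne) Q κ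
    fibres-disintegrate = disintegrates κ integrates

  module _ {S : Set} {{_ : DecEq S}} where
    count-unique : ∀ (L : List S) {s} → Unique L → s ∈ L → ℚ∫.∫ (unit L) (λ t → 𝟙 (does (t ≟ s))) ≡ 1ℚ
    count-unique (t ∷ L) (t∉ AllPairs.∷ uniq) (here refl) rewrite dec-true (t ≟ t) refl = cong₂ _+_ (refl {x = 1ℚ}) (none L t∉)
      where
      none : ∀ L → All (t ≢_) L → ℚ∫.∫ (unit L) (λ u → 𝟙 (does (u ≟ t))) ≡ 0ℚ
      none []      []        = refl
      none (u ∷ L) (t≢ ∷ ts) rewrite dec-false (u ≟ t) (t≢ ∘ sym) = trans (cong₂ _+_ (ℚₚ.*-zeroʳ 1ℚ) (none L ts)) refl
    count-unique (t ∷ L) {s} (t∉ AllPairs.∷ uniq) (there s∈) rewrite dec-false (t ≟ s) (λ { refl → All.lookup t∉ s∈ refl }) =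
      trans (cong₂ _+_ (ℚₚ.*-zeroʳ 1ℚ) (count-unique L uniq s∈)) (ℚₚ.+-identityˡ 1ℚ)

    H-uniform : ∀ (L : List S) ne → Unique L → H (uniform L ne) ⟨ id ⟩ ≈ᵛ log (fromℕℚ (length L))
    H-uniform L ne uniq = ≈ᵛ-trans (𝔼-cong (uniform L ne) λ s s∈ → ≈ᵛ-trans (-ᵛ-cong (≈ᵛ-trans (≡⇒≈ᵛ (cong log (weight s s∈))) (≈ᵛ-trans (≡⇒≈ᵛ (cong log (density≡ (length L)))) (log-recip 0<N))))
        (≈ᵛ-trans (≈ᵛ-sym (neg-• _)) (≈ᵛ-trans (•-congʳ (- 1ℚ) (≈ᵛ-sym (neg-• _))) (≈ᵛ-trans (≈ᵛ-sym (•-assoc (- 1ℚ) (- 1ℚ) _)) (•-identity _)))))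
      (𝔼-const (uniform L ne) _)
      where
      0<N = card-pos L ne
      weight : ∀ s → s ∈ supp (uniform L ne) → ℙ (uniform L ne) ⟨ id ⟩ s ≡ density (length L)
      weight s s∈ = trans (ℚ-≈⇒≡ (𝔼-uniform ℚ-module L ne (λ t → 𝟙 (does (t ≟ s))))) (trans (cong (density (length L) *_)
        (count-unique L uniq (supp-uniform L ne s∈))) (ℚₚ.*-identityʳ (density (length L))))

  -- With m the number of listed values, log(1/ℙ) ≤ 1/(ℙ m) - 1 + log m, and 1/ℙ has mean at most m.
  H-≤-log-card : ∀ {S T : Set} {{_ : DecEq T}} (Ω : Space S) (Y : S → T) us → (∀ s → s ∈ supp Ω → Y s ∈ us) → us ≢ [] →
    H Ω ⟨ Y ⟩ ≤ᵛ log (fromℕℚ (length us))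
  H-≤-log-card Ω Y us cover ne = ≤ᵛ-trans (𝔼-mono Ω pointwise) (≤ᵛ-trans (proj₁ (𝔼-+ Ω _ _))
      (linear (𝔼 Ω (λ s → (r s * recip m - 1ℚ) • one) ∷ 𝔼 Ω (λ _ → log m) ∷ log m ∷ []) (v₀ ⊹ v₁) v₂
        (1 · v₀ ≦ 𝕠 ∵ ≤ᵛ-trans (proj₁ (𝔼-scalar Ω _ one)) (≤ᵛ-trans (•-monoˡ 0≤one mean≤0) (proj₁ (•-zeroˡ one))) ∷
         1 · v₁ ≦ v₂ ∵ proj₁ (𝔼-const Ω (log m)) ∷ [])))
    where
    m : ℚ
    m = fromℕℚ (length us)
    0<m = card-pos us ne
    r : _ → ℚ
    r s = recip (ℙ Ω ⟨ Y ⟩ s)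
    pointwise : ∀ s → s ∈ supp Ω → -ᵛ log (ℙ Ω ⟨ Y ⟩ s) ≤ᵛ (r s * recip m - 1ℚ) • one +ᵛ log m
    pointwise s s∈ = ≤ᵛ-trans (proj₂ (log-recip (ℙ-pos Ω ⟨ Y ⟩ s∈))) (≤ᵛ-trans
      (proj₁ (≈ᵛ-trans (≡⇒≈ᵛ (cong log r≡)) (log-* 0<rm 0<m))) (+ᵛ-mono (log-≤ 0<rm) ≤ᵛ-refl))
      where
      0<rm = *-pos (recip-pos (ℙ-pos Ω ⟨ Y ⟩ s∈)) (recip-pos 0<m)
      r≡ : r s ≡ r s * recip m * m
      r≡ = sym (trans (ℚₚ.*-assoc (r s) (recip m) m) (trans (cong (r s *_) (recip-inverseˡ 0<m)) (ℚₚ.*-identityʳ (r s))))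
    mean≤0 : 𝔼ℚ Ω (λ s → r s * recip m - 1ℚ) ≤ 0ℚ
    mean≤0 = ℚₚ.≤-trans (ℚₚ.≤-reflexive (trans (ℚ-≈⇒≡ (ℚ𝔼.𝔼-+ Ω _ _)) (cong₂ _+_ (ℚ𝔼.*-distʳ Ω (recip m) r) (ℚ-≈⇒≡ (ℚ𝔼.𝔼-const Ω (- 1ℚ))))))
      (ℚₚ.≤-trans (ℚₚ.+-monoˡ-≤ (- 1ℚ) (ℚₚ.≤-trans (ℚₚ.*-monoʳ-≤-nonNeg (recip m) {{nonNegative (ℚₚ.<⇒≤ (recip-pos 0<m))}} (Counting.𝔼-recip-≤ Ω Y us cover))
        (ℚₚ.≤-reflexive (recip-inverseʳ 0<m)))) (ℚₚ.≤-reflexive (ℚₚ.+-inverseʳ 1ℚ)))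

  δᴸ Φᴸ : ∀ {n} (A B : List (Vec ℤ n)) → A ≢ [] → B ≢ [] → Carrier
  δᴸ A B A≢[] B≢[] = δ (uniform A A≢[]) id (uniform B B≢[]) id
  Φᴸ A B A≢[] B≢[] = Φ (uniform A A≢[]) id (uniform B B≢[]) id

  module _ {n r : ℕ} (T : Vec ℤ r → Vec ℤ n) (T-+ : ∀ u v → T (u ⊞ᶻ v) ≡ T u ⊞ᶻ T v) (T-inj : ∀ u v → T u ≡ T v → u ≡ v)
           (a b : Vec ℤ n) (A B : List (Vec ℤ r)) (A≢[] : A ≢ []) (B≢[] : B ≢ []) where
    private
      f g : Vec ℤ r → Vec ℤ n
      f u = T u ⊞ᶻ a
      g u = T u ⊞ᶻ b
      fA≢[] = map-nonempty f A A≢[]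
      gB≢[] = map-nonempty g B B≢[]
      ΩA = uniform A A≢[]
      ΩB = uniform B B≢[]
      translate-inj : ∀ (c u v : Vec ℤ n) → u ⊞ᶻ c ≡ v ⊞ᶻ c → u ≡ v
      translate-inj c u v p = trans (sym (⊞ᶻ-cancelʳ u c)) (trans (cong (_⊞ᶻ (-ᶻ c)) p) (⊞ᶻ-cancelʳ v c))
      H-f : H (uniform (List.map f A) fA≢[]) ⟨ id ⟩ ≈ᵛ H ΩA ⟨ id ⟩
      H-f = ≈ᵛ-trans (≈ᵛ-sym (mp-H (mp-map f A A≢[] fA≢[]) ⟨ id ⟩)) (H-cong ΩA ⟨ f ⟩ ⟨ id ⟩ (λ u v p → T-inj u v (translate-inj a (T u) (T v) p)) (det-refl f))
      H-g : H (uniform (List.map g B) gB≢[]) ⟨ id ⟩ ≈ᵛ H ΩB ⟨ id ⟩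
      H-g = ≈ᵛ-trans (≈ᵛ-sym (mp-H (mp-map g B B≢[] gB≢[]) ⟨ id ⟩)) (H-cong ΩB ⟨ g ⟩ ⟨ id ⟩ (λ u v p → T-inj u v (translate-inj b (T u) (T v) p)) (det-refl g))
      H-fg : H (uniform (List.map f A) fA≢[] ⊗ uniform (List.map g B) gB≢[]) ⟨ (λ (u , v) → u ⊞ᶻ v) ⟩ ≈ᵛ H (ΩA ⊗ ΩB) ⟨ (λ (u , v) → u ⊞ᶻ v) ⟩
      H-fg = ≈ᵛ-trans (≈ᵛ-sym (mp-H (mp-⊗ ΩB (uniform (List.map g B) gB≢[]) (mp-map f A A≢[] fA≢[]) (mp-map g B B≢[] gB≢[])) ⟨ (λ (u , v) → u ⊞ᶻ v) ⟩))
        (H-cong (ΩA ⊗ ΩB) ⟨ (λ (u , v) → f u ⊞ᶻ g v) ⟩ ⟨ (λ (u , v) → u ⊞ᶻ v) ⟩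
          (λ (u , v) (u′ , v′) p → T-inj _ _ (translate-inj (a ⊞ᶻ b) _ _ (trans (sym (fg≡ u v)) (trans p (fg≡ u′ v′)))))
          (det (λ w → T w ⊞ᶻ (a ⊞ᶻ b)) λ (u , v) → fg≡ u v))
        where
        fg≡ : ∀ u v → f u ⊞ᶻ g v ≡ T (u ⊞ᶻ v) ⊞ᶻ (a ⊞ᶻ b)
        fg≡ u v = trans (⊞ᶻ-interchange (T u) a (T v) b) (cong (_⊞ᶻ (a ⊞ᶻ b)) (sym (T-+ u v)))

    δ-map : δᴸ (List.map f A) (List.map g B) fA≢[] gB≢[] ≈ᵛ δᴸ A B A≢[] B≢[]
    δ-map = +ᵛ-cong (+ᵛ-cong (•-congʳ (fromℕℚ 2) H-fg) (-ᵛ-cong H-f)) (-ᵛ-cong H-g)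

    Φ-map : Φᴸ (List.map f A) (List.map g B) fA≢[] gB≢[] ≈ᵛ Φᴸ A B A≢[] B≢[]
    Φ-map = +ᵛ-cong (+ᵛ-cong (•-congʳ (fromℕℚ 101) δ-map) (-ᵛ-cong H-f)) (-ᵛ-cong H-g)

  -- Splitting a pair of sets along a binary homomorphism

  pull-back : ∀ {S T : Set} (f : S → T) {L} → All (λ t → Σ[ s ∈ S ] f s ≡ t) L → Σ[ K ∈ List S ] List.map f K ≡ L
  pull-back f []              = [] , refl
  pull-back f ((s , refl) ∷ p) with pull-back f p
  ... | K , refl = s ∷ K , refl

  length-fibre-< : ∀ {S T : Set} {{_ : DecEq T}} (Q : S → T) q L →
    All (λ s → Q s ≡ q) L ⊎ length (List.filter (λ s → Q s ≟ q) L) ℕ.< length L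
  length-fibre-< Q q L with All.all? (λ s → Q s ≟ q) L
  ... | yes all = inj₁ all
  ... | no ¬all = inj₂ (Listₚ.filter-notAll (λ s → Q s ≟ q) L (Allₚ.¬All⇒Any¬ (λ s → Q s ≟ q) L ¬all))

  bit : Bool → ℤ
  bit true  = + 1
  bit false = + 0

  parity-bit : ∀ {n} (v : Vec Bool n) → parity (Vec.map bit v) ≡ v
  parity-bit []          = refl
  parity-bit (true ∷ v)  = cong (true ∷_) (parity-bit v)
  parity-bit (false ∷ v) = cong (false ∷_) (parity-bit v)

  trivial-codimension : ∀ {n m} (φ : Surjection n m) → (∀ v → ψ φ v ≡ 𝟎) → m ≡ 0
  trivial-codimension {m = zero}  φ ψ≡𝟎 = refl
  trivial-codimension {m = suc m} φ ψ≡𝟎 with trans (sym (ψ-section φ (true ∷ 𝟎))) (ψ≡𝟎 (section φ (true ∷ 𝟎)))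
  ... | ()

  -- Φ is compared with the pair one starts from, so the property passes up the recursion by
  -- transitivity, while the rank is bounded by the δ of the final pair.
  Pieces : ∀ {n} (A B : List (Vec ℤ n)) → A ≢ [] → B ≢ [] → Set
  Pieces {n} A B A≢[] B≢[] = Σ[ A′ ∈ List (Vec ℤ n) ] Σ[ B′ ∈ List (Vec ℤ n) ] Σ[ A′≢[] ∈ A′ ≢ [] ] Σ[ B′≢[] ∈ B′ ≢ [] ]
    (A′ ⊆ A × B′ ⊆ B × Φᴸ A′ B′ A′≢[] B′≢[] ≤ᵛ Φᴸ A B A≢[] B≢[] × rank (hull-basis A′) ×ᵛ log₂ ≤ᵛ 20 ×ᵛ δᴸ A′ B′ A′≢[] B′≢[])

  -- In coordinates for the lattice generated by the differences of A and of B, either a homomorphism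
  -- to a binary space splits A or B, or it vanishes and bounds the rank of the lattice.
  module Lattice {n : ℕ} (a b : Vec ℤ n) (A₀ B₀ : List (Vec ℤ n)) (E : Echelon n) where
    A B : List (Vec ℤ n)
    A = a ∷ A₀
    B = b ∷ B₀
    𝕋 : Vec ℤ (rank E) → Vec ℤ n
    𝕋 = combine E
    f g : Vec ℤ (rank E) → Vec ℤ n
    f u = 𝕋 u ⊞ᶻ a
    g u = 𝕋 u ⊞ᶻ b

    module _ (A≢[] : A ≢ []) (B≢[] : B ≢ [])
             (generated-by : ∀ {v} → Row E v → Span (λ v → v ∈ differences b B ⊎ v ∈ differences a A) v)
             (rank≤ : rank (hull-basis A) ℕ.≤ rank E)
             (recursion : ∀ (A′ B′ : List (Vec ℤ n)) A′≢[] B′≢[] → length A′ ℕ.+ length B′ ℕ.< length A ℕ.+ length B → ¬ ¬ Pieces A′ B′ A′≢[] B′≢[])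
             (none : ¬ Pieces A B A≢[] B≢[]) where
      in-coordinates : Σ[ A₁ ∈ List (Vec ℤ (rank E)) ] List.map f A₁ ≡ A → Σ[ B₁ ∈ List (Vec ℤ (rank E)) ] List.map g B₁ ≡ B → ⊥
      in-coordinates (A₁ , fA₁≡) (B₁ , gB₁≡) = structure (rank E) ℕₚ.≤-refl ΩA parity with-φ
        where
        A₁≢[] : A₁ ≢ []
        A₁≢[] p = A≢[] (trans (sym fA₁≡) (cong (List.map f) p))
        B₁≢[] : B₁ ≢ []
        B₁≢[] p = B≢[] (trans (sym gB₁≡) (cong (List.map g) p))
        ΩA = uniform A₁ A₁≢[]
        ΩB = uniform B₁ B₁≢[]
        δ≈ : δᴸ A B A≢[] B≢[] ≈ᵛ δᴸ A₁ B₁ A₁≢[] B₁≢[]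
        δ≈ = transport A B A≢[] B≢[] fA₁≡ gB₁≡
          where
          transport : ∀ A B A≢[] B≢[] → List.map f A₁ ≡ A → List.map g B₁ ≡ B → δᴸ A B A≢[] B≢[] ≈ᵛ δᴸ A₁ B₁ A₁≢[] B₁≢[]
          transport _ _ A≢[] B≢[] refl refl = δ-map 𝕋 (combine-+ E) (combine-injective E) a b A₁ B₁ A₁≢[] B₁≢[]
        Φ≈ : Φᴸ A B A≢[] B≢[] ≈ᵛ Φᴸ A₁ B₁ A₁≢[] B₁≢[]
        Φ≈ = transport A B A≢[] B≢[] fA₁≡ gB₁≡
          where
          transport : ∀ A B A≢[] B≢[] → List.map f A₁ ≡ A → List.map g B₁ ≡ B → Φᴸ A B A≢[] B≢[] ≈ᵛ Φᴸ A₁ B₁ A₁≢[] B₁≢[]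
          transport _ _ A≢[] B≢[] refl refl = Φ-map 𝕋 (combine-+ E) (combine-injective E) a b A₁ B₁ A₁≢[] B₁≢[]

        with-φ : ¬ (Σ[ m ∈ ℕ ] Σ[ φ ∈ Surjection (rank E) m ] ((rank E ℕ.∸ m) ×ᵛ log₂ ≤ᵛ 10 ×ᵛ H ΩA ⟨ parity ⟩ × H ΩA ⟨ ψ φ ∘ parity ⟩ ≤ᵛ 50 ×ᵛ D₁ ΩA (ψ φ ∘ parity)))
        with-φ (m , φ , dim , structured) = fibre-pick χ χ-hom ΩA id ΩB id FA.fibres-disintegrate FB.fibres-disintegrate structured picked
          where
          χ : Vec ℤ (rank E) → Vec Bool m
          χ = ψ φ ∘ parity
          χ-hom : ∀ u v → χ (u ⊞ᶻ v) ≡ χ u ⊞ χ v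
          χ-hom u v = trans (cong (ψ φ) (parity-+ u v)) (ψ-hom φ (parity u) (parity v))
          χ-𝟎 : χ 𝟎ᶻ ≡ 𝟎
          χ-𝟎 = trans (sym (⊞-cancelʳ (χ 𝟎ᶻ) (χ 𝟎ᶻ))) (trans (cong (_⊞ χ 𝟎ᶻ) (trans (sym (χ-hom 𝟎ᶻ 𝟎ᶻ)) (cong χ (⊞ᶻ-identityˡ 𝟎ᶻ)))) (⊞-self (χ 𝟎ᶻ)))
          module FA = Fibres A₁ A₁≢[] χ
          module FB = Fibres B₁ B₁≢[] χ

          recurse : ∀ {s t} → length (FA.fibre (χ s)) ℕ.+ length (FB.fibre (χ t)) ℕ.< length A₁ ℕ.+ length B₁ → s ∈ A₁ → t ∈ B₁ →
            Φ (FA.κ (χ s)) id (FB.κ (χ t)) id ≤ᵛ Φ ΩA id ΩB id → ⊥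
          recurse {s} {t} shorter s∈ t∈ Φ≤ = recursion A′ B′ A′≢[] B′≢[] (ℕₚ.≤-trans (ℕₚ.≤-reflexive (cong suc lengths)) (ℕₚ.≤-trans shorter (ℕₚ.≤-reflexive total-length)))
              λ (A″ , B″ , A″≢[] , B″≢[] , A″⊆ , B″⊆ , Φ″≤ , rank≤) → none (A″ , B″ , A″≢[] , B″≢[] , ⊆-trans A″⊆ A′⊆A , ⊆-trans B″⊆ B′⊆B ,
                ≤ᵛ-trans Φ″≤ Φ′≤ , rank≤)
            where
            F = FA.fibre (χ s)
            G = FB.fibre (χ t)
            F≢[] = FA.fibre-nonempty s∈
            G≢[] = FB.fibre-nonempty t∈
            A′ = List.map f F
            B′ = List.map g G
            A′≢[] = map-nonempty f F F≢[]
            B′≢[] = map-nonempty g G G≢[]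
            A′⊆A : A′ ⊆ A
            A′⊆A = subst (A′ ⊆_) fA₁≡ (Sublistₚ.map⁺ f (Sublistₚ.filter-⊆ (λ u → χ u ≟ χ s) A₁))
            B′⊆B : B′ ⊆ B
            B′⊆B = subst (B′ ⊆_) gB₁≡ (Sublistₚ.map⁺ g (Sublistₚ.filter-⊆ (λ u → χ u ≟ χ t) B₁))
            lengths : length A′ ℕ.+ length B′ ≡ length F ℕ.+ length G
            lengths = cong₂ ℕ._+_ (Listₚ.length-map f F) (Listₚ.length-map g G)
            total-length : length A₁ ℕ.+ length B₁ ≡ length A ℕ.+ length B
            total-length = cong₂ ℕ._+_ (trans (sym (Listₚ.length-map f A₁)) (cong length fA₁≡)) (trans (sym (Listₚ.length-map g B₁)) (cong length gB₁≡))
            Φ′≤ : Φᴸ A′ B′ A′≢[] B′≢[] ≤ᵛ Φᴸ A B A≢[] B≢[]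
            Φ′≤ = ≤ᵛ-trans (proj₁ (Φ-map 𝕋 (combine-+ E) (combine-injective E) a b F G F≢[] G≢[])) (≤ᵛ-trans
              (subst₂ (λ Ω Ω′ → Φ Ω id Ω′ id ≤ᵛ Φ ΩA id ΩB id) (uniform-or≡ F ΩA F≢[]) (uniform-or≡ G ΩB G≢[]) Φ≤) (proj₂ Φ≈))

          picked : ¬ (Σ[ s ∈ _ ] Σ[ t ∈ _ ] (s ∈ supp ΩA × t ∈ supp ΩB × Φ (FA.κ (χ s)) id (FB.κ (χ t)) id ≤ᵛ Φ ΩA id ΩB id))
          picked (s , t , s∈ , t∈ , Φ≤) with length-fibre-< χ (χ s) A₁ | length-fibre-< χ (χ t) B₁
          -- χ is constant on both lists, hence zero on all differences and on the lattice; as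
          -- parity and φ are onto, m = 0. So the full rank counts: rank · log 2 ≤ 10 H(parity) ≤ 20
          -- δ.
          ... | inj₁ allA | inj₁ allB = none (A , B , A≢[] , B≢[] , ⊆-refl , ⊆-refl , ≤ᵛ-refl ,
              linear (rank (hull-basis A) ×ᵛ log₂ ∷ rank E ×ᵛ log₂ ∷ H ΩA ⟨ parity ⟩ ∷ δᴸ A B A≢[] B≢[] ∷ δᴸ A₁ B₁ A₁≢[] B₁≢[] ∷ []) v₀ (20 ⊛ v₃)
                (1 · v₀ ≦ v₁ ∵ •-monoˡ 0≤log₂ (fromℕℚ-mono rank≤) ∷
                 1 · v₁ ≦ 10 ⊛ v₂ ∵ subst (λ l → l ×ᵛ log₂ ≤ᵛ 10 ×ᵛ H ΩA ⟨ parity ⟩) (cong (rank E ℕ.∸_) m≡0) dim ∷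
                 10 · v₂ ≦ 2 ⊛ v₄ ∵ parity-entropy ΩA id ΩB id ∷ 20 · v₄ ≦ v₃ ∵ proj₂ δ≈ ∷ []))
            where
            0≤log₂ : 0ᵛ ≤ᵛ log₂
            0≤log₂ = ≤ᵛ-trans (proj₂ log-1) (log-mono (ℚₚ.positive⁻¹ 1ℚ) (fromℕℚ-mono {1} {2} (s≤s z≤n)))
            killed : ∀ {v} → Span (λ v → v ∈ differences b B ⊎ v ∈ differences a A) v → Σ[ u ∈ _ ] (𝕋 u ≡ v × χ u ≡ 𝟎)
            killed (gen (inj₁ v∈)) = from-difference E χ χ-𝟎 g b (λ _ → refl) gB₁≡ refl allB v∈
            killed (gen (inj₂ v∈)) = from-difference E χ χ-𝟎 f a (λ _ → refl) fA₁≡ refl allA v∈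
            killed zero = 𝟎ᶻ , combine-𝟎 E , χ-𝟎
            killed (add p q) with killed p | killed q
            ... | u , refl , χu | v , refl , χv = u ⊞ᶻ v , combine-+ E u v , trans (χ-hom u v) (trans (cong₂ _⊞_ χu χv) (⊞-self 𝟎))
            killed (minus p) with killed p
            ... | u , refl , χu = -ᶻ u , combine-neg E u , trans (sym (⊞-identityˡ (χ (-ᶻ u)))) (trans (cong (_⊞ χ (-ᶻ u)) (sym χu))
                    (trans (sym (χ-hom u (-ᶻ u))) (trans (cong χ (⊞ᶻ-inverseʳ u)) χ-𝟎)))
            χ≡𝟎 : ∀ u → χ u ≡ 𝟎
            χ≡𝟎 u with killed (Span-bind generated-by (combine-Span E u))
            ... | v , 𝕋v≡Tu , χv = trans (cong χ (sym (combine-injective E v u 𝕋v≡Tu))) χv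
            m≡0 : m ≡ 0
            m≡0 = trivial-codimension φ λ v → trans (cong (ψ φ) (sym (parity-bit v))) (χ≡𝟎 (Vec.map bit v))
          ... | inj₂ fewer | _ = recurse (ℕₚ.+-mono-<-≤ fewer (Listₚ.length-filter (λ u → χ u ≟ χ t) B₁)) (supp-uniform A₁ A₁≢[] s∈) (supp-uniform B₁ B₁≢[] t∈) Φ≤
          ... | inj₁ _ | inj₂ fewer = recurse (ℕₚ.+-mono-≤-< (Listₚ.length-filter (λ u → χ u ≟ χ s) A₁) fewer) (supp-uniform A₁ A₁≢[] s∈) (supp-uniform B₁ B₁≢[] t∈) Φ≤

  pieces : ∀ fuel {n} (A B : List (Vec ℤ n)) A≢[] B≢[] → length A ℕ.+ length B ℕ.≤ fuel → ¬ ¬ Pieces A B A≢[] B≢[]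
  pieces fuel []         B          A≢[] B≢[] len none = A≢[] refl
  pieces fuel (a ∷ A₀)   []         A≢[] B≢[] len none = B≢[] refl
  pieces zero (a ∷ A₀)   (b ∷ B₀)   A≢[] B≢[] () none
  pieces (suc fuel) {n} (a ∷ A₀) (b ∷ B₀) A≢[] B≢[] len none =
    Λ.in-coordinates A≢[] B≢[] generators (insert-all-rank (differences b (b ∷ B₀)) EA)
      (λ A′ B′ A′≢[] B′≢[] shorter → pieces fuel A′ B′ A′≢[] B′≢[] (ℕₚ.≤-pred (ℕₚ.≤-trans shorter len))) none
      (pull-back Λ.f (All.tabulate in-A)) (pull-back Λ.g (All.tabulate in-B))
    where
    EA E : Echelon n
    EA = hull-basis (a ∷ A₀)
    -- Starting from the hull basis of A makes rank monotonicity bound the rank of A alone by that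
    -- of the common lattice.
    E = insert-all (differences b (b ∷ B₀)) EA
    module Λ = Lattice a b A₀ B₀ E
    undo : ∀ (c v : Vec ℤ n) → (v ⊞ᶻ (-ᶻ c)) ⊞ᶻ c ≡ v
    undo c v = trans (⊞ᶻ-assoc v (-ᶻ c) c) (trans (cong (v ⊞ᶻ_) (trans (⊞ᶻ-comm (-ᶻ c) c) (⊞ᶻ-inverseʳ c))) (⊞ᶻ-identityʳ v))
    in-A : ∀ {v} → v ∈ a ∷ A₀ → Σ[ u ∈ Vec ℤ (rank E) ] Λ.f u ≡ v
    in-A {v} v∈ with coordinates E (Span-bind (insert-all-extends (differences b (b ∷ B₀)) EA)
                       (hull-covers a A₀ (∈ₚ.∈-map⁺ (_⊞ᶻ (-ᶻ a)) v∈)))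
    ... | u , eq = u , trans (cong (_⊞ᶻ a) eq) (undo a v)
    in-B : ∀ {v} → v ∈ b ∷ B₀ → Σ[ u ∈ Vec ℤ (rank E) ] Λ.g u ≡ v
    in-B {v} v∈ with coordinates E (insert-all-covers (differences b (b ∷ B₀)) EA (∈ₚ.∈-map⁺ (_⊞ᶻ (-ᶻ b)) v∈))
    ... | u , eq = u , trans (cong (_⊞ᶻ b) eq) (undo b v)
    generators : ∀ {v} → Row E v → Span (λ v → v ∈ differences b (b ∷ B₀) ⊎ v ∈ differences a (a ∷ A₀)) v
    generators = Span-bind (λ { (inj₁ v∈) → gen (inj₁ v∈) ; (inj₂ r) → Span-bind (λ v∈ → gen (inj₂ v∈)) (hull-generated a A₀ r) })
      ∘ insert-all-generated (differences b (b ∷ B₀)) EA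

  -- From entropies back to cardinalities

  -- 0 ≤ log (q/p) ≤ q/p - 1 gives 1 ≤ q/p, because rational multiples of `one` reflect the order.
  log-reflect : ∀ {p q} → 0ℚ < p → 0ℚ < q → log p ≤ᵛ log q → p ≤ q
  log-reflect {p} {q} 0<p 0<q le = subst₂ _≤_ (ℚₚ.*-identityˡ p) r*p≡q (ℚₚ.*-monoʳ-≤-nonNeg p {{nonNegative (ℚₚ.<⇒≤ 0<p)}} 1≤r)
    where
    r = q * recip p
    0<r = *-pos 0<q (recip-pos 0<p)
    r*p≡q : r * p ≡ q
    r*p≡q = trans (ℚₚ.*-assoc q (recip p) p) (trans (cong (q *_) (recip-inverseˡ 0<p)) (ℚₚ.*-identityʳ q))
    0≤[r-1]•one : 0ᵛ ≤ᵛ (r - 1ℚ) • one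
    0≤[r-1]•one = linear (log p ∷ log q ∷ log (recip p) ∷ log r ∷ (r - 1ℚ) • one ∷ -ᵛ log p ∷ []) 𝕠 v₄
      (1 · v₀ ≦ v₁ ∵ le ∷ 1 · v₃ ≦ v₄ ∵ log-≤ 0<r ∷ 1 · v₁ ⊹ v₂ ≦ v₃ ∵ proj₂ (log-* 0<q (recip-pos 0<p)) ∷
       1 · v₅ ≦ v₂ ∵ proj₂ (log-recip 0<p) ∷ 1 · 𝕠 ≦ v₀ ⊹ v₅ ∵ proj₂ (+ᵛ-inverseʳ (log p)) ∷ [])
    1≤r : 1ℚ ≤ r
    1≤r = subst₂ _≤_ (ℚₚ.+-identityˡ 1ℚ) (sym (split-+ r 1ℚ)) (ℚₚ.+-monoˡ-≤ 1ℚ (•one-cancel (≤ᵛ-trans (proj₁ (•-zeroˡ one)) 0≤[r-1]•one)))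

  logℕ : ℕ → Carrier
  logℕ n = log (fromℕℚ n)

  logℕ-mono : ∀ {m n} → 1 ℕ.≤ m → m ℕ.≤ n → logℕ m ≤ᵛ logℕ n
  logℕ-mono {m} 1≤m m≤n = log-mono (fromℕℚ-pos m 1≤m) (fromℕℚ-mono m≤n)

  logℕ-reflect : ∀ {m n} → 1 ℕ.≤ m → 1 ℕ.≤ n → logℕ m ≤ᵛ logℕ n → m ℕ.≤ n
  logℕ-reflect {m} {n} 1≤m 1≤n le = fromℕℚ-cancel (log-reflect (fromℕℚ-pos m 1≤m) (fromℕℚ-pos n 1≤n) le)

  logℕ-* : ∀ {m n} → 1 ℕ.≤ m → 1 ℕ.≤ n → logℕ (m ℕ.* n) ≈ᵛ logℕ m +ᵛ logℕ n
  logℕ-* {m} {n} 1≤m 1≤n = ≈ᵛ-trans (≡⇒≈ᵛ (cong log (fromℕℚ-* m n))) (log-* (fromℕℚ-pos m 1≤m) (fromℕℚ-pos n 1≤n))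

  logℕ-^ : ∀ {n} → 1 ℕ.≤ n → ∀ k → logℕ (n ℕ.^ k) ≈ᵛ k ×ᵛ logℕ n
  logℕ-^ {n} 1≤n zero    = ≈ᵛ-trans log-1 (≈ᵛ-sym (•-zeroˡ (logℕ n)))
  logℕ-^ {n} 1≤n (suc k) = ≈ᵛ-trans (logℕ-* 1≤n (1≤^ 1≤n k)) (≈ᵛ-trans (+ᵛ-cong ≈ᵛ-refl (logℕ-^ 1≤n k)) (≈ᵛ-sym (×ᵛ-suc k (logℕ n))))

  module _ (s t : ℕ) {n m k : ℕ} (d : ℕ) (1≤n : 1 ℕ.≤ n) (1≤m : 1 ℕ.≤ m) (1≤k : 1 ℕ.≤ k) where
    private
      1≤k*m^s : 1 ℕ.≤ k ℕ.* m ℕ.^ s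
      1≤k*m^s = ℕₚ.*-mono-≤ 1≤k (1≤^ 1≤m s)
      1≤2^d*n^t : 1 ℕ.≤ 2 ℕ.^ d ℕ.* n ℕ.^ t
      1≤2^d*n^t = ℕₚ.*-mono-≤ (1≤^ {2} (s≤s z≤n) d) (1≤^ 1≤n t)
      log-k*m^s : logℕ (k ℕ.* m ℕ.^ s) ≈ᵛ logℕ k +ᵛ s ×ᵛ logℕ m
      log-k*m^s = ≈ᵛ-trans (logℕ-* 1≤k (1≤^ 1≤m s)) (+ᵛ-cong ≈ᵛ-refl (logℕ-^ 1≤m s))
      log-2^d*n^t : logℕ (2 ℕ.^ d ℕ.* n ℕ.^ t) ≈ᵛ d ×ᵛ log₂ +ᵛ t ×ᵛ logℕ n
      log-2^d*n^t = ≈ᵛ-trans (logℕ-* (1≤^ {2} (s≤s z≤n) d) (1≤^ 1≤n t)) (+ᵛ-cong (log-2^ d) (logℕ-^ 1≤n t))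

    power-size : n ℕ.^ suc s ℕ.≤ k ℕ.* m ℕ.^ s → suc s ×ᵛ logℕ n ≤ᵛ logℕ k +ᵛ s ×ᵛ logℕ m
    power-size le = ≤ᵛ-trans (proj₂ (logℕ-^ 1≤n (suc s))) (≤ᵛ-trans (logℕ-mono (1≤^ 1≤n (suc s)) le) (proj₁ log-k*m^s))

    log-size : suc s ×ᵛ logℕ n ≤ᵛ logℕ k +ᵛ s ×ᵛ logℕ m → n ℕ.^ suc s ℕ.≤ k ℕ.* m ℕ.^ s
    log-size le = logℕ-reflect (1≤^ 1≤n (suc s)) 1≤k*m^s (≤ᵛ-trans (proj₁ (logℕ-^ 1≤n (suc s))) (≤ᵛ-trans le (proj₂ log-k*m^s)))

    power-rank : 2 ℕ.^ d ℕ.* n ℕ.^ t ℕ.≤ m ℕ.^ t → d ×ᵛ log₂ +ᵛ t ×ᵛ logℕ n ≤ᵛ t ×ᵛ logℕ m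
    power-rank le = ≤ᵛ-trans (proj₂ log-2^d*n^t) (≤ᵛ-trans (logℕ-mono 1≤2^d*n^t le) (proj₁ (logℕ-^ 1≤m t)))

    log-rank : d ×ᵛ log₂ +ᵛ t ×ᵛ logℕ n ≤ᵛ t ×ᵛ logℕ m → 2 ℕ.^ d ℕ.* n ℕ.^ t ℕ.≤ m ℕ.^ t
    log-rank le = logℕ-reflect 1≤2^d*n^t (1≤^ 1≤m t) (≤ᵛ-trans (proj₁ log-2^d*n^t) (≤ᵛ-trans le (proj₂ (logℕ-^ 1≤m t))))

  -- The logarithmic inequalities are undecidable, but their exponentials are inequalities of natural numbers,
  -- so that a sublist that cannot fail to exist can be found by search.
  search : ∀ {S : Set} (s t : ℕ) (rk : List S → ℕ) (A : List S) → A ≢ [] → ∀ m → 1 ℕ.≤ m →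
    let Dense = λ A′ → suc s ×ᵛ logℕ (length A) ≤ᵛ logℕ (length A′) +ᵛ s ×ᵛ logℕ m × rk A′ ×ᵛ log₂ +ᵛ t ×ᵛ logℕ (length A) ≤ᵛ t ×ᵛ logℕ m
    in ¬ ¬ (Σ[ A′ ∈ List S ] (A′ ⊆ A × A′ ≢ [] × Dense A′)) → Σ[ A′ ∈ List S ] (A′ ⊆ A × A′ ≢ [] × Dense A′)
  search {S} s t rk A A≢[] m 1≤m ¬¬found =
    let A′ , sub , 1≤k , size , rank≤ = decidable-stable (sublist? P? A) λ none → ¬¬found λ (A′ , sub , A′≢[] , size , rank≤) →
          let 1≤k = nonempty-length A′ A′≢[] in none (A′ , sub , 1≤k , log-size s t (rk A′) 1≤n 1≤m 1≤k size , log-rank s t (rk A′) 1≤n 1≤m 1≤k rank≤)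
    in A′ , sub , length-nonempty A′ 1≤k , power-size s t (rk A′) 1≤n 1≤m 1≤k size , power-rank s t (rk A′) 1≤n 1≤m 1≤k rank≤
    where
    length-nonempty : ∀ L → 1 ℕ.≤ length L → L ≢ []
    length-nonempty (_ ∷ _) _ ()
    n = length A
    1≤n = nonempty-length A A≢[]
    P : List S → Set
    P A′ = 1 ℕ.≤ length A′ × n ℕ.^ suc s ℕ.≤ length A′ ℕ.* m ℕ.^ s × 2 ℕ.^ rk A′ ℕ.* n ℕ.^ t ℕ.≤ m ℕ.^ t
    P? : ∀ A′ → Dec (P A′)
    P? A′ = 1 ℕₚ.≤? length A′ ×-dec n ℕ.^ suc s ℕₚ.≤? length A′ ℕ.* m ℕ.^ s ×-dec 2 ℕ.^ rk A′ ℕ.* n ℕ.^ t ℕₚ.≤? m ℕ.^ t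

  module _ {n : ℕ} (A : List (Vec ℤ n)) (A≢[] : A ≢ []) (unique-A : Unique A)
           (sums : List (Vec ℤ n)) (cover : ∀ {u v} → u ∈ A → v ∈ A → u ⊞ᶻ v ∈ sums) where
    private
      ΩA = uniform A A≢[]
      a m : Carrier
      a = logℕ (length A)
      m = logℕ (length sums)
      Hs = H (ΩA ⊗ ΩA) ⟨ (λ (u , v) → u ⊞ᶻ v) ⟩
      ha = H ΩA ⟨ id ⟩

      sums≢[] : sums ≢ []
      sums≢[] = nonempty A A≢[] cover
        where
        nonempty : ∀ A → A ≢ [] → (∀ {u v} → u ∈ A → v ∈ A → u ⊞ᶻ v ∈ sums) → sums ≢ []
        nonempty []      A≢[] _     = λ _ → A≢[] refl
        nonempty (a ∷ A) _    cover = ∈⇒nonempty (cover (here refl) (here refl))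

      Hs≤m : Hs ≤ᵛ m
      Hs≤m = H-≤-log-card (ΩA ⊗ ΩA) (λ (u , v) → u ⊞ᶻ v) sums
        (λ _ uv∈ → cover (supp-uniform A A≢[] (proj₁ (supp->>= ΩA (λ _ → ΩA) uv∈))) (supp-uniform A A≢[] (proj₂ (supp->>= ΩA (λ _ → ΩA) uv∈)))) sums≢[]

      a≤ha : a ≤ᵛ ha
      a≤ha = proj₂ (H-uniform A A≢[] unique-A)

      entropy-⊆ : ∀ B → B ⊆ A → ∀ B≢[] → H (uniform B B≢[]) ⟨ id ⟩ ≤ᵛ a
      entropy-⊆ B sub B≢[] = ≤ᵛ-trans (proj₁ (H-uniform B B≢[] (Unique-⊆ sub unique-A))) (logℕ-mono (nonempty-length B B≢[]) (Sublistₚ.length-mono-≤ sub))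

    -- Written with the size of the sumset in place of K, so that both inequalities are logarithms
    -- of inequalities between natural numbers, as `search` requires. 202 = 2 · 101 and 40 = 2 · 20,
    -- because δ of a pair (A, A) is at most twice the logarithm of the doubling.
    DensePiece : Set
    DensePiece = Σ[ A′ ∈ List (Vec ℤ n) ] (A′ ⊆ A × A′ ≢ [] ×
      203 ×ᵛ logℕ (length A) ≤ᵛ logℕ (length A′) +ᵛ 202 ×ᵛ logℕ (length sums) ×
      rank (hull-basis A′) ×ᵛ log₂ +ᵛ 40 ×ᵛ logℕ (length A) ≤ᵛ 40 ×ᵛ logℕ (length sums))

    dense-piece : DensePiece
    dense-piece = search 202 40 (λ A′ → rank (hull-basis A′)) A A≢[] (length sums) (nonempty-length sums sums≢[])
      λ none → pieces (length A ℕ.+ length A) A A A≢[] A≢[] ℕₚ.≤-refl (none ∘ convert)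
      where
      convert : Pieces A A A≢[] A≢[] → DensePiece
      convert (A′ , B′ , A′≢[] , B′≢[] , A′⊆ , B′⊆ , Φ≤ , rank≤) = A′ , A′⊆ , A′≢[] ,
        linear (ha′ ∷ hb′ ∷ a ∷ a′ ∷ m ∷ δ′ ∷ ha ∷ Hs ∷ []) (203 ⊛ v₂) (v₃ ⊹ 202 ⊛ v₄)
          (1 · 101 ⊛ v₅ ⊝ v₀ ⊝ v₁ ≦ 101 ⊛ (2 ⊛ v₇ ⊝ v₆ ⊝ v₆) ⊝ v₆ ⊝ v₆ ∵ Φ≤ ∷ 101 · 𝕠 ≦ v₅ ∵ 0≤δ′ ∷
           1 · v₀ ≦ v₃ ∵ proj₁ (H-uniform A′ A′≢[] (Unique-⊆ A′⊆ unique-A)) ∷ 1 · v₁ ≦ v₂ ∵ entropy-⊆ B′ B′⊆ B′≢[] ∷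
           204 · v₂ ≦ v₆ ∵ a≤ha ∷ 202 · v₇ ≦ v₄ ∵ Hs≤m ∷ []) ,
        linear (rank (hull-basis A′) ×ᵛ log₂ ∷ a ∷ m ∷ δ′ ∷ ha ∷ Hs ∷ []) (v₀ ⊹ 40 ⊛ v₁) (40 ⊛ v₂)
          (1 · v₀ ≦ 20 ⊛ v₃ ∵ rank≤ ∷ 20 · v₃ ≦ 2 ⊛ v₅ ⊝ v₄ ⊝ v₄ ∵ δ′≤δ ∷ 40 · v₁ ≦ v₄ ∵ a≤ha ∷ 40 · v₅ ≦ v₂ ∵ Hs≤m ∷ [])
        where
        a′ ha′ hb′ δ′ : Carrier
        a′ = logℕ (length A′)
        ha′ = H (uniform A′ A′≢[]) ⟨ id ⟩
        hb′ = H (uniform B′ B′≢[]) ⟨ id ⟩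
        δ′ = δᴸ A′ B′ A′≢[] B′≢[]
        0≤δ′ : 0ᵛ ≤ᵛ δ′
        0≤δ′ = δ-nonNeg (uniform A′ A′≢[]) id (uniform B′ B′≢[]) id
        -- Sublists of A have entropy at most that of A, so in Φ′ ≤ Φ the entropy terms only help
        -- and the δ terms can be compared.
        δ′≤δ : δ′ ≤ᵛ 2 ×ᵛ Hs -ᵛ ha -ᵛ ha
        δ′≤δ = •-cancel-≤ (fromℕℚ-pos 101 (s≤s z≤n)) (linear (ha′ ∷ hb′ ∷ a ∷ δ′ ∷ ha ∷ Hs ∷ []) (101 ⊛ v₃) (101 ⊛ (2 ⊛ v₅ ⊝ v₄ ⊝ v₄))
          (1 · 101 ⊛ v₃ ⊝ v₀ ⊝ v₁ ≦ 101 ⊛ (2 ⊛ v₅ ⊝ v₄ ⊝ v₄) ⊝ v₄ ⊝ v₄ ∵ Φ≤ ∷ 1 · v₀ ≦ v₂ ∵ entropy-⊆ A′ A′⊆ A′≢[] ∷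
           1 · v₁ ≦ v₂ ∵ entropy-⊆ B′ B′⊆ B′≢[] ∷ 2 · v₂ ≦ v₄ ∵ a≤ha ∷ []))

    card-≤-sums : length A ℕ.≤ length sums
    card-≤-sums = logℕ-reflect (nonempty-length A A≢[]) (nonempty-length sums sums≢[]) (•-cancel-≤ (fromℕℚ-pos 2 (s≤s z≤n))
      (linear (a ∷ m ∷ ha ∷ Hs ∷ []) (2 ⊛ v₀) (2 ⊛ v₁)
        (2 · v₀ ≦ v₂ ∵ a≤ha ∷ 2 · v₃ ≦ v₁ ∵ Hs≤m ∷ 1 · 𝕠 ≦ 2 ⊛ v₃ ⊝ v₂ ⊝ v₂ ∵ δ-nonNeg ΩA id ΩA id ∷ [])))

    small-doubling : ∀ k → logℕ (length sums) ≤ᵛ k +ᵛ logℕ (length A) →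
      Σ[ A′ ∈ List (Vec ℤ n) ] (A′ ⊆ A × A′ ≢ [] × logℕ (length A) ≤ᵛ logℕ (length A′) +ᵛ 202 ×ᵛ k × rank (hull-basis A′) ×ᵛ one ≤ᵛ 80 ×ᵛ k)
    small-doubling k m≤k+a =
      let A′ , A′⊆ , A′≢[] , size , rank≤ = dense-piece
          d = rank (hull-basis A′)
      in A′ , A′⊆ , A′≢[] ,
        linear (a ∷ logℕ (length A′) ∷ m ∷ k ∷ []) v₀ (v₁ ⊹ 202 ⊛ v₃)
          (1 · 203 ⊛ v₀ ≦ v₁ ⊹ 202 ⊛ v₂ ∵ size ∷ 202 · v₂ ≦ v₃ ⊹ v₀ ∵ m≤k+a ∷ []) ,
        linear (d ×ᵛ one ∷ d ×ᵛ log₂ ∷ d ×ᵛ (log₂ +ᵛ log₂) ∷ a ∷ m ∷ k ∷ []) v₀ (80 ⊛ v₅)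
          (1 · v₀ ≦ v₂ ∵ ×ᵛ-mono d one≤2log₂ ∷ 1 · v₂ ≦ v₁ ⊹ v₁ ∵ proj₁ (•-distribˡ (fromℕℚ d) log₂ log₂) ∷
           2 · v₁ ⊹ 40 ⊛ v₃ ≦ 40 ⊛ v₄ ∵ rank≤ ∷ 80 · v₄ ≦ v₅ ⊹ v₃ ∵ m≤k+a ∷ [])
      where
      -- log ½ ≤ - ½ gives log 2 ≥ ½, which doubles the rank constant 40 to 80.
      c = ½ - 1ℚ
      one≤2log₂ : one ≤ᵛ log₂ +ᵛ log₂
      one≤2log₂ = linear (one ∷ log₂ ∷ log ½ ∷ c • one ∷ (- 1ℚ) • one ∷ -ᵛ one ∷ 0ᵛ ∷ log 1ℚ ∷ []) v₀ (v₁ ⊹ v₁)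
        (2 · v₂ ≦ v₃ ∵ log-≤ (ℚₚ.positive⁻¹ ½) ∷ 1 · v₃ ⊹ v₃ ≦ v₄ ∵ proj₂ (•-distribʳ c c one) ∷ 1 · v₄ ≦ v₅ ∵ proj₁ (neg-• one) ∷
         1 · v₀ ⊹ v₅ ≦ v₆ ∵ proj₁ (+ᵛ-inverseʳ one) ∷ 2 · v₇ ≦ v₁ ⊹ v₂ ∵ proj₁ (log-* (fromℕℚ-pos 2 (s≤s z≤n)) (ℚₚ.positive⁻¹ ½)) ∷
         2 · v₆ ≦ v₇ ∵ proj₂ log-1 ∷ 1 · 𝕠 ≦ v₆ ∵ ≤ᵛ-refl ∷ [])

-- Order on the reals

∣p-q∣<ε : ∀ {p q ε} → p < q + ε → q < p + ε → ∣ p - q ∣ < ε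
∣p-q∣<ε {p} {q} {ε} p<q+ε q<p+ε with ℚₚ.∣p∣≡p∨∣p∣≡-p (p - q)
... | inj₁ eq rewrite eq = subst (p - q <_) (drop q ε) (ℚₚ.+-monoˡ-< (- q) p<q+ε)
  where
  open +-*-Solver
  drop : ∀ q ε → (q + ε) - q ≡ ε
  drop = solve 2 (λ q ε → (q :+ ε) :- q := ε) refl
... | inj₂ eq rewrite eq = subst₂ _<_ (flip p q) (drop p ε) (ℚₚ.+-monoˡ-< (- p) q<p+ε)
  where
  open +-*-Solver
  drop : ∀ q ε → (q + ε) - q ≡ ε
  drop = solve 2 (λ q ε → (q :+ ε) :- q := ε) refl
  flip : ∀ p q → q - p ≡ - (p - q)
  flip = solve 2 (λ p q → q :- p := :- (p :- q)) refl

∣p-q∣<ε⇒< : ∀ p q {ε} → ∣ p - q ∣ < ε → p < q + ε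
∣p-q∣<ε⇒< p q {ε} lt = subst (_< q + ε) (rejoin p q) (ℚₚ.+-monoʳ-< q (ℚₚ.≤-<-trans (p≤∣p∣ (p - q)) lt))
  where
  open +-*-Solver
  rejoin : ∀ p q → q + (p - q) ≡ p
  rejoin = solve 2 (λ p q → q :+ (p :- q) := p) refl
  p≤∣p∣ : ∀ p → p ≤ ∣ p ∣
  p≤∣p∣ p with ℚₚ.∣p∣≡p∨∣p∣≡-p p
  ... | inj₁ eq = ℚₚ.≤-reflexive (sym eq)
  ... | inj₂ eq with ℚₚ.≤-total 0ℚ p
  ...   | inj₁ 0≤p = ℚₚ.≤-reflexive (sym (ℚₚ.0≤p⇒∣p∣≡p 0≤p))
  ...   | inj₂ p≤0 = ℚₚ.≤-trans p≤0 (ℚₚ.0≤∣p∣ p)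

p<p+ε : ∀ {p ε} → 0ℚ < ε → p < p + ε
p<p+ε {p} {ε} 0<ε = subst (_< p + ε) (ℚₚ.+-identityʳ p) (ℚₚ.+-monoʳ-< p 0<ε)

half-+ : ∀ p ε → (p + ε * ½) + ε * ½ ≡ p + ε
half-+ p ε = trans (ℚₚ.+-assoc p (ε * ½) (ε * ½)) (cong (λ z → p + z) (halves ε))

⊔-split : ∀ {M N n} → M ℕ.⊔ N ℕ.≤ n → M ℕ.≤ n × N ℕ.≤ n
⊔-split {M} {N} le = ℕₚ.m⊔n≤o⇒m≤o M N le , ℕₚ.m⊔n≤o⇒n≤o M N le

-- _≤ᴿ_ with x and y recoverable by unification.
infix 4 _≤ʳ_
record _≤ʳ_ (x y : ℝ) : Set where
  constructor ↑
  field ↓ : x ≤ᴿ y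

open _≤ʳ_ public

-- One rational comparison, of x with y + ε/2 at an index past both moduli for ε/8, decides between
-- two overlapping alternatives: errors of ε/8 neither exhaust ε in the first nor close the gap in
-- the second.
compare : ∀ x y ε → 0ℚ < ε →
  Σ[ N ∈ ℕ ] (∀ n → N ℕ.≤ n → seq x n < seq y n + ε) ⊎ Σ[ N ∈ ℕ ] (∀ n → N ℕ.≤ n → seq y n + ε * (+ 1 / 8) < seq x n)
compare x y ε 0<ε with cauchy x (ε * (+ 1 / 8)) (*-pos 0<ε (ℚₚ.positive⁻¹ (+ 1 / 8))) | cauchy y (ε * (+ 1 / 8)) (*-pos 0<ε (ℚₚ.positive⁻¹ (+ 1 / 8)))
... | M , cx | N , cy with seq x (M ℕ.⊔ N) ℚₚ.<? seq y (M ℕ.⊔ N) + ε * ½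
...   | yes lt = inj₁ (M ℕ.⊔ N , λ n le → let M≤n , N≤n = ⊔-split {M} {N} le in begin-strict
        seq x n                      <⟨ ∣p-q∣<ε⇒< (seq x n) (seq x L) (cx n L M≤n (ℕₚ.m≤m⊔n M N)) ⟩
        seq x L + d                  <⟨ ℚₚ.+-monoˡ-< d lt ⟩
        (seq y L + ε * ½) + d        <⟨ ℚₚ.+-monoˡ-< d (ℚₚ.+-monoˡ-< (ε * ½) (∣p-q∣<ε⇒< (seq y L) (seq y n) (cy L n (ℕₚ.m≤n⊔m M N) N≤n))) ⟩
        ((seq y n + d) + ε * ½) + d  ≤⟨ ℚₚ.≤-trans (ℚₚ.≤-reflexive (sym (ℚₚ.+-identityʳ _))) (ℚₚ.+-monoʳ-≤ (((seq y n + d) + ε * ½) + d) (ℚₚ.<⇒≤ 0<2d)) ⟩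
        ((seq y n + d) + ε * ½) + d + (d + d) ≡⟨ regroup (seq y n) ε ⟩
        seq y n + ε                  ∎)
  where
  open ℚₚ.≤-Reasoning
  open +-*-Solver
  L = M ℕ.⊔ N
  d = ε * (+ 1 / 8)
  0<d = *-pos 0<ε (ℚₚ.positive⁻¹ (+ 1 / 8))
  0<2d = ℚₚ.+-mono-< 0<d 0<d
  regroup : ∀ y ε → let d = ε * (+ 1 / 8) in ((y + d) + ε * ½) + d + (d + d) ≡ y + ε
  regroup = solve 2 (λ y ε → let d = ε :* con (+ 1 / 8) in ((y :+ d) :+ ε :* con ½) :+ d :+ (d :+ d) := y :+ ε) refl
...   | no ≮ = inj₂ (M ℕ.⊔ N , λ n le → let M≤n , N≤n = ⊔-split {M} {N} le in begin-strict
        seq y n + d                          <⟨ ℚₚ.+-monoˡ-< d (∣p-q∣<ε⇒< (seq y n) (seq y L) (cy n L N≤n (ℕₚ.m≤n⊔m M N))) ⟩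
        (seq y L + d) + d                    ≡⟨ regroup (seq y L) ε ⟩
        (seq y L + ε * ½) - (d + d)          ≤⟨ ℚₚ.+-monoˡ-≤ (- (d + d)) (ℚₚ.≮⇒≥ ≮) ⟩
        seq x L - (d + d)                    <⟨ ℚₚ.+-monoˡ-< (- (d + d)) (∣p-q∣<ε⇒< (seq x L) (seq x n) (cx L n (ℕₚ.m≤m⊔n M N) M≤n)) ⟩
        (seq x n + d) - (d + d)              ≤⟨ ℚₚ.≤-trans (ℚₚ.≤-reflexive (undo (seq x n) d)) (ℚₚ.≤-trans (ℚₚ.+-monoʳ-≤ (seq x n) (ℚₚ.neg-antimono-≤ (ℚₚ.<⇒≤ 0<d))) (ℚₚ.≤-reflexive (ℚₚ.+-identityʳ (seq x n)))) ⟩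
        seq x n                              ∎)
  where
  open ℚₚ.≤-Reasoning
  open +-*-Solver
  L = M ℕ.⊔ N
  d = ε * (+ 1 / 8)
  0<d = *-pos 0<ε (ℚₚ.positive⁻¹ (+ 1 / 8))
  regroup : ∀ y ε → let d = ε * (+ 1 / 8) in (y + d) + d ≡ (y + ε * ½) - (d + d)
  regroup = solve 2 (λ y ε → let d = ε :* con (+ 1 / 8) in (y :+ d) :+ d := (y :+ ε :* con ½) :- (d :+ d)) refl
  undo : ∀ x e → (x + e) - (e + e) ≡ x - e
  undo = solve 2 (λ x e → (x :+ e) :- (e :+ e) := x :- e) refl


p≤∣p∣ : ∀ p → p ≤ ∣ p ∣
p≤∣p∣ p with ℚₚ.≤-total 0ℚ p
... | inj₁ 0≤p = ℚₚ.≤-reflexive (sym (ℚₚ.0≤p⇒∣p∣≡p 0≤p))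
... | inj₂ p≤0 = ℚₚ.≤-trans p≤0 (ℚₚ.0≤∣p∣ p)

pointwise-≤ : ∀ {x y} → (∀ n → seq x n ≤ seq y n) → x ≤ʳ y
pointwise-≤ {x} {y} le = ↑ λ ε 0<ε → 0 , λ n _ → ℚₚ.≤-<-trans (le n) (p<p+ε 0<ε)

eventually-≤ : ∀ {x y} N → (∀ n → N ℕ.≤ n → seq x n ≤ seq y n) → x ≤ʳ y
eventually-≤ {x} {y} N le = ↑ λ ε 0<ε → N , λ n N≤n → ℚₚ.≤-<-trans (le n N≤n) (p<p+ε 0<ε)

≤ʳ-refl : ∀ {x} → x ≤ʳ x
≤ʳ-refl = pointwise-≤ λ _ → ℚₚ.≤-refl

≤ʳ-trans : ∀ {x y z} → x ≤ʳ y → y ≤ʳ z → x ≤ʳ z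
≤ʳ-trans {x} {y} {z} (↑ x≤y) (↑ y≤z) = ↑ λ ε 0<ε →
  let M , p = x≤y (ε * ½) (half>0 0<ε)
      N , q = y≤z (ε * ½) (half>0 0<ε)
  in M ℕ.⊔ N , λ n le → ℚₚ.<-trans (p n (proj₁ (⊔-split {M} {N} le)))
       (subst (seq y n + ε * ½ <_) (half-+ (seq z n) ε) (ℚₚ.+-monoˡ-< (ε * ½) (q n (proj₂ (⊔-split {M} {N} le)))))

+ʳ-mono : ∀ {x y u v} → x ≤ʳ y → u ≤ʳ v → x +ᴿ u ≤ʳ y +ᴿ v
+ʳ-mono {x} {y} {u} {v} (↑ x≤y) (↑ u≤v) = ↑ λ ε 0<ε →
  let M , p = x≤y (ε * ½) (half>0 0<ε)
      N , q = u≤v (ε * ½) (half>0 0<ε)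
  in M ℕ.⊔ N , λ n le → subst (seq x n + seq u n <_) (regroup (seq y n) (seq v n) ε)
       (ℚₚ.+-mono-< (p n (proj₁ (⊔-split {M} {N} le))) (q n (proj₂ (⊔-split {M} {N} le))))
  where
  open +-*-Solver
  regroup : ∀ y v ε → (y + ε * ½) + (v + ε * ½) ≡ (y + v) + ε
  regroup = solve 3 (λ y v ε → (y :+ ε :* con ½) :+ (v :+ ε :* con ½) := (y :+ v) :+ ε) refl

≃⇒≤ : ∀ x y → x ≃ᴿ y → x ≤ʳ y × y ≤ʳ x
≃⇒≤ x y x≃y = ↑ (λ ε 0<ε → let N , p = x≃y ε 0<ε in N , λ n N≤n → ∣p-q∣<ε⇒< (seq x n) (seq y n) (p n N≤n)) ,
  ↑ (λ ε 0<ε → let N , p = x≃y ε 0<ε in N , λ n N≤n → ∣p-q∣<ε⇒< (seq y n) (seq x n) (subst (_< ε) (dist-sym (seq x n) (seq y n)) (p n N≤n)))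

≤⇒≃ : ∀ {x y} → x ≤ʳ y × y ≤ʳ x → x ≃ᴿ y
≤⇒≃ {x} {y} (↑ x≤y , ↑ y≤x) ε 0<ε =
  let M , p = x≤y ε 0<ε
      N , q = y≤x ε 0<ε
  in M ℕ.⊔ N , λ n le → ∣p-q∣<ε {seq x n} {seq y n} (p n (proj₁ (⊔-split {M} {N} le))) (q n (proj₂ (⊔-split {M} {N} le)))

pointwise-≡ : ∀ {x y} → (∀ n → seq x n ≡ seq y n) → x ≤ʳ y × y ≤ʳ x
pointwise-≡ eq = pointwise-≤ (λ n → ℚₚ.≤-reflexive (eq n)) , pointwise-≤ (λ n → ℚₚ.≤-reflexive (sym (eq n)))

fromℚ-mono : ∀ {p q} → p ≤ q → fromℚ p ≤ʳ fromℚ q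
fromℚ-mono p≤q = pointwise-≤ λ _ → p≤q

q+[p-q] : ∀ p q → q + (p - q) ≡ p
q+[p-q] = solve 2 (λ p q → q :+ (p :- q) := p) refl
  where open +-*-Solver

fromℚ-cancel : ∀ {p q} → fromℚ p ≤ʳ fromℚ q → p ≤ q
fromℚ-cancel {p} {q} (↑ le) with p ℚₚ.≤? q
... | yes p≤q = p≤q
... | no p≰q =
  let N , lt = le (p - q) (subst (_< p - q) (ℚₚ.+-inverseʳ q) (ℚₚ.+-monoˡ-< (- q) (ℚₚ.≰⇒> p≰q)))
  in contradiction (subst (p <_) (q+[p-q] p q) (lt N ℕₚ.≤-refl)) (ℚₚ.<-irrefl refl)

0<ε/8 : ∀ {ε} → 0ℚ < ε → 0ℚ < ε * (+ 1 / 8)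
0<ε/8 0<ε = *-pos 0<ε (ℚₚ.positive⁻¹ (+ 1 / 8))

≰ʳ⇒≥ : ∀ {x y} → ¬ (x ≤ʳ y) → y ≤ʳ x
≰ʳ⇒≥ {x} {y} x≰y = ↑ λ ε 0<ε → case compare y x ε 0<ε of λ where
  (inj₁ p)        → p
  (inj₂ (N , lt)) → contradiction (eventually-≤ {x} {y} N λ n N≤n →
    ℚₚ.<⇒≤ (ℚₚ.<-trans (p<p+ε {seq x n} (0<ε/8 0<ε)) (lt n N≤n))) x≰y

-- The second alternative of `compare` refutes x ≤ y, so under double negation the first one holds
-- for every ε.
≤ʳ-stable : ∀ {x y} → ¬ ¬ (x ≤ʳ y) → x ≤ʳ y
≤ʳ-stable {x} {y} ¬¬x≤y = ↑ λ ε 0<ε → case compare x y ε 0<ε of λ where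
  (inj₁ p)        → p
  (inj₂ (N , lt)) → ⊥-elim (¬¬x≤y λ (↑ x≤y) → let M , p = x≤y (ε * (+ 1 / 8)) (0<ε/8 0<ε) in
    ℚₚ.<-irrefl refl (ℚₚ.<-trans (p (M ℕ.⊔ N) (ℕₚ.m≤m⊔n M N)) (lt (M ℕ.⊔ N) (ℕₚ.m≤n⊔m M N))))

private
  product-bound : ∀ {b c δ ε} → 0ℚ < b → 0ℚ < c → 0ℚ < δ → δ ≤ 1ℚ → δ * ((b + c) + 1ℚ) ≤ ε →
    ∀ x y → ∣ x ∣ ≤ b → ∣ y ∣ ≤ c → 0ℚ < x + δ → 0ℚ < y + δ → 0ℚ < x * y + ε
  product-bound {b} {c} {δ} {ε} 0<b 0<c 0<δ δ≤1 δ≤ x y x≤ y≤ 0<x 0<y =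
    ℚₚ.<-≤-trans (*-pos 0<x 0<y) (ℚₚ.≤-trans (ℚₚ.≤-reflexive (expand x y δ)) (ℚₚ.+-monoʳ-≤ (x * y)
      (ℚₚ.≤-trans (ℚₚ.*-monoˡ-≤-nonNeg δ {{nonNegative (ℚₚ.<⇒≤ 0<δ)}}
        (ℚₚ.+-mono-≤ (ℚₚ.+-mono-≤ (ℚₚ.≤-trans (p≤∣p∣ x) x≤) (ℚₚ.≤-trans (p≤∣p∣ y) y≤)) δ≤1)) δ≤)))
    where
    open +-*-Solver
    expand : ∀ x y d → (x + d) * (y + d) ≡ x * y + d * ((x + y) + d)
    expand = solve 3 (λ x y d → (x :+ d) :* (y :+ d) := x :* y :+ d :* ((x :+ y) :+ d)) refl

  min-1 : ∀ p → 0ℚ < p → Σ[ q ∈ ℚ ] (0ℚ < q × q ≤ p × q ≤ 1ℚ)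
  min-1 p 0<p with ℚₚ.≤-total p 1ℚ
  ... | inj₁ p≤1 = p , 0<p , ℚₚ.≤-refl , p≤1
  ... | inj₂ 1≤p = 1ℚ , ℚₚ.positive⁻¹ 1ℚ , 1≤p , ℚₚ.≤-refl

-- Nonnegativity holds only up to δ, so (x + δ)(y + δ) > 0 is expanded; the bounds on x and y keep
-- the excess δ (x + y + δ) below ε.
*ʳ-nonNeg : ∀ {x y} → 0ᴿ ≤ʳ x → 0ᴿ ≤ʳ y → 0ᴿ ≤ʳ x *ᴿ y
*ʳ-nonNeg {x} {y} (↑ 0≤x) (↑ 0≤y) = ↑ λ ε 0<ε →
  let b , 0<b , N₁ , ∣x∣≤b = eventually-bounded x
      c , 0<c , N₂ , ∣y∣≤c = eventually-bounded y
      0<s                  = ℚₚ.+-mono-< (ℚₚ.+-mono-< 0<b 0<c) (ℚₚ.positive⁻¹ 1ℚ)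
      δ₀ , 0<δ₀ , δ₀≡      = quotient ε ((b + c) + 1ℚ) 0<ε 0<s
      δ , 0<δ , δ≤δ₀ , δ≤1 = min-1 δ₀ 0<δ₀
      N₃ , px              = 0≤x δ 0<δ
      N₄ , py              = 0≤y δ 0<δ
      δ≤ε                  = ℚₚ.≤-trans (ℚₚ.*-monoʳ-≤-nonNeg ((b + c) + 1ℚ) {{nonNegative (ℚₚ.<⇒≤ 0<s)}} δ≤δ₀) (ℚₚ.≤-reflexive δ₀≡)
      L                    = N₁ ℕ.⊔ N₂
      L′                   = N₃ ℕ.⊔ N₄
  in L ℕ.⊔ L′ , λ n le → product-bound 0<b 0<c 0<δ δ≤1 δ≤ε (seq x n) (seq y n)
       (∣x∣≤b n (proj₁ (⊔-split {N₁} {N₂} (proj₁ (⊔-split {L} {L′} le))))) (∣y∣≤c n (proj₂ (⊔-split {N₁} {N₂} (proj₁ (⊔-split {L} {L′} le)))))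
       (px n (proj₁ (⊔-split {N₃} {N₄} (proj₂ (⊔-split {L} {L′} le))))) (py n (proj₂ (⊔-split {N₃} {N₄} (proj₂ (⊔-split {L} {L′} le)))))

difference-nonNeg : ∀ {x y} → x ≤ʳ y → 0ᴿ ≤ʳ y -ᴿ x
difference-nonNeg {x} {y} (↑ x≤y) = ↑ λ ε 0<ε → let N , p = x≤y ε 0<ε in
  N , λ n N≤n → subst₂ _<_ (ℚₚ.+-inverseʳ (seq x n)) (regroup (seq x n) (seq y n) ε) (ℚₚ.+-monoˡ-< (- seq x n) (p n N≤n))
  where
  open +-*-Solver
  regroup : ∀ x y ε → (y + ε) - x ≡ (y - x) + ε
  regroup = solve 3 (λ x y ε → (y :+ ε) :- x := (y :- x) :+ ε) refl

*ʳ-monoʳ : ∀ {z x y} → 0ᴿ ≤ʳ z → x ≤ʳ y → z *ᴿ x ≤ʳ z *ᴿ y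
*ʳ-monoʳ {z} {x} {y} 0≤z x≤y = ≤ʳ-trans (pointwise-≤ {z *ᴿ x} {0ᴿ +ᴿ z *ᴿ x} λ n → ℚₚ.≤-reflexive (sym (ℚₚ.+-identityˡ (seq z n * seq x n))))
  (≤ʳ-trans (+ʳ-mono (*ʳ-nonNeg 0≤z (difference-nonNeg x≤y)) (≤ʳ-refl {z *ᴿ x}))
  (pointwise-≤ {z *ᴿ (y -ᴿ x) +ᴿ z *ᴿ x} {z *ᴿ y} λ n → ℚₚ.≤-reflexive (rejoin (seq z n) (seq x n) (seq y n))))
  where
  open +-*-Solver
  rejoin : ∀ z x y → z * (y - x) + z * x ≡ z * y
  rejoin = solve 3 (λ z x y → z :* (y :- x) :+ z :* x := z :* y) refl

ℝ-module : OrderedModule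
ℝ-module = record
  { Carrier = ℝ ; _≤ᵛ_ = _≤ʳ_ ; _+ᵛ_ = _+ᴿ_ ; -ᵛ_ = -ᴿ_ ; 0ᵛ = 0ᴿ ; _•_ = λ q x → fromℚ q *ᴿ x
  ; ≤ᵛ-refl = ≤ʳ-refl ; ≤ᵛ-trans = ≤ʳ-trans ; +ᵛ-mono = +ʳ-mono
  ; +ᵛ-assoc = λ x y z → pointwise-≡ λ n → ℚₚ.+-assoc (seq x n) (seq y n) (seq z n)
  ; +ᵛ-comm = λ x y → pointwise-≡ λ n → ℚₚ.+-comm (seq x n) (seq y n)
  ; +ᵛ-identityˡ = λ x → pointwise-≡ λ n → ℚₚ.+-identityˡ (seq x n)
  ; +ᵛ-inverseʳ = λ x → pointwise-≡ λ n → ℚₚ.+-inverseʳ (seq x n)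
  ; •-distribˡ = λ q x y → pointwise-≡ λ n → ℚₚ.*-distribˡ-+ q (seq x n) (seq y n)
  ; •-distribʳ = λ p q x → pointwise-≡ λ n → ℚₚ.*-distribʳ-+ (seq x n) p q
  ; •-assoc = λ p q x → pointwise-≡ λ n → ℚₚ.*-assoc p q (seq x n)
  ; •-identity = λ x → pointwise-≡ λ n → ℚₚ.*-identityˡ (seq x n)
  ; •-monoʳ = λ 0≤q x≤y → *ʳ-monoʳ (fromℚ-mono 0≤q) x≤y
  }

-- The exponential and the logarithm

-- conv f g m = Σ_{i + j = m} f i · g j
conv : (ℕ → ℚ) → (ℕ → ℚ) → ℕ → ℚ
conv f g zero    = f 0 * g 0
conv f g (suc m) = f 0 * g (suc m) + conv (f ∘ suc) g m

weighted : (ℕ → ℚ) → ℕ → ℚ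
weighted f i = fromℕℚ i * f i

conv-cong : ∀ {f f′ g g′ : ℕ → ℚ} → (∀ i → f i ≡ f′ i) → (∀ i → g i ≡ g′ i) → ∀ m → conv f g m ≡ conv f′ g′ m
conv-cong f≡ g≡ zero    = cong₂ _*_ (f≡ 0) (g≡ 0)
conv-cong f≡ g≡ (suc m) = cong₂ _+_ (cong₂ _*_ (f≡ 0) (g≡ (suc m))) (conv-cong (f≡ ∘ suc) g≡ m)

conv-+ : ∀ (f f′ g : ℕ → ℚ) m → conv (λ i → f i + f′ i) g m ≡ conv f g m + conv f′ g m
conv-+ f f′ g zero    = ℚₚ.*-distribʳ-+ (g 0) (f 0) (f′ 0)
conv-+ f f′ g (suc m) = trans (cong₂ _+_ (ℚₚ.*-distribʳ-+ (g (suc m)) (f 0) (f′ 0)) (conv-+ (f ∘ suc) (f′ ∘ suc) g m))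
  (interchange (f 0 * g (suc m)) (f′ 0 * g (suc m)) (conv (f ∘ suc) g m) (conv (f′ ∘ suc) g m))
  where
  open +-*-Solver
  interchange : ∀ a b c d → (a + b) + (c + d) ≡ (a + c) + (b + d)
  interchange = solve 4 (λ a b c d → (a :+ b) :+ (c :+ d) := (a :+ c) :+ (b :+ d)) refl

conv-*ˡ : ∀ q (f g : ℕ → ℚ) m → conv (λ i → q * f i) g m ≡ q * conv f g m
conv-*ˡ q f g zero    = ℚₚ.*-assoc q (f 0) (g 0)
conv-*ˡ q f g (suc m) = trans (cong₂ _+_ (ℚₚ.*-assoc q (f 0) (g (suc m))) (conv-*ˡ q (f ∘ suc) g m)) (sym (ℚₚ.*-distribˡ-+ q _ _))

conv-*ʳ : ∀ q (f g : ℕ → ℚ) m → conv f (λ i → q * g i) m ≡ q * conv f g m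
conv-*ʳ q f g zero    = move q (f 0) (g 0)
  where
  open +-*-Solver
  move : ∀ q a b → a * (q * b) ≡ q * (a * b)
  move = solve 3 (λ q a b → a :* (q :* b) := q :* (a :* b)) refl
conv-*ʳ q f g (suc m) = trans (cong₂ _+_ (move q (f 0) (g (suc m))) (conv-*ʳ q (f ∘ suc) g m)) (sym (ℚₚ.*-distribˡ-+ q _ _))
  where
  open +-*-Solver
  move : ∀ q a b → a * (q * b) ≡ q * (a * b)
  move = solve 3 (λ q a b → a :* (q :* b) := q :* (a :* b)) refl

conv-shiftʳ : ∀ (f g : ℕ → ℚ) → g 0 ≡ 0ℚ → ∀ m → conv f g (suc m) ≡ conv f (g ∘ suc) m
conv-shiftʳ f g g0 zero    = trans (cong (λ z → f 0 * g 1 + z) (trans (cong (f 1 *_) g0) (ℚₚ.*-zeroʳ (f 1)))) (ℚₚ.+-identityʳ (f 0 * g 1))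
conv-shiftʳ f g g0 (suc m) = cong (λ z → f 0 * g (suc (suc m)) + z) (conv-shiftʳ (f ∘ suc) g g0 m)

-- The Leibniz rule: weighting by the degree is a derivation of the convolution.
conv-weighted : ∀ (f g : ℕ → ℚ) m → fromℕℚ m * conv f g m ≡ conv (weighted f) g m + conv f (weighted g) m
conv-weighted f g zero = zeros (f 0) (g 0)
  where
  open +-*-Solver
  zeros : ∀ a b → 0ℚ * (a * b) ≡ 0ℚ * a * b + a * (0ℚ * b)
  zeros = solve 2 (λ a b → con 0ℚ :* (a :* b) := con 0ℚ :* a :* b :+ a :* (con 0ℚ :* b)) refl
conv-weighted f g (suc m) = begin
  fromℕℚ (suc m) * (f 0 * g (suc m) + c)
    ≡⟨ cong (_* (f 0 * g (suc m) + c)) (fromℕℚ-suc m) ⟩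
  (1ℚ + k) * (f 0 * g (suc m) + c)
    ≡⟨ expand k (f 0) (g (suc m)) c ⟩
  (0ℚ * f 0 * g (suc m) + c) + (f 0 * ((1ℚ + k) * g (suc m)) + k * c)
    ≡⟨ cong (λ z → (0ℚ * f 0 * g (suc m) + c) + (f 0 * ((1ℚ + k) * g (suc m)) + z)) (conv-weighted (f ∘ suc) g m) ⟩
  (0ℚ * f 0 * g (suc m) + c) + (f 0 * ((1ℚ + k) * g (suc m)) + (cw + conv (f ∘ suc) (weighted g) m))
    ≡⟨ regroup (0ℚ * f 0 * g (suc m)) c (f 0 * ((1ℚ + k) * g (suc m))) cw (conv (f ∘ suc) (weighted g) m) ⟩
  (0ℚ * f 0 * g (suc m) + (c + cw)) + (f 0 * ((1ℚ + k) * g (suc m)) + conv (f ∘ suc) (weighted g) m)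
    ≡⟨ cong₂ (λ y z → (0ℚ * f 0 * g (suc m) + y) + (f 0 * (z * g (suc m)) + conv (f ∘ suc) (weighted g) m))
         (trans (sym (conv-+ (f ∘ suc) (weighted (f ∘ suc)) g m)) (conv-cong shifted (λ _ → refl) m)) (sym (fromℕℚ-suc m)) ⟩
  conv (weighted f) g (suc m) + conv f (weighted g) (suc m) ∎
  where
  open ≡-Reasoning
  open +-*-Solver
  k = fromℕℚ m
  c = conv (f ∘ suc) g m
  cw = conv (weighted (f ∘ suc)) g m
  expand : ∀ k a b c → (1ℚ + k) * (a * b + c) ≡ (0ℚ * a * b + c) + (a * ((1ℚ + k) * b) + k * c)
  expand = solve 4 (λ k a b c → (con 1ℚ :+ k) :* (a :* b :+ c) := (con 0ℚ :* a :* b :+ c) :+ (a :* ((con 1ℚ :+ k) :* b) :+ k :* c)) refl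
  regroup : ∀ a b c d e → (a + b) + (c + (d + e)) ≡ (a + (b + d)) + (c + e)
  regroup = solve 5 (λ a b c d e → (a :+ b) :+ (c :+ (d :+ e)) := (a :+ (b :+ d)) :+ (c :+ e)) refl
  shifted : ∀ i → f (suc i) + fromℕℚ i * f (suc i) ≡ fromℕℚ (suc i) * f (suc i)
  shifted i = trans (cong (_+ fromℕℚ i * f (suc i)) (sym (ℚₚ.*-identityˡ (f (suc i)))))
    (trans (sym (ℚₚ.*-distribʳ-+ (f (suc i)) 1ℚ (fromℕℚ i))) (cong (_* f (suc i)) (sym (fromℕℚ-suc i))))

weighted-expTerm : ∀ q i → weighted (expTerm q) (suc i) ≡ q * expTerm q i
weighted-expTerm q i = trans (regroup (fromℕℚ (suc i)) (expTerm q i) q (+ 1 / suc i))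
  (trans (cong (_* (q * expTerm q i)) (suc*1/suc i)) (ℚₚ.*-identityˡ (q * expTerm q i)))
  where
  open +-*-Solver
  regroup : ∀ k e q r → k * (e * (q * r)) ≡ (k * r) * (q * e)
  regroup = solve 4 (λ k e q r → k :* (e :* (q :* r)) := (k :* r) :* (q :* e)) refl

-- By the Leibniz rule m times the m-th coefficient is p + q times the previous one, which is the
-- recursion of `expTerm (p + q)`.
conv-expTerm : ∀ p q m → conv (expTerm p) (expTerm q) m ≡ expTerm (p + q) m
conv-expTerm p q zero    = ℚₚ.*-identityˡ 1ℚ
conv-expTerm p q (suc m) = begin
  c (suc m)                              ≡⟨ trans (sym (ℚₚ.*-identityʳ (c (suc m)))) (cong (c (suc m) *_) (sym (suc*1/suc m))) ⟩
  c (suc m) * (fromℕℚ (suc m) * r)       ≡⟨ regroup (c (suc m)) (fromℕℚ (suc m)) r ⟩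
  (fromℕℚ (suc m) * c (suc m)) * r       ≡⟨ cong (_* r) (trans (conv-weighted (expTerm p) (expTerm q) (suc m)) (cong₂ _+_ left right)) ⟩
  (p * c m + q * c m) * r                ≡⟨ collect p q (c m) r ⟩
  c m * ((p + q) * r)                    ≡⟨ cong (_* ((p + q) * r)) (conv-expTerm p q m) ⟩
  expTerm (p + q) (suc m)                ∎
  where
  open ≡-Reasoning
  open +-*-Solver
  r = + 1 / suc m
  c : ℕ → ℚ
  c = conv (expTerm p) (expTerm q)
  regroup : ∀ a b c → a * (b * c) ≡ (b * a) * c
  regroup = solve 3 (λ a b c → a :* (b :* c) := (b :* a) :* c) refl
  collect : ∀ p q c r → (p * c + q * c) * r ≡ c * ((p + q) * r)
  collect = solve 4 (λ p q c r → (p :* c :+ q :* c) :* r := c :* ((p :+ q) :* r)) refl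
  left : conv (weighted (expTerm p)) (expTerm q) (suc m) ≡ p * c m
  left = trans (cong (_+ conv (weighted (expTerm p) ∘ suc) (expTerm q) m) (trans (cong (_* expTerm q (suc m)) (ℚₚ.*-zeroˡ (expTerm p 0))) (ℚₚ.*-zeroˡ (expTerm q (suc m)))))
    (trans (ℚₚ.+-identityˡ _) (trans (conv-cong (weighted-expTerm p) (λ _ → refl) m) (conv-*ˡ p (expTerm p) (expTerm q) m)))
  right : conv (expTerm p) (weighted (expTerm q)) (suc m) ≡ q * c m
  right = trans (conv-shiftʳ (expTerm p) (weighted (expTerm q)) (ℚₚ.*-zeroˡ (expTerm q 0)) m)
    (trans (conv-cong (λ _ → refl) (weighted-expTerm q) m) (conv-*ʳ q (expTerm p) (expTerm q) m))

sumTo : (ℕ → ℚ) → ℕ → ℚ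
sumTo f zero    = 0ℚ
sumTo f (suc n) = sumTo f n + f n

sumTo-suc : ∀ f n → sumTo f (suc n) ≡ f 0 + sumTo (f ∘ suc) n
sumTo-suc f zero    = trans (ℚₚ.+-identityˡ (f 0)) (sym (ℚₚ.+-identityʳ (f 0)))
sumTo-suc f (suc n) = trans (cong (_+ f (suc n)) (sumTo-suc f n)) (ℚₚ.+-assoc (f 0) (sumTo (f ∘ suc) n) (f (suc n)))

sumTo-cong : ∀ {f g : ℕ → ℚ} → (∀ i → f i ≡ g i) → ∀ n → sumTo f n ≡ sumTo g n
sumTo-cong f≡g zero    = refl
sumTo-cong f≡g (suc n) = cong₂ _+_ (sumTo-cong f≡g n) (f≡g n)

expSum≡ : ∀ q n → expSum q n ≡ sumTo (expTerm q) n
expSum≡ q zero    = refl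
expSum≡ q (suc n) = cong (_+ expTerm q n) (expSum≡ q n)

-- Σ_{i + j < n} f i · g j
triangularSum : (ℕ → ℚ) → (ℕ → ℚ) → ℕ → ℚ
triangularSum f g zero    = 0ℚ
triangularSum f g (suc n) = f 0 * sumTo g (suc n) + triangularSum (f ∘ suc) g n

sumTo-conv : ∀ f g n → sumTo (conv f g) n ≡ triangularSum f g n
sumTo-conv f g zero          = refl
sumTo-conv f g (suc zero)    = trans (ℚₚ.+-identityˡ (f 0 * g 0)) (sym (trans (ℚₚ.+-identityʳ _) (cong (f 0 *_) (ℚₚ.+-identityˡ (g 0)))))
sumTo-conv f g (suc (suc n)) = begin
  sumTo (conv f g) (suc n) + (f 0 * g (suc n) + conv (f ∘ suc) g n)
    ≡⟨ cong (_+ (f 0 * g (suc n) + conv (f ∘ suc) g n)) (sumTo-conv f g (suc n)) ⟩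
  (f 0 * sumTo g (suc n) + triangularSum (f ∘ suc) g n) + (f 0 * g (suc n) + conv (f ∘ suc) g n)
    ≡⟨ cong (λ z → (f 0 * sumTo g (suc n) + z) + (f 0 * g (suc n) + conv (f ∘ suc) g n)) (sumTo-conv (f ∘ suc) g n) ⟨
  (f 0 * sumTo g (suc n) + sumTo (conv (f ∘ suc) g) n) + (f 0 * g (suc n) + conv (f ∘ suc) g n)
    ≡⟨ regroup (f 0) (sumTo g (suc n)) (sumTo (conv (f ∘ suc) g) n) (g (suc n)) (conv (f ∘ suc) g n) ⟩
  f 0 * (sumTo g (suc n) + g (suc n)) + sumTo (conv (f ∘ suc) g) (suc n)
    ≡⟨ cong (λ z → f 0 * (sumTo g (suc n) + g (suc n)) + z) (sumTo-conv (f ∘ suc) g (suc n)) ⟩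
  triangularSum f g (suc (suc n)) ∎
  where
  open ≡-Reasoning
  open +-*-Solver
  regroup : ∀ a G t g c → (a * G + t) + (a * g + c) ≡ a * (G + g) + (t + c)
  regroup = solve 5 (λ a G t g c → (a :* G :+ t) :+ (a :* g :+ c) := a :* (G :+ g) :+ (t :+ c)) refl

module Dominated {f g φ γ : ℕ → ℚ} (∣g∣≤γ : ∀ i → ∣ g i ∣ ≤ γ i) where
  γ-nonNeg : ∀ i → 0ℚ ≤ γ i
  γ-nonNeg i = ℚₚ.≤-trans (ℚₚ.0≤∣p∣ (g i)) (∣g∣≤γ i)

  sumTo-mono : ∀ k n → sumTo γ n ≤ sumTo γ (k ℕ.+ n)
  sumTo-mono zero    n = ℚₚ.≤-refl
  sumTo-mono (suc k) n = ℚₚ.≤-trans (sumTo-mono k n) (ℚₚ.≤-trans (ℚₚ.≤-reflexive (sym (ℚₚ.+-identityʳ _))) (ℚₚ.+-monoʳ-≤ (sumTo γ (k ℕ.+ n)) (γ-nonNeg (k ℕ.+ n))))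

  tail : ∀ k n → ∣ sumTo g (k ℕ.+ n) - sumTo g n ∣ ≤ sumTo γ (k ℕ.+ n) - sumTo γ n
  tail zero    n = ℚₚ.≤-reflexive (trans (cong ∣_∣ (ℚₚ.+-inverseʳ (sumTo g n))) (sym (ℚₚ.+-inverseʳ (sumTo γ n))))
  tail (suc k) n = ℚₚ.≤-trans (ℚₚ.≤-reflexive (cong ∣_∣ (dist-step (sumTo g (k ℕ.+ n)) (sumTo g n) (g (k ℕ.+ n)))))
    (ℚₚ.≤-trans (ℚₚ.∣p+q∣≤∣p∣+∣q∣ (sumTo g (k ℕ.+ n) - sumTo g n) (g (k ℕ.+ n))) (ℚₚ.≤-trans (ℚₚ.+-mono-≤ (tail k n) (∣g∣≤γ (k ℕ.+ n)))
      (ℚₚ.≤-reflexive (sym (dist-step (sumTo γ (k ℕ.+ n)) (sumTo γ n) (γ (k ℕ.+ n)))))))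

  -- The part of the n × (k + n) rectangle outside the triangle.
  excess : (ℕ → ℚ) → (ℕ → ℚ) → ℕ → ℕ → ℚ
  excess f g k n = sumTo f n * sumTo g (k ℕ.+ n) - triangularSum f g n

  excess-suc : ∀ f g k n → excess f g k (suc n) ≡ f 0 * (sumTo g (k ℕ.+ suc n) - sumTo g (suc n)) + excess (f ∘ suc) g (suc k) n
  excess-suc f g k n = trans (cong₂ (λ F m → F * sumTo g (k ℕ.+ suc n) - (f 0 * sumTo g (suc n) + m)) (sumTo-suc f n) (refl {x = triangularSum (f ∘ suc) g n}))
    (trans (regroup (f 0) (sumTo (f ∘ suc) n) (sumTo g (k ℕ.+ suc n)) (sumTo g (suc n)) (triangularSum (f ∘ suc) g n))
      (cong (λ l → f 0 * (sumTo g (k ℕ.+ suc n) - sumTo g (suc n)) + (sumTo (f ∘ suc) n * sumTo g l - triangularSum (f ∘ suc) g n)) (ℕₚ.+-suc k n)))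
    where
    open +-*-Solver
    regroup : ∀ a F G G′ t → (a + F) * G - (a * G′ + t) ≡ a * (G - G′) + (F * G - t)
    regroup = solve 5 (λ a F G G′ t → (a :+ F) :* G :- (a :* G′ :+ t) := a :* (G :- G′) :+ (F :* G :- t)) refl

  excess-bound : ∀ (f φ : ℕ → ℚ) → (∀ i → ∣ f i ∣ ≤ φ i) → ∀ k n → ∣ excess f g k n ∣ ≤ excess φ γ k n
  excess-bound f φ ∣f∣≤φ k zero = ℚₚ.≤-reflexive (trans (cong (λ z → ∣ z - 0ℚ ∣) (ℚₚ.*-zeroˡ (sumTo g (k ℕ.+ 0)))) (sym (cong (_- 0ℚ) (ℚₚ.*-zeroˡ (sumTo γ (k ℕ.+ 0))))))
  excess-bound f φ ∣f∣≤φ k (suc n) = begin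
    ∣ excess f g k (suc n) ∣
      ≡⟨ cong ∣_∣ (excess-suc f g k n) ⟩
    ∣ f 0 * d + e ∣
      ≤⟨ ℚₚ.∣p+q∣≤∣p∣+∣q∣ (f 0 * d) e ⟩
    ∣ f 0 * d ∣ + ∣ e ∣
      ≡⟨ cong (_+ ∣ e ∣) (ℚₚ.∣p*q∣≡∣p∣*∣q∣ (f 0) d) ⟩
    ∣ f 0 ∣ * ∣ d ∣ + ∣ e ∣
      ≤⟨ ℚₚ.+-mono-≤ (*-mono-≤-nn (ℚₚ.0≤∣p∣ d) (ℚₚ.≤-trans (ℚₚ.0≤∣p∣ (f 0)) (∣f∣≤φ 0)) (∣f∣≤φ 0) (tail k (suc n)))
           (excess-bound (f ∘ suc) (φ ∘ suc) (∣f∣≤φ ∘ suc) (suc k) n) ⟩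
    φ 0 * (sumTo γ (k ℕ.+ suc n) - sumTo γ (suc n)) + excess (φ ∘ suc) γ (suc k) n
      ≡⟨ excess-suc φ γ k n ⟨
    excess φ γ k (suc n) ∎
    where
    open ℚₚ.≤-Reasoning
    d = sumTo g (k ℕ.+ suc n) - sumTo g (suc n)
    e = excess (f ∘ suc) g (suc k) n

  -- The n by k rectangle of indices lies in the triangle of side n + k, and all terms are
  -- nonnegative.
  rectangle-≤-triangle : ∀ (φ : ℕ → ℚ) → (∀ i → 0ℚ ≤ φ i) → ∀ n k → sumTo φ n * sumTo γ k ≤ triangularSum φ γ (n ℕ.+ k)
  rectangle-≤-triangle φ 0≤φ zero    k = ℚₚ.≤-trans (ℚₚ.≤-reflexive (ℚₚ.*-zeroˡ (sumTo γ k))) (triangle-nonNeg φ 0≤φ k)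
    where
    sumTo-nonNeg : ∀ n → 0ℚ ≤ sumTo γ n
    sumTo-nonNeg zero    = ℚₚ.≤-refl
    sumTo-nonNeg (suc n) = ℚₚ.+-mono-≤ (sumTo-nonNeg n) (γ-nonNeg n)
    triangle-nonNeg : ∀ φ → (∀ i → 0ℚ ≤ φ i) → ∀ k → 0ℚ ≤ triangularSum φ γ k
    triangle-nonNeg φ 0≤φ zero    = ℚₚ.≤-refl
    triangle-nonNeg φ 0≤φ (suc k) = ℚₚ.+-mono-≤ (ℚₚ.≤-trans (ℚₚ.≤-reflexive (sym (ℚₚ.*-zeroʳ (φ 0))))
      (ℚₚ.*-monoˡ-≤-nonNeg (φ 0) {{nonNegative (0≤φ 0)}} (sumTo-nonNeg (suc k)))) (triangle-nonNeg (φ ∘ suc) (0≤φ ∘ suc) k)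
  rectangle-≤-triangle φ 0≤φ (suc n) k = ℚₚ.≤-trans (ℚₚ.≤-reflexive (trans (cong (_* sumTo γ k) (sumTo-suc φ n)) (ℚₚ.*-distribʳ-+ (sumTo γ k) (φ 0) (sumTo (φ ∘ suc) n))))
    (ℚₚ.+-mono-≤ (ℚₚ.*-monoˡ-≤-nonNeg (φ 0) {{nonNegative (0≤φ 0)}} (sumTo-mono (suc n) k)) (rectangle-≤-triangle (φ ∘ suc) (0≤φ ∘ suc) n k))

-- The product is a sum over a square, the truncation at p + q a sum over a triangle. Their
-- difference is dominated termwise by that for b, b, and the square lies in the triangle of side
-- 2n; what remains is a piece of the series of exp (2b) beyond n.
expSum-+ : ∀ {b} → 0ℚ < b → ∀ p q → ∣ p ∣ ≤ b → ∣ q ∣ ≤ b → ∀ n →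
  ∣ expSum p n * expSum q n - expSum (p + q) n ∣ ≤ expSum (b + b) (n ℕ.+ n) - expSum (b + b) n
expSum-+ {b} 0<b p q ∣p∣≤b ∣q∣≤b n = begin
  ∣ expSum p n * expSum q n - expSum (p + q) n ∣
    ≡⟨ cong ∣_∣ (cong₂ _-_ (cong₂ _*_ (expSum≡ p n) (expSum≡ q n)) (as-triangle p q n)) ⟩
  ∣ Dom.excess (expTerm p) (expTerm q) 0 n ∣
    ≤⟨ Dom.excess-bound (expTerm p) (expTerm b) (Tail.∣expTerm∣≤t b 0<b p ∣p∣≤b) 0 n ⟩
  sumTo (expTerm b) n * sumTo (expTerm b) n - triangularSum (expTerm b) (expTerm b) n
    ≤⟨ ℚₚ.+-monoˡ-≤ (- triangularSum (expTerm b) (expTerm b) n) (Dom.rectangle-≤-triangle (expTerm b) (λ i → ℚₚ.<⇒≤ (Tail.t>0 b 0<b i)) n n) ⟩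
  triangularSum (expTerm b) (expTerm b) (n ℕ.+ n) - triangularSum (expTerm b) (expTerm b) n
    ≡⟨ cong₂ _-_ (sym (as-triangle b b (n ℕ.+ n))) (sym (as-triangle b b n)) ⟩
  expSum (b + b) (n ℕ.+ n) - expSum (b + b) n ∎
  where
  open ℚₚ.≤-Reasoning
  module Dom = Dominated {expTerm p} {expTerm q} {expTerm b} {expTerm b} (Tail.∣expTerm∣≤t b 0<b q ∣q∣≤b)
  as-triangle : ∀ p q n → expSum (p + q) n ≡ triangularSum (expTerm p) (expTerm q) n
  as-triangle p q n = trans (expSum≡ (p + q) n) (trans (sumTo-cong (λ i → sym (conv-expTerm p q i)) n) (sumTo-conv (expTerm p) (expTerm q) n))

exp-+ : ∀ x y → exp (x +ᴿ y) ≃ᴿ exp x *ᴿ exp y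
exp-+ x y ε 0<ε =
  let b₁ , 0<b₁ , N₁ , ∣x∣≤ = eventually-bounded x
      b₂ , 0<b₂ , N₂ , ∣y∣≤ = eventually-bounded y
      b = b₁ + b₂
      0<b = ℚₚ.+-mono-< 0<b₁ 0<b₂
      b₁≤b = ℚₚ.≤-trans (ℚₚ.≤-reflexive (sym (ℚₚ.+-identityʳ b₁))) (ℚₚ.+-monoʳ-≤ b₁ (ℚₚ.<⇒≤ 0<b₂))
      b₂≤b = ℚₚ.≤-trans (ℚₚ.≤-reflexive (sym (ℚₚ.+-identityˡ b₂))) (ℚₚ.+-monoˡ-≤ b₂ (ℚₚ.<⇒≤ 0<b₁))
      0<2b = ℚₚ.+-mono-< 0<b 0<b
      N₃ , tail = Tail.expSum-tail (b + b) 0<2b (ε * ½) (half>0 0<ε)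
      ∣2b∣≤ = ℚₚ.≤-reflexive (ℚₚ.0≤p⇒∣p∣≡p (ℚₚ.<⇒≤ 0<2b))
      L = N₁ ℕ.⊔ N₂
  in L ℕ.⊔ N₃ , λ n le →
     let l , n≥N₃ = ⊔-split {L} {N₃} le
         n≥N₁ , n≥N₂ = ⊔-split {N₁} {N₂} l
     in subst (_< ε) (dist-sym (expSum (seq x n) n * expSum (seq y n) n) (expSum (seq x n + seq y n) n))
        (ℚₚ.≤-<-trans (expSum-+ 0<b (seq x n) (seq y n) (ℚₚ.≤-trans (∣x∣≤ n n≥N₁) b₁≤b) (ℚₚ.≤-trans (∣y∣≤ n n≥N₂) b₂≤b) n)
          (close (expSum (b + b) (n ℕ.+ n)) (expSum (b + b) N₃) (expSum (b + b) n)
            (tail (b + b) ∣2b∣≤ (n ℕ.+ n) (ℕₚ.≤-trans n≥N₃ (ℕₚ.m≤m+n n n))) (tail (b + b) ∣2b∣≤ n n≥N₃)))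
  where
  close : ∀ u v w → ∣ u - v ∣ < ε * ½ → ∣ w - v ∣ < ε * ½ → u - w < ε
  close u v w u~v w~v = ℚₚ.≤-<-trans (p≤∣p∣ (u - w)) (ℚₚ.≤-<-trans (triangle u v w)
    (subst (∣ u - v ∣ + ∣ v - w ∣ <_) (halves ε) (ℚₚ.+-mono-< u~v (subst (_< ε * ½) (dist-sym w v) w~v))))

expTerm-nonNeg : ∀ {q} → 0ℚ ≤ q → ∀ k → 0ℚ ≤ expTerm q k
expTerm-nonNeg 0≤q zero    = 0≤1
expTerm-nonNeg 0≤q (suc k) = *-nonNeg (expTerm-nonNeg 0≤q k) (*-nonNeg 0≤q (ℚₚ.<⇒≤ (1/suc>0 k)))

expTerm-mono : ∀ {p q} → 0ℚ ≤ p → p ≤ q → ∀ k → expTerm p k ≤ expTerm q k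
expTerm-mono 0≤p p≤q zero    = ℚₚ.≤-refl
expTerm-mono {p} {q} 0≤p p≤q (suc k) = *-mono-≤-nn (*-nonNeg 0≤p 0≤r) (expTerm-nonNeg (ℚₚ.≤-trans 0≤p p≤q) k)
  (expTerm-mono 0≤p p≤q k) (ℚₚ.*-monoʳ-≤-nonNeg (+ 1 / suc k) {{nonNegative 0≤r}} p≤q)
  where 0≤r = ℚₚ.<⇒≤ (1/suc>0 k)

expSum-mono : ∀ {p q} → 0ℚ ≤ p → p ≤ q → ∀ n → expSum p n ≤ expSum q n
expSum-mono 0≤p p≤q zero    = ℚₚ.≤-refl
expSum-mono 0≤p p≤q (suc n) = ℚₚ.+-mono-≤ (expSum-mono 0≤p p≤q n) (expTerm-mono 0≤p p≤q n)

expSum-0 : ∀ n → expSum 0ℚ (suc n) ≡ 1ℚ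
expSum-0 zero    = ℚₚ.+-identityˡ 1ℚ
expSum-0 (suc n) = trans (cong₂ _+_ (expSum-0 n) (trans (cong (expTerm 0ℚ n *_) (ℚₚ.*-zeroˡ (+ 1 / suc n))) (ℚₚ.*-zeroʳ (expTerm 0ℚ n)))) (ℚₚ.+-identityʳ 1ℚ)

expSum-2 : ∀ q → expSum q 2 ≡ 1ℚ + q
expSum-2 = solve 1 (λ q → con 0ℚ :+ con 1ℚ :+ con 1ℚ :* (q :* con (+ 1 / 1)) := con 1ℚ :+ q) refl
  where open +-*-Solver

-- Degrees 0 and 1 contribute exactly q - p, and from degree 2 on the terms at q dominate those at
-- p.
expSum-gap-lower : ∀ {p q} → 0ℚ ≤ p → p ≤ q → ∀ m → q + expSum p (suc (suc m)) ≤ expSum q (suc (suc m)) + p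
expSum-gap-lower {p} {q} 0≤p p≤q zero = ℚₚ.≤-reflexive (trans (cong (λ z → q + z) (expSum-2 p)) (trans (swap p q) (cong (_+ p) (sym (expSum-2 q)))))
  where
  open +-*-Solver
  swap : ∀ p q → q + (1ℚ + p) ≡ (1ℚ + q) + p
  swap = solve 2 (λ p q → q :+ (con 1ℚ :+ p) := (con 1ℚ :+ q) :+ p) refl
expSum-gap-lower {p} {q} 0≤p p≤q (suc m) = ℚₚ.≤-trans (ℚₚ.≤-reflexive (sym (ℚₚ.+-assoc q (expSum p (suc (suc m))) (expTerm p (suc (suc m))))))
  (ℚₚ.≤-trans (ℚₚ.+-mono-≤ (expSum-gap-lower 0≤p p≤q m) (expTerm-mono 0≤p p≤q (suc (suc m))))
    (ℚₚ.≤-reflexive (swap (expSum q (suc (suc m))) p (expTerm q (suc (suc m))))))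
  where
  open +-*-Solver
  swap : ∀ a p b → (a + p) + b ≡ (a + b) + p
  swap = solve 3 (λ a p b → (a :+ p) :+ b := (a :+ b) :+ p) refl

1+q≤expSum : ∀ {q} → 0ℚ ≤ q → ∀ m → 1ℚ + q ≤ expSum q (suc (suc m))
1+q≤expSum {q} 0≤q m = subst₂ _≤_ (trans (cong (λ z → q + z) (expSum-0 (suc m))) (ℚₚ.+-comm q 1ℚ)) (ℚₚ.+-identityʳ _) (expSum-gap-lower ℚₚ.≤-refl 0≤q m)

-- The derivative of a term is the preceding term.
expTerm-gap : ∀ {q h} → 0ℚ ≤ q → 0ℚ ≤ h → ∀ k → expTerm (q + h) (suc k) ≤ expTerm q (suc k) + h * expTerm (q + h) k
expTerm-gap {q} {h} 0≤q 0≤h zero = ℚₚ.≤-reflexive (first q h)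
  where
  open +-*-Solver
  first : ∀ q h → 1ℚ * ((q + h) * (+ 1 / 1)) ≡ 1ℚ * (q * (+ 1 / 1)) + h * 1ℚ
  first = solve 2 (λ q h → con 1ℚ :* ((q :+ h) :* con (+ 1 / 1)) := con 1ℚ :* (q :* con (+ 1 / 1)) :+ h :* con 1ℚ) refl
expTerm-gap {q} {h} 0≤q 0≤h (suc k) = begin
  e′ * ((q + h) * r)                                  ≡⟨ split e′ q h r ⟩
  (q * r) * e′ + (h * r) * e′                         ≤⟨ ℚₚ.+-monoˡ-≤ ((h * r) * e′) (ℚₚ.*-monoˡ-≤-nonNeg (q * r) {{nonNegative 0≤qr}} (expTerm-gap 0≤q 0≤h k)) ⟩
  (q * r) * (e + h * e″) + (h * r) * e′               ≤⟨ ℚₚ.+-monoˡ-≤ ((h * r) * e′) (ℚₚ.≤-trans (ℚₚ.≤-reflexive (ℚₚ.*-distribˡ-+ (q * r) e (h * e″)))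
                                                           (ℚₚ.+-monoʳ-≤ ((q * r) * e) (ℚₚ.*-monoʳ-≤-nonNeg (h * e″) {{nonNegative 0≤he″}} q≤))) ⟩
  ((q * r) * e + ((q + h) * r) * (h * e″)) + (h * r) * e′  ≡⟨ cong (λ z → ((q * r) * e + z) + (h * r) * e′) degree ⟩
  ((q * r) * e + (h * r) * (fromℕℚ (suc k) * e′)) + (h * r) * e′ ≡⟨ collect q r e h (fromℕℚ (suc k)) e′ ⟩
  e * (q * r) + h * (((1ℚ + fromℕℚ (suc k)) * r) * e′)     ≡⟨ cong (λ z → e * (q * r) + h * (z * e′)) (trans (cong (_* r) (sym (fromℕℚ-suc (suc k)))) (suc*1/suc (suc k))) ⟩
  e * (q * r) + h * (1ℚ * e′)                              ≡⟨ cong (λ z → e * (q * r) + h * z) (ℚₚ.*-identityˡ e′) ⟩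
  e * (q * r) + h * e′                                     ∎
  where
  open ℚₚ.≤-Reasoning
  open +-*-Solver
  r = + 1 / suc (suc k)
  e e′ e″ : ℚ
  e = expTerm q (suc k)
  e′ = expTerm (q + h) (suc k)
  e″ = expTerm (q + h) k
  0≤q+h = ℚₚ.+-mono-≤ 0≤q 0≤h
  0≤r = ℚₚ.<⇒≤ (1/suc>0 (suc k))
  0≤qr = *-nonNeg 0≤q 0≤r
  0≤he″ = *-nonNeg 0≤h (expTerm-nonNeg 0≤q+h k)
  q≤ : q * r ≤ (q + h) * r
  q≤ = ℚₚ.*-monoʳ-≤-nonNeg r {{nonNegative 0≤r}} (ℚₚ.≤-trans (ℚₚ.≤-reflexive (sym (ℚₚ.+-identityʳ q))) (ℚₚ.+-monoʳ-≤ q 0≤h))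
  split : ∀ e q h r → e * ((q + h) * r) ≡ (q * r) * e + (h * r) * e
  split = solve 4 (λ e q h r → e :* ((q :+ h) :* r) := (q :* r) :* e :+ (h :* r) :* e) refl
  degree : ((q + h) * r) * (h * e″) ≡ (h * r) * (fromℕℚ (suc k) * e′)
  degree = trans (regroup (q + h) r h e″) (cong ((h * r) *_) (sym (weighted-expTerm (q + h) k)))
    where
    regroup : ∀ s r h e → (s * r) * (h * e) ≡ (h * r) * (s * e)
    regroup = solve 4 (λ s r h e → (s :* r) :* (h :* e) := (h :* r) :* (s :* e)) refl
  collect : ∀ q r e h k e′ → ((q * r) * e + (h * r) * (k * e′)) + (h * r) * e′ ≡ e * (q * r) + h * (((1ℚ + k) * r) * e′)
  collect = solve 6 (λ q r e h k e′ → ((q :* r) :* e :+ (h :* r) :* (k :* e′)) :+ (h :* r) :* e′ := e :* (q :* r) :+ h :* (((con 1ℚ :+ k) :* r) :* e′)) refl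

expSum-gap-upper : ∀ {q h} → 0ℚ ≤ q → 0ℚ ≤ h → ∀ n → expSum (q + h) (suc n) ≤ expSum q (suc n) + h * expSum (q + h) n
expSum-gap-upper {q} {h} 0≤q 0≤h zero    = ℚₚ.≤-reflexive (sym (trans (cong (λ z → expSum q 1 + z) (ℚₚ.*-zeroʳ h)) (ℚₚ.+-identityʳ (expSum q 1))))
expSum-gap-upper {q} {h} 0≤q 0≤h (suc n) = ℚₚ.≤-trans (ℚₚ.+-mono-≤ (expSum-gap-upper 0≤q 0≤h n) (expTerm-gap 0≤q 0≤h n))
  (ℚₚ.≤-reflexive (regroup (expSum q (suc n)) h (expSum (q + h) n) (expTerm q (suc n)) (expTerm (q + h) n)))
  where
  open +-*-Solver
  regroup : ∀ a h s b t → (a + h * s) + (b + h * t) ≡ (a + b) + h * (s + t)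
  regroup = solve 5 (λ a h s b t → (a :+ h :* s) :+ (b :+ h :* t) := (a :+ b) :+ h :* (s :+ t)) refl

first-crossing : ∀ (f : ℕ → ℚ) κ bnd → f 0 ≤ κ → κ < f bnd → Σ[ j ∈ ℕ ] (f j ≤ κ × κ < f (suc j))
first-crossing f κ zero    f0≤κ κ<f = contradiction (ℚₚ.<-≤-trans κ<f f0≤κ) (ℚₚ.<-irrefl refl)
first-crossing f κ (suc bnd) f0≤κ κ<f with f bnd ℚₚ.≤? κ
... | yes le = bnd , le , κ<f
... | no  ≰  = first-crossing f κ bnd f0≤κ (ℚₚ.≰⇒> ≰)

-- With n = m + 2, q is a point of the grid of mesh 1/n at which the exponential truncated to n
-- terms crosses κ. Keeping at least two terms lets the truncation grow at least as fast as q.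
record ApproxLog (κ : ℚ) (m : ℕ) : Set where
  h : ℚ
  h = + 1 / suc (suc m)
  field
    q     : ℚ
    0≤q   : 0ℚ ≤ q
    lower : expSum q (suc (suc m)) ≤ κ
    upper : κ < expSum (q + h) (suc (suc m))

private
  module _ (κ : ℚ) (1≤κ : 1ℚ ≤ κ) (m : ℕ) where
    step-size : ℚ
    step-size = + 1 / suc (suc m)

    grid : ℕ → ℚ
    grid i = fromℕℚ i * step-size

    0≤step-size : 0ℚ ≤ step-size
    0≤step-size = ℚₚ.<⇒≤ (1/suc>0 (suc m))

    0≤grid : ∀ i → 0ℚ ≤ grid i
    0≤grid i = *-nonNeg (ℚₚ.nonNegative⁻¹ (fromℕℚ i) {{ℚₚ.normalize-nonNeg i 1}}) 0≤step-size

    grid-suc : ∀ i → grid (suc i) ≡ grid i + step-size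
    grid-suc i = trans (cong (_* step-size) (fromℕℚ-suc i)) (next (fromℕℚ i) step-size)
      where
      next : ∀ j h → (1ℚ + j) * h ≡ j * h + h
      next = solve 2 (λ j h → (con 1ℚ :+ j) :* h := j :* h :+ h) refl
        where open +-*-Solver

    grid-exceeds : ∀ i → κ * fromℕℚ (suc (suc m)) ≤ fromℕℚ i → κ ≤ grid i
    grid-exceeds i le = subst (_≤ grid i) κ≡ (ℚₚ.*-monoʳ-≤-nonNeg step-size {{nonNegative 0≤step-size}} le)
      where
      κ≡ : κ * fromℕℚ (suc (suc m)) * step-size ≡ κ
      κ≡ = trans (ℚₚ.*-assoc κ (fromℕℚ (suc (suc m))) step-size) (trans (cong (κ *_) (suc*1/suc (suc m))) (ℚₚ.*-identityʳ κ))

    expSum-grid-0 : expSum (grid 0) (suc (suc m)) ≤ κ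
    expSum-grid-0 = subst (_≤ κ) (sym at-0) 1≤κ
      where
      at-0 : expSum (grid 0) (suc (suc m)) ≡ 1ℚ
      at-0 = trans (cong (λ q → expSum q (suc (suc m))) (ℚₚ.*-zeroˡ step-size)) (expSum-0 (suc m))

    expSum-grid-exceeds : ∀ i → κ ≤ grid i → κ < expSum (grid i) (suc (suc m))
    expSum-grid-exceeds i κ≤ = ℚₚ.≤-<-trans κ≤ (ℚₚ.<-≤-trans grid< (1+q≤expSum {grid i} (0≤grid i) m))
      where
      grid< : grid i < 1ℚ + grid i
      grid< = subst (_< 1ℚ + grid i) (ℚₚ.+-identityˡ (grid i)) (ℚₚ.+-monoˡ-< (grid i) (ℚₚ.positive⁻¹ 1ℚ))

abstract
  approx-log : ∀ κ → 1ℚ ≤ κ → ∀ m → ApproxLog κ m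
  approx-log κ 1≤κ m = from-crossing (first-crossing f κ i (expSum-grid-0 κ 1≤κ m) (expSum-grid-exceeds κ 1≤κ m i (grid-exceeds κ 1≤κ m i κN≤i)))
    where
    f : ℕ → ℚ
    f j = expSum (grid κ 1≤κ m j) (suc (suc m))
    i : ℕ
    i = proj₁ (archimedean (κ * fromℕℚ (suc (suc m))))
    κN≤i : κ * fromℕℚ (suc (suc m)) ≤ fromℕℚ i
    κN≤i = proj₂ (archimedean (κ * fromℕℚ (suc (suc m))))
    from-crossing : Σ[ j ∈ ℕ ] (f j ≤ κ × κ < f (suc j)) → ApproxLog κ m
    from-crossing (j , low , high) = record
      { q = grid κ 1≤κ m j
      ; 0≤q = 0≤grid κ 1≤κ m j
      ; lower = low
      ; upper = subst (λ q → κ < expSum q (suc (suc m))) (grid-suc κ 1≤κ m j) high }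

1/suc-small : ∀ E → 0ℚ < E → ∀ ε → 0ℚ < ε → Σ[ N ∈ ℕ ] (∀ m → N ℕ.≤ m → (+ 1 / suc m) * E < ε)
1/suc-small E 0<E ε 0<ε =
  let c , _ , c*ε≡E = quotient E ε 0<E 0<ε
      N , c≤N       = archimedean c
  in N , λ m N≤m → begin-strict
    (+ 1 / suc m) * E                        ≡⟨ cong ((+ 1 / suc m) *_) c*ε≡E ⟨
    (+ 1 / suc m) * (c * ε)                  ≤⟨ ℚₚ.*-monoˡ-≤-nonNeg (+ 1 / suc m) {{nonNegative (ℚₚ.<⇒≤ (1/suc>0 m))}}
                                                  (ℚₚ.*-monoʳ-≤-nonNeg ε {{nonNegative (ℚₚ.<⇒≤ 0<ε)}} (ℚₚ.≤-trans c≤N (fromℕℚ-mono N≤m))) ⟩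
    (+ 1 / suc m) * (fromℕℚ m * ε)           <⟨ ℚₚ.*-monoʳ-<-pos (+ 1 / suc m) {{positive (1/suc>0 m)}}
                                                  (ℚₚ.*-monoˡ-<-pos ε {{positive 0<ε}} (m<1+m m)) ⟩
    (+ 1 / suc m) * (fromℕℚ (suc m) * ε)     ≡⟨ regroup (+ 1 / suc m) (fromℕℚ (suc m)) ε ⟩
    (fromℕℚ (suc m) * (+ 1 / suc m)) * ε     ≡⟨ cong (_* ε) (suc*1/suc m) ⟩
    1ℚ * ε                                   ≡⟨ ℚₚ.*-identityˡ ε ⟩
    ε                                        ∎
  where
  open ℚₚ.≤-Reasoning
  open +-*-Solver
  m<1+m : ∀ m → fromℕℚ m < fromℕℚ (suc m)
  m<1+m m = subst₂ _<_ (ℚₚ.+-identityˡ (fromℕℚ m)) (sym (fromℕℚ-suc m)) (ℚₚ.+-monoˡ-< (fromℕℚ m) (ℚₚ.positive⁻¹ 1ℚ))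
  regroup : ∀ r n e → r * (n * e) ≡ (n * r) * e
  regroup = solve 3 (λ r n e → r :* (n :* e) := (n :* r) :* e) refl

+-cancelʳ-< : ∀ p q r → p + r < q + r → p < q
+-cancelʳ-< p q r lt = subst₂ _<_ (cancel p r) (cancel q r) (ℚₚ.+-monoˡ-< (- r) lt)
  where
  open +-*-Solver
  cancel : ∀ p r → (p + r) - r ≡ p
  cancel = solve 2 (λ p r → (p :+ r) :- r := p) refl

module LogOf (x : ℝ) (1≤x : fromℚ 1ℚ ≤ʳ x) where
  -- 1 ≤ x restrains the terms only up to an error; they are raised to 1, so that a nonnegative grid
  -- point with truncated exponential below them exists. In the limit nothing changes.
  κ : ℕ → ℚ
  κ n = seq x n ⊔ 1ℚ

  1≤κ : ∀ n → 1ℚ ≤ κ n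
  1≤κ n = ℚₚ.p≤q⊔p (seq x n) 1ℚ

  approx : ∀ m → ApproxLog (κ (suc (suc m))) m
  approx m = approx-log (κ (suc (suc m))) (1≤κ (suc (suc m))) m

  open ApproxLog

  ℓ : ℕ → ℚ
  ℓ (suc (suc m)) = q (approx m)
  ℓ _             = 0ℚ

  -- b bounds the terms of x, so κ ≤ b + 1, and a grid point plus its mesh is at most B = b + 2. E
  -- bounds the truncated exponentials at B, hence their increase per unit of mesh.
  module Modulus {b B E : ℚ} {N₁ N₂ : ℕ} (0<b : 0ℚ < b) (∣x∣≤b : ∀ n → N₁ ℕ.≤ n → ∣ seq x n ∣ ≤ b)
                 (B≡ : B ≡ (b + 1ℚ) + 1ℚ) (0<B : 0ℚ < B) (0<E : 0ℚ < E) (∣exp∣≤E : ∀ n → N₂ ℕ.≤ n → ∣ expSum B n ∣ ≤ E) where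
    κ≤ : ∀ n → N₁ ℕ.≤ n → κ n ≤ b + 1ℚ
    κ≤ n le = ℚₚ.⊔-lub (ℚₚ.≤-trans (p≤∣p∣ (seq x n)) (ℚₚ.≤-trans (∣x∣≤b n le) (ℚₚ.≤-trans (ℚₚ.≤-reflexive (sym (ℚₚ.+-identityʳ b))) (ℚₚ.+-monoʳ-≤ b 0≤1))))
      (ℚₚ.≤-trans (ℚₚ.≤-reflexive (sym (ℚₚ.+-identityˡ 1ℚ))) (ℚₚ.+-monoˡ-≤ 1ℚ (ℚₚ.<⇒≤ 0<b)))

    q≤κ : ∀ m → q (approx m) ≤ κ (suc (suc m))
    q≤κ m = ℚₚ.≤-trans (ℚₚ.≤-trans (ℚₚ.≤-reflexive (sym (ℚₚ.+-identityˡ _))) (ℚₚ.+-monoˡ-≤ (q (approx m)) 0≤1)) (ℚₚ.≤-trans (1+q≤expSum (0≤q (approx m)) m) (lower (approx m)))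

    h≤1 : ∀ m → + 1 / suc m ≤ 1ℚ
    h≤1 m = subst₂ _≤_ (ℚₚ.*-identityˡ (+ 1 / suc m)) (suc*1/suc m) (ℚₚ.*-monoʳ-≤-nonNeg (+ 1 / suc m) {{nonNegative (ℚₚ.<⇒≤ (1/suc>0 m))}} (fromℕℚ-mono {1} {suc m} (s≤s z≤n)))

    close : ∀ m → N₁ ℕ.≤ suc (suc m) → N₂ ℕ.≤ suc (suc m) → κ (suc (suc m)) < expSum (q (approx m)) (suc (suc m)) + (+ 1 / suc (suc m)) * E
    close m l₁ l₂ = ℚₚ.<-≤-trans (upper a) (ℚₚ.≤-trans (expSum-gap-upper (0≤q a) 0≤h (suc m)) (ℚₚ.+-monoʳ-≤ (expSum (q a) (suc (suc m)))
      (ℚₚ.*-monoˡ-≤-nonNeg (h a) {{nonNegative 0≤h}} (ℚₚ.≤-trans (ℚₚ.≤-trans (ℚₚ.≤-trans (ℚₚ.≤-reflexive (sym (ℚₚ.+-identityʳ _)))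
        (ℚₚ.+-monoʳ-≤ (expSum (q a + h a) (suc m)) (expTerm-nonNeg 0≤q+h (suc m))))
        (expSum-mono 0≤q+h (ℚₚ.≤-trans (ℚₚ.+-mono-≤ (ℚₚ.≤-trans (q≤κ m) (κ≤ (suc (suc m)) l₁)) (h≤1 (suc m))) (ℚₚ.≤-reflexive (sym B≡))) (suc (suc m))))
        (ℚₚ.≤-trans (p≤∣p∣ _) (∣exp∣≤E (suc (suc m)) l₂))))))
      where
      a = approx m
      0≤h = ℚₚ.<⇒≤ (1/suc>0 (suc m))
      0≤q+h = ℚₚ.+-mono-≤ (0≤q a) 0≤h

    κ-near : ∀ {ε} → 0ℚ < ε → ∀ m n → ∣ seq x m - seq x n ∣ < ε → κ m < κ n + ε
    κ-near {ε} 0<ε m n lt = [ (λ eq → subst (_< κ n + ε) (sym eq) (ℚₚ.<-≤-trans (∣p-q∣<ε⇒< (seq x m) (seq x n) lt) (ℚₚ.+-monoˡ-≤ ε (ℚₚ.p≤p⊔q (seq x n) 1ℚ))))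
      , (λ eq → subst (_< κ n + ε) (sym eq) (ℚₚ.≤-<-trans (1≤κ n) (p<p+ε 0<ε))) ]′ (ℚₚ.⊔-sel (seq x m) 1ℚ)

    -- If q at m is the larger, its excess is at most the excess of the truncated exponentials, and
    -- that consists of three errors d: from the terms of x, from the grid, and from the truncation.
    near : ∀ {d} → 0ℚ < d → ∀ m n → κ (suc (suc m)) < κ (suc (suc n)) + d → κ (suc (suc n)) < expSum (q (approx n)) (suc (suc n)) + d →
      ∣ expSum (q (approx n)) (suc (suc m)) - expSum (q (approx n)) (suc (suc n)) ∣ < d → q (approx m) < q (approx n) + ((d + d) + d)
    near {d} 0<d m n κ<κ κ< trunc with ℚₚ.≤-total (q (approx m)) (q (approx n))
    ... | inj₁ le = ℚₚ.≤-<-trans le (p<p+ε (ℚₚ.+-mono-< (ℚₚ.+-mono-< 0<d 0<d) 0<d))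
    ... | inj₂ ge = +-cancelʳ-< qₘ (qₙ + ((d + d) + d)) (expSum qₙ M) (begin-strict
      qₘ + expSum qₙ M                     ≤⟨ expSum-gap-lower (0≤q (approx n)) ge m ⟩
      expSum qₘ M + qₙ                     ≤⟨ ℚₚ.+-monoˡ-≤ qₙ (lower (approx m)) ⟩
      κ M + qₙ                             <⟨ ℚₚ.+-monoˡ-< qₙ κ<κ ⟩
      (κ N + d) + qₙ                       <⟨ ℚₚ.+-monoˡ-< qₙ (ℚₚ.+-monoˡ-< d κ<) ⟩
      ((expSum qₙ N + d) + d) + qₙ         <⟨ ℚₚ.+-monoˡ-< qₙ (ℚₚ.+-monoˡ-< d (ℚₚ.+-monoˡ-< d (∣p-q∣<ε⇒< (expSum qₙ N) (expSum qₙ M) (subst (_< d) (dist-sym (expSum qₙ M) (expSum qₙ N)) trunc)))) ⟩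
      (((expSum qₙ M + d) + d) + d) + qₙ   ≡⟨ regroup (expSum qₙ M) d qₙ ⟩
      (qₙ + ((d + d) + d)) + expSum qₙ M   ∎)
      where
      open ℚₚ.≤-Reasoning
      open +-*-Solver
      M = suc (suc m)
      N = suc (suc n)
      qₘ = q (approx m)
      qₙ = q (approx n)
      regroup : ∀ e d q → (((e + d) + d) + d) + q ≡ (q + ((d + d) + d)) + e
      regroup = solve 3 (λ e d q → (((e :+ d) :+ d) :+ d) :+ q := (q :+ ((d :+ d) :+ d)) :+ e) refl

    private
      ≥2 : ∀ {n} → 2 ℕ.≤ n → Σ[ m ∈ ℕ ] n ≡ suc (suc m)
      ≥2 {suc (suc m)} _ = m , refl
      ≥2 {suc zero} (s≤s ())

    ℓ-cauchy : IsCauchy ℓ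
    ℓ-cauchy ε 0<ε =
      let d = ε * (+ 1 / 3)
          0<d = *-pos 0<ε (ℚₚ.positive⁻¹ (+ 1 / 3))
          N₃ , cx = cauchy x d 0<d
          N₄ , small = 1/suc-small E 0<E d 0<d
          N₅ , tail = Tail.expSum-tail B 0<B (d * ½) (half>0 0<d)
          L = 2 ℕ.⊔ (N₁ ℕ.⊔ N₂)
          L′ = N₃ ℕ.⊔ (suc N₄ ℕ.⊔ N₅)
          step : ∀ m n → L ℕ.⊔ L′ ℕ.≤ m → L ℕ.⊔ L′ ℕ.≤ n → ℓ m < ℓ n + ε
          step m n m≥ n≥ =
            let ml , mr = ⊔-split {L} {L′} m≥ ; nl , nr = ⊔-split {L} {L′} n≥
                m≥2 , m₁₂ = ⊔-split {2} {N₁ ℕ.⊔ N₂} ml ; n≥2 , n₁₂ = ⊔-split {2} {N₁ ℕ.⊔ N₂} nl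
                n₁ , n₂ = ⊔-split {N₁} {N₂} n₁₂
                m₃ , m₄₅ = ⊔-split {N₃} {suc N₄ ℕ.⊔ N₅} mr ; n₃ , n₄₅ = ⊔-split {N₃} {suc N₄ ℕ.⊔ N₅} nr
                m₄ , m₅ = ⊔-split {suc N₄} {N₅} m₄₅ ; n₄ , n₅ = ⊔-split {suc N₄} {N₅} n₄₅
            in go m n (≥2 m≥2) (≥2 n≥2) d 0<d (cx m n m₃ n₃) n₁ n₂
                 (λ k eq → small k (ℕₚ.≤-pred (subst (suc N₄ ℕ.≤_) eq n₄))) (λ p p≤ → truncation d (expSum p m) (expSum p N₅) (expSum p n) (tail p p≤ m m₅) (tail p p≤ n n₅)) (thirds ε)
      in L ℕ.⊔ L′ , λ m n m≥ n≥ → ∣p-q∣<ε {ℓ m} {ℓ n} (step m n m≥ n≥) (step n m n≥ m≥)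
      where
      truncation : ∀ d u v w → ∣ u - v ∣ < d * ½ → ∣ w - v ∣ < d * ½ → ∣ u - w ∣ < d
      truncation d u v w u~v w~v = ℚₚ.≤-<-trans (triangle u v w) (subst (∣ u - v ∣ + ∣ v - w ∣ <_) (halves d) (ℚₚ.+-mono-< u~v (subst (_< d * ½) (dist-sym w v) w~v)))
      go : ∀ m n → Σ[ k ∈ ℕ ] m ≡ suc (suc k) → Σ[ k ∈ ℕ ] n ≡ suc (suc k) → ∀ d → 0ℚ < d → ∣ seq x m - seq x n ∣ < d → N₁ ℕ.≤ n → N₂ ℕ.≤ n →
        (∀ k → n ≡ suc k → (+ 1 / suc k) * E < d) → (∀ p → ∣ p ∣ ≤ B → ∣ expSum p m - expSum p n ∣ < d) → (d + d) + d ≡ ε → ℓ m < ℓ n + ε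
      go m n (i , refl) (j , refl) d 0<d xm~xn n₁ n₂ small trunc refl = near 0<d i j (κ-near 0<d m n xm~xn)
        (ℚₚ.<-trans (close j n₁ n₂) (ℚₚ.+-monoʳ-< (expSum (q (approx j)) n) (small (suc j) refl)))
        (trunc (q (approx j)) (subst (_≤ B) (sym (ℚₚ.0≤p⇒∣p∣≡p (0≤q (approx j)))) (ℚₚ.≤-trans (ℚₚ.≤-trans (q≤κ j) (κ≤ n n₁))
          (ℚₚ.≤-trans (ℚₚ.≤-trans (ℚₚ.≤-reflexive (sym (ℚₚ.+-identityʳ (b + 1ℚ)))) (ℚₚ.+-monoʳ-≤ (b + 1ℚ) 0≤1)) (ℚₚ.≤-reflexive (sym B≡))))))

    exp-near : ∀ ε → 0ℚ < ε → Σ[ N ∈ ℕ ] (∀ n → N ℕ.≤ n → ∣ expSum (ℓ n) n - seq x n ∣ < ε)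
    exp-near ε 0<ε =
      let N₃ , 1< = ↓ 1≤x ε 0<ε
          N₄ , small = 1/suc-small E 0<E ε 0<ε
          L = 2 ℕ.⊔ (N₁ ℕ.⊔ N₂)
          L′ = N₃ ℕ.⊔ suc N₄
      in L ℕ.⊔ L′ , λ n n≥ →
         let nl , nr = ⊔-split {L} {L′} n≥
             n≥2 , n₁₂ = ⊔-split {2} {N₁ ℕ.⊔ N₂} nl
             n₁ , n₂ = ⊔-split {N₁} {N₂} n₁₂
             n₃ , n₄ = ⊔-split {N₃} {suc N₄} nr
         in go n (≥2 n≥2) n₁ n₂ (1< n n₃) (λ k eq → small k (ℕₚ.≤-pred (subst (suc N₄ ℕ.≤_) eq n₄)))
      where
      go : ∀ n → Σ[ k ∈ ℕ ] n ≡ suc (suc k) → N₁ ℕ.≤ n → N₂ ℕ.≤ n → 1ℚ < seq x n + ε → (∀ k → n ≡ suc k → (+ 1 / suc k) * E < ε) →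
        ∣ expSum (ℓ n) n - seq x n ∣ < ε
      go n (j , refl) n₁ n₂ 1<x small = ∣p-q∣<ε {expSum (q (approx j)) n} {seq x n}
        (ℚₚ.≤-<-trans (lower (approx j)) ([ (λ eq → subst (_< seq x n + ε) (sym eq) (p<p+ε 0<ε)) , (λ eq → subst (_< seq x n + ε) (sym eq) 1<x) ]′ (ℚₚ.⊔-sel (seq x n) 1ℚ)))
        (ℚₚ.≤-<-trans (ℚₚ.p≤p⊔q (seq x n) 1ℚ) (ℚₚ.<-trans (close j n₁ n₂) (ℚₚ.+-monoʳ-< (expSum (q (approx j)) n) (small (suc j) refl))))

  IsLog : Set
  IsLog = IsCauchy ℓ × (∀ ε → 0ℚ < ε → Σ[ N ∈ ℕ ] (∀ n → N ℕ.≤ n → ∣ expSum (ℓ n) n - seq x n ∣ < ε))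

  abstract
    ℓ-properties : IsLog
    ℓ-properties = with-bound (eventually-bounded x)
      where
      with-bound : Σ[ b ∈ ℚ ] (0ℚ < b × Σ[ N ∈ ℕ ] (∀ n → N ℕ.≤ n → ∣ seq x n ∣ ≤ b)) → IsLog
      with-bound (b , 0<b , N₁ , ∣x∣≤b) = with-exp-bound ((b + 1ℚ) + 1ℚ) refl (eventually-bounded (exp (fromℚ ((b + 1ℚ) + 1ℚ))))
        where
        with-exp-bound : ∀ B → B ≡ (b + 1ℚ) + 1ℚ → Σ[ E ∈ ℚ ] (0ℚ < E × Σ[ N ∈ ℕ ] (∀ n → N ℕ.≤ n → ∣ expSum B n ∣ ≤ E)) → IsLog
        with-exp-bound B B≡ (E , 0<E , N₂ , ∣exp∣≤E) = Mod.ℓ-cauchy , Mod.exp-near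
          where
          0<B : 0ℚ < B
          0<B = subst (0ℚ <_) (sym B≡) (ℚₚ.+-mono-< (ℚₚ.+-mono-< 0<b (ℚₚ.positive⁻¹ 1ℚ)) (ℚₚ.positive⁻¹ 1ℚ))
          module Mod = Modulus {b} {B} {E} {N₁} {N₂} 0<b ∣x∣≤b B≡ 0<B 0<E ∣exp∣≤E

  logᴿ : ℝ
  logᴿ = mkℝ ℓ (proj₁ ℓ-properties)

  exp-logᴿ : exp logᴿ ≃ᴿ x
  exp-logᴿ = proj₂ ℓ-properties

module RealLogarithm where
  open OrderedModule ℝ-module

  *ʳ-comm : ∀ x y → x *ᴿ y ≤ʳ y *ᴿ x
  *ʳ-comm x y = pointwise-≤ λ n → ℚₚ.≤-reflexive (ℚₚ.*-comm (seq x n) (seq y n))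

  *ʳ-assoc : ∀ x y z → (x *ᴿ y) *ᴿ z ≈ᵛ x *ᴿ (y *ᴿ z)
  *ʳ-assoc x y z = pointwise-≡ λ n → ℚₚ.*-assoc (seq x n) (seq y n) (seq z n)

  *ʳ-identityʳ : ∀ x → x *ᴿ fromℚ 1ℚ ≈ᵛ x
  *ʳ-identityʳ x = pointwise-≡ λ n → ℚₚ.*-identityʳ (seq x n)

  *ʳ-monoˡ : ∀ {z x y} → 0ᴿ ≤ʳ z → x ≤ʳ y → x *ᴿ z ≤ʳ y *ᴿ z
  *ʳ-monoˡ {z} {x} {y} 0≤z x≤y = ≤ʳ-trans (*ʳ-comm x z) (≤ʳ-trans (*ʳ-monoʳ 0≤z x≤y) (*ʳ-comm z y))

  fromℚ-* : ∀ p q → fromℚ p *ᴿ fromℚ q ≈ᵛ fromℚ (p * q)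
  fromℚ-* p q = pointwise-≡ λ _ → refl

  limit-≤ : ∀ {x y} → (∀ ε → 0ℚ < ε → x ≤ʳ y +ᴿ fromℚ ε) → x ≤ʳ y
  limit-≤ {x} {y} le = ↑ λ ε 0<ε →
    let N , lt = ↓ (le (ε * ½) (half>0 0<ε)) (ε * ½) (half>0 0<ε)
    in N , λ n n≥ → subst (seq x n <_) (half-+ (seq y n) ε) (lt n n≥)

  exp-pointwise : ∀ {x y} → (∀ n → seq x n ≡ seq y n) → exp x ≈ᵛ exp y
  exp-pointwise x≡y = pointwise-≡ λ n → cong (λ q → expSum q n) (x≡y n)

  exp-+-≈ : ∀ x y → exp (x +ᴿ y) ≈ᵛ exp x *ᴿ exp y
  exp-+-≈ x y = ≃⇒≤ (exp (x +ᴿ y)) (exp x *ᴿ exp y) (exp-+ x y)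

  -- exp x is the square of exp (x/2).
  exp-nonNeg : ∀ x → 0ᴿ ≤ʳ exp x
  exp-nonNeg x = ≤ʳ-trans (≤ʳ-trans (pointwise-≤ λ n → square-nonNeg (expSum (seq half n) n)) (proj₂ (exp-+-≈ half half)))
    (proj₁ (exp-pointwise {half +ᴿ half} {x} λ n → halves (seq x n)))
    where
    half : ℝ
    half = x *ᴿ fromℚ ½

  exp-0 : exp 0ᴿ ≈ᵛ fromℚ 1ℚ
  exp-0 = eventually-≤ 1 (λ n 1≤n → ℚₚ.≤-reflexive (at-0 n 1≤n)) , eventually-≤ 1 (λ n 1≤n → ℚₚ.≤-reflexive (sym (at-0 n 1≤n)))
    where
    at-0 : ∀ n → 1 ℕ.≤ n → expSum 0ℚ n ≡ 1ℚ
    at-0 (suc n) _ = expSum-0 n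

  exp-inverse : ∀ x → exp x *ᴿ exp (-ᴿ x) ≈ᵛ fromℚ 1ℚ
  exp-inverse x = ≈ᵛ-trans (≈ᵛ-sym (exp-+-≈ x (-ᴿ x))) (≈ᵛ-trans (exp-pointwise {x -ᴿ x} {0ᴿ} λ n → ℚₚ.+-inverseʳ (seq x n)) exp-0)

  *ʳ-exp-cancel : ∀ {x} → 0ᴿ ≤ʳ x → ∀ y → (x *ᴿ exp y) *ᴿ exp (-ᴿ y) ≈ᵛ x
  *ʳ-exp-cancel {x} 0≤x y = ≈ᵛ-trans (*ʳ-assoc x (exp y) (exp (-ᴿ y)))
    (≈ᵛ-trans (*ʳ-monoʳ 0≤x (proj₁ (exp-inverse y)) , *ʳ-monoʳ 0≤x (proj₂ (exp-inverse y))) (*ʳ-identityʳ x))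

  -- A truncated form of exp q ≤ 1/(1 - q). The extra term t makes the induction telescope: (1 - q)
  -- t plus the next term is at most t.
  [1-q]*expSum≤1 : ∀ {q} → 0ℚ ≤ q → ∀ n → (1ℚ - q) * expSum q n + expTerm q n ≤ 1ℚ
  [1-q]*expSum≤1 {q} 0≤q zero = ℚₚ.≤-reflexive (trans (cong (_+ 1ℚ) (ℚₚ.*-zeroʳ (1ℚ - q))) (ℚₚ.+-identityˡ 1ℚ))
  [1-q]*expSum≤1 {q} 0≤q (suc n) = begin
    (1ℚ - q) * (S + t) + t * (q * r)   ≤⟨ ℚₚ.+-monoʳ-≤ ((1ℚ - q) * (S + t)) (ℚₚ.*-monoˡ-≤-nonNeg t {{nonNegative (expTerm-nonNeg 0≤q n)}} qr≤q) ⟩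
    (1ℚ - q) * (S + t) + t * q         ≡⟨ regroup q S t ⟩
    (1ℚ - q) * S + t                   ≤⟨ [1-q]*expSum≤1 0≤q n ⟩
    1ℚ                                 ∎
    where
    open ℚₚ.≤-Reasoning
    open +-*-Solver
    S = expSum q n
    t = expTerm q n
    r = + 1 / suc n
    r≤1 : r ≤ 1ℚ
    r≤1 = subst₂ _≤_ (ℚₚ.*-identityˡ r) (suc*1/suc n) (ℚₚ.*-monoʳ-≤-nonNeg r {{nonNegative (ℚₚ.<⇒≤ (1/suc>0 n))}} (fromℕℚ-mono {1} {suc n} (s≤s z≤n)))
    qr≤q : q * r ≤ q
    qr≤q = ℚₚ.≤-trans (ℚₚ.*-monoˡ-≤-nonNeg q {{nonNegative 0≤q}} r≤1) (ℚₚ.≤-reflexive (ℚₚ.*-identityʳ q))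
    regroup : ∀ q S t → (1ℚ - q) * (S + t) + t * q ≡ (1ℚ - q) * S + t
    regroup = solve 3 (λ q S t → (con 1ℚ :- q) :* (S :+ t) :+ t :* q := (con 1ℚ :- q) :* S :+ t) refl

  [1-q]*exp≤1 : ∀ {q} → 0ℚ ≤ q → fromℚ (1ℚ - q) *ᴿ exp (fromℚ q) ≤ʳ fromℚ 1ℚ
  [1-q]*exp≤1 {q} 0≤q = pointwise-≤ λ n → ℚₚ.≤-trans (ℚₚ.≤-trans (ℚₚ.≤-reflexive (sym (ℚₚ.+-identityʳ _)))
    (ℚₚ.+-monoʳ-≤ ((1ℚ - q) * expSum q n) (expTerm-nonNeg 0≤q n))) ([1-q]*expSum≤1 0≤q n)

  1-q≤exp[-q] : ∀ {q} → 0ℚ ≤ q → q ≤ 1ℚ → fromℚ (1ℚ - q) ≤ʳ exp (-ᴿ fromℚ q)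
  1-q≤exp[-q] {q} 0≤q q≤1 = ≤ʳ-trans (proj₂ (*ʳ-exp-cancel (fromℚ-mono 0≤1-q) (fromℚ q)))
    (≤ʳ-trans (*ʳ-monoˡ (exp-nonNeg (-ᴿ fromℚ q)) ([1-q]*exp≤1 0≤q)) (proj₁ (1*x (exp (-ᴿ fromℚ q)))))
    where
    0≤1-q : 0ℚ ≤ 1ℚ - q
    0≤1-q = subst (_≤ 1ℚ - q) (ℚₚ.+-inverseʳ q) (ℚₚ.+-monoˡ-≤ (- q) q≤1)
    1*x : ∀ x → fromℚ 1ℚ *ᴿ x ≈ᵛ x
    1*x = •-identity

  eventually-1+q≤exp : ∀ {q x} → 0ℚ ≤ q → ∀ N → (∀ n → N ℕ.≤ n → q ≤ seq x n) → fromℚ (1ℚ + q) ≤ʳ exp x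
  eventually-1+q≤exp {q} {x} 0≤q N q≤x = eventually-≤ (2 ℕ.⊔ N) λ n le →
    let n≥2 , n≥N = ⊔-split {2} {N} le in bound n n≥2 (q≤x n n≥N)
    where
    bound : ∀ n → 2 ℕ.≤ n → q ≤ seq x n → 1ℚ + q ≤ expSum (seq x n) n
    bound (suc (suc n)) _ q≤ = ℚₚ.≤-trans (ℚₚ.+-monoʳ-≤ 1ℚ q≤) (1+q≤expSum (ℚₚ.≤-trans 0≤q q≤) n)
    bound (suc zero) (s≤s ())

  -- The terms of x are bounded below only by - ε. So exp (x + ε) ≥ 1 is shown, and multiplying by 1
  -- - ε, where (1 - ε) exp ε ≤ 1, gives exp x ≥ 1 - ε.
  1≤exp : ∀ {x} → 0ᴿ ≤ʳ x → fromℚ 1ℚ ≤ʳ exp x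
  1≤exp {x} 0≤x = limit-≤ λ ε 0<ε → [ small ε 0<ε , large ε ]′ (ℚₚ.≤-total ε 1ℚ)
    where
    large : ∀ ε → 1ℚ ≤ ε → fromℚ 1ℚ ≤ʳ exp x +ᴿ fromℚ ε
    large ε 1≤ε = ≤ʳ-trans (proj₂ (+ᵛ-identityˡ (fromℚ 1ℚ))) (+ʳ-mono (exp-nonNeg x) (fromℚ-mono 1≤ε))
    small : ∀ ε → 0ℚ < ε → ε ≤ 1ℚ → fromℚ 1ℚ ≤ʳ exp x +ᴿ fromℚ ε
    small ε 0<ε ε≤1 =
      let N , lt = ↓ 0≤x ε 0<ε
          1≤ : fromℚ 1ℚ ≤ʳ exp (x +ᴿ fromℚ ε)
          1≤ = eventually-1+q≤exp {0ℚ} {x +ᴿ fromℚ ε} ℚₚ.≤-refl N (λ n n≥ → ℚₚ.<⇒≤ (lt n n≥))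
          1-ε≤ : fromℚ (1ℚ - ε) ≤ʳ exp x
          1-ε≤ = ≤ʳ-trans (proj₂ (*ʳ-identityʳ (fromℚ (1ℚ - ε)))) (≤ʳ-trans (*ʳ-monoʳ 0≤1-ε (≤ʳ-trans 1≤ (proj₁ (exp-+-≈ x (fromℚ ε)))))
            (≤ʳ-trans (pointwise-≤ λ n → ℚₚ.≤-reflexive (swap (1ℚ - ε) (expSum (seq x n) n) (expSum ε n)))
            (≤ʳ-trans (*ʳ-monoʳ (exp-nonNeg x) ([1-q]*exp≤1 (ℚₚ.<⇒≤ 0<ε))) (proj₁ (*ʳ-identityʳ (exp x))))))
      in ≤ʳ-trans (pointwise-≤ λ _ → ℚₚ.≤-reflexive (rejoin ε)) (+ʳ-mono 1-ε≤ (≤ʳ-refl {fromℚ ε}))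
      where
      open +-*-Solver
      swap : ∀ a b c → a * (b * c) ≡ b * (a * c)
      swap = solve 3 (λ a b c → a :* (b :* c) := b :* (a :* c)) refl
      rejoin : ∀ ε → 1ℚ ≡ (1ℚ - ε) + ε
      rejoin = solve 1 (λ ε → con 1ℚ := (con 1ℚ :- ε) :+ ε) refl
      0≤1-ε : 0ᴿ ≤ʳ fromℚ (1ℚ - ε)
      0≤1-ε = fromℚ-mono (subst (_≤ 1ℚ - ε) (ℚₚ.+-inverseʳ ε) (ℚₚ.+-monoˡ-≤ (- ε) ε≤1))

  exp-mono : ∀ {x y} → x ≤ʳ y → exp x ≤ʳ exp y
  exp-mono {x} {y} x≤y = ≤ʳ-trans (proj₂ (*ʳ-identityʳ (exp x))) (≤ʳ-trans (*ʳ-monoʳ (exp-nonNeg x) (1≤exp (difference-nonNeg x≤y)))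
    (≤ʳ-trans (proj₂ (exp-+-≈ x (y -ᴿ x))) (proj₁ (exp-pointwise {x +ᴿ (y -ᴿ x)} {y} λ n → q+[p-q] (seq y n) (seq x n)))))

  exp≤1⇒≤0 : ∀ {x} → exp x ≤ʳ fromℚ 1ℚ → x ≤ʳ 0ᴿ
  exp≤1⇒≤0 {x} le = ↑ λ ε 0<ε → case compare x 0ᴿ ε 0<ε of λ where
    (inj₁ p)        → p
    (inj₂ (N , lt)) → contradiction
      (ℚₚ.<-≤-trans (p<p+ε (0<ε/8 0<ε)) (fromℚ-cancel (≤ʳ-trans (eventually-1+q≤exp {ε * (+ 1 / 8)} {x} (ℚₚ.<⇒≤ (0<ε/8 0<ε)) N
        (λ n n≥ → ℚₚ.≤-trans (ℚₚ.≤-reflexive (sym (ℚₚ.+-identityˡ _))) (ℚₚ.<⇒≤ (lt n n≥)))) le)))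
      (ℚₚ.<-irrefl refl)

  exp-reflect : ∀ {x y} → exp x ≤ʳ exp y → x ≤ʳ y
  exp-reflect {x} {y} le = ≤ʳ-trans (pointwise-≤ λ n → ℚₚ.≤-reflexive (sym (q+[p-q] (seq x n) (seq y n))))
    (≤ʳ-trans (+ʳ-mono (≤ʳ-refl {y}) (exp≤1⇒≤0 exp≤1)) (pointwise-≤ λ n → ℚₚ.≤-reflexive (ℚₚ.+-identityʳ (seq y n))))
    where
    exp≤1 : exp (x -ᴿ y) ≤ʳ fromℚ 1ℚ
    exp≤1 = ≤ʳ-trans (proj₁ (exp-+-≈ x (-ᴿ y))) (≤ʳ-trans (*ʳ-monoˡ (exp-nonNeg (-ᴿ y)) le) (proj₁ (exp-inverse y)))

  private
    -- `LogOf` takes arguments at least 1; below 1 the logarithm of the reciprocal is negated. The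
    -- third case is a default, impossible for p > 0.
    log-cases : ∀ p → Dec (1ℚ ≤ p) → Dec (1ℚ ≤ recip p) → ℝ
    log-cases p (yes 1≤p) _       = LogOf.logᴿ (fromℚ p) (fromℚ-mono 1≤p)
    log-cases p (no _) (yes 1≤p⁻¹) = -ᴿ LogOf.logᴿ (fromℚ (recip p)) (fromℚ-mono 1≤p⁻¹)
    log-cases p (no _) (no _)      = 0ᴿ

    exp-log-cases : ∀ {p} → 0ℚ < p → (d : Dec (1ℚ ≤ p)) (d′ : Dec (1ℚ ≤ recip p)) → exp (log-cases p d d′) ≈ᵛ fromℚ p
    exp-log-cases {p} 0<p (yes 1≤p) _ = ≃⇒≤ (exp (LogOf.logᴿ (fromℚ p) (fromℚ-mono 1≤p))) (fromℚ p) (LogOf.exp-logᴿ (fromℚ p) (fromℚ-mono 1≤p))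
    exp-log-cases {p} 0<p (no _) (yes 1≤p⁻¹) = ≈ᵛ-trans (≈ᵛ-sym 1*e≈) (≈ᵛ-trans 1≈ (*ʳ-exp-cancel (fromℚ-mono (ℚₚ.<⇒≤ 0<p)) ℓ))
      where
      ℓ : ℝ
      ℓ = LogOf.logᴿ (fromℚ (recip p)) (fromℚ-mono 1≤p⁻¹)
      exp-ℓ : exp ℓ ≈ᵛ fromℚ (recip p)
      exp-ℓ = ≃⇒≤ (exp ℓ) (fromℚ (recip p)) (LogOf.exp-logᴿ (fromℚ (recip p)) (fromℚ-mono 1≤p⁻¹))
      1*e≈ : fromℚ 1ℚ *ᴿ exp (-ᴿ ℓ) ≈ᵛ exp (-ᴿ ℓ)
      1*e≈ = •-identity (exp (-ᴿ ℓ))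
      p*exp-ℓ : fromℚ p *ᴿ exp ℓ ≈ᵛ fromℚ 1ℚ
      p*exp-ℓ = ≈ᵛ-trans (*ʳ-monoʳ (fromℚ-mono (ℚₚ.<⇒≤ 0<p)) (proj₁ exp-ℓ) , *ʳ-monoʳ (fromℚ-mono (ℚₚ.<⇒≤ 0<p)) (proj₂ exp-ℓ))
        (pointwise-≡ λ _ → recip-inverseʳ 0<p)
      1≈ : fromℚ 1ℚ *ᴿ exp (-ᴿ ℓ) ≈ᵛ (fromℚ p *ᴿ exp ℓ) *ᴿ exp (-ᴿ ℓ)
      1≈ = *ʳ-monoˡ (exp-nonNeg (-ᴿ ℓ)) (proj₂ p*exp-ℓ) , *ʳ-monoˡ (exp-nonNeg (-ᴿ ℓ)) (proj₁ p*exp-ℓ)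
    exp-log-cases {p} 0<p (no 1≰p) (no 1≰p⁻¹) = contradiction
      (subst₂ _≤_ (recip-inverseˡ 0<p) (ℚₚ.*-identityʳ (recip p))
        (ℚₚ.*-monoˡ-≤-nonNeg (recip p) {{nonNegative (ℚₚ.<⇒≤ (recip-pos 0<p))}} (ℚₚ.<⇒≤ (ℚₚ.≰⇒> 1≰p)))) 1≰p⁻¹

  abstract
    logᵠ : ℚ → ℝ
    logᵠ p = log-cases p (1ℚ ℚₚ.≤? p) (1ℚ ℚₚ.≤? recip p)

    exp-logᵠ : ∀ {p} → 0ℚ < p → exp (logᵠ p) ≈ᵛ fromℚ p
    exp-logᵠ {p} 0<p = exp-log-cases 0<p (1ℚ ℚₚ.≤? p) (1ℚ ℚₚ.≤? recip p)

  exp-unique : ∀ {x y} → exp x ≈ᵛ exp y → x ≈ᵛ y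
  exp-unique (p , q) = exp-reflect p , exp-reflect q

  logᵠ-* : ∀ {p q} → 0ℚ < p → 0ℚ < q → logᵠ (p * q) ≈ᵛ logᵠ p +ᴿ logᵠ q
  logᵠ-* {p} {q} 0<p 0<q = exp-unique (≈ᵛ-trans (exp-logᵠ (*-pos 0<p 0<q)) (≈ᵛ-trans (≈ᵛ-sym (fromℚ-* p q))
    (≈ᵛ-trans (≈ᵛ-sym product) (≈ᵛ-sym (exp-+-≈ (logᵠ p) (logᵠ q))))))
    where
    0≤p = fromℚ-mono (ℚₚ.<⇒≤ 0<p)
    product : exp (logᵠ p) *ᴿ exp (logᵠ q) ≈ᵛ fromℚ p *ᴿ fromℚ q
    product = ≈ᵛ-trans (*ʳ-monoˡ (exp-nonNeg (logᵠ q)) (proj₁ (exp-logᵠ 0<p)) , *ʳ-monoˡ (exp-nonNeg (logᵠ q)) (proj₂ (exp-logᵠ 0<p)))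
      (*ʳ-monoʳ 0≤p (proj₁ (exp-logᵠ 0<q)) , *ʳ-monoʳ 0≤p (proj₂ (exp-logᵠ 0<q)))

  p≤exp[p-1] : ∀ {p} → 0ℚ < p → fromℚ p ≤ʳ exp (fromℚ (p - 1ℚ))
  p≤exp[p-1] {p} 0<p = [ below , above ]′ (ℚₚ.≤-total p 1ℚ)
    where
    open +-*-Solver
    1-[1-p] : ∀ p → p ≡ 1ℚ - (1ℚ - p)
    1-[1-p] = solve 1 (λ p → p := con 1ℚ :- (con 1ℚ :- p)) refl
    1+[p-1] : ∀ p → p ≡ 1ℚ + (p - 1ℚ)
    1+[p-1] = solve 1 (λ p → p := con 1ℚ :+ (p :- con 1ℚ)) refl
    -[1-p] : ∀ p → - (1ℚ - p) ≡ p - 1ℚ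
    -[1-p] = solve 1 (λ p → :- (con 1ℚ :- p) := p :- con 1ℚ) refl
    below : p ≤ 1ℚ → fromℚ p ≤ʳ exp (fromℚ (p - 1ℚ))
    below p≤1 = ≤ʳ-trans (≤ʳ-trans (fromℚ-mono (ℚₚ.≤-reflexive (1-[1-p] p))) (1-q≤exp[-q] {1ℚ - p}
        (subst (_≤ 1ℚ - p) (ℚₚ.+-inverseʳ p) (ℚₚ.+-monoˡ-≤ (- p) p≤1))
        (ℚₚ.≤-trans (ℚₚ.+-monoʳ-≤ 1ℚ (ℚₚ.neg-antimono-≤ (ℚₚ.<⇒≤ 0<p))) (ℚₚ.≤-reflexive (ℚₚ.+-identityʳ 1ℚ)))))
      (proj₁ (exp-pointwise { -ᴿ fromℚ (1ℚ - p)} {fromℚ (p - 1ℚ)} λ _ → -[1-p] p))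
    above : 1ℚ ≤ p → fromℚ p ≤ʳ exp (fromℚ (p - 1ℚ))
    above 1≤p = ≤ʳ-trans (fromℚ-mono (ℚₚ.≤-reflexive (1+[p-1] p)))
      (eventually-1+q≤exp {p - 1ℚ} {fromℚ (p - 1ℚ)} (subst (_≤ p - 1ℚ) (ℚₚ.+-inverseʳ 1ℚ) (ℚₚ.+-monoˡ-≤ (- 1ℚ) 1≤p)) 0 λ _ _ → ℚₚ.≤-refl)

  logᵠ-≤ : ∀ {p} → 0ℚ < p → logᵠ p ≤ʳ fromℚ (p - 1ℚ) *ᴿ fromℚ 1ℚ
  logᵠ-≤ {p} 0<p = ≤ʳ-trans (exp-reflect (≤ʳ-trans (proj₁ (exp-logᵠ 0<p)) (p≤exp[p-1] 0<p))) (proj₂ (*ʳ-identityʳ (fromℚ (p - 1ℚ))))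

  ℝ-log : LogModule
  ℝ-log = record
    { orderedModule = ℝ-module
    ; one = fromℚ 1ℚ
    ; log = logᵠ
    ; 0≤one = fromℚ-mono 0≤1
    ; one≰0 = λ le → ℚₚ.<-irrefl refl (ℚₚ.<-≤-trans (ℚₚ.positive⁻¹ 1ℚ) (fromℚ-cancel le))
    ; log-* = logᵠ-*
    ; log-≤ = logᵠ-≤
    ; ≰⇒≥ = ≰ʳ⇒≥
    ; ≤-stable = ≤ʳ-stable
    ; bounded = λ x →
        let b , _ , N , ∣x∣≤b = eventually-bounded x
            k , b≤k = archimedean b
        in k , ≤ʳ-trans (eventually-≤ {x} {fromℚ (fromℕℚ k)} N (λ n n≥ → ℚₚ.≤-trans (p≤∣p∣ (seq x n)) (ℚₚ.≤-trans (∣x∣≤b n n≥) b≤k))) (proj₂ (*ʳ-identityʳ (fromℚ (fromℕℚ k))))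
    ; archimedes = archimedes
    }
    where
    archimedes : ∀ {x} → ¬ (x ≤ʳ 0ᴿ) → ¬ ¬ (Σ[ n ∈ ℕ ] fromℚ 1ℚ ≤ʳ n ×ᵛ x)
    archimedes {x} x≰0 none = x≰0 (↑ λ ε 0<ε → case compare x 0ᴿ ε 0<ε of λ where
      (inj₁ p)        → p
      (inj₂ (N , lt)) → ⊥-elim (none (multiple (ε * (+ 1 / 8)) (0<ε/8 0<ε) N λ n n≥ →
        ℚₚ.≤-trans (ℚₚ.≤-reflexive (sym (ℚₚ.+-identityˡ _))) (ℚₚ.<⇒≤ (lt n n≥)))))
      where
      multiple : ∀ δ → 0ℚ < δ → ∀ N → (∀ n → N ℕ.≤ n → δ ≤ seq x n) → Σ[ n ∈ ℕ ] fromℚ 1ℚ ≤ʳ n ×ᵛ x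
      multiple δ 0<δ N δ≤ =
        let k , δ⁻¹≤k = archimedean (recip δ)
        in k , eventually-≤ {fromℚ 1ℚ} {k ×ᵛ x} N λ n n≥ → ℚₚ.≤-trans (ℚₚ.≤-reflexive (sym (recip-inverseˡ 0<δ)))
             (*-mono-≤-nn (ℚₚ.<⇒≤ 0<δ) (ℚₚ.≤-trans (ℚₚ.<⇒≤ (recip-pos 0<δ)) δ⁻¹≤k) δ⁻¹≤k (δ≤ n n≥))

-- Linear algebra over the reals

*ʳ-congʳ : ∀ z {x y} → x ≃ᴿ y → z *ᴿ x ≃ᴿ z *ᴿ y
*ʳ-congʳ z {x} {y} x≃y ε 0<ε =
  let b , 0<b , M , ∣z∣≤b = eventually-bounded z
      δ , 0<δ , δ*b≡ε    = quotient ε b 0<ε 0<b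
      N , x~y            = x≃y δ 0<δ
  in M ℕ.⊔ N , λ n le → let n≥M , n≥N = ⊔-split {M} {N} le in begin-strict
    ∣ seq z n * seq x n - seq z n * seq y n ∣ ≡⟨ cong ∣_∣ (factor (seq z n) (seq x n) (seq y n)) ⟩
    ∣ seq z n * (seq x n - seq y n) ∣         ≡⟨ ℚₚ.∣p*q∣≡∣p∣*∣q∣ (seq z n) (seq x n - seq y n) ⟩
    ∣ seq z n ∣ * ∣ seq x n - seq y n ∣       ≤⟨ ℚₚ.*-monoʳ-≤-nonNeg ∣ seq x n - seq y n ∣ {{ℚₚ.∣-∣-nonNeg (seq x n - seq y n)}} (∣z∣≤b n n≥M) ⟩
    b * ∣ seq x n - seq y n ∣                 <⟨ ℚₚ.*-monoʳ-<-pos b {{positive 0<b}} (x~y n n≥N) ⟩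
    b * δ                                     ≡⟨ trans (ℚₚ.*-comm b δ) δ*b≡ε ⟩
    ε                                         ∎
  where
  open ℚₚ.≤-Reasoning
  factor : ∀ z x y → z * x - z * y ≡ z * (x - y)
  factor = solve 3 (λ z x y → z :* x :- z :* y := z :* (x :- y)) refl
    where open +-*-Solver

/1-injective-0 : ∀ {p} → p / 1 ≡ 0ℚ → p ≡ + 0
/1-injective-0 {p} p/1≡0 = ℤₚ.*-cancelʳ-≡ p (+ 0) (+ 1) (ℚᵘₚ.drop-*≡* (ℚᵘₚ.≃-trans (ℚᵘₚ.≃-sym (ℚₚ.toℚᵘ-fromℚᵘ (ℚᵘ.mkℚᵘ p 0)))
  (ℚᵘₚ.≃-reflexive (cong toℚᵘ p/1≡0))))

module RealHull where
  open OrderedModule ℝ-module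

  private
    to≈ : ∀ {x y} → x ≃ᴿ y → x ≈ᵛ y
    to≈ {x} {y} = ≃⇒≤ x y

    *ʳ-cong-≈ : ∀ z {x y} → x ≈ᵛ y → z *ᴿ x ≈ᵛ z *ᴿ y
    *ʳ-cong-≈ z {x} {y} x≈y = ≃⇒≤ (z *ᴿ x) (z *ᴿ y) (*ʳ-congʳ z {x} {y} (≤⇒≃ x≈y))

  seq-sum-0 : ∀ {d} (c : Vector ℝ d) n → seq (sumⱽ (λ j → c j *ᴿ fromℤ (+ 0))) n ≡ 0ℚ
  seq-sum-0 {zero}  c n = refl
  seq-sum-0 {suc d} c n = cong₂ _+_ (ℚₚ.*-zeroʳ (seq (c Fin.zero) n)) (seq-sum-0 (c ∘ Fin.suc) n)

  sum-+ : ∀ {D d} (c c′ : Vector ℝ d) (b : Vector (Vector ℝ D) d) i n →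
    seq (linComb c b i +ᴿ linComb c′ b i) n ≡ seq (linComb (λ j → c j +ᴿ c′ j) b i) n
  sum-+ {d = zero}  c c′ b i n = refl
  sum-+ {d = suc d} c c′ b i n = trans (regroup (seq (c Fin.zero) n) (seq (c′ Fin.zero) n) (seq (b Fin.zero i) n) _ _)
    (cong (λ z → (seq (c Fin.zero) n + seq (c′ Fin.zero) n) * seq (b Fin.zero i) n + z) (sum-+ (c ∘ Fin.suc) (c′ ∘ Fin.suc) (b ∘ Fin.suc) i n))
    where
    regroup : ∀ c c′ b s s′ → (c * b + s) + (c′ * b + s′) ≡ (c + c′) * b + (s + s′)
    regroup = solve 5 (λ c c′ b s s′ → (c :* b :+ s) :+ (c′ :* b :+ s′) := (c :+ c′) :* b :+ (s :+ s′)) refl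
      where open +-*-Solver

  sum-* : ∀ {D d} r (c : Vector ℝ d) (b : Vector (Vector ℝ D) d) i n →
    seq (r *ᴿ linComb c b i) n ≡ seq (linComb (λ j → r *ᴿ c j) b i) n
  sum-* {d = zero}  r c b i n = ℚₚ.*-zeroʳ (seq r n)
  sum-* {d = suc d} r c b i n = trans (ℚₚ.*-distribˡ-+ (seq r n) (seq (c Fin.zero) n * seq (b Fin.zero i) n) _)
    (cong₂ _+_ (sym (ℚₚ.*-assoc (seq r n) (seq (c Fin.zero) n) (seq (b Fin.zero i) n))) (sum-* r (c ∘ Fin.suc) (b ∘ Fin.suc) i n))

  sum-0* : ∀ {D d} (b : Vector (Vector ℝ D) d) i n → 0ℚ ≡ seq (linComb (λ _ → 0ᴿ) b i) n
  sum-0* {d = zero}  b i n = refl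
  sum-0* {d = suc d} b i n = sym (cong₂ _+_ (ℚₚ.*-zeroˡ (seq (b Fin.zero i) n)) (sym (sum-0* (b ∘ Fin.suc) i n)))

  linear-span : ∀ {D d} → Vector (Vector ℝ D) d → LinearSubspace D
  linear-span {D} {d} b = record
    { Member = λ v → Σ[ c ∈ Vector ℝ d ] v ≈ⱽ linComb c b
    ; respᴹ  = λ {v} {w} v≈w (c , v≈) → c , λ i → ≤⇒≃ (≈ᵛ-trans (≈ᵛ-sym (≃⇒≤ (v i) (w i) (v≈w i))) (≃⇒≤ (v i) (linComb c b i) (v≈ i)))
    ; zeroᴹ  = (λ _ → 0ᴿ) , λ i → ≤⇒≃ (pointwise-≡ {0ᴿ} {linComb (λ _ → 0ᴿ) b i} (sum-0* b i))
    ; addᴹ   = λ {v} {w} (c , v≈) (c′ , w≈) → (λ j → c j +ᴿ c′ j) , λ i →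
        ≤⇒≃ (≈ᵛ-trans (+ᵛ-cong (≃⇒≤ (v i) (linComb c b i) (v≈ i)) (≃⇒≤ (w i) (linComb c′ b i) (w≈ i))) (pointwise-≡ {linComb c b i +ᴿ linComb c′ b i} {linComb (λ j → c j +ᴿ c′ j) b i} (sum-+ c c′ b i)))
    ; scaleᴹ = λ r {v} (c , v≈) → (λ j → r *ᴿ c j) , λ i →
        ≤⇒≃ (≈ᵛ-trans (*ʳ-cong-≈ r (≃⇒≤ (v i) (linComb c b i) (v≈ i))) (pointwise-≡ {r *ᴿ linComb c b i} {linComb (λ j → r *ᴿ c j) b i} (sum-* r c b i)))
    }

  member-linComb : ∀ {D d} (W : LinearSubspace D) (c : Vector ℝ d) b → (∀ j → Member W (b j)) → Member W (linComb c b)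
  member-linComb {d = zero}  W c b inside = zeroᴹ W
  member-linComb {d = suc d} W c b inside = addᴹ W (scaleᴹ W (c Fin.zero) (inside Fin.zero)) (member-linComb W (c ∘ Fin.suc) (b ∘ Fin.suc) (inside ∘ Fin.suc))

  respᴹ-≡ : ∀ {D} (W : LinearSubspace D) v w → (∀ i n → seq (v i) n ≡ seq (w i) n) → Member W v → Member W w
  respᴹ-≡ W v w v≡w = respᴹ W λ i → ≤⇒≃ (pointwise-≡ {v i} {w i} (v≡w i))

  rows : ∀ {D} (E : Echelon D) → Vector (Vector ℝ D) (rank E)
  rows E j = embed (row E j)

  -- In the pivot column only the first row is nonzero, so its coefficient vanishes, and the
  -- remaining rows follow by induction.
  rows-independent : ∀ {D} (E : Echelon D) → LinearlyIndependent (rows E)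
  rows-independent (skip E)          c c≈0 j = rows-independent E c (λ i → c≈0 (Fin.suc i)) j
  rows-independent {suc D} (pivot p p≢0 t E) c c≈0 = λ where
      Fin.zero    → ≤⇒≃ c₀≈0
      (Fin.suc j) → rows-independent E (c ∘ Fin.suc) (λ i → ≤⇒≃ (rest≈0 i)) j
    where
    P = p / 1
    instance
      P≢0 : NonZero P
      P≢0 = ≢-nonZero (p≢0 ∘ /1-injective-0)
    c₀ = c Fin.zero
    c₀*P≈0 : fromℤ p *ᴿ c₀ ≈ᵛ 0ᴿ
    c₀*P≈0 = ≈ᵛ-trans (pointwise-≡ λ n → sym (trans (cong (λ z → seq c₀ n * P + z) (seq-sum-0 (c ∘ Fin.suc) n))
      (trans (ℚₚ.+-identityʳ (seq c₀ n * P)) (ℚₚ.*-comm (seq c₀ n) P)))) (to≈ {linComb c (rows (pivot p p≢0 t E)) Fin.zero} {0ᴿ} (c≈0 Fin.zero))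
    c₀≈0 : c₀ ≈ᵛ 0ᴿ
    c₀≈0 = ≈ᵛ-trans (pointwise-≡ λ n → sym (trans (sym (ℚₚ.*-assoc (1/ P) P (seq c₀ n)))
        (trans (cong (_* seq c₀ n) (ℚₚ.*-inverseˡ P)) (ℚₚ.*-identityˡ (seq c₀ n)))))
      (≈ᵛ-trans (*ʳ-cong-≈ (fromℚ (1/ P)) c₀*P≈0) (pointwise-≡ λ _ → ℚₚ.*-zeroʳ (1/ P)))
    rest≈0 : ∀ i → linComb (c ∘ Fin.suc) (rows E) i ≈ᵛ 0ᴿ
    rest≈0 i = ≈ᵛ-trans (≈ᵛ-sym (+ᵛ-identityˡ rest)) (≈ᵛ-trans (+ᵛ-cong (≈ᵛ-sym first≈0) (≈ᵛ-refl {rest}))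
      (to≈ {c₀ *ᴿ fromℤ (lookup t i) +ᴿ rest} {0ᴿ} (c≈0 (Fin.suc i))))
      where
      rest = linComb (c ∘ Fin.suc) (rows E) i
      first≈0 : c₀ *ᴿ fromℤ (lookup t i) ≈ᵛ 0ᴿ
      first≈0 = ≈ᵛ-trans (pointwise-≡ λ n → ℚₚ.*-comm (seq c₀ n) (lookup t i / 1))
        (≈ᵛ-trans (*ʳ-cong-≈ (fromℤ (lookup t i)) c₀≈0) (pointwise-≡ λ _ → ℚₚ.*-zeroʳ (lookup t i / 1)))

  embed-combine : ∀ {D} (E : Echelon D) u i n → lookup (combine E u) i / 1 ≡ seq (linComb (λ j → fromℤ (lookup u j)) (rows E) i) n
  embed-combine (skip E)          u       Fin.zero    n = sym (seq-sum-0 (λ j → fromℤ (lookup u j)) n)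
  embed-combine (skip E)          u       (Fin.suc i) n = embed-combine E u i n
  embed-combine (pivot p _ t E) (a ∷ u) Fin.zero    n = trans (/1-* a p) (sym (trans (cong (λ z → (a / 1) * (p / 1) + z) (seq-sum-0 (λ j → fromℤ (lookup u j)) n))
    (ℚₚ.+-identityʳ ((a / 1) * (p / 1)))))
  embed-combine (pivot p _ t E) (a ∷ u) (Fin.suc i) n = trans (cong (_/ 1) (Vecₚ.lookup-zipWith ℤ._+_ i (a ·ᶻ t) (combine E u)))
    (trans (/1-+ (lookup (a ·ᶻ t) i) (lookup (combine E u) i)) (cong₂ _+_ (trans (cong (_/ 1) (Vecₚ.lookup-map i (a ℤ.*_) t)) (/1-* a (lookup t i))) (embed-combine E u i n)))

  embed-⊞ : ∀ {D} (u v : Vec ℤ D) i → lookup (u ⊞ᶻ v) i / 1 ≡ (lookup u i / 1) + (lookup v i / 1)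
  embed-⊞ u v i = trans (cong (_/ 1) (Vecₚ.lookup-zipWith ℤ._+_ i u v)) (/1-+ (lookup u i) (lookup v i))

  embed-neg : ∀ {D} (v : Vec ℤ D) i → lookup (-ᶻ v) i / 1 ≡ - (lookup v i / 1)
  embed-neg v i = trans (cong (_/ 1) (Vecₚ.lookup-map i (λ a → ℤ.- a) v)) (/1-neg (lookup v i))

  embed-difference : ∀ {D} (u v : Vec ℤ D) i → lookup (u ⊞ᶻ (-ᶻ v)) i / 1 ≡ (lookup u i / 1) - (lookup v i / 1)
  embed-difference u v i = trans (embed-⊞ u (-ᶻ v) i) (cong (λ z → lookup u i / 1 + z) (embed-neg v i))

  member-Span : ∀ {D} (W : LinearSubspace D) {P : Vec ℤ D → Set} → (∀ {v} → P v → Member W (embed v)) → ∀ {v} → Span P v → Member W (embed v)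
  member-Span W inside (gen p)   = inside p
  member-Span W inside zero      = respᴹ-≡ W _ (embed 𝟎ᶻ) (λ i _ → sym (cong (_/ 1) (Vecₚ.lookup-replicate i (+ 0)))) (zeroᴹ W)
  member-Span W inside (add {u} {v} s t) = respᴹ-≡ W (λ i → embed u i +ᴿ embed v i) (embed (u ⊞ᶻ v)) (λ i _ → sym (embed-⊞ u v i))
    (addᴹ W (member-Span W inside s) (member-Span W inside t))
  member-Span W inside (minus {v} s) = respᴹ-≡ W (λ i → fromℚ (- 1ℚ) *ᴿ embed v i) (embed (-ᶻ v))
    (λ i _ → trans (sym (ℚₚ.neg-distribˡ-* 1ℚ (lookup v i / 1))) (trans (cong -_ (ℚₚ.*-identityˡ (lookup v i / 1))) (sym (embed-neg v i))))
    (scaleᴹ W (fromℚ (- 1ℚ)) (member-Span W inside s))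

  -- The echelon rows and the differences of B generate each other over ℤ, hence span the same real
  -- subspace; its translate by a is the affine hull, and the rank is its dimension.
  hasDim : ∀ {D} (B : FinSet D) → elements B ≢ [] → HasDim B (rank (hull-basis (elements B)))
  hasDim (mkFinSet [] _)      ne = contradiction refl ne
  hasDim {D} (mkFinSet (a ∷ A) _) ne = record
    { hull = record { point = embed a ; direction = linear-span (rows E) }
    ; contains = λ v∈ → covered (∈ₚ.∈-map⁺ (_⊞ᶻ (-ᶻ a)) v∈)
    ; smallest = smallest
    ; basis = record
      { vectors = rows E
      ; inside = λ j → in-span j
      ; independent = rows-independent E
      ; spanning = λ v v∈ → v∈ }
    }
    where
    E : Echelon D
    E = hull-basis (a ∷ A)
    W = linear-span (rows E)
    covered : ∀ {v} → v ⊞ᶻ (-ᶻ a) ∈ differences a (a ∷ A) → Member W (λ i → embed v i -ᴿ embed a i)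
    covered {v} v∈ with coordinates E (hull-covers a A v∈)
    ... | u , combine≡ = (λ j → fromℤ (lookup u j)) , λ i → ≤⇒≃ (pointwise-≡ {embed v i -ᴿ embed a i} {linComb (λ j → fromℤ (lookup u j)) (rows E) i} λ n →
      trans (sym (embed-difference v a i)) (trans (cong (λ w → lookup w i / 1) (sym combine≡)) (embed-combine E u i n)))
    in-span : ∀ j → Member W (embed (row E j))
    in-span j with combine-Row E (j , refl)
    ... | u , combine≡ = (λ j → fromℤ (lookup u j)) , λ i → ≤⇒≃ (pointwise-≡ {embed (row E j) i} {linComb (λ j → fromℤ (lookup u j)) (rows E) i} λ n →
      trans (cong (λ w → lookup w i / 1) (sym combine≡)) (embed-combine E u i n))
    smallest : ∀ T → (∀ {v} → v ∈ a ∷ A → embed v ∈ᵃ T) → ∀ v → Member W (λ i → v i -ᴿ embed a i) → v ∈ᵃ T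
    smallest T T∋ v (c , v-a≈) = respᴹ-≡ V (λ i → (v i -ᴿ embed a i) +ᴿ (embed a i -ᴿ point T i)) (λ i → v i -ᴿ point T i)
      (λ i n → sym (dist-split (seq (v i) n) (lookup a i / 1) (seq (point T i) n)))
      (addᴹ V (respᴹ V (λ i → ≤⇒≃ (≈ᵛ-sym (≃⇒≤ (v i -ᴿ embed a i) (linComb c (rows E) i) (v-a≈ i)))) (member-linComb V c (rows E) row∈)) (T∋ (here refl)))
      where
      V = direction T
      difference∈ : ∀ {u} → u ∈ differences a (a ∷ A) → Member V (embed u)
      difference∈ u∈ with ∈ₚ.∈-map⁻ (_⊞ᶻ (-ᶻ a)) u∈
      ... | w , w∈ , refl = respᴹ-≡ V (λ i → (embed w i -ᴿ point T i) +ᴿ (fromℚ (- 1ℚ) *ᴿ (embed a i -ᴿ point T i))) (embed (w ⊞ᶻ (-ᶻ a)))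
        (λ i n → trans (regroup (lookup w i / 1) (lookup a i / 1) (seq (point T i) n)) (sym (embed-difference w a i)))
        (addᴹ V (T∋ w∈) (scaleᴹ V (fromℚ (- 1ℚ)) (T∋ (here refl))))
        where
        regroup : ∀ w a p → (w - p) + (- 1ℚ) * (a - p) ≡ w - a
        regroup = solve 3 (λ w a p → (w :- p) :+ con (- 1ℚ) :* (a :- p) := w :- a) refl
          where open +-*-Solver
      row∈ : ∀ j → Member V (rows E j)
      row∈ j = member-Span V difference∈ (hull-generated a A (j , refl))

-- Sets of doubling K and the final constants

open RealLogarithm using (*ʳ-monoˡ; exp-+-≈; exp-nonNeg; exp-mono; exp-reflect; logᵠ; exp-logᵠ; ℝ-log)

fromℕ-pos : ∀ n → 1 ℕ.≤ n → 0ᴿ <ᴿ fromℕ n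
fromℕ-pos n 1≤n = ½ , ℚₚ.positive⁻¹ ½ , 0 , λ _ _ → ℚₚ.<-≤-trans {j = 1ℚ} (toWitness {a? = (0ℚ + ½) ℚₚ.<? 1ℚ} tt) (fromℕℚ-mono {1} {n} 1≤n)

∈⊕ : ∀ {D} (A : FinSet D) {u v} → u ∈ elements A → v ∈ elements A → u ⊞ᶻ v ∈ elements (A ⊕ A)
∈⊕ A u∈ v∈ = ∈ₚ.∈-deduplicate⁺ _≟ⱽ_ (∈ₚ.∈-cartesianProductWith⁺ (zipWith ℤ._+_) u∈ v∈)

nonempty-elements : ∀ {D} (A : FinSet D) → Nonempty A → elements A ≢ []
nonempty-elements (mkFinSet [] _) (_ , ())
nonempty-elements (mkFinSet (_ ∷ _) _) _ ()

module _ (K : ℝ) (m n : ℕ) (1≤n : 1 ℕ.≤ n) (n≤m : n ℕ.≤ m) (m≤K*n : fromℕ m ≤ᴿ K *ᴿ fromℕ n) where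
  private
    N = fromℕℚ n
    0<N : 0ℚ < N
    0<N = ℚₚ.<-≤-trans (ℚₚ.positive⁻¹ 1ℚ) (fromℕℚ-mono {1} {n} 1≤n)
    0<M : 0ℚ < fromℕℚ m
    0<M = ℚₚ.<-≤-trans 0<N (fromℕℚ-mono n≤m)

  -- |A| ≤ |A + A| ≤ K|A|, divided by |A|. It makes log K constructible, as `LogOf` requires an
  -- argument at least 1.
  1≤ratio : fromℚ 1ℚ ≤ʳ K
  1≤ratio = ≤ʳ-trans (pointwise-≤ λ _ → ℚₚ.≤-reflexive (sym (recip-inverseʳ 0<N)))
    (≤ʳ-trans (*ʳ-monoˡ {fromℚ (recip N)} {fromℕ n} {K *ᴿ fromℕ n} (fromℚ-mono (ℚₚ.<⇒≤ (recip-pos 0<N))) (≤ʳ-trans (fromℚ-mono (fromℕℚ-mono n≤m)) (↑ m≤K*n)))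
    (pointwise-≤ λ k → ℚₚ.≤-reflexive (trans (ℚₚ.*-assoc (seq K k) N (recip N)) (trans (cong (seq K k *_) (recip-inverseʳ 0<N)) (ℚₚ.*-identityʳ (seq K k))))))

  log-ratio : ∀ k → k IsLogOf K → logᵠ (fromℕℚ m) ≤ʳ k +ᴿ logᵠ N
  log-ratio k exp-k≃K = exp-reflect (≤ʳ-trans (proj₁ (exp-logᵠ 0<M)) (≤ʳ-trans (↑ m≤K*n) (≤ʳ-trans
    (*ʳ-monoˡ (fromℚ-mono (ℚₚ.<⇒≤ 0<N)) (proj₂ (≃⇒≤ (exp k) K exp-k≃K)))
    (≤ʳ-trans (*ʳ-monoʳ (exp-nonNeg k) (proj₂ (exp-logᵠ 0<N))) (proj₂ (exp-+-≈ k (logᵠ N)))))))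

exp-*-≤ : ∀ {p q} → 0ℚ < p → 0ℚ < q → ∀ y → y +ᴿ logᵠ p ≤ʳ logᵠ q → exp y *ᴿ fromℚ p ≤ʳ fromℚ q
exp-*-≤ {p} 0<p 0<q y le = ≤ʳ-trans (*ʳ-monoʳ (exp-nonNeg y) (proj₂ (exp-logᵠ 0<p)))
  (≤ʳ-trans (proj₂ (exp-+-≈ y (logᵠ p))) (≤ʳ-trans (exp-mono le) (proj₁ (exp-logᵠ 0<q))))

theorem1p3 :
    Σ[ C₁ ∈ ℝ ] Σ[ C₂ ∈ ℝ ] (0ᴿ <ᴿ C₁ × 0ᴿ <ᴿ C₂ ×
      (∀ (D : ℕ) → D > 0 → (K : ℝ) (A : FinSet D) → Nonempty A →
        fromℕ (card (A ⊕ A)) ≤ᴿ K *ᴿ fromℕ (card A) →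
        Σ[ logK ∈ ℝ ] (logK IsLogOf K ×
          Σ[ A′ ∈ FinSet D ] (A′ ⊆ˢ A ×
            exp (-ᴿ (fromℚ ½ *ᴿ C₁) *ᴿ logK) *ᴿ fromℕ (card A) ≤ᴿ fromℕ (card A′) ×
            Σ[ d ∈ ℕ ] (HasDim A′ d × fromℕ d ≤ᴿ C₂ *ᴿ logK)))))
-- 404 is twice the exponent 202 of `small-doubling`, because C₁ enters halved; 80 is its rank
-- constant.
theorem1p3 = fromℕ 404 , fromℕ 80 , fromℕ-pos 404 (s≤s z≤n) , fromℕ-pos 80 (s≤s z≤n) , λ D _ K A A≢∅ A+A≤ →
  let A≢[]  = nonempty-elements A A≢∅
      1≤n   = nonempty-length (elements A) A≢[]
      n≤m   = WithLog.card-≤-sums ℝ-log (elements A) A≢[] (unique A) (elements (A ⊕ A)) (∈⊕ A)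
      1≤K   = 1≤ratio K (card (A ⊕ A)) (card A) 1≤n n≤m A+A≤
      logK  = LogOf.logᴿ K 1≤K
      A′ , A′⊆A , A′≢[] , size , dimension = WithLog.small-doubling ℝ-log (elements A) A≢[] (unique A) (elements (A ⊕ A)) (∈⊕ A) logK
        (log-ratio K (card (A ⊕ A)) (card A) 1≤n n≤m A+A≤ logK (LogOf.exp-logᴿ K 1≤K))
      B     = mkFinSet A′ (Unique-⊆ A′⊆A (unique A))
  in logK , LogOf.exp-logᴿ K 1≤K , B , Sublist.lookup A′⊆A ,
     ↓ {x = exp (-ᴿ (fromℚ ½ *ᴿ fromℕ 404) *ᴿ logK) *ᴿ fromℕ (card A)} {y = fromℕ (length A′)} (exp-*-≤ (card-pos (elements A) A≢[]) (card-pos A′ A′≢[]) (-ᴿ (fromℚ ½ *ᴿ fromℕ 404) *ᴿ logK)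
       (exponent logK (logᵠ (fromℕℚ (card A))) (logᵠ (fromℕℚ (length A′))) size)) ,
     rank (hull-basis A′) , RealHull.hasDim B A′≢[] ,
     ↓ {x = fromℕ (rank (hull-basis A′))} {y = fromℕ 80 *ᴿ logK} (≤ʳ-trans (pointwise-≤ λ _ → ℚₚ.≤-reflexive (sym (ℚₚ.*-identityʳ (fromℕℚ (rank (hull-basis A′)))))) dimension)
  where
  exponent : ∀ k a a′ → a ≤ʳ a′ +ᴿ fromℕ 202 *ᴿ k → -ᴿ (fromℚ ½ *ᴿ fromℕ 404) *ᴿ k +ᴿ a ≤ʳ a′
  exponent k a a′ le = ≤ʳ-trans (+ʳ-mono (≤ʳ-refl { -ᴿ (fromℚ ½ *ᴿ fromℕ 404) *ᴿ k}) le)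
    (pointwise-≤ λ n → ℚₚ.≤-reflexive (cancel (fromℕℚ 202) (seq k n) (seq a′ n)))
    where
    open +-*-Solver
    cancel : ∀ c k a → (- c) * k + (a + c * k) ≡ a
    cancel = solve 3 (λ c k a → (:- c) :* k :+ (a :+ c :* k) := a) refl
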